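{- Let $(\vartheta_0,D_4,D_3)$ be one of the triples $(0.729,1,2)$, $(0.616,3,6)$, $(0.554,4,8)$, $(0.515,7,12)$, and suppose some $\vartheta>\vartheta_0$ satisfies both conditions (A) and (B) below. Then at least one of the following holds: (i) there exists an integer $d$ with $0<|d|\le D_4$ such that $\lambda(p+d)=-1$ for infinitely many primes $p$; (ii) $\liminf_{n\to\infty}(p_{n+1}-p_n)\le D_3$.
   Context: $p_n$ is the $n$-th prime. $\Omega(n)$ is the number of prime factors of $n$ counted with multiplicity and $\lambda(n)=(-1)^{\Omega(n)}$. Condition (A): for every $\varepsilon>0$, $A>0$, $\sum_{q\le N^{\vartheta-\varepsilon}}\max_{a:(a,q)=1}\bigl|\sum_{p\le N,\,p\equiv a\ (\mathrm{mod}\ q)}\log p-\frac{N}{\varphi(q)}\bigr|\ll_{\varepsilon,A}\frac{N}{(\log N)^A}$ ($p$ over primes). Condition (B): for every $\varepsilon>0$, $A>0$, $\sum_{q\le N^{\vartheta-\varepsilon}}\max_{y\le N}\max_a\bigl|\sum_{n\le y,\,n\equiv a\ (\mathrm{mod}\ q)}\lambda(n)\bigr|\ll_{\varepsilon,A}\frac{N}{(\log N)^A}$. -}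

module Defs where

open import Axiom.ExcludedMiddle using (ExcludedMiddle)
open import Data.Integer as ℤ using (ℤ; +_; -[1+_]; -1ℤ)
import Data.Integer.Properties as ℤ
open import Data.List as List using (List; []; _∷_; applyUpTo; filter; foldr; length; map)
open import Data.List.Extrema.Nat using (max)
open import Data.List.Relation.Unary.All using (_∷_)
open import Data.Nat as ℕ using (ℕ; zero; suc; _!)
open import Data.Nat.Coprimality using (coprime?)
open import Data.Nat.Divisibility using (_∣_; _∣?_; ∣m+n∣m⇒∣n; ∣1⇒≡1; ∣-trans; divides; m∣m*n)
open import Data.Nat.ListAction using (sum)
open import Data.Nat.Primality using (Prime; prime?; ¬prime[1])
open import Data.Nat.Primality.Factorisation using (PrimeFactorisation; factorise)
import Data.Nat.Properties as ℕ
open import Data.Product using (∃; _×_; _,_; proj₁; proj₂)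
open import Data.Rational as ℚ using (ℚ; 0ℚ; 1ℚ; ½; _/_; mkℚ)
import Data.Rational.Properties as ℚ
open import Data.Rational.Solver using (module +-*-Solver)
import Data.Rational.Unnormalised as ℚᵘ
import Data.Rational.Unnormalised.Properties as ℚᵘ
open import Data.Sum using (_⊎_; inj₁; inj₂)
open import Level using (0ℓ)
open import Relation.Binary.PropositionalEquality using (_≡_; refl; sym; trans; cong; cong₂; subst; subst₂)
open import Relation.Nullary using (yes; no; contradiction)
open import Relation.Nullary.Decidable using (_×-dec_)

fromℕ : ℕ → ℚ
fromℕ n = + n / 1

IsCauchy : (ℕ → ℚ) → Set
IsCauchy s = ∀ ε → 0ℚ ℚ.< ε →
  ∃ λ M → ∀ m n → M ℕ.≤ m → M ℕ.≤ n → ℚ.∣ s m ℚ.- s n ∣ ℚ.≤ ε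

private
  module _ where
    open import Data.Rational using (_+_; _*_; _-_; -_; _≤_; _<_; ∣_∣; _⊔_)
    open ℚ.≤-Reasoning

    half : ∀ ε → ½ * ε + ½ * ε ≡ ε
    half ε = trans (sym (ℚ.*-distribʳ-+ ε ½ ½)) (ℚ.*-identityˡ ε)

    0<* : ∀ {p q} → 0ℚ < p → 0ℚ < q → 0ℚ < p * q
    0<* {p} {q} 0<p 0<q = ℚ.positive⁻¹ (p * q) ⦃ ℚ.pos*pos⇒pos p ⦃ ℚ.positive 0<p ⦄ q ⦃ ℚ.positive 0<q ⦄ ⦄

    0≤* : ∀ {p q} → 0ℚ ≤ p → 0ℚ ≤ q → 0ℚ ≤ p * q
    0≤* {p} {q} 0≤p 0≤q = ℚ.nonNegative⁻¹ (p * q) ⦃ ℚ.nonNeg*nonNeg⇒nonNeg p ⦃ ℚ.nonNegative 0≤p ⦄ q ⦃ ℚ.nonNegative 0≤q ⦄ ⦄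

    0<½* : ∀ {ε} → 0ℚ < ε → 0ℚ < ½ * ε
    0<½* = 0<* (ℚ.positive⁻¹ ½)

    *-mono : ∀ {p q r s} → 0ℚ ≤ p → 0ℚ ≤ s → p ≤ q → r ≤ s → p * r ≤ q * s
    *-mono {p} {q} {r} {s} 0≤p 0≤s p≤q r≤s = ℚ.≤-trans
      (ℚ.*-monoˡ-≤-nonNeg p ⦃ ℚ.nonNegative 0≤p ⦄ r≤s)
      (ℚ.*-monoʳ-≤-nonNeg s ⦃ ℚ.nonNegative 0≤s ⦄ p≤q)

    ∣-∣-sym : ∀ p q → ∣ p - q ∣ ≡ ∣ q - p ∣
    ∣-∣-sym p q = trans (sym (ℚ.∣-p∣≡∣p∣ (p - q))) (cong ∣_∣ lem)
      where
      open +-*-Solver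
      lem : - (p - q) ≡ q - p
      lem = solve 2 (λ p q → :- (p :- q) := q :- p) refl p q

    triangle : ∀ p q r → ∣ p - r ∣ ≤ ∣ p - q ∣ + ∣ q - r ∣
    triangle p q r = subst (λ t → ∣ t ∣ ≤ ∣ p - q ∣ + ∣ q - r ∣) lem (ℚ.∣p+q∣≤∣p∣+∣q∣ (p - q) (q - r))
      where
      open +-*-Solver
      lem : (p - q) + (q - r) ≡ p - r
      lem = solve 3 (λ p q r → (p :- q) :+ (q :- r) := p :- r) refl p q r

    p≤∣p∣ : ∀ p → p ≤ ∣ p ∣
    p≤∣p∣ p with ℚ.≤-total 0ℚ p
    ... | inj₁ 0≤p = ℚ.≤-reflexive (sym (ℚ.0≤p⇒∣p∣≡p 0≤p))
    ... | inj₂ p≤0 = ℚ.≤-trans p≤0 (ℚ.0≤∣p∣ p)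

    ∣p∣≤q : ∀ {p q} → p ≤ q → - p ≤ q → ∣ p ∣ ≤ q
    ∣p∣≤q {p} {q} p≤q -p≤q with ℚ.∣p∣≡p∨∣p∣≡-p p
    ... | inj₁ eq = subst (_≤ q) (sym eq) p≤q
    ... | inj₂ eq = subst (_≤ q) (sym eq) -p≤q

    p≤q+∣p-q∣ : ∀ p q → p ≤ q + ∣ p - q ∣
    p≤q+∣p-q∣ p q = subst (_≤ q + ∣ p - q ∣) lem (ℚ.+-monoʳ-≤ q (p≤∣p∣ (p - q)))
      where
      open +-*-Solver
      lem : q + (p - q) ≡ p
      lem = solve 2 (λ p q → q :+ (p :- q) := p) refl p q

    p≤q+r⇒p-q≤r : ∀ {p q r} → p ≤ q + r → p - q ≤ r
    p≤q+r⇒p-q≤r {p} {q} {r} h = subst (p - q ≤_) lem (ℚ.+-monoˡ-≤ (- q) h)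
      where
      open +-*-Solver
      lem : q + r - q ≡ r
      lem = solve 2 (λ q r → q :+ r :- q := r) refl q r

    ∣p-q∣≤r : ∀ {p q r} → p ≤ q + r → q ≤ p + r → ∣ p - q ∣ ≤ r
    ∣p-q∣≤r {p} {q} {r} h k = ∣p∣≤q (p≤q+r⇒p-q≤r h) (subst (_≤ r) lem (p≤q+r⇒p-q≤r k))
      where
      open +-*-Solver
      lem : q - p ≡ - (p - q)
      lem = solve 2 (λ p q → q :- p := :- (p :- q)) refl p q

    ⊔-step : ∀ p q p′ q′ → p ⊔ q ≤ (p′ ⊔ q′) + (∣ p - p′ ∣ + ∣ q - q′ ∣)
    ⊔-step p q p′ q′ = ℚ.⊔-lub
      (begin
        p                                  ≤⟨ p≤q+∣p-q∣ p p′ ⟩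
        p′ + ∣ p - p′ ∣                    ≤⟨ ℚ.+-mono-≤ (ℚ.p≤p⊔q p′ q′) (ℚ.≤-reflexive (sym (ℚ.+-identityʳ _))) ⟩
        (p′ ⊔ q′) + (∣ p - p′ ∣ + 0ℚ)        ≤⟨ ℚ.+-monoʳ-≤ (p′ ⊔ q′) (ℚ.+-monoʳ-≤ ∣ p - p′ ∣ (ℚ.0≤∣p∣ (q - q′))) ⟩
        (p′ ⊔ q′) + (∣ p - p′ ∣ + ∣ q - q′ ∣) ∎)
      (begin
        q                                  ≤⟨ p≤q+∣p-q∣ q q′ ⟩
        q′ + ∣ q - q′ ∣                    ≤⟨ ℚ.+-mono-≤ (ℚ.p≤q⊔p p′ q′) (ℚ.≤-reflexive (sym (ℚ.+-identityˡ _))) ⟩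
        (p′ ⊔ q′) + (0ℚ + ∣ q - q′ ∣)        ≤⟨ ℚ.+-monoʳ-≤ (p′ ⊔ q′) (ℚ.+-monoˡ-≤ ∣ q - q′ ∣ (ℚ.0≤∣p∣ (p - p′))) ⟩
        (p′ ⊔ q′) + (∣ p - p′ ∣ + ∣ q - q′ ∣) ∎)

    ⊔-lipschitz : ∀ p q p′ q′ → ∣ p ⊔ q - (p′ ⊔ q′) ∣ ≤ ∣ p - p′ ∣ + ∣ q - q′ ∣
    ⊔-lipschitz p q p′ q′ = ∣p-q∣≤r (⊔-step p q p′ q′)
      (subst₂ (λ a b → p′ ⊔ q′ ≤ (p ⊔ q) + (a + b)) (∣-∣-sym p′ p) (∣-∣-sym q′ q) (⊔-step p′ q′ p q))

    +-lipschitz : ∀ p q p′ q′ → ∣ (p + q) - (p′ + q′) ∣ ≤ ∣ p - p′ ∣ + ∣ q - q′ ∣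
    +-lipschitz p q p′ q′ = subst (λ t → ∣ t ∣ ≤ ∣ p - p′ ∣ + ∣ q - q′ ∣) lem (ℚ.∣p+q∣≤∣p∣+∣q∣ (p - p′) (q - q′))
      where
      open +-*-Solver
      lem : (p - p′) + (q - q′) ≡ (p + q) - (p′ + q′)
      lem = solve 4 (λ p q p′ q′ → (p :- p′) :+ (q :- q′) := (p :+ q) :- (p′ :+ q′)) refl p q p′ q′

    *-lipschitz : ∀ {B} p q p′ q′ → ∣ q ∣ ≤ B → ∣ p′ ∣ ≤ B →
                  ∣ p * q - p′ * q′ ∣ ≤ B * (∣ p - p′ ∣ + ∣ q - q′ ∣)
    *-lipschitz {B} p q p′ q′ q≤B p′≤B = begin
      ∣ p * q - p′ * q′ ∣                       ≡⟨ cong ∣_∣ lem ⟩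
      ∣ q * (p - p′) + p′ * (q - q′) ∣          ≤⟨ ℚ.∣p+q∣≤∣p∣+∣q∣ (q * (p - p′)) (p′ * (q - q′)) ⟩
      ∣ q * (p - p′) ∣ + ∣ p′ * (q - q′) ∣      ≡⟨ cong₂ _+_ (ℚ.∣p*q∣≡∣p∣*∣q∣ q (p - p′)) (ℚ.∣p*q∣≡∣p∣*∣q∣ p′ (q - q′)) ⟩
      ∣ q ∣ * ∣ p - p′ ∣ + ∣ p′ ∣ * ∣ q - q′ ∣  ≤⟨ ℚ.+-mono-≤ (*-mono (ℚ.0≤∣p∣ q) (ℚ.0≤∣p∣ (p - p′)) q≤B ℚ.≤-refl)
                                                               (*-mono (ℚ.0≤∣p∣ p′) (ℚ.0≤∣p∣ (q - q′)) p′≤B ℚ.≤-refl) ⟩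
      B * ∣ p - p′ ∣ + B * ∣ q - q′ ∣           ≡⟨ sym (ℚ.*-distribˡ-+ B ∣ p - p′ ∣ ∣ q - q′ ∣) ⟩
      B * (∣ p - p′ ∣ + ∣ q - q′ ∣)             ∎
      where
      open +-*-Solver
      lem : p * q - p′ * q′ ≡ q * (p - p′) + p′ * (q - q′)
      lem = solve 4 (λ p q p′ q′ → p :* q :- p′ :* q′ := q :* (p :- p′) :+ p′ :* (q :- q′)) refl p q p′ q′

    divide : ∀ B ε → 0ℚ < B → 0ℚ < ε → ∃ λ δ → 0ℚ < δ × B * δ ≡ ε
    divide B ε 0<B 0<ε = B⁻¹ * ε , 0<* (ℚ.positive⁻¹ B⁻¹ ⦃ ℚ.1/pos⇒pos B ⦃ pos ⦄ ⦄) 0<ε ,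
      trans (sym (ℚ.*-assoc B B⁻¹ ε)) (trans (cong (_* ε) (ℚ.*-inverseʳ B ⦃ ℚ.pos⇒nonZero B ⦃ pos ⦄ ⦄)) (ℚ.*-identityˡ ε))
      where
      pos = ℚ.positive 0<B
      B⁻¹ = (ℚ.1/ B) ⦃ ℚ.pos⇒nonZero B ⦃ pos ⦄ ⦄

    bounded : ∀ {s} → IsCauchy s → ∃ λ B → 0ℚ < B × ∃ λ M → ∀ n → M ℕ.≤ n → ∣ s n ∣ ≤ B
    bounded {s} c with c 1ℚ (ℚ.positive⁻¹ 1ℚ)
    ... | M , h = ∣ s M ∣ + 1ℚ , ℚ.<-≤-trans (ℚ.positive⁻¹ 1ℚ) (subst (_≤ ∣ s M ∣ + 1ℚ) (ℚ.+-identityˡ 1ℚ) (ℚ.+-monoˡ-≤ 1ℚ (ℚ.0≤∣p∣ (s M)))) , M ,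
      λ n M≤n → begin
        ∣ s n ∣                  ≡⟨ cong ∣_∣ (lem (s n) (s M)) ⟩
        ∣ s M + (s n - s M) ∣    ≤⟨ ℚ.∣p+q∣≤∣p∣+∣q∣ (s M) (s n - s M) ⟩
        ∣ s M ∣ + ∣ s n - s M ∣  ≤⟨ ℚ.+-monoʳ-≤ ∣ s M ∣ (h n M M≤n ℕ.≤-refl) ⟩
        ∣ s M ∣ + 1ℚ             ∎
      where
      open +-*-Solver
      lem : ∀ p q → p ≡ q + (p - q)
      lem = solve 2 (λ p q → p := q :+ (p :- q)) refl

    lipschitz-cauchy : ∀ {s t} (u : ℕ → ℚ) → IsCauchy s → IsCauchy t →
      (∃ λ B → 0ℚ < B × ∃ λ M → ∀ m n → M ℕ.≤ m → M ℕ.≤ n →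
         ∣ u m - u n ∣ ≤ B * (∣ s m - s n ∣ + ∣ t m - t n ∣)) →
      IsCauchy u
    lipschitz-cauchy {s} {t} u cs ct (B , 0<B , M , h) ε 0<ε with divide B ε 0<B 0<ε
    ... | δ , 0<δ , Bδ≡ε with cs (½ * δ) (0<½* 0<δ) | ct (½ * δ) (0<½* 0<δ)
    ... | M₁ , h₁ | M₂ , h₂ = M ℕ.⊔ (M₁ ℕ.⊔ M₂) , λ m n p q → begin
        ∣ u m - u n ∣                          ≤⟨ h m n (ℕ.≤-trans (ℕ.m≤m⊔n M _) p) (ℕ.≤-trans (ℕ.m≤m⊔n M _) q) ⟩
        B * (∣ s m - s n ∣ + ∣ t m - t n ∣)    ≤⟨ ℚ.*-monoˡ-≤-nonNeg B ⦃ ℚ.nonNegative (ℚ.<⇒≤ 0<B) ⦄ (ℚ.+-mono-≤ (h₁ m n (le₁ p) (le₁ q)) (h₂ m n (le₂ p) (le₂ q))) ⟩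
        B * (½ * δ + ½ * δ)                    ≡⟨ cong (B *_) (half δ) ⟩
        B * δ                                  ≡⟨ Bδ≡ε ⟩
        ε                                      ∎
      where
      le₁ : ∀ {m} → M ℕ.⊔ (M₁ ℕ.⊔ M₂) ℕ.≤ m → M₁ ℕ.≤ m
      le₁ p = ℕ.≤-trans (ℕ.≤-trans (ℕ.m≤m⊔n M₁ M₂) (ℕ.m≤n⊔m M _)) p
      le₂ : ∀ {m} → M ℕ.⊔ (M₁ ℕ.⊔ M₂) ℕ.≤ m → M₂ ℕ.≤ m
      le₂ p = ℕ.≤-trans (ℕ.≤-trans (ℕ.m≤n⊔m M₁ M₂) (ℕ.m≤n⊔m M _)) p

    const-cauchy : ∀ q → IsCauchy (λ _ → q)
    const-cauchy q ε 0<ε = 0 , λ _ _ _ _ → subst (λ t → ∣ t ∣ ≤ ε) (sym (ℚ.+-inverseʳ q)) (ℚ.<⇒≤ 0<ε)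

    +-cauchy : ∀ {s t} → IsCauchy s → IsCauchy t → IsCauchy (λ n → s n + t n)
    +-cauchy {s} {t} cs ct = lipschitz-cauchy {s} {t} (λ n → s n + t n) cs ct (1ℚ , ℚ.positive⁻¹ 1ℚ , 0 , λ m n _ _ →
      subst (∣ (s m + t m) - (s n + t n) ∣ ≤_) (sym (ℚ.*-identityˡ (∣ s m - s n ∣ + ∣ t m - t n ∣))) (+-lipschitz (s m) (t m) (s n) (t n)))

    ⊔-cauchy : ∀ {s t} → IsCauchy s → IsCauchy t → IsCauchy (λ n → s n ⊔ t n)
    ⊔-cauchy {s} {t} cs ct = lipschitz-cauchy {s} {t} (λ n → s n ⊔ t n) cs ct (1ℚ , ℚ.positive⁻¹ 1ℚ , 0 , λ m n _ _ →
      subst (∣ (s m ⊔ t m) - (s n ⊔ t n) ∣ ≤_) (sym (ℚ.*-identityˡ (∣ s m - s n ∣ + ∣ t m - t n ∣))) (⊔-lipschitz (s m) (t m) (s n) (t n)))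

    neg-cauchy : ∀ {s} → IsCauchy s → IsCauchy (λ n → - s n)
    neg-cauchy {s} cs ε 0<ε with cs ε 0<ε
    ... | M , h = M , λ m n p q → subst (_≤ ε) (trans (∣-∣-sym (s m) (s n)) (cong ∣_∣ (lem (s m) (s n)))) (h m n p q)
      where
      open +-*-Solver
      lem : ∀ p q → q - p ≡ (- p) - (- q)
      lem = solve 2 (λ p q → q :- p := (:- p) :- (:- q)) refl

    *-cauchy : ∀ {s t} → IsCauchy s → IsCauchy t → IsCauchy (λ n → s n * t n)
    *-cauchy {s} {t} cs ct = lipschitz-cauchy {s} {t} (λ n → s n * t n) cs ct (lem (bounded {s} cs) (bounded {t} ct))
      where
      Bounded : (ℕ → ℚ) → Set
      Bounded s = ∃ λ B → 0ℚ < B × ∃ λ M → ∀ n → M ℕ.≤ n → ∣ s n ∣ ≤ B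
      lem : Bounded s → Bounded t → ∃ λ B → 0ℚ < B × ∃ λ M → ∀ m n → M ℕ.≤ m → M ℕ.≤ n →
            ∣ s m * t m - s n * t n ∣ ≤ B * (∣ s m - s n ∣ + ∣ t m - t n ∣)
      lem (B₁ , 0<B₁ , M₁ , h₁) (B₂ , 0<B₂ , M₂ , h₂) =
        B₁ ⊔ B₂ , ℚ.<-≤-trans 0<B₁ (ℚ.p≤p⊔q B₁ B₂) , M₁ ℕ.⊔ M₂ , λ m n p q →
        *-lipschitz {B₁ ⊔ B₂} (s m) (t m) (s n) (t n)
          (ℚ.≤-trans (h₂ m (ℕ.≤-trans (ℕ.m≤n⊔m M₁ M₂) p)) (ℚ.p≤q⊔p B₁ B₂))
          (ℚ.≤-trans (h₁ n (ℕ.≤-trans (ℕ.m≤m⊔n M₁ M₂) q)) (ℚ.p≤p⊔q B₁ B₂))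

    toℚᵘ-/ : ∀ i n .⦃ _ : ℕ.NonZero n ⦄ → ℚ.toℚᵘ (i / n) ℚᵘ.≃ (i ℚᵘ./ n)
    toℚᵘ-/ i (suc n) = ℚ.toℚᵘ-fromℚᵘ (ℚᵘ.mkℚᵘ i n)

    fromℕ-suc : ∀ n → fromℕ (suc n) ≡ 1ℚ + fromℕ n
    fromℕ-suc n = ℚ.toℚᵘ-injective (ℚᵘ.≃-trans (toℚᵘ-/ (+ suc n) 1)
      (ℚᵘ.≃-trans (ℚᵘ.*≡* lem)
      (ℚᵘ.≃-trans (ℚᵘ.+-congʳ (ℚ.toℚᵘ 1ℚ) (ℚᵘ.≃-sym (toℚᵘ-/ (+ n) 1)))
      (ℚᵘ.≃-sym (ℚ.toℚᵘ-homo-+ 1ℚ (fromℕ n))))))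
      where
      lem : + suc n ℤ.* + 1 ≡ (+ 1 ℤ.* + 1 ℤ.+ + n ℤ.* + 1) ℤ.* + 1
      lem = cong (ℤ._* + 1) (cong (ℤ._+_ (+ 1)) (sym (ℤ.*-identityʳ (+ n))))

    reciprocal : ∀ n → (+ 1 / suc n) * fromℕ (suc n) ≡ 1ℚ
    reciprocal n = ℚ.toℚᵘ-injective (ℚᵘ.≃-trans (ℚ.toℚᵘ-homo-* (+ 1 / suc n) (fromℕ (suc n)))
      (ℚᵘ.≃-trans (ℚᵘ.*-cong (toℚᵘ-/ (+ 1) (suc n)) (toℚᵘ-/ (+ suc n) 1)) (ℚᵘ.*≡* lem)))
      where
      lem : (+ 1 ℤ.* + suc n) ℤ.* + 1 ≡ + 1 ℤ.* (+ suc n ℤ.* + 1)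
      lem = ℤ.*-assoc (+ 1) (+ suc n) (+ 1)

    fromℕ-nonNeg : ∀ n → 0ℚ ≤ fromℕ n
    fromℕ-nonNeg n = ℚ.nonNegative⁻¹ (fromℕ n) ⦃ ℚ.normalize-nonNeg n 1 ⦄

    fromℕ-mono : ∀ {m n} → m ℕ.≤ n → fromℕ m ≤ fromℕ n
    fromℕ-mono {n = n} ℕ.z≤n = fromℕ-nonNeg n
    fromℕ-mono (ℕ.s≤s {m} {n} m≤n) = subst₂ _≤_ (sym (fromℕ-suc m)) (sym (fromℕ-suc n)) (ℚ.+-monoʳ-≤ 1ℚ (fromℕ-mono m≤n))

    archimedean : ∀ q → ∃ λ n → q ≤ fromℕ n
    archimedean q@(mkℚ i d _) = ℤ.∣ i ∣ , ℚ.toℚᵘ-cancel-≤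
      (ℚᵘ.≤-trans (ℚᵘ.*≤* (lem i)) (ℚᵘ.≤-reflexive (ℚᵘ.≃-sym (toℚᵘ-/ (+ ℤ.∣ i ∣) 1))))
      where
      lem : ∀ i → i ℤ.* + 1 ℤ.≤ + ℤ.∣ i ∣ ℤ.* + suc d
      lem (+ n)    = subst₂ ℤ._≤_ (ℤ.pos-* n 1) (ℤ.pos-* n (suc d)) (ℤ.+≤+ (ℕ.*-monoʳ-≤ n (ℕ.s≤s ℕ.z≤n)))
      lem -[1+ n ] = ℤ.-≤+

    inv : ℕ → ℚ
    inv k = + 1 / suc k

    0≤inv : ∀ k → 0ℚ ≤ inv k
    0≤inv k = ℚ.nonNegative⁻¹ (inv k) ⦃ ℚ.normalize-nonNeg 1 (suc k) ⦄

-- expTerm z k = zᵏ / k! and expSum z n = Σ_{k<n} zᵏ / k!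
expTerm : ℚ → ℕ → ℚ
expTerm z zero    = 1ℚ
expTerm z (suc k) = expTerm z k ℚ.* (z ℚ.* (+ 1 / suc k))

expSum : ℚ → ℕ → ℚ
expSum z zero    = 0ℚ
expSum z (suc n) = expSum z n ℚ.+ expTerm z n

private
  module _ where
    open import Data.Rational using (_+_; _*_; _-_; -_; _≤_; _<_; ∣_∣; _⊔_)
    open ℚ.≤-Reasoning

    expTerm-abs : ∀ {D} z k → ∣ z ∣ ≤ D → ∣ expTerm z k ∣ ≤ expTerm D k
    expTerm-abs     z zero    _   = ℚ.≤-refl
    expTerm-abs {D} z (suc k) z≤D = begin
      ∣ expTerm z k * (z * inv k) ∣         ≡⟨ ℚ.∣p*q∣≡∣p∣*∣q∣ (expTerm z k) (z * inv k) ⟩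
      ∣ expTerm z k ∣ * ∣ z * inv k ∣       ≡⟨ cong (∣ expTerm z k ∣ *_) (ℚ.∣p*q∣≡∣p∣*∣q∣ z (inv k)) ⟩
      ∣ expTerm z k ∣ * (∣ z ∣ * ∣ inv k ∣) ≡⟨ cong (λ t → ∣ expTerm z k ∣ * (∣ z ∣ * t)) (ℚ.0≤p⇒∣p∣≡p (0≤inv k)) ⟩
      ∣ expTerm z k ∣ * (∣ z ∣ * inv k)     ≤⟨ *-mono (ℚ.0≤∣p∣ (expTerm z k)) (0≤* 0≤D (0≤inv k)) (expTerm-abs z k z≤D)
                                                 (*-mono (ℚ.0≤∣p∣ z) (0≤inv k) z≤D ℚ.≤-refl) ⟩
      expTerm D k * (D * inv k)             ∎
      where
      0≤D : 0ℚ ≤ D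
      0≤D = ℚ.≤-trans (ℚ.0≤∣p∣ z) z≤D

    expTerm-nonNeg : ∀ {D} k → 0ℚ ≤ D → 0ℚ ≤ expTerm D k
    expTerm-nonNeg zero    _   = ℚ.nonNegative⁻¹ 1ℚ
    expTerm-nonNeg (suc k) 0≤D = 0≤* (expTerm-nonNeg k 0≤D) (0≤* 0≤D (0≤inv k))

    expSum-mono : ∀ {D} n → 0ℚ ≤ D → expSum D n ≤ expSum D (suc n)
    expSum-mono {D} n 0≤D = subst (_≤ expSum D (suc n)) (ℚ.+-identityʳ (expSum D n)) (ℚ.+-monoʳ-≤ (expSum D n) (expTerm-nonNeg n 0≤D))

    expSum-nonNeg : ∀ {D} n → 0ℚ ≤ D → 0ℚ ≤ expSum D n
    expSum-nonNeg zero    _   = ℚ.≤-refl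
    expSum-nonNeg (suc n) 0≤D = ℚ.≤-trans (expSum-nonNeg n 0≤D) (expSum-mono n 0≤D)

    expTerm-suc : ∀ D k → expTerm D (suc k) * fromℕ (suc k) ≡ D * expTerm D k
    expTerm-suc D k = trans (lem (expTerm D k) D (inv k) (fromℕ (suc k)))
      (trans (cong ((D * expTerm D k) *_) (reciprocal k)) (ℚ.*-identityʳ (D * expTerm D k)))
      where
      open +-*-Solver
      lem : ∀ t z i n → t * (z * i) * n ≡ (z * t) * (i * n)
      lem = solve 4 (λ t z i n → t :* (z :* i) :* n := (z :* t) :* (i :* n)) refl

    expTerm-lipschitz : ∀ {D} z w k → ∣ z ∣ ≤ D → ∣ w ∣ ≤ D →
                        ∣ expTerm z (suc k) - expTerm w (suc k) ∣ ≤ ∣ z - w ∣ * expTerm D k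
    expTerm-lipschitz z w zero _ _ = ℚ.≤-reflexive (trans (cong ∣_∣ (lem z w)) (sym (ℚ.*-identityʳ ∣ z - w ∣)))
      where
      open +-*-Solver
      lem : ∀ z w → 1ℚ * (z * 1ℚ) - 1ℚ * (w * 1ℚ) ≡ z - w
      lem = solve 2 (λ z w → con 1ℚ :* (z :* con 1ℚ) :- con 1ℚ :* (w :* con 1ℚ) := z :- w) refl
    expTerm-lipschitz {D} z w (suc k) z≤D w≤D = begin
      ∣ tz * (z * i) - tw * (w * i) ∣
        ≡⟨ cong ∣_∣ (lem₁ tz tw z w i) ⟩
      ∣ ((z - w) * tz + w * (tz - tw)) * i ∣
        ≡⟨ ℚ.∣p*q∣≡∣p∣*∣q∣ ((z - w) * tz + w * (tz - tw)) i ⟩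
      ∣ (z - w) * tz + w * (tz - tw) ∣ * ∣ i ∣
        ≡⟨ cong (∣ (z - w) * tz + w * (tz - tw) ∣ *_) (ℚ.0≤p⇒∣p∣≡p (0≤inv (suc k))) ⟩
      ∣ (z - w) * tz + w * (tz - tw) ∣ * i
        ≤⟨ ℚ.*-monoʳ-≤-nonNeg i ⦃ ℚ.nonNegative (0≤inv (suc k)) ⦄ (ℚ.∣p+q∣≤∣p∣+∣q∣ ((z - w) * tz) (w * (tz - tw))) ⟩
      (∣ (z - w) * tz ∣ + ∣ w * (tz - tw) ∣) * i
        ≡⟨ cong (_* i) (cong₂ _+_ (ℚ.∣p*q∣≡∣p∣*∣q∣ (z - w) tz) (ℚ.∣p*q∣≡∣p∣*∣q∣ w (tz - tw))) ⟩
      (∣ z - w ∣ * ∣ tz ∣ + ∣ w ∣ * ∣ tz - tw ∣) * i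
        ≤⟨ ℚ.*-monoʳ-≤-nonNeg i ⦃ ℚ.nonNegative (0≤inv (suc k)) ⦄ (ℚ.+-mono-≤
             (*-mono (ℚ.0≤∣p∣ (z - w)) (expTerm-nonNeg (suc k) 0≤D) ℚ.≤-refl (expTerm-abs z (suc k) z≤D))
             (*-mono (ℚ.0≤∣p∣ w) (0≤* (ℚ.0≤∣p∣ (z - w)) (expTerm-nonNeg k 0≤D)) w≤D (expTerm-lipschitz z w k z≤D w≤D))) ⟩
      (δ * T′ + D * (δ * T)) * i
        ≡⟨ lem₂ δ T′ D T i ⟩
      δ * ((T′ + D * T) * i)
        ≡⟨ cong (λ t → δ * ((T′ + t) * i)) (sym (expTerm-suc D k)) ⟩
      δ * ((T′ + T′ * fromℕ (suc k)) * i)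
        ≡⟨ cong (δ *_) (lem₃ T′ (fromℕ (suc k)) i) ⟩
      δ * (T′ * (i * (1ℚ + fromℕ (suc k))))
        ≡⟨ cong (λ t → δ * (T′ * (i * t))) (sym (fromℕ-suc (suc k))) ⟩
      δ * (T′ * (i * fromℕ (suc (suc k))))
        ≡⟨ cong (λ t → δ * (T′ * t)) (reciprocal (suc k)) ⟩
      δ * (T′ * 1ℚ)
        ≡⟨ cong (δ *_) (ℚ.*-identityʳ T′) ⟩
      δ * T′ ∎
      where
      open +-*-Solver using (solve; _:=_; _:+_; _:*_; _:-_; con)
      tz tw i δ T T′ : ℚ
      tz = expTerm z (suc k)
      tw = expTerm w (suc k)
      i  = inv (suc k)
      δ  = ∣ z - w ∣
      T  = expTerm D k
      T′ = expTerm D (suc k)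
      0≤D : 0ℚ ≤ D
      0≤D = ℚ.≤-trans (ℚ.0≤∣p∣ z) z≤D
      lem₁ : ∀ tz tw z w i → tz * (z * i) - tw * (w * i) ≡ ((z - w) * tz + w * (tz - tw)) * i
      lem₁ = solve 5 (λ tz tw z w i → tz :* (z :* i) :- tw :* (w :* i) := ((z :- w) :* tz :+ w :* (tz :- tw)) :* i) refl
      lem₂ : ∀ δ T′ D T i → (δ * T′ + D * (δ * T)) * i ≡ δ * ((T′ + D * T) * i)
      lem₂ = solve 5 (λ δ T′ D T i → (δ :* T′ :+ D :* (δ :* T)) :* i := δ :* ((T′ :+ D :* T) :* i)) refl
      lem₃ : ∀ T′ n i → (T′ + T′ * n) * i ≡ T′ * (i * (1ℚ + n))
      lem₃ = solve 3 (λ T′ n i → (T′ :+ T′ :* n) :* i := T′ :* (i :* (con 1ℚ :+ n))) refl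

    expSum-lipschitz : ∀ {D} z w n → ∣ z ∣ ≤ D → ∣ w ∣ ≤ D →
                       ∣ expSum z (suc n) - expSum w (suc n) ∣ ≤ ∣ z - w ∣ * expSum D n
    expSum-lipschitz z w zero _ _ = ℚ.≤-reflexive (sym (ℚ.*-zeroʳ ∣ z - w ∣))
    expSum-lipschitz {D} z w (suc n) z≤D w≤D = begin
      ∣ expSum z (suc (suc n)) - expSum w (suc (suc n)) ∣
        ≤⟨ +-lipschitz (expSum z (suc n)) (expTerm z (suc n)) (expSum w (suc n)) (expTerm w (suc n)) ⟩
      ∣ expSum z (suc n) - expSum w (suc n) ∣ + ∣ expTerm z (suc n) - expTerm w (suc n) ∣
        ≤⟨ ℚ.+-mono-≤ (expSum-lipschitz z w n z≤D w≤D) (expTerm-lipschitz z w n z≤D w≤D) ⟩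
      ∣ z - w ∣ * expSum D n + ∣ z - w ∣ * expTerm D n
        ≡⟨ sym (ℚ.*-distribˡ-+ ∣ z - w ∣ (expSum D n) (expTerm D n)) ⟩
      ∣ z - w ∣ * expSum D (suc n) ∎

    expSum-lipschitz′ : ∀ {D} z w n → ∣ z ∣ ≤ D → ∣ w ∣ ≤ D →
                        ∣ expSum z n - expSum w n ∣ ≤ ∣ z - w ∣ * expSum D n
    expSum-lipschitz′ z w zero _ _ = ℚ.≤-reflexive (sym (ℚ.*-zeroʳ ∣ z - w ∣))
    expSum-lipschitz′ {D} z w (suc n) z≤D w≤D = ℚ.≤-trans (expSum-lipschitz z w n z≤D w≤D)
      (ℚ.*-monoˡ-≤-nonNeg ∣ z - w ∣ ⦃ ℚ.nonNegative (ℚ.0≤∣p∣ (z - w)) ⦄ (expSum-mono n (ℚ.≤-trans (ℚ.0≤∣p∣ z) z≤D)))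

    expSum-tail : ∀ {D m n} z → ∣ z ∣ ≤ D → m ℕ.≤′ n → ∣ expSum z n - expSum z m ∣ ≤ expSum D n - expSum D m
    expSum-tail {D} {m} z _ (ℕ.≤′-reflexive refl) = ℚ.≤-reflexive
      (trans (cong ∣_∣ (ℚ.+-inverseʳ (expSum z m))) (sym (ℚ.+-inverseʳ (expSum D m))))
    expSum-tail {D} {m} z z≤D (ℕ.≤′-step {n} m≤n) = begin
      ∣ (expSum z n + expTerm z n) - expSum z m ∣    ≡⟨ cong ∣_∣ (lem (expSum z n) (expTerm z n) (expSum z m)) ⟩
      ∣ (expSum z n - expSum z m) + expTerm z n ∣    ≤⟨ ℚ.∣p+q∣≤∣p∣+∣q∣ (expSum z n - expSum z m) (expTerm z n) ⟩
      ∣ expSum z n - expSum z m ∣ + ∣ expTerm z n ∣  ≤⟨ ℚ.+-mono-≤ (expSum-tail z z≤D m≤n) (expTerm-abs z n z≤D) ⟩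
      (expSum D n - expSum D m) + expTerm D n        ≡⟨ sym (lem (expSum D n) (expTerm D n) (expSum D m)) ⟩
      (expSum D n + expTerm D n) - expSum D m        ∎
      where
      open +-*-Solver using (solve; _:=_; _:+_; _:-_)
      lem : ∀ p q r → (p + q) - r ≡ (p - r) + q
      lem = solve 3 (λ p q r → (p :+ q) :- r := (p :- r) :+ q) refl

    module Tail (D : ℚ) (0≤D : 0ℚ ≤ D) where
      M : ℕ
      M = proj₁ (archimedean (D + D))

      T S : ℕ → ℚ
      T = expTerm D
      S = expSum D

      halves : ∀ n → M ℕ.≤ n → T (suc n) + T (suc n) ≤ T n
      halves n M≤n = begin
        T n * (D * inv n) + T n * (D * inv n)  ≡⟨ lem (T n) D (inv n) ⟩
        T n * (inv n * (D + D))                ≤⟨ ℚ.*-monoˡ-≤-nonNeg (T n) ⦃ ℚ.nonNegative (expTerm-nonNeg n 0≤D) ⦄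
                                                    (ℚ.*-monoˡ-≤-nonNeg (inv n) ⦃ ℚ.nonNegative (0≤inv n) ⦄
                                                    (ℚ.≤-trans (proj₂ (archimedean (D + D))) (fromℕ-mono (ℕ.m≤n⇒m≤1+n M≤n)))) ⟩
        T n * (inv n * fromℕ (suc n))          ≡⟨ cong (T n *_) (reciprocal n) ⟩
        T n * 1ℚ                               ≡⟨ ℚ.*-identityʳ (T n) ⟩
        T n                                    ∎
        where
        open +-*-Solver using (solve; _:=_; _:+_; _:*_)
        lem : ∀ t z i → t * (z * i) + t * (z * i) ≡ t * (i * (z + z))
        lem = solve 3 (λ t z i → t :* (z :* i) :+ t :* (z :* i) := t :* (i :* (z :+ z))) refl

      decreasing : ∀ n → M ℕ.≤ n → T (suc n) ≤ T n
      decreasing n M≤n = ℚ.≤-trans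
        (subst (_≤ T (suc n) + T (suc n)) (ℚ.+-identityʳ (T (suc n))) (ℚ.+-monoʳ-≤ (T (suc n)) (expTerm-nonNeg (suc n) 0≤D)))
        (halves n M≤n)

      T≤ : ∀ {n} → M ℕ.≤′ n → T n ≤ T M
      T≤ (ℕ.≤′-reflexive refl) = ℚ.≤-refl
      T≤ (ℕ.≤′-step {n} M≤n)   = ℚ.≤-trans (decreasing n (ℕ.≤′⇒≤ M≤n)) (T≤ M≤n)

      S≤ : ∀ {m n} → M ℕ.≤ m → m ℕ.≤′ n → S n + (T n + T n) ≤ S m + (T m + T m)
      S≤ _   (ℕ.≤′-reflexive refl) = ℚ.≤-refl
      S≤ {m} M≤m (ℕ.≤′-step {n} m≤n) = begin
        (S n + T n) + (T (suc n) + T (suc n))  ≤⟨ ℚ.+-monoʳ-≤ (S n + T n) (halves n (ℕ.≤-trans M≤m (ℕ.≤′⇒≤ m≤n))) ⟩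
        (S n + T n) + T n                      ≡⟨ ℚ.+-assoc (S n) (T n) (T n) ⟩
        S n + (T n + T n)                      ≤⟨ S≤ M≤m m≤n ⟩
        S m + (T m + T m)                      ∎

      tail : ∀ {m n} → M ℕ.≤ m → m ℕ.≤′ n → S n ≤ S m + (T m + T m)
      tail {m} {n} M≤m m≤n = ℚ.≤-trans
        (subst (_≤ S n + (T n + T n)) (ℚ.+-identityʳ (S n)) (ℚ.+-monoʳ-≤ (S n)
          (ℚ.+-mono-≤ (expTerm-nonNeg n 0≤D) (expTerm-nonNeg n 0≤D))))
        (S≤ M≤m m≤n)

      -- T (n + 1) * (n + 1) = D * T n ≤ D * T M
      small : ∀ ε → 0ℚ < ε → ∃ λ K → ∀ n → K ℕ.≤ n → T n ≤ ε
      small ε 0<ε = suc (M ℕ.⊔ K) , λ { (suc n) (ℕ.s≤s K≤n) → bound n K≤n }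
        where
        ε⁻¹ : ∃ λ r → 0ℚ < r × ε * r ≡ 1ℚ
        ε⁻¹ = divide ε 1ℚ 0<ε (ℚ.positive⁻¹ 1ℚ)
        r : ℚ
        r = proj₁ ε⁻¹
        arch : ∃ λ K → r * (D * T M) ≤ fromℕ K
        arch = archimedean (r * (D * T M))
        K : ℕ
        K = proj₁ arch
        bound : ∀ n → M ℕ.⊔ K ℕ.≤ n → T (suc n) ≤ ε
        bound n p = begin
          T n * (D * inv n)                ≡⟨ lem₁ (T n) D (inv n) ⟩
          (D * T n) * inv n                ≤⟨ ℚ.*-monoʳ-≤-nonNeg (inv n) ⦃ ℚ.nonNegative (0≤inv n) ⦄
                                                (ℚ.*-monoˡ-≤-nonNeg D ⦃ ℚ.nonNegative 0≤D ⦄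
                                                (T≤ (ℕ.≤⇒≤′ (ℕ.≤-trans (ℕ.m≤m⊔n M K) p)))) ⟩
          (D * T M) * inv n                ≡⟨ cong (_* inv n) (sym (ℚ.*-identityˡ (D * T M))) ⟩
          (1ℚ * (D * T M)) * inv n         ≡⟨ cong (λ t → (t * (D * T M)) * inv n) (sym (proj₂ (proj₂ ε⁻¹))) ⟩
          (ε * r * (D * T M)) * inv n      ≡⟨ lem₂ ε r (D * T M) (inv n) ⟩
          ε * (inv n * (r * (D * T M)))    ≤⟨ ℚ.*-monoˡ-≤-nonNeg ε ⦃ ℚ.nonNegative (ℚ.<⇒≤ 0<ε) ⦄
                                                (ℚ.*-monoˡ-≤-nonNeg (inv n) ⦃ ℚ.nonNegative (0≤inv n) ⦄
                                                (ℚ.≤-trans (proj₂ arch) (fromℕ-mono (ℕ.m≤n⇒m≤1+n (ℕ.≤-trans (ℕ.m≤n⊔m M K) p))))) ⟩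
          ε * (inv n * fromℕ (suc n))      ≡⟨ cong (ε *_) (reciprocal n) ⟩
          ε * 1ℚ                           ≡⟨ ℚ.*-identityʳ ε ⟩
          ε                                ∎
          where
          open +-*-Solver using (solve; _:=_; _:*_)
          lem₁ : ∀ t z i → t * (z * i) ≡ (z * t) * i
          lem₁ = solve 3 (λ t z i → t :* (z :* i) := (z :* t) :* i) refl
          lem₂ : ∀ e r t i → (e * r * t) * i ≡ e * (i * (r * t))
          lem₂ = solve 4 (λ e r t i → (e :* r :* t) :* i := e :* (i :* (r :* t))) refl

      B : ℚ
      B = (S M + (T M + T M)) + 1ℚ

      S≤B : ∀ {n} → M ℕ.≤ n → S n ≤ B
      S≤B {n} M≤n = begin
        S n                            ≤⟨ tail ℕ.≤-refl (ℕ.≤⇒≤′ M≤n) ⟩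
        S M + (T M + T M)              ≡⟨ sym (ℚ.+-identityʳ (S M + (T M + T M))) ⟩
        (S M + (T M + T M)) + 0ℚ       ≤⟨ ℚ.+-monoʳ-≤ (S M + (T M + T M)) (ℚ.nonNegative⁻¹ 1ℚ) ⟩
        B                              ∎

      0<B : 0ℚ < B
      0<B = ℚ.+-mono-≤-< {0ℚ} {S M + (T M + T M)} {0ℚ} {1ℚ}
        (ℚ.+-mono-≤ {0ℚ} {S M} {0ℚ} {T M + T M} (expSum-nonNeg M 0≤D)
          (ℚ.+-mono-≤ {0ℚ} {T M} {0ℚ} {T M} (expTerm-nonNeg M 0≤D) (expTerm-nonNeg M 0≤D)))
        (ℚ.positive⁻¹ 1ℚ)

      step : ∀ {m n z w} → ∣ z ∣ ≤ D → ∣ w ∣ ≤ D → M ℕ.≤ m → m ℕ.≤ n →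
             ∣ expSum z m - expSum w n ∣ ≤ B * ∣ z - w ∣ + (T m + T m)
      step {m} {n} {z} {w} z≤D w≤D M≤m m≤n = begin
        ∣ expSum z m - expSum w n ∣
          ≤⟨ triangle (expSum z m) (expSum w m) (expSum w n) ⟩
        ∣ expSum z m - expSum w m ∣ + ∣ expSum w m - expSum w n ∣
          ≤⟨ ℚ.+-mono-≤ (expSum-lipschitz′ z w m z≤D w≤D)
               (ℚ.≤-trans (ℚ.≤-reflexive (∣-∣-sym (expSum w m) (expSum w n)))
               (ℚ.≤-trans (expSum-tail w w≤D (ℕ.≤⇒≤′ m≤n)) (p≤q+r⇒p-q≤r {S n} {S m} {T m + T m} (tail M≤m (ℕ.≤⇒≤′ m≤n))))) ⟩
        ∣ z - w ∣ * S m + (T m + T m)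
          ≤⟨ ℚ.+-monoˡ-≤ (T m + T m) (ℚ.*-monoˡ-≤-nonNeg ∣ z - w ∣ ⦃ ℚ.nonNegative (ℚ.0≤∣p∣ (z - w)) ⦄ (S≤B M≤m)) ⟩
        ∣ z - w ∣ * B + (T m + T m)
          ≡⟨ cong (_+ (T m + T m)) (ℚ.*-comm ∣ z - w ∣ B) ⟩
        B * ∣ z - w ∣ + (T m + T m) ∎

    exp-cauchy : ∀ {s} → IsCauchy s → IsCauchy (λ n → expSum (s n) n)
    exp-cauchy {s} cs ε 0<ε = N , λ m n p q → main m n p q (ℕ.≤-total m n)
      where
      bnd : ∃ λ B → 0ℚ < B × ∃ λ M → ∀ n → M ℕ.≤ n → ∣ s n ∣ ≤ B
      bnd = bounded {s} cs
      D : ℚ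
      D = proj₁ bnd
      open Tail D (ℚ.<⇒≤ (proj₁ (proj₂ bnd)))
      M₀ : ℕ
      M₀ = proj₁ (proj₂ (proj₂ bnd))
      dv : ∃ λ δ → 0ℚ < δ × B * δ ≡ ½ * ε
      dv = divide B (½ * ε) 0<B (0<½* 0<ε)
      δ : ℚ
      δ = proj₁ dv
      c : ∃ λ M → ∀ m n → M ℕ.≤ m → M ℕ.≤ n → ∣ s m - s n ∣ ≤ δ
      c = cs δ (proj₁ (proj₂ dv))
      sm : ∃ λ K → ∀ n → K ℕ.≤ n → T n ≤ ½ * (½ * ε)
      sm = small (½ * (½ * ε)) (0<½* (0<½* 0<ε))
      N : ℕ
      N = (M₀ ℕ.⊔ M) ℕ.⊔ (proj₁ c ℕ.⊔ proj₁ sm)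
      module _ {n : ℕ} (p : N ℕ.≤ n) where
        p₁ = ℕ.≤-trans (ℕ.m≤m⊔n (M₀ ℕ.⊔ M) (proj₁ c ℕ.⊔ proj₁ sm)) p
        p₂ = ℕ.≤-trans (ℕ.m≤n⊔m (M₀ ℕ.⊔ M) (proj₁ c ℕ.⊔ proj₁ sm)) p
        ≥M₀ = ℕ.≤-trans (ℕ.m≤m⊔n M₀ M) p₁
        ≥M  = ℕ.≤-trans (ℕ.m≤n⊔m M₀ M) p₁
        ≥c  = ℕ.≤-trans (ℕ.m≤m⊔n (proj₁ c) (proj₁ sm)) p₂
        ≥s  = ℕ.≤-trans (ℕ.m≤n⊔m (proj₁ c) (proj₁ sm)) p₂
      one : ∀ m n → N ℕ.≤ m → N ℕ.≤ n → m ℕ.≤ n → ∣ expSum (s m) m - expSum (s n) n ∣ ≤ ε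
      one m n p q m≤n = begin
        ∣ expSum (s m) m - expSum (s n) n ∣
          ≤⟨ step (proj₂ (proj₂ (proj₂ bnd)) m (≥M₀ p)) (proj₂ (proj₂ (proj₂ bnd)) n (≥M₀ q)) (≥M p) m≤n ⟩
        B * ∣ s m - s n ∣ + (T m + T m)
          ≤⟨ ℚ.+-mono-≤ (ℚ.*-monoˡ-≤-nonNeg B ⦃ ℚ.nonNegative (ℚ.<⇒≤ 0<B) ⦄ (proj₂ c m n (≥c p) (≥c q)))
               (ℚ.+-mono-≤ (proj₂ sm m (≥s p)) (proj₂ sm m (≥s p))) ⟩
        B * δ + (½ * (½ * ε) + ½ * (½ * ε))
          ≡⟨ cong₂ _+_ (proj₂ (proj₂ dv)) (half (½ * ε)) ⟩
        ½ * ε + ½ * ε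
          ≡⟨ half ε ⟩
        ε ∎
      main : ∀ m n → N ℕ.≤ m → N ℕ.≤ n → m ℕ.≤ n ⊎ n ℕ.≤ m → ∣ expSum (s m) m - expSum (s n) n ∣ ≤ ε
      main m n p q (inj₁ m≤n) = one m n p q m≤n
      main m n p q (inj₂ n≤m) = ℚ.≤-trans (ℚ.≤-reflexive (∣-∣-sym (expSum (s m) m) (expSum (s n) n))) (one n m q p n≤m)

-- The real numbers: Cauchy sequences of rationals, up to _≈ᴿ_.
record ℝ : Set where
  constructor mkℝ
  field
    seq    : ℕ → ℚ
    cauchy : IsCauchy seq

open ℝ

infix  4 _≤ᴿ_ _<ᴿ_ _≈ᴿ_
infixl 6 _+ᴿ_ _-ᴿ_ _⊔ᴿ_
infixl 7 _*ᴿ_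
infix  8 -ᴿ_

_≤ᴿ_ : ℝ → ℝ → Set
x ≤ᴿ y = ∀ ε → 0ℚ ℚ.< ε → ∃ λ M → ∀ n → M ℕ.≤ n → seq x n ℚ.≤ seq y n ℚ.+ ε

_<ᴿ_ : ℝ → ℝ → Set
x <ᴿ y = ∃ λ ε → 0ℚ ℚ.< ε × ∃ λ M → ∀ n → M ℕ.≤ n → seq x n ℚ.+ ε ℚ.≤ seq y n

_≈ᴿ_ : ℝ → ℝ → Set
x ≈ᴿ y = x ≤ᴿ y × y ≤ᴿ x

fromℚᴿ : ℚ → ℝ
fromℚᴿ q = mkℝ (λ _ → q) (const-cauchy q)

fromℕᴿ : ℕ → ℝ
fromℕᴿ n = fromℚᴿ (fromℕ n)

0ᴿ 1ᴿ : ℝ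
0ᴿ = fromℕᴿ 0
1ᴿ = fromℕᴿ 1

_+ᴿ_ : ℝ → ℝ → ℝ
mkℝ s cs +ᴿ mkℝ t ct = mkℝ (λ n → s n ℚ.+ t n) (+-cauchy {s} {t} cs ct)

-ᴿ_ : ℝ → ℝ
-ᴿ mkℝ s cs = mkℝ (λ n → ℚ.- s n) (neg-cauchy {s} cs)

_-ᴿ_ : ℝ → ℝ → ℝ
x -ᴿ y = x +ᴿ -ᴿ y

_*ᴿ_ : ℝ → ℝ → ℝ
mkℝ s cs *ᴿ mkℝ t ct = mkℝ (λ n → s n ℚ.* t n) (*-cauchy {s} {t} cs ct)

_⊔ᴿ_ : ℝ → ℝ → ℝ
mkℝ s cs ⊔ᴿ mkℝ t ct = mkℝ (λ n → s n ℚ.⊔ t n) (⊔-cauchy {s} {t} cs ct)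

∣_∣ᴿ : ℝ → ℝ
∣ x ∣ᴿ = x ⊔ᴿ -ᴿ x

-- The diagonal n ↦ Σ_{k<n} (seq x n)ᵏ / k! of the exponential series.
exp : ℝ → ℝ
exp (mkℝ s cs) = mkℝ (λ n → expSum (s n) n) (exp-cauchy {s} cs)

sumᴿ : List ℝ → ℝ
sumᴿ = foldr _+ᴿ_ 0ᴿ

-- The maximum of a list of nonnegative reals.
maxᴿ : List ℝ → ℝ
maxᴿ = foldr _⊔ᴿ_ 0ᴿ

[1⋯_] : ℕ → List ℕ
[1⋯ n ] = applyUpTo suc n

φ : ℕ → ℕ
φ q = length (filter (λ a → coprime? a q) [1⋯ q ])

-- Ω 0 is a dummy value.
Ω : ℕ → ℕ
Ω zero      = 0
Ω n@(suc _) = length (PrimeFactorisation.factors (factorise n))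

liouville : ℕ → ℤ
liouville n = -1ℤ ℤ.^ Ω n

InfinitelyMany : (ℕ → Set) → Set
InfinitelyMany P = ∀ m → ∃ λ n → m ℕ.< n × P n

private
  leastPrime≥ : ∀ k m → Prime (k ℕ.+ m) → ∃ λ p → Prime p × m ℕ.≤ p × (∀ q → Prime q → m ℕ.≤ q → p ℕ.≤ q)
  leastPrime≥ zero    m pr = m , pr , ℕ.≤-refl , λ _ _ m≤q → m≤q
  leastPrime≥ (suc k) m pr with prime? m
  ... | yes pm = m , pm , ℕ.≤-refl , λ _ _ m≤q → m≤q
  ... | no ¬pm with leastPrime≥ k (suc m) (subst Prime (sym (ℕ.+-suc k m)) pr)
  ...   | p , pp , m<p , least = p , pp , ℕ.<⇒≤ m<p , λ q pq m≤q →
            least q pq (ℕ.≤∧≢⇒< m≤q λ { refl → ¬pm pq })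

  ∣! : ∀ {m n} → 0 ℕ.< m → m ℕ.≤ n → m ∣ n !
  ∣! {suc m} {zero} _ ()
  ∣! {m} {suc n} 0<m m≤1+n with m ℕ.≟ suc n
  ... | yes refl = m∣m*n (n !)
  ... | no  m≢   = ∣-trans (∣! 0<m (ℕ.≤-pred (ℕ.≤∧≢⇒< m≤1+n m≢))) (divides (suc n) refl)

  euclid : ∀ n → ∃ λ p → Prime p × n ℕ.< p
  euclid n = fromFactors (factorise (suc (n !)))
    where
    fromFactors : PrimeFactorisation (suc (n !)) → ∃ λ p → Prime p × n ℕ.< p
    fromFactors record { factors = [] ; isFactorisation = eq } =
      contradiction (ℕ.suc-injective eq) (ℕ.≢-nonZero⁻¹ (n !) ⦃ n ℕ.!≢0 ⦄)
    fromFactors record { factors = p ∷ ps ; isFactorisation = eq ; factorsPrime = pp ∷ _ } with n ℕ.<? p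
    ... | yes n<p = p , pp , n<p
    ... | no  n≮p = contradiction (subst Prime (∣1⇒≡1 p∣1) pp) ¬prime[1]
      where
      p∣1+n! : p ∣ n ! ℕ.+ 1
      p∣1+n! = subst (p ∣_) (trans (sym eq) (ℕ.+-comm 1 (n !))) (m∣m*n (List.foldr ℕ._*_ 1 ps))
      p∣1 : p ∣ 1
      p∣1 = ∣m+n∣m⇒∣n p∣1+n! (∣! (ℕ.n≢0⇒n>0 λ { refl → contradiction pp λ () }) (ℕ.≮⇒≥ n≮p))

nextPrime : ∀ n → ∃ λ p → Prime p × n ℕ.< p × (∀ q → Prime q → n ℕ.< q → p ℕ.≤ q)
nextPrime n with euclid n
... | p , pp , n<p = leastPrime≥ (p ℕ.∸ suc n) (suc n) (subst Prime (sym (ℕ.m∸n+n≡m n<p)) pp)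

-- nthPrime 1 = 2, nthPrime 2 = 3, …; the value at 0 is a dummy.
nthPrime : ℕ → ℕ
nthPrime zero    = 0
nthPrime (suc n) = proj₁ (nextPrime (nthPrime n))

primeGap : ℕ → ℕ
primeGap n = nthPrime (suc n) ℕ.∸ nthPrime n

-- m = inf_{k≥n} g k, as a greatest lower bound.
IsTailInf : (ℕ → ℕ) → ℕ → ℕ → Set
IsTailInf g n m = (∀ k → n ℕ.≤ k → m ℕ.≤ g k)
                × (∀ l → (∀ k → n ℕ.≤ k → l ℕ.≤ g k) → l ℕ.≤ m)

-- L = sup_n inf_{k≥n} g k, as a least upper bound. No L qualifies when the
-- lower limit is infinite.
IsLimInf : (ℕ → ℕ) → ℕ → Set
IsLimInf g L = (∀ n m → IsTailInf g n m → m ℕ.≤ L)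
             × (∀ U → (∀ n m → IsTailInf g n m → m ℕ.≤ U) → L ℕ.≤ U)

-- max_{y≤N} max_a |Σ_{n≤y, n≡a (q)} λ(n)|, with a over a complete residue system.
liouvilleError : ℕ → ℕ → ℕ
liouvilleError N q = max 0 (map (λ y → max 0 (map (λ a → ℤ.∣ liouvilleSum y a ∣) [1⋯ q ])) [1⋯ N ])
  where
  liouvilleSum : ℕ → ℕ → ℤ
  liouvilleSum y a = foldr ℤ._+_ (+ 0) (map liouville (filter (λ n → q ∣? ℕ.∣ n - a ∣) [1⋯ y ]))

-- Inverse, logarithm and integer part are not computable on Cauchy reals;
-- excluded middle makes them total functions, with dummy values outside
-- their domains of definition.
module Classical (lem : ExcludedMiddle 0ℓ) where

  infixl 7 _/ᴿ_
  infixr 8 _^ᴿ_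

  _⁻¹ᴿ : ℝ → ℝ
  x ⁻¹ᴿ with lem {∃ λ y → x *ᴿ y ≈ᴿ 1ᴿ}
  ... | yes (y , _) = y
  ... | no  _       = 0ᴿ

  _/ᴿ_ : ℝ → ℝ → ℝ
  x /ᴿ y = x *ᴿ y ⁻¹ᴿ

  log : ℝ → ℝ
  log x with lem {∃ λ y → exp y ≈ᴿ x}
  ... | yes (y , _) = y
  ... | no  _       = 0ᴿ

  -- Meaningful for x > 0.
  _^ᴿ_ : ℝ → ℝ → ℝ
  x ^ᴿ s = exp (s *ᴿ log x)

  -- Meaningful for x ≥ 0.
  ⌊_⌋ : ℝ → ℕ
  ⌊ x ⌋ with lem {∃ λ k → fromℕᴿ k ≤ᴿ x × x <ᴿ fromℕᴿ (suc k)}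
  ... | yes (k , _) = k
  ... | no  _       = 0

  -- max_{(a,q)=1} |Σ_{p≤N, p≡a (q)} log p - N/φ(q)|
  primeError : ℕ → ℕ → ℝ
  primeError N q = maxᴿ (map (λ a → ∣ θ a -ᴿ fromℕᴿ N /ᴿ fromℕᴿ (φ q) ∣ᴿ) (filter (λ a → coprime? a q) [1⋯ q ]))
    where
    θ : ℕ → ℝ
    θ a = sumᴿ (map (λ p → log (fromℕᴿ p)) (filter (λ p → prime? p ×-dec (q ∣? ℕ.∣ p - a ∣)) [1⋯ N ]))

  -- E N Q ≪_{ε,A} N/(log N)^A with Q = ⌊N^{ϑ-ε}⌋, for all ε, A > 0. The
  -- range N ≥ 2 is where log N > 0.
  HasLevel : (ℕ → ℕ → ℝ) → ℝ → Set
  HasLevel E ϑ = ∀ ε A → 0ᴿ <ᴿ ε → 0ᴿ <ᴿ A → ∃ λ C → ∀ N → 2 ℕ.≤ N →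
    E N ⌊ fromℕᴿ N ^ᴿ (ϑ -ᴿ ε) ⌋ ≤ᴿ C *ᴿ (fromℕᴿ N /ᴿ log (fromℕᴿ N) ^ᴿ A)

  ConditionA : ℝ → Set
  ConditionA = HasLevel λ N Q → sumᴿ (map (primeError N) [1⋯ Q ])

  ConditionB : ℝ → Set
  ConditionB = HasLevel λ N Q → fromℕᴿ (sum (map (liouvilleError N) [1⋯ Q ]))

open Classical public

-- (ϑ₀ , D₄ , D₃)
triples : List (ℚ × ℕ × ℕ)
triples = (+ 729 / 1000 , 1 , 2)
        ∷ (+ 616 / 1000 , 3 , 6)
        ∷ (+ 554 / 1000 , 4 , 8)
        ∷ (+ 515 / 1000 , 7 , 12)
        ∷ []

{-# OPTIONS --safe #-}
module Submission where

-- A Goldston–Pintz–Yıldırım sieve, carried out with finite sums only. If both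
-- alternatives fail then, for an admissible tuple h₁ < … < hₖ and a suitable
-- h₀, every large n satisfies 2 Σᵢ 1_P(n + hᵢ) ≤ 1 + λ(n + h₀): at most one
-- n + hᵢ is prime, and λ(n + h₀) = 1 when one is. Sum this against the square
-- of a Selberg weight of level R over n in a fixed residue class modulo
-- W = 2·∏ (odd numbers ≤ z). Condition (A) evaluates the left side, condition
-- (B) makes the contribution of λ negligible, and the ratio of the two main
-- terms is a finite quadratic inequality for the values of the weight at the
-- powers of one number X, which is decided by computation.
--
-- The sieve is developed over an arbitrary ordered field. It is applied over
-- ℚ: all real quantities occurring for a given N are evaluated at one large
-- index of their Cauchy sequences, where log p lies between −1 and
-- 1 + Σ_{n≤p} 1/n up to a negligible error.

-- The weight is not written as a truncated divisor sum but in the basis of products of mean-zero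
-- functions, one for each prime. This makes the main term over all integers exactly diagonal, and
-- each prime enters through one linear indicator, so a single induction over the list of primes
-- gives main term and error together. In the main terms neither logarithms nor integrals appear:
-- the harmonic number `ℋ X` stands for log X, a sum over squarefree r with weight k^ω(r)/r is
-- compared with a k-fold iteration of Σ 1/m, and each of these becomes a sum over powers of X
-- because the weight decreases. An integral inequality for a polynomial in log(R/r) thus turns into
-- one for iterated prefix sums of its values, inclusive sums above and exclusive sums below; the
-- loss in this is kept small by taking several thousand powers of X up to R. N is an exact 1000th
-- power of a power of X, so the level of distribution is an inequality between exponents. The other
-- multiplicative losses are convergent products over primes above z, controlled by z, and the
-- masses of cells between powers of X, controlled by the size of `ℋ X` against W.

open import Algebra.Structures using (IsCommutativeRing)
open import Relation.Binary.PropositionalEquality using (_≡_; _≢_)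
open import Relation.Binary.Structures using (IsTotalOrder)

-- Congruences, the Chinese remainder theorem and the modulus W.

module Arith where

  open import Data.List using (List; []; _∷_)
  open import Data.List.Relation.Unary.All using (All; []; _∷_)
  open import Data.Nat
  open import Data.Nat.Coprimality as Coprime using (Coprime; coprime-Bézout; coprime-divisor)
  open import Data.Nat.Divisibility
  open import Data.Nat.GCD using (module Bézout)
  open import Data.Nat.Primality using (Prime; prime?; euclidsLemma; prime⇒nonTrivial; prime⇒irreducible; prime[2]; ¬prime[1])
  open import Data.Nat.Primality.Factorisation using (factorise)
  open import Data.Nat.Properties
  open import Data.Nat.Tactic.RingSolver using () renaming (solve-∀ to ℕ-ring)
  open import Data.Product using (∃; _×_; _,_)
  open import Data.Sum using (inj₁; inj₂)
  open import Relation.Binary.PropositionalEquality using (_≡_; _≢_; refl; sym; trans; cong; subst)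
  open import Relation.Nullary using (¬_; yes; no; contradiction)

  -- M divides ∣ a - b ∣, in a form without truncation.
  Cong : ℕ → ℕ → ℕ → Set
  Cong M a b = ∃ λ s → ∃ λ t → a + s * M ≡ b + t * M

  private
    diff-≤ : ∀ {M a b} → a ≤ b → M ∣ ∣ a - b ∣ → Cong M a b
    diff-≤ {M} {a} {b} a≤b (divides k eq) = k , 0 , trans (cong (a +_) (trans (sym eq) (m≤n⇒∣m-n∣≡n∸m a≤b))) (trans (m+[n∸m]≡n a≤b) (sym (+-identityʳ b)))

    Cong-sym : ∀ {M a b} → Cong M a b → Cong M b a
    Cong-sym (s , t , eq) = t , s , sym eq

    diff-≤⁻ : ∀ {M a b} → a ≤ b → Cong M a b → M ∣ ∣ a - b ∣
    diff-≤⁻ {M} {a} {b} a≤b (s , t , eq) = subst (M ∣_) (sym (m≤n⇒∣m-n∣≡n∸m a≤b)) (∣m+n∣m⇒∣n (divides s e) (divides t refl))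
      where
      l : ∀ a t d → a + (t + d) ≡ a + d + t
      l = ℕ-ring
      e : t * M + (b ∸ a) ≡ s * M
      e = +-cancelˡ-≡ a _ _ (trans (l a (t * M) (b ∸ a)) (trans (cong (_+ t * M) (m+[n∸m]≡n a≤b)) (sym eq)))

  ∣⇒Cong : ∀ {M} a b → M ∣ ∣ a - b ∣ → Cong M a b
  ∣⇒Cong {M} a b d with ≤-total a b
  ... | inj₁ a≤b = diff-≤ a≤b d
  ... | inj₂ b≤a = Cong-sym (diff-≤ b≤a (subst (M ∣_) (∣-∣-comm a b) d))

  Cong⇒∣ : ∀ {M} a b → Cong M a b → M ∣ ∣ a - b ∣
  Cong⇒∣ {M} a b c with ≤-total a b
  ... | inj₁ a≤b = diff-≤⁻ a≤b c
  ... | inj₂ b≤a = subst (M ∣_) (∣-∣-comm b a) (diff-≤⁻ b≤a (Cong-sym c))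

  Cong-trans : ∀ {M a b c} → Cong M a b → Cong M b c → Cong M a c
  Cong-trans {M} {a} {b} {c} (s , t , e) (u , v , f) = s + u , v + t ,
    trans (l₁ a s u M) (trans (cong (_+ u * M) e) (trans (l₂ b t u M) (trans (cong (_+ t * M) f) (sym (l₁ c v t M)))))
    where
    l₁ : ∀ a s u M → a + (s + u) * M ≡ a + s * M + u * M
    l₁ = ℕ-ring
    l₂ : ∀ b t u M → b + t * M + u * M ≡ b + u * M + t * M
    l₂ = ℕ-ring

  Cong-divisor : ∀ {M a b h} → Cong M a b → M ∣ b + h → M ∣ a + h
  Cong-divisor {M} {a} {b} {h} (s , t , e) d = ∣m+n∣m⇒∣n (subst (M ∣_) eq (∣m∣n⇒∣m+n d (divides t refl))) (divides s refl)
    where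
    l₁ : ∀ b h t → b + h + t ≡ b + t + h
    l₁ = ℕ-ring
    l₂ : ∀ a h s → a + s + h ≡ s + (a + h)
    l₂ = ℕ-ring
    eq : b + h + t * M ≡ s * M + (a + h)
    eq = trans (l₁ b h (t * M)) (trans (cong (_+ h) (sym e)) (l₂ a h (s * M)))

  ∣+⇒Cong : ∀ {M a b h} → M ∣ a + h → M ∣ b + h → Cong M a b
  ∣+⇒Cong {M} {a} {b} {h} (divides s e) (divides t f) = t , s , +-cancelʳ-≡ h _ _
    (trans (l a t h M) (trans (cong (_+ t * M) e) (trans (+-comm (s * M) (t * M)) (trans (cong (_+ s * M) (sym f)) (sym (l b s h M))))))
    where
    l : ∀ a t h M → a + t * M + h ≡ a + h + t * M
    l = ℕ-ring

  Cong-weaken : ∀ {M d a b} → d ∣ M → Cong M a b → Cong d a b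
  Cong-weaken {M} {d} {a} {b} (divides k refl) (s , t , e) = s * k , t * k , trans (cong (a +_) (*-assoc s k d)) (trans e (cong (b +_) (sym (*-assoc t k d))))

  private
    -- Bézout over the naturals comes with either sign. In the first case `x * M` is -1 modulo `p`,
    -- so `x * c` works; in the second it is 1, and -c is represented by `c * p-1`.
    solve-class : ∀ {M p} → 1 ≤ p → Coprime M p → ∀ c → ∃ λ t → p ∣ c + M * t
    solve-class {M} {p@(suc p-1)} _ cop c with coprime-Bézout cop
    ... | Bézout.-+ x y eq = x * c , divides (c * y) (trans (l₁ c M x) (trans (cong (c *_) eq) (sym (*-assoc c y p))))
      where
      l₁ : ∀ c M x → c + M * (x * c) ≡ c * (1 + x * M)
      l₁ = ℕ-ring
    ... | Bézout.+- x y eq = x * (c * p-1) , divides (c + y * c * p-1)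
          (trans (l₁ c M x p-1) (trans (cong (λ t → c + t * (c * p-1)) (sym eq)) (l₂ c y p-1)))
      where
      l₁ : ∀ c M x p-1 → c + M * (x * (c * p-1)) ≡ c + x * M * (c * p-1)
      l₁ = ℕ-ring
      l₂ : ∀ c y p-1 → c + (1 + y * suc p-1) * (c * p-1) ≡ (c + y * c * p-1) * suc p-1
      l₂ = ℕ-ring

  coprime-* : ∀ {m n d} → Coprime m n → m ∣ d → n ∣ d → m * n ∣ d
  coprime-* {m} {n} cop (divides k refl) n∣d = subst (_∣ k * m) (*-comm n m) (*-monoˡ-∣ m (coprime-divisor (Coprime.sym cop) (subst (n ∣_) (*-comm k m) n∣d)))

  -- A sieve step adds the condition `p ∣ n + h` to a class modulo `M`. The two conditions merge
  -- into one class modulo `M * p`, that of `v + M * t` with `t` from `solve-class`; both directions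
  -- are given because indicator functions have to agree.
  crt : ∀ {M p} → 1 ≤ p → Coprime M p → ∀ v h → ∃ λ v′ → M ∣ ∣ v′ - v ∣ × p ∣ v′ + h ×
    (∀ n → M ∣ ∣ n - v ∣ → p ∣ n + h → M * p ∣ ∣ n - v′ ∣) × (∀ n → M * p ∣ ∣ n - v′ ∣ → M ∣ ∣ n - v ∣ × p ∣ n + h)
  crt {M} {p} 1≤p cop v h with solve-class 1≤p cop (v + h)
  ... | t , d = v′ , Cong⇒∣ v′ v v′≡v , d′ ,
      (λ n a b → coprime-* cop (Cong⇒∣ n v′ (Cong-trans {b = v} (∣⇒Cong n v a) (Cong-sym v′≡v))) (Cong⇒∣ n v′ (∣+⇒Cong {h = h} b d′))) ,
      (λ n a → Cong⇒∣ n v (Cong-trans {b = v′} (Cong-weaken (m∣m*n p) (∣⇒Cong n v′ a)) v′≡v) , Cong-divisor {h = h} (Cong-weaken (n∣m*n M) (∣⇒Cong n v′ a)) d′)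
    where
    v′ = v + M * t
    v′≡v : Cong M v′ v
    v′≡v = 0 , t , trans (+-identityʳ v′) (cong (v +_) (*-comm M t))
    l : ∀ v h x → v + h + x ≡ v + x + h
    l = ℕ-ring
    d′ : p ∣ v′ + h
    d′ = subst (p ∣_) (l v h (M * t)) d

  prime≥2 : ∀ {p} → Prime p → 2 ≤ p
  prime≥2 {p} pp = nonTrivial⇒n>1 p ⦃ prime⇒nonTrivial pp ⦄

  prime≥1 : ∀ {p} → Prime p → 1 ≤ p
  prime≥1 pp = <⇒≤ (prime≥2 pp)

  primeDivisor : ∀ n → 2 ≤ n → ∃ λ p → Prime p × p ∣ n
  primeDivisor n@(suc _) 2≤n with factorise n
  ... | record { factors = [] ; isFactorisation = eq } = contradiction (subst (2 ≤_) eq 2≤n) λ { (s≤s ()) }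
  ... | record { factors = p ∷ ps ; isFactorisation = eq ; factorsPrime = pp ∷ _ } = p , pp , subst (p ∣_) (sym eq) (m∣m*n _)

  -- A common divisor other than 1 has a prime divisor, which the hypothesis excludes: primes are
  -- positive, so `¬ 1 ≤ p` serves as the absurd conclusion.
  coprime-primes : ∀ {m n} → 1 ≤ m → (∀ {p} → Prime p → p ∣ m → p ∣ n → ¬ 1 ≤ p) → Coprime m n
  coprime-primes {m} {n} 1≤m h {d} (d∣m , d∣n) with d ≟ 0 | d ≟ 1
  ... | yes refl | _ = contradiction (0∣⇒≡0 d∣m) λ { refl → contradiction 1≤m λ () }
  ... | no _ | yes d≡1 = d≡1
  ... | no d≢0 | no d≢1 with primeDivisor d (≤∧≢⇒< (n≢0⇒n>0 d≢0) (λ e → d≢1 (sym e)))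
  ... | p , pp , p∣d = contradiction (prime≥1 pp) (h pp (∣-trans p∣d d∣m) (∣-trans p∣d d∣n))

  coprime⇒¬∣ : ∀ {m n p} → Prime p → Coprime m n → p ∣ m → ¬ p ∣ n
  coprime⇒¬∣ pp cop p∣m p∣n = contradiction (subst Prime (cop (p∣m , p∣n)) pp) ¬prime[1]

  prime-coprime : ∀ {p n} → Prime p → ¬ p ∣ n → Coprime n p
  prime-coprime {p} pp ¬p∣n (d∣n , d∣p) with prime⇒irreducible pp d∣p
  ... | inj₁ d≡1 = d≡1
  ... | inj₂ refl = contradiction d∣n ¬p∣n

  prime∣prime : ∀ {p q} → Prime p → Prime q → p ∣ q → p ≡ q
  prime∣prime pp pq p∣q with prime⇒irreducible pq p∣q
  ... | inj₁ refl = contradiction pp ¬prime[1]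
  ... | inj₂ e = e

  -- odd j = 1 · 3 · 5 ⋯ (2j+1)
  odd : ℕ → ℕ
  odd zero = 1
  odd (suc j) = (3 + 2 * j) * odd j

  private
    2∤odd′ : ∀ j → ¬ 2 ∣ 3 + 2 * j
    2∤odd′ j d = contradiction (∣m+n∣m⇒∣n (subst (2 ∣_) (l j) d) (m∣m*n (1 + j))) λ d → contradiction (∣⇒≤ d) λ { (s≤s ()) }
      where
      l : ∀ j → 3 + 2 * j ≡ 2 * (1 + j) + 1
      l = ℕ-ring

  2∤odd : ∀ j → ¬ 2 ∣ odd j
  2∤odd zero d = contradiction (∣⇒≤ d) λ { (s≤s ()) }
  2∤odd (suc j) d with euclidsLemma (3 + 2 * j) (odd j) prime[2] d
  ... | inj₁ d = 2∤odd′ j d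
  ... | inj₂ d = 2∤odd j d

  1≤odd : ∀ j → 1 ≤ odd j
  1≤odd zero = ≤-refl
  1≤odd (suc j) = *-mono-≤ {1} {3 + 2 * j} {1} (s≤s z≤n) (1≤odd j)

  j≤odd : ∀ j → 1 + 2 * j ≤ odd j
  j≤odd zero = ≤-refl
  j≤odd (suc j) = ≤-trans (≤-reflexive (l j)) (subst (_≤ (3 + 2 * j) * odd j) (*-identityʳ (3 + 2 * j)) (*-monoʳ-≤ (3 + 2 * j) (1≤odd j)))
    where
    l : ∀ j → 1 + 2 * suc j ≡ 3 + 2 * j
    l = ℕ-ring

  -- An odd prime in range is itself one of the factors of `odd j`, and an even one is 2. Together
  -- with `2*odd-smooth` this identifies the prime divisors of W as the primes up to z, although W
  -- multiplies composite odd numbers as well.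
  ∣2*odd : ∀ j {p} → Prime p → p ≤ 1 + 2 * j → p ∣ 2 * odd j
  ∣2*odd zero pp l = contradiction (prime≥2 pp) (<⇒≱ (s≤s l))
  ∣2*odd (suc j) {p} pp l with p ≟ 3 + 2 * j | p ≟ 2 + 2 * j
  ... | yes refl | _ = ∣-trans (m∣m*n (odd j)) (n∣m*n 2)
  ... | no _ | yes refl = subst (2 + 2 * j ∣_) (cong (λ t → t * ((3 + 2 * j) * odd j)) e) (m∣m*n ((3 + 2 * j) * odd j))
    where
    l′ : ∀ j → 2 * (1 + j) ≡ 2 + 2 * j
    l′ = ℕ-ring
    e : 2 + 2 * j ≡ 2
    e = sym (prime∣prime prime[2] pp (subst (2 ∣_) (l′ j) (m∣m*n (1 + j))))
  ... | no a | no b = ∣-trans (∣2*odd j pp (≤-pred (≤∧≢⇒< (≤-pred (≤∧≢⇒< l′ a)) b))) (subst (2 * odd j ∣_) (l₂ (3 + 2 * j) (odd j)) (m∣m*n (3 + 2 * j)))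
    where
    l₁ : ∀ j → 1 + 2 * suc j ≡ 3 + 2 * j
    l₁ = ℕ-ring
    l₂ : ∀ a b → 2 * b * a ≡ 2 * (a * b)
    l₂ = ℕ-ring
    l′ : p ≤ 3 + 2 * j
    l′ = subst (p ≤_) (l₁ j) l

  2*odd-smooth : ∀ j → 1 ≤ j → ∀ {p} → Prime p → p ∣ 2 * odd j → p ≤ 1 + 2 * j
  2*odd-smooth j 1≤j {p} pp d with euclidsLemma 2 (odd j) pp d
  ... | inj₁ d = ≤-trans (∣⇒≤ d) (s≤s (*-mono-≤ {1} {2} (s≤s z≤n) 1≤j))
  ... | inj₂ d = go j d
    where
    l₁ : ∀ j → 1 + 2 * suc j ≡ 3 + 2 * j
    l₁ = ℕ-ring
    go : ∀ j → p ∣ odd j → p ≤ 1 + 2 * j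
    go zero d = ∣⇒≤ d
    go (suc j) d with euclidsLemma (3 + 2 * j) (odd j) pp d
    ... | inj₁ d = subst (p ≤_) (sym (l₁ j)) (∣⇒≤ d)
    ... | inj₂ d = ≤-trans (go j d) (s≤s (*-monoʳ-≤ 2 (n≤1+n j)))

  -- With n ≡ odd j − 4, every shift h with |h − 4| a power of two keeps n + h prime to 2 · odd j.
  shift-coprime : ∀ j {v h} → v + 4 ≡ odd j → 2 ∣ h → ∣ 4 - h ∣ ∣ 8 → 1 ≤ v + h → Coprime (v + h) (2 * odd j)
  shift-coprime j {v} {h} eq 2∣h d8 1≤ = coprime-primes 1≤ main
    where
    not2 : ¬ 2 ∣ v + h
    not2 d = 2∤odd j (subst (2 ∣_) eq (∣m∣n⇒∣m+n (∣m+n∣m⇒∣n (subst (2 ∣_) (+-comm v h) d) 2∣h) (divides 2 refl)))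
    main : ∀ {p} → Prime p → p ∣ v + h → p ∣ 2 * odd j → ¬ 1 ≤ p
    main {p} pp a b _ with euclidsLemma 2 (odd j) pp b
    ... | inj₁ b = not2 (subst (_∣ v + h) (prime∣prime pp prime[2] b) a)
    ... | inj₂ b = not2 (subst (_∣ v + h) p≡2 a)
      where
      p∣8 : p ∣ 8
      p∣8 = ∣-trans (Cong⇒∣ 4 h (∣+⇒Cong {a = 4} {h} {v} (subst (p ∣_) (trans (sym eq) (+-comm v 4)) b) (subst (p ∣_) (+-comm v h) a))) d8
      p≡2 : p ≡ 2
      p≡2 with euclidsLemma 2 4 pp p∣8
      ... | inj₁ d = prime∣prime pp prime[2] d
      ... | inj₂ d with euclidsLemma 2 2 pp d
      ... | inj₁ d = prime∣prime pp prime[2] d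
      ... | inj₂ d = prime∣prime pp prime[2] d

  -- The primes in (b, b + n], in increasing order: when a prime is reached, everything treated
  -- before it is composed of smaller primes.
  primesAbove : ℕ → ℕ → List ℕ
  primesAbove b zero = []
  primesAbove b (suc n) with prime? (suc b)
  ... | yes _ = suc b ∷ primesAbove (suc b) n
  ... | no _ = primesAbove (suc b) n

  primesAbove-All : ∀ b n → All (λ p → Prime p × b < p) (primesAbove b n)
  primesAbove-All b zero = []
  primesAbove-All b (suc n) with prime? (suc b)
  ... | yes pp = (pp , ≤-refl) ∷ All.map (λ (pp , l) → pp , <-trans ≤-refl l) (primesAbove-All (suc b) n)
    where import Data.List.Relation.Unary.All as All
  ... | no _ = All.map (λ (pp , l) → pp , <-trans ≤-refl l) (primesAbove-All (suc b) n)
    where import Data.List.Relation.Unary.All as All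

  ^-distribʳ-* : ∀ o m n → (m * n) ^ o ≡ m ^ o * n ^ o
  ^-distribʳ-* zero m n = refl
  ^-distribʳ-* (suc o) m n = trans (cong (m * n *_) (^-distribʳ-* o m n)) (l m n (m ^ o) (n ^ o))
    where
    l : ∀ m n a b → m * n * (a * b) ≡ m * a * (n * b)
    l = ℕ-ring

-- Evaluation of the final inequality by iterated prefix sums.

module Numerics where

  open import Data.Bool using (Bool; true; T)
  open import Data.List using (List; []; _∷_)
  open import Data.Nat
  open import Data.Nat.Properties
  open import Data.Product using (_×_; _,_; proj₁; proj₂)
  open import Data.Unit using (tt)
  open import Relation.Binary.PropositionalEquality using (_≡_; refl; sym; trans; cong; cong₂; subst)

  -- Inclusive and exclusive prefix sums. They come from bounding a decreasing function on a cell
  -- between two powers of X by its value at the left end or at the right end.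
  pre⁺ pre⁻ : (ℕ → ℕ) → ℕ → ℕ
  pre⁺ f zero = f 0
  pre⁺ f (suc i) = pre⁺ f i + f (suc i)
  pre⁻ f zero = 0
  pre⁻ f (suc i) = pre⁻ f i + f i

  square : (ℕ → ℕ) → ℕ → ℕ
  square f i = f i * f i

  iterℕ : ((ℕ → ℕ) → ℕ → ℕ) → ℕ → (ℕ → ℕ) → ℕ → ℕ
  iterℕ U zero f = f
  iterℕ U (suc k) f = iterℕ U k (U f)

  -- All iterated prefix sums at one index `i`, as a column. Passing to the next index takes one
  -- addition per entry, so no table of earlier values is kept.
  tower : ((ℕ → ℕ) → ℕ → ℕ) → ℕ → (ℕ → ℕ) → ℕ → List ℕ
  tower U zero f i = []
  tower U (suc k) f i = U f i ∷ tower U k (U f) i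

  final : List ℕ → ℕ
  final [] = 0
  final (a ∷ []) = a
  final (_ ∷ b ∷ as) = final (b ∷ as)

  final-tower : ∀ U k f i → final (tower U (suc k) f i) ≡ iterℕ U (suc k) f i
  final-tower U zero f i = refl
  final-tower U (suc k) f i = final-tower U k (U f) i

  mutual
    -- Each entry adds the already updated entry before it, whereas `push⁻` adds the old one; this
    -- is the difference between inclusive and exclusive sums. Handing the new entry to `cons⁺` as
    -- an argument lets both of its uses share one value.
    push⁺ : List ℕ → ℕ → List ℕ
    push⁺ [] x = []
    push⁺ (a ∷ as) x = cons⁺ (a + x) as

    cons⁺ : ℕ → List ℕ → List ℕ
    cons⁺ s as = s ∷ push⁺ as s

  push⁻ : List ℕ → ℕ → List ℕ
  push⁻ [] x = []
  push⁻ (a ∷ as) x = (a + x) ∷ push⁻ as a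

  push⁺-tower : ∀ k f i → push⁺ (tower pre⁺ k f i) (f (suc i)) ≡ tower pre⁺ k f (suc i)
  push⁺-tower zero f i = refl
  push⁺-tower (suc k) f i = cong (pre⁺ f (suc i) ∷_) (push⁺-tower k (pre⁺ f) i)

  push⁻-tower : ∀ k f i → push⁻ (tower pre⁻ k f i) (f i) ≡ tower pre⁻ k f (suc i)
  push⁻-tower zero f i = refl
  push⁻-tower (suc k) f i = cong (pre⁻ f (suc i) ∷_) (push⁻-tower k (pre⁻ f) i)

  module Run (c a b : ℕ) where

    -- Increments of the weight. Their prefix sum at `i` is c + a i + b i (i + 1)/2, a polynomial of
    -- degree at most two in log(R/r)/log X.
    d : ℕ → ℕ
    d zero = c
    d (suc i) = a + b * suc i

    mutual
      -- `P` is the weight at index `i` and `S` its exclusive prefix sum; the two columns belong to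
      -- the squares of these, which are what the two main terms sum.
      loop : ℕ → ℕ → ℕ → ℕ → List ℕ → List ℕ → List ℕ × List ℕ
      loop zero i P S T⁺ T⁻ = T⁺ , T⁻
      loop (suc n) i P S T⁺ T⁻ = loop′ n i (P + d (suc i)) P S T⁺ T⁻

      loop′ : ℕ → ℕ → ℕ → ℕ → ℕ → List ℕ → List ℕ → List ℕ × List ℕ
      loop′ n i P′ P S T⁺ T⁻ = loop n (suc i) P′ (S + P) (push⁺ T⁺ (P′ * P′)) (push⁻ T⁻ (S * S))

    loop-spec : ∀ k l n i → loop n i (pre⁺ d i) (pre⁻ (pre⁺ d) i) (tower pre⁺ k (square (pre⁺ d)) i) (tower pre⁻ l (square (pre⁻ (pre⁺ d))) i)
      ≡ (tower pre⁺ k (square (pre⁺ d)) (n + i) , tower pre⁻ l (square (pre⁻ (pre⁺ d))) (n + i))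
    loop-spec k l zero i = refl
    loop-spec k l (suc n) i = trans (cong₂ (loop n (suc i) (pre⁺ d (suc i)) (pre⁻ (pre⁺ d) (suc i))) (push⁺-tower k (square (pre⁺ d)) i) (push⁻-tower l (square (pre⁻ (pre⁺ d))) i))
      (trans (loop-spec k l n (suc i)) (cong (λ t → tower pre⁺ k (square (pre⁺ d)) t , tower pre⁻ l (square (pre⁻ (pre⁺ d))) t) (+-suc n i)))

    results : ℕ → ℕ → ℕ → List ℕ × List ℕ
    results k l J = loop J 0 c 0 (tower pre⁺ k (square (pre⁺ d)) 0) (tower pre⁻ l (square (pre⁻ (pre⁺ d))) 0)

    -- With k = `suc l`, this is (2 + K) n⁺ < 2 k n⁻ with a margin. K is log N / log X; the cube of
    -- (M - 1)/M pays for the multiplicative losses, and the additive constant for the error terms.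
    inequality : ℕ → ℕ → ℕ → List ℕ × List ℕ → Bool
    inequality l K M (T⁺ , T⁻) = M * M * M * ((2 + K) * final T⁺ + (2 * suc l + ((2 + K) + (2 + K)))) <ᵇ 2 * suc l * ((M ∸ 1) * (M ∸ 1) * (M ∸ 1)) * final T⁻

    verified : ∀ l J K M → inequality (suc l) K M (results (suc (suc l)) (suc l) J) ≡ true →
      M * M * M * ((2 + K) * iterℕ pre⁺ (suc (suc l)) (square (pre⁺ d)) J + (2 * suc (suc l) + ((2 + K) + (2 + K))))
        < 2 * suc (suc l) * ((M ∸ 1) * (M ∸ 1) * (M ∸ 1)) * iterℕ pre⁻ (suc l) (square (pre⁻ (pre⁺ d))) J
    verified l J K M eq = <ᵇ⇒< _ _ (subst T (sym (trans (sym (cong₂ (λ s t → M * M * M * ((2 + K) * s + (2 * suc (suc l) + ((2 + K) + (2 + K)))) <ᵇ 2 * suc (suc l) * ((M ∸ 1) * (M ∸ 1) * (M ∸ 1)) * t)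
        (trans (cong final (trans (cong proj₁ spec) (cong (tower pre⁺ (suc (suc l)) (square (pre⁺ d))) (+-identityʳ J)))) (final-tower pre⁺ (suc l) (square (pre⁺ d)) J))
        (trans (cong final (trans (cong proj₂ spec) (cong (tower pre⁻ (suc l) (square (pre⁻ (pre⁺ d)))) (+-identityʳ J)))) (final-tower pre⁻ l (square (pre⁻ (pre⁺ d))) J)))) eq)) tt)
      where
      spec : results (suc (suc l)) (suc l) J ≡ (tower pre⁺ (suc (suc l)) (square (pre⁺ d)) (J + 0) , tower pre⁻ (suc l) (square (pre⁻ (pre⁺ d))) (J + 0))
      spec = loop-spec (suc (suc l)) (suc l) J 0

-- Ordered fields: ring solver, inequalities, two-sided approximation, indicators.

record OrderedField : Set₁ where
  infix 8 -_
  infix 9 _⁻¹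
  infixl 7 _*_
  infixl 6 _+_
  infix 4 _≤_
  field
    Carrier : Set
    _+_ _*_ : Carrier → Carrier → Carrier
    -_ _⁻¹ : Carrier → Carrier
    0# 1# : Carrier
    _≤_ : Carrier → Carrier → Set
    isCommutativeRing : IsCommutativeRing _≡_ _+_ _*_ -_ 0# 1#
    isTotalOrder : IsTotalOrder _≡_ _≤_
    +-monoʳ-≤ : ∀ z {x y} → x ≤ y → z + x ≤ z + y
    *-nonNeg : ∀ {x y} → 0# ≤ x → 0# ≤ y → 0# ≤ x * y
    ⁻¹-inverseʳ : ∀ {x} → x ≢ 0# → x * x ⁻¹ ≡ 1#
    1≢0 : 1# ≢ 0#

module OverField (F : OrderedField) where
  open import Algebra.Bundles using (CommutativeRing; RawRing)
  import Algebra.Solver.Ring as RingSolver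
  open import Algebra.Solver.Ring.AlmostCommutativeRing using (AlmostCommutativeRing; fromCommutativeRing; _-Raw-AlmostCommutative⟶_)
  open import Algebra.Structures using (IsCommutativeRing)
  open import Data.Empty using (⊥; ⊥-elim)
  open import Data.Integer as ℤ using (ℤ; -[1+_]) renaming (+_ to pos)
  import Data.Integer.Properties as ℤ
  open import Data.List as List using (List; []; _∷_; length; filter; _++_; _∷ʳ_)
  open import Data.List.Membership.Propositional using (_∈_)
  import Data.List.Properties as List
  open import Data.List.Relation.Unary.All using (All; []; _∷_)
  import Data.List.Relation.Unary.All as All
  open import Data.List.Relation.Unary.AllPairs using (AllPairs; []; _∷_)
  open import Data.List.Relation.Unary.Any using (Any; here; there; any?)
  open import Data.Maybe using (Maybe; just; nothing)
  open import Data.Nat as ℕ using (ℕ; zero; suc)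
  open import Data.Nat.Coprimality as Coprime using (Coprime; coprime?)
  open import Data.Nat.DivMod using (_/_; _%_; m≡m%n+[m/n]*n; m%n<n)
  open import Data.Nat.Divisibility using (_∣_; _∣?_; ∣⇒≤; m∣m*n; n∣m*n; ∣m+n∣m⇒∣n; ∣m∣n⇒∣m+n; ∣-trans; ∣m⇒∣m*n; ∣n⇒∣m*n)
  open import Data.Nat.ListAction using () renaming (sum to ℕ-sum)
  open import Data.Nat.Primality using (Prime; euclidsLemma; prime?)
  import Data.Nat.Properties as ℕ
  open import Data.Nat.Tactic.RingSolver using () renaming (solve-∀ to ℕ-ring)
  open import Data.Product using (∃; _×_; _,_; proj₁; proj₂)
  import Data.Sign as Sign
  open import Data.Sum using (_⊎_; inj₁; inj₂)
  open import Data.Unit using (⊤; tt)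
  open import Defs using (φ; [1⋯_])
  open import Level using (0ℓ)
  open import Relation.Binary.Bundles using (Poset)
  open import Relation.Binary.PropositionalEquality using (_≡_; _≢_; refl; sym; trans; cong; cong₂; subst; subst₂; module ≡-Reasoning)
  open import Relation.Binary.Structures using (IsTotalOrder)
  open import Relation.Nullary using (¬_; Dec; yes; no; contradiction)
  open import Relation.Unary using (Decidable)
  open Arith
  open Numerics using (pre⁺; pre⁻; square; iterℕ)

  open OrderedField F public

  infixl 6 _-_
  _-_ : Carrier → Carrier → Carrier
  x - y = x + - y

  open IsTotalOrder isTotalOrder public
    using (antisym; total) renaming (refl to ≤-refl; reflexive to ≤-reflexive; trans to ≤-trans)

  private
    commutativeRing : CommutativeRing 0ℓ 0ℓ
    commutativeRing = record { isCommutativeRing = isCommutativeRing }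
    almost : AlmostCommutativeRing 0ℓ 0ℓ
    almost = fromCommutativeRing commutativeRing

  open IsCommutativeRing isCommutativeRing public
    using (+-comm; +-assoc; *-comm; *-assoc; +-identityˡ; +-identityʳ; *-identityˡ; *-identityʳ; zeroˡ; zeroʳ; distribˡ; distribʳ; -‿inverseʳ; -‿inverseˡ)

  -- The clause for 1 makes the solver's constant 1 evaluate to 1# on the nose.
  ι : ℕ → Carrier
  ι zero = 0#
  ι (suc zero) = 1#
  ι (suc (suc n)) = 1# + ι (suc n)

  ι-suc : ∀ n → ι (suc n) ≡ 1# + ι n
  ι-suc zero = sym (+-identityʳ 1#)
  ι-suc (suc n) = refl

  ι-+ : ∀ m n → ι (m ℕ.+ n) ≡ ι m + ι n
  ι-+ zero n = sym (+-identityˡ (ι n))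
  ι-+ (suc m) n = begin
    ι (suc (m ℕ.+ n)) ≡⟨ ι-suc (m ℕ.+ n) ⟩
    1# + ι (m ℕ.+ n) ≡⟨ cong (1# +_) (ι-+ m n) ⟩
    1# + (ι m + ι n) ≡⟨ sym (+-assoc 1# (ι m) (ι n)) ⟩
    1# + ι m + ι n ≡⟨ cong (_+ ι n) (sym (ι-suc m)) ⟩
    ι (suc m) + ι n ∎
    where open ≡-Reasoning

  ι-* : ∀ m n → ι (m ℕ.* n) ≡ ι m * ι n
  ι-* zero n = sym (zeroˡ (ι n))
  ι-* (suc m) n = begin
    ι (n ℕ.+ m ℕ.* n) ≡⟨ ι-+ n (m ℕ.* n) ⟩
    ι n + ι (m ℕ.* n) ≡⟨ cong₂ _+_ (sym (*-identityˡ (ι n))) (ι-* m n) ⟩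
    1# * ι n + ι m * ι n ≡⟨ sym (distribʳ (ι n) 1# (ι m)) ⟩
    (1# + ι m) * ι n ≡⟨ cong (_* ι n) (sym (ι-suc m)) ⟩
    ι (suc m) * ι n ∎
    where open ≡-Reasoning

  ⟦_⟧ℤ : ℤ → Carrier
  ⟦ pos n ⟧ℤ = ι n
  ⟦ -[1+ n ] ⟧ℤ = - ι (suc n)

  private
    open import Algebra.Properties.Ring (CommutativeRing.ring commutativeRing)
      using (-‿involutive; -‿distribˡ-*; -‿distribʳ-*; -‿+-comm; -0#≈0#)

    neg-homo : ∀ i → ⟦ ℤ.- i ⟧ℤ ≡ - ⟦ i ⟧ℤ
    neg-homo (pos zero) = sym -0#≈0#
    neg-homo (pos (suc n)) = refl
    neg-homo -[1+ n ] = sym (-‿involutive (ι (suc n)))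

    ⊖-homo : ∀ m n → ⟦ m ℤ.⊖ n ⟧ℤ ≡ ι m - ι n
    ⊖-homo zero zero = sym (trans (cong (λ t → 0# + t) -0#≈0#) (+-identityʳ 0#))
    ⊖-homo zero (suc n) = sym (+-identityˡ _)
    ⊖-homo (suc m) zero = sym (trans (cong (λ t → ι (suc m) + t) -0#≈0#) (+-identityʳ _))
    ⊖-homo (suc m) (suc n) = begin
      ⟦ suc m ℤ.⊖ suc n ⟧ℤ ≡⟨ cong ⟦_⟧ℤ (ℤ.[1+m]⊖[1+n]≡m⊖n m n) ⟩
      ⟦ m ℤ.⊖ n ⟧ℤ ≡⟨ ⊖-homo m n ⟩
      ι m - ι n ≡⟨ cong (_- ι n) (sym (+-identityˡ (ι m))) ⟩
      0# + ι m - ι n ≡⟨ cong (λ t → t + ι m - ι n) (sym (-‿inverseʳ 1#)) ⟩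
      1# - 1# + ι m - ι n ≡⟨ cong (_- ι n) (trans (+-assoc 1# (- 1#) (ι m)) (trans (cong (1# +_) (+-comm (- 1#) (ι m))) (sym (+-assoc 1# (ι m) (- 1#))))) ⟩
      1# + ι m - 1# - ι n ≡⟨ +-assoc (1# + ι m) (- 1#) (- ι n) ⟩
      1# + ι m + (- 1# + - ι n) ≡⟨ cong (1# + ι m +_) (-‿+-comm 1# (ι n)) ⟩
      1# + ι m - (1# + ι n) ≡⟨ cong₂ _-_ (sym (ι-suc m)) (sym (ι-suc n)) ⟩
      ι (suc m) - ι (suc n) ∎
      where open ≡-Reasoning

  +-homo : ∀ i j → ⟦ i ℤ.+ j ⟧ℤ ≡ ⟦ i ⟧ℤ + ⟦ j ⟧ℤ
  +-homo (pos m) (pos n) = ι-+ m n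
  +-homo (pos m) -[1+ n ] = ⊖-homo m (suc n)
  +-homo -[1+ m ] (pos n) = trans (⊖-homo n (suc m)) (+-comm (ι n) (- ι (suc m)))
  +-homo -[1+ m ] -[1+ n ] = trans (cong (λ t → - ι t) (cong suc (sym (ℕ.+-suc m n))))
      (trans (cong -_ (ι-+ (suc m) (suc n))) (sym (-‿+-comm (ι (suc m)) (ι (suc n)))))

  private
    ◃-homo : ∀ n → ⟦ Sign.- ℤ.◃ n ⟧ℤ ≡ - ι n
    ◃-homo zero = sym -0#≈0#
    ◃-homo (suc n) = refl

    *-homo : ∀ i j → ⟦ i ℤ.* j ⟧ℤ ≡ ⟦ i ⟧ℤ * ⟦ j ⟧ℤ
    *-homo (pos m) (pos n) = trans (cong ⟦_⟧ℤ (ℤ.+◃n≡+n (m ℕ.* n))) (ι-* m n)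
    *-homo (pos m) -[1+ n ] = trans (◃-homo (m ℕ.* suc n)) (trans (cong -_ (ι-* m (suc n))) (-‿distribʳ-* (ι m) (ι (suc n))))
    *-homo -[1+ m ] (pos n) = trans (◃-homo (suc m ℕ.* n)) (trans (cong -_ (ι-* (suc m) n)) (-‿distribˡ-* (ι (suc m)) (ι n)))
    *-homo -[1+ m ] -[1+ n ] = trans (ι-* (suc m) (suc n)) (trans (sym (-‿involutive _))
      (trans (cong -_ (-‿distribˡ-* (ι (suc m)) (ι (suc n)))) (-‿distribʳ-* (- ι (suc m)) (ι (suc n)))))

    ℤ-raw : RawRing 0ℓ 0ℓ
    ℤ-raw = CommutativeRing.rawRing ℤ.+-*-commutativeRing

    morphism : ℤ-raw -Raw-AlmostCommutative⟶ almost
    morphism = record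
      { ⟦_⟧ = ⟦_⟧ℤ ; +-homo = +-homo ; *-homo = *-homo ; -‿homo = neg-homo ; 0-homo = refl ; 1-homo = refl }

    _≟ᶜ_ : ∀ i j → Maybe (⟦ i ⟧ℤ ≡ ⟦ j ⟧ℤ)
    i ≟ᶜ j with i ℤ.≟ j
    ... | yes refl = just refl
    ... | no _ = nothing

  module S = RingSolver ℤ-raw almost morphism _≟ᶜ_
  open S public using (solve; _:+_; _:*_; _:-_; :-_; _:=_; con)

  :1 : ∀ {n} → S.Polynomial n
  :1 = con (pos 1)

  poset : Poset 0ℓ 0ℓ 0ℓ
  poset = record { isPartialOrder = IsTotalOrder.isPartialOrder isTotalOrder }

  module ≤-Reasoning where
    open import Relation.Binary.Reasoning.PartialOrder poset public
      hiding (step-≈; step-≈˘; step-≈-⟩; step-≈-⟨)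

  +-mono-≤ : ∀ {x y u v} → x ≤ y → u ≤ v → x + u ≤ y + v
  +-mono-≤ {x} {y} {u} {v} h k = ≤-trans (+-monoʳ-≤ x k) (subst₂ _≤_ (+-comm v x) (+-comm v y) (+-monoʳ-≤ v h))

  +-monoˡ-≤ : ∀ z {x y} → x ≤ y → x + z ≤ y + z
  +-monoˡ-≤ z h = +-mono-≤ h ≤-refl

  0≤+ : ∀ {x y} → 0# ≤ x → 0# ≤ y → 0# ≤ x + y
  0≤+ {x} {y} h k = subst (_≤ x + y) (+-identityʳ 0#) (+-mono-≤ h k)

  x≤x+y : ∀ {x y} → 0# ≤ y → x ≤ x + y
  x≤x+y {x} {y} h = subst (_≤ x + y) (+-identityʳ x) (+-monoʳ-≤ x h)

  x≤y+x : ∀ {x y} → 0# ≤ y → x ≤ y + x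
  x≤y+x {x} {y} h = subst (x ≤_) (+-comm x y) (x≤x+y h)

  ≤⇒0≤- : ∀ {x y} → x ≤ y → 0# ≤ y - x
  ≤⇒0≤- {x} {y} h = subst (_≤ y - x) (-‿inverseʳ x) (+-monoˡ-≤ (- x) h)

  0≤-⇒≤ : ∀ {x y} → 0# ≤ y - x → x ≤ y
  0≤-⇒≤ {x} {y} h = subst₂ _≤_ (+-identityˡ x) (solve 2 (λ x y → y :- x :+ x := y) refl x y) (+-monoˡ-≤ x h)

  *-monoˡ : ∀ {c x y} → 0# ≤ c → x ≤ y → c * x ≤ c * y
  *-monoˡ {c} {x} {y} hc h = 0≤-⇒≤ (subst (0# ≤_) (solve 3 (λ c x y → c :* (y :- x) := c :* y :- c :* x) refl c x y) (*-nonNeg hc (≤⇒0≤- h)))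

  *-monoʳ : ∀ {c x y} → 0# ≤ c → x ≤ y → x * c ≤ y * c
  *-monoʳ {c} {x} {y} hc h = subst₂ _≤_ (*-comm c x) (*-comm c y) (*-monoˡ hc h)

  *-mono : ∀ {x y u v} → 0# ≤ x → 0# ≤ v → x ≤ y → u ≤ v → x * u ≤ y * v
  *-mono hx hv h k = ≤-trans (*-monoˡ hx k) (*-monoʳ hv h)

  sq-nonNeg : ∀ x → 0# ≤ x * x
  sq-nonNeg x with total 0# x
  ... | inj₁ h = *-nonNeg h h
  ... | inj₂ h = subst (0# ≤_) (solve 1 (λ x → (con (pos 0) :- x) :* (con (pos 0) :- x) := x :* x) refl x) (*-nonNeg (≤⇒0≤- h) (≤⇒0≤- h))

  sq-mono : ∀ {x y} → 0# ≤ x → x ≤ y → x * x ≤ y * y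
  sq-mono h k = *-mono h (≤-trans h k) k k

  0≤1 : 0# ≤ 1#
  0≤1 = subst (0# ≤_) (*-identityʳ 1#) (sq-nonNeg 1#)

  neg-≤ : ∀ {x y} → x ≤ y → - y ≤ - x
  neg-≤ {x} {y} h = 0≤-⇒≤ (subst (0# ≤_) (solve 2 (λ x y → y :- x := :- x :- :- y) refl x y) (≤⇒0≤- h))

  0≤ι : ∀ n → 0# ≤ ι n
  0≤ι zero = ≤-refl
  0≤ι (suc n) = subst (0# ≤_) (sym (ι-suc n)) (0≤+ 0≤1 (0≤ι n))

  ι-mono : ∀ {m n} → m ℕ.≤ n → ι m ≤ ι n
  ι-mono {n = n} ℕ.z≤n = 0≤ι n
  ι-mono (ℕ.s≤s {m} {n} h) = subst₂ _≤_ (sym (ι-suc m)) (sym (ι-suc n)) (+-monoʳ-≤ 1# (ι-mono h))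

  1≤ι : ∀ {n} → 1 ℕ.≤ n → 1# ≤ ι n
  1≤ι = ι-mono

  1≤⇒≢0 : ∀ {x} → 1# ≤ x → x ≢ 0#
  1≤⇒≢0 h refl = 1≢0 (antisym h 0≤1)

  ι≢0 : ∀ {n} → 1 ℕ.≤ n → ι n ≢ 0#
  ι≢0 h = 1≤⇒≢0 (1≤ι h)

  ⁻¹-inverseˡ : ∀ {x} → x ≢ 0# → x ⁻¹ * x ≡ 1#
  ⁻¹-inverseˡ {x} h = trans (*-comm (x ⁻¹) x) (⁻¹-inverseʳ h)

  *-cancelˡ : ∀ {c x y} → c ≢ 0# → c * x ≡ c * y → x ≡ y
  *-cancelˡ {c} {x} {y} h e = trans (lem x) (trans (cong (c ⁻¹ *_) e) (sym (lem y)))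
    where
    lem : ∀ x → x ≡ c ⁻¹ * (c * x)
    lem x = sym (trans (sym (*-assoc (c ⁻¹) c x)) (trans (cong (_* x) (⁻¹-inverseˡ h)) (*-identityˡ x)))

  ⁻¹-nonNeg : ∀ {x} → 0# ≤ x → x ≢ 0# → 0# ≤ x ⁻¹
  ⁻¹-nonNeg {x} h k with total 0# (x ⁻¹)
  ... | inj₁ r = r
  ... | inj₂ r = contradiction (antisym (subst₂ _≤_ (⁻¹-inverseʳ k) (zeroʳ x) (*-monoˡ h r)) 0≤1) 1≢0

  *-cancelˡ-≤ : ∀ {c x y} → 0# ≤ c → c ≢ 0# → c * x ≤ c * y → x ≤ y
  *-cancelˡ-≤ {c} {x} {y} h k e = subst₂ _≤_ (lem x) (lem y) (*-monoˡ (⁻¹-nonNeg h k) e)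
    where
    lem : ∀ x → c ⁻¹ * (c * x) ≡ x
    lem x = trans (sym (*-assoc (c ⁻¹) c x)) (trans (cong (_* x) (⁻¹-inverseˡ k)) (*-identityˡ x))

  -- ρ n = 1/n, and ρ 0 = 0.
  ρ : ℕ → Carrier
  ρ zero = 0#
  ρ n@(suc _) = ι n ⁻¹

  ρ-inverse : ∀ {n} → 1 ℕ.≤ n → ι n * ρ n ≡ 1#
  ρ-inverse {suc n} h = ⁻¹-inverseʳ (ι≢0 h)

  0≤ρ : ∀ n → 0# ≤ ρ n
  0≤ρ zero = ≤-refl
  0≤ρ (suc n) = ⁻¹-nonNeg (0≤ι (suc n)) (ι≢0 {suc n} (ℕ.s≤s ℕ.z≤n))

  *-≢0 : ∀ {x y} → x ≢ 0# → y ≢ 0# → x * y ≢ 0#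
  *-≢0 {x} {y} hx hy e = hy (*-cancelˡ hx (trans e (sym (zeroʳ x))))

  ⁻¹-unique : ∀ {x y} → x * y ≡ 1# → y ≡ x ⁻¹
  ⁻¹-unique {x} {y} e = *-cancelˡ x≢0 (trans e (sym (⁻¹-inverseʳ x≢0)))
    where
    x≢0 : x ≢ 0#
    x≢0 refl = 1≢0 (trans (sym e) (zeroˡ y))

  ρ-unique : ∀ {n y} → 1 ℕ.≤ n → ι n * y ≡ 1# → y ≡ ρ n
  ρ-unique {suc n} _ e = ⁻¹-unique e

  ρ-* : ∀ m n → ρ (m ℕ.* n) ≡ ρ m * ρ n
  ρ-* zero n = sym (zeroˡ (ρ n))
  ρ-* (suc m) zero = trans (cong ρ (ℕ.*-zeroʳ m)) (sym (zeroʳ (ρ (suc m))))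
  ρ-* m′@(suc m) n′@(suc n) = sym (ρ-unique {m′ ℕ.* n′} (ℕ.s≤s ℕ.z≤n) (begin
    ι (m′ ℕ.* n′) * (ρ m′ * ρ n′) ≡⟨ cong (_* (ρ m′ * ρ n′)) (ι-* m′ n′) ⟩
    ι m′ * ι n′ * (ρ m′ * ρ n′) ≡⟨ solve 4 (λ a b c d → a :* b :* (c :* d) := (a :* c) :* (b :* d)) refl (ι m′) (ι n′) (ρ m′) (ρ n′) ⟩
    (ι m′ * ρ m′) * (ι n′ * ρ n′) ≡⟨ cong₂ _*_ (ρ-inverse {m′} (ℕ.s≤s ℕ.z≤n)) (ρ-inverse {n′} (ℕ.s≤s ℕ.z≤n)) ⟩
    1# * 1# ≡⟨ *-identityˡ 1# ⟩
    1# ∎))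
    where open ≡-Reasoning

  ρ-antitone : ∀ {m n} → 1 ℕ.≤ m → m ℕ.≤ n → ρ n ≤ ρ m
  ρ-antitone {m} {n} hm h = subst₂ _≤_ e₁ e₂ (*-monoˡ (*-nonNeg (0≤ρ m) (0≤ρ n)) (ι-mono h))
    where
    hn = ℕ.≤-trans hm h
    e₁ : ρ m * ρ n * ι m ≡ ρ n
    e₁ = trans (solve 3 (λ a b c → a :* b :* c := (c :* a) :* b) refl (ρ m) (ρ n) (ι m)) (trans (cong (_* ρ n) (ρ-inverse hm)) (*-identityˡ (ρ n)))
    e₂ : ρ m * ρ n * ι n ≡ ρ m
    e₂ = trans (solve 3 (λ a b c → a :* b :* c := (c :* b) :* a) refl (ρ m) (ρ n) (ι n)) (trans (cong (_* ρ m) (ρ-inverse hn)) (*-identityˡ (ρ m)))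

  ρ1 : ρ 1 ≡ 1#
  ρ1 = trans (sym (*-identityˡ (ρ 1))) (ρ-inverse ℕ.≤-refl)

  infixr 8 _^_
  _^_ : Carrier → ℕ → Carrier
  x ^ zero = 1#
  x ^ suc n = x * x ^ n

  ^-nonNeg : ∀ {x} n → 0# ≤ x → 0# ≤ x ^ n
  ^-nonNeg zero h = 0≤1
  ^-nonNeg (suc n) h = *-nonNeg h (^-nonNeg n h)

  ^-mono : ∀ {x y} n → 0# ≤ x → x ≤ y → x ^ n ≤ y ^ n
  ^-mono zero h k = ≤-refl
  ^-mono (suc n) h k = *-mono h (^-nonNeg n (≤-trans h k)) k (^-mono n h k)

  -- Two-sided closeness: x ≈[ e ] d means |x − d| ≤ e.
  infix 4 _≈[_]_
  _≈[_]_ : Carrier → Carrier → Carrier → Set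
  x ≈[ e ] d = (x ≤ d + e) × (d ≤ x + e)

  ≈-refl : ∀ {x} → x ≈[ 0# ] x
  ≈-refl {x} = ≤-reflexive (sym (+-identityʳ x)) , ≤-reflexive (sym (+-identityʳ x))

  ≈-+ : ∀ {x y d d′ e e′} → x ≈[ e ] d → y ≈[ e′ ] d′ → x + y ≈[ e + e′ ] d + d′
  ≈-+ {x} {y} {d} {d′} {e} {e′} (a , b) (a′ , b′) =
    subst (x + y ≤_) (lem d e d′ e′) (+-mono-≤ a a′) , subst (d + d′ ≤_) (lem x e y e′) (+-mono-≤ b b′)
    where
    lem : ∀ d e d′ e′ → (d + e) + (d′ + e′) ≡ (d + d′) + (e + e′)
    lem = solve 4 (λ d e d′ e′ → (d :+ e) :+ (d′ :+ e′) := (d :+ d′) :+ (e :+ e′)) refl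

  ≈-neg : ∀ {x d e} → x ≈[ e ] d → - x ≈[ e ] - d
  ≈-neg {x} {d} {e} (a , b) = lem a b , lem b a
    where
    lem : ∀ {x d} → x ≤ d + e → d ≤ x + e → - x ≤ - d + e
    lem {x} {d} a b = 0≤-⇒≤ (subst (0# ≤_) (solve 3 (λ x d e → x :+ e :- d := :- d :+ e :- :- x) refl x d e) (≤⇒0≤- b))

  ≈-scale : ∀ {c x d e} → 0# ≤ c → x ≈[ e ] d → c * x ≈[ c * e ] c * d
  ≈-scale {c} {x} {d} {e} h (a , b) = subst (c * x ≤_) (distribˡ c d e) (*-monoˡ h a) , subst (c * d ≤_) (distribˡ c x e) (*-monoˡ h b)

  ≈-weaken : ∀ {x d e e′} → e ≤ e′ → x ≈[ e ] d → x ≈[ e′ ] d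
  ≈-weaken h (a , b) = ≤-trans a (+-monoʳ-≤ _ h) , ≤-trans b (+-monoʳ-≤ _ h)

  ≈-subst : ∀ {x x′ d d′ e} → x ≡ x′ → d ≡ d′ → x ≈[ e ] d → x′ ≈[ e ] d′
  ≈-subst refl refl h = h

  𝟙 : ∀ {P : Set} → Dec P → Carrier
  𝟙 (yes _) = 1#
  𝟙 (no _) = 0#

  𝟙-nonNeg : ∀ {P : Set} (d : Dec P) → 0# ≤ 𝟙 d
  𝟙-nonNeg (yes _) = 0≤1
  𝟙-nonNeg (no _) = ≤-refl

  𝟙≤1 : ∀ {P : Set} (d : Dec P) → 𝟙 d ≤ 1#
  𝟙≤1 (yes _) = ≤-refl
  𝟙≤1 (no _) = 0≤1

  𝟙-idem : ∀ {P : Set} (d : Dec P) → 𝟙 d * 𝟙 d ≡ 𝟙 d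
  𝟙-idem (yes _) = *-identityˡ 1#
  𝟙-idem (no _) = zeroˡ 0#

  𝟙-yes : ∀ {P : Set} (d : Dec P) → P → 𝟙 d ≡ 1#
  𝟙-yes (yes _) _ = refl
  𝟙-yes (no ¬p) p = contradiction p ¬p

  𝟙-no : ∀ {P : Set} (d : Dec P) → ¬ P → 𝟙 d ≡ 0#
  𝟙-no (yes p) ¬p = contradiction p ¬p
  𝟙-no (no _) _ = refl

  𝟙-mono : ∀ {P Q : Set} (d : Dec P) (e : Dec Q) → (P → Q) → 𝟙 d ≤ 𝟙 e
  𝟙-mono (yes p) e f = ≤-reflexive (sym (𝟙-yes e (f p)))
  𝟙-mono (no _) e f = 𝟙-nonNeg e

  𝟙-cong : ∀ {P Q : Set} (d : Dec P) (e : Dec Q) → (P → Q) → (Q → P) → 𝟙 d ≡ 𝟙 e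
  𝟙-cong d e f g = antisym (𝟙-mono d e f) (𝟙-mono e d g)

  𝟙-× : ∀ {P Q R : Set} (d : Dec P) (e : Dec Q) (f : Dec R) → (P → Q → R) → (R → P × Q) → 𝟙 d * 𝟙 e ≡ 𝟙 f
  𝟙-× (yes p) (yes q) f g h = trans (*-identityˡ 1#) (sym (𝟙-yes f (g p q)))
  𝟙-× (yes p) (no ¬q) f g h = trans (*-identityˡ 0#) (sym (𝟙-no f (λ r → ¬q (proj₂ (h r)))))
  𝟙-× (no ¬p) e f g h = trans (zeroˡ (𝟙 e)) (sym (𝟙-no f (λ r → ¬p (proj₁ (h r)))))

  -- Finite sums.

  ∑ : ℕ → (ℕ → Carrier) → Carrier
  ∑ zero f = 0#
  ∑ (suc N) f = ∑ N f + f (suc N)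

  ∑-cong : ∀ N {f g} → (∀ n → 1 ℕ.≤ n → n ℕ.≤ N → f n ≡ g n) → ∑ N f ≡ ∑ N g
  ∑-cong zero h = refl
  ∑-cong (suc N) h = cong₂ _+_ (∑-cong N (λ n l m → h n l (ℕ.m≤n⇒m≤1+n m))) (h (suc N) (ℕ.s≤s ℕ.z≤n) ℕ.≤-refl)

  ∑-mono : ∀ N {f g} → (∀ n → 1 ℕ.≤ n → n ℕ.≤ N → f n ≤ g n) → ∑ N f ≤ ∑ N g
  ∑-mono zero h = ≤-refl
  ∑-mono (suc N) h = +-mono-≤ (∑-mono N (λ n l m → h n l (ℕ.m≤n⇒m≤1+n m))) (h (suc N) (ℕ.s≤s ℕ.z≤n) ℕ.≤-refl)

  ∑-0 : ∀ N → ∑ N (λ _ → 0#) ≡ 0#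
  ∑-0 zero = refl
  ∑-0 (suc N) = trans (cong (_+ 0#) (∑-0 N)) (+-identityʳ 0#)

  ∑-nonNeg : ∀ N {f} → (∀ n → 0# ≤ f n) → 0# ≤ ∑ N f
  ∑-nonNeg N h = subst (_≤ ∑ N _) (∑-0 N) (∑-mono N (λ n _ _ → h n))

  ∑-linear : ∀ N c f g → ∑ N (λ n → f n + c * g n) ≡ ∑ N f + c * ∑ N g
  ∑-linear zero c f g = solve 1 (λ c → con (pos 0) := con (pos 0) :+ c :* con (pos 0)) refl c
  ∑-linear (suc N) c f g = trans (cong (_+ (f (suc N) + c * g (suc N))) (∑-linear N c f g))
    (solve 5 (λ c a b x y → a :+ c :* b :+ (x :+ c :* y) := a :+ x :+ c :* (b :+ y)) refl c (∑ N f) (∑ N g) (f (suc N)) (g (suc N)))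

  ∑-scale : ∀ N c f → ∑ N (λ n → c * f n) ≡ c * ∑ N f
  ∑-scale zero c f = sym (zeroʳ c)
  ∑-scale (suc N) c f = trans (cong (_+ c * f (suc N)) (∑-scale N c f)) (sym (distribˡ c (∑ N f) (f (suc N))))

  ∑-+ : ∀ N f g → ∑ N (λ n → f n + g n) ≡ ∑ N f + ∑ N g
  ∑-+ zero f g = sym (+-identityʳ 0#)
  ∑-+ (suc N) f g = trans (cong (_+ (f (suc N) + g (suc N))) (∑-+ N f g))
    (solve 4 (λ a b x y → a :+ b :+ (x :+ y) := a :+ x :+ (b :+ y)) refl (∑ N f) (∑ N g) (f (suc N)) (g (suc N)))

  ∑-extend : ∀ {M N f} → M ℕ.≤ N → (∀ n → 0# ≤ f n) → ∑ M f ≤ ∑ N f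
  ∑-extend {M} {N} {f} M≤N h = go (ℕ.≤⇒≤′ M≤N)
    where
    go : ∀ {N} → M ℕ.≤′ N → ∑ M f ≤ ∑ N f
    go ℕ.≤′-refl = ≤-refl
    go (ℕ.≤′-step l) = ≤-trans (go l) (x≤x+y (h _))

  ∑-const : ∀ N c → ∑ N (λ _ → c) ≡ ι N * c
  ∑-const zero c = sym (zeroˡ c)
  ∑-const (suc N) c = trans (cong (_+ c) (∑-const N c)) (trans (solve 2 (λ n c → n :* c :+ c := (:1 :+ n) :* c) refl (ι N) c) (cong (_* c) (sym (ι-suc N))))

  ∑[_] : ∀ {A : Set} → List A → (A → Carrier) → Carrier
  ∑[ [] ] f = 0#
  ∑[ x ∷ xs ] f = f x + ∑[ xs ] f

  ∑[]-mono : ∀ {A : Set} (xs : List A) {f g : A → Carrier} → (∀ x → f x ≤ g x) → ∑[ xs ] f ≤ ∑[ xs ] g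
  ∑[]-mono [] h = ≤-refl
  ∑[]-mono (x ∷ xs) h = +-mono-≤ (h x) (∑[]-mono xs h)

  ∑[]-scale : ∀ {A : Set} (xs : List A) c (f : A → Carrier) → ∑[ xs ] (λ x → c * f x) ≡ c * ∑[ xs ] f
  ∑[]-scale [] c f = sym (zeroʳ c)
  ∑[]-scale (x ∷ xs) c f = trans (cong (c * f x +_) (∑[]-scale xs c f)) (sym (distribˡ c (f x) (∑[ xs ] f)))

  ∑-swap : ∀ {A : Set} N (xs : List A) (f : ℕ → A → Carrier) → ∑ N (λ n → ∑[ xs ] (f n)) ≡ ∑[ xs ] (λ x → ∑ N (λ n → f n x))
  ∑-swap N [] f = ∑-0 N
  ∑-swap N (x ∷ xs) f = trans (∑-+ N (λ n → f n x) (λ n → ∑[ xs ] (f n))) (cong (∑ N (λ n → f n x) +_) (∑-swap N xs f))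

  ∑[]-≈ : ∀ {A : Set} {xs : List A} {f : A → Carrier} {e d} → All (λ x → f x ≈[ e ] d) xs → ∑[ xs ] f ≈[ ι (length xs) * e ] ι (length xs) * d
  ∑[]-≈ {e = e} {d} [] = ≤-reflexive (lem d e) , ≤-reflexive (solve 2 (λ d e → con (pos 0) :* d := con (pos 0) :+ con (pos 0) :* e) refl d e)
    where
    lem : ∀ d e → 0# ≡ 0# * d + 0# * e
    lem = solve 2 (λ d e → con (pos 0) := con (pos 0) :* d :+ con (pos 0) :* e) refl
  ∑[]-≈ {xs = x ∷ xs} {f} {e} {d} (h ∷ hs) = subst₂ (λ s t → f x + ∑[ xs ] f ≈[ s ] t) (lem e) (lem d) (≈-+ h (∑[]-≈ hs))
    where
    lem : ∀ e → e + ι (length xs) * e ≡ ι (suc (length xs)) * e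
    lem e = trans (solve 2 (λ n e → e :+ n :* e := (:1 :+ n) :* e) refl (ι (length xs)) e) (cong (_* e) (sym (ι-suc (length xs))))

  -- Multiplicatively weighted sums over squarefree products.

  NonNeg : (ℕ → Carrier) → Set
  NonNeg f = ∀ n → 0# ≤ f n

  Antitone : (ℕ → Carrier) → Set
  Antitone f = ∀ {m n} → m ℕ.≤ n → f n ≤ f m

  shift : ℕ → (ℕ → Carrier) → ℕ → Carrier
  shift p y r = y (p ℕ.* r)

  -- 𝕊 w ps y = Σ_r w(r) y(r), over the products r of subsets of ps, with w
  -- extended multiplicatively.
  𝕊 : (ℕ → Carrier) → List ℕ → (ℕ → Carrier) → Carrier
  𝕊 w [] y = y 1
  𝕊 w (p ∷ ps) y = 𝕊 w ps y + w p * 𝕊 w ps (shift p y)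

  shift-nonNeg : ∀ {y} p → NonNeg y → NonNeg (shift p y)
  shift-nonNeg p h r = h (p ℕ.* r)

  shift-antitone : ∀ {y} p → Antitone y → Antitone (shift p y)
  shift-antitone p h r≤s = h (ℕ.*-monoʳ-≤ p r≤s)

  shift-≤ : ∀ {y p} → 1 ℕ.≤ p → Antitone y → ∀ r → shift p y r ≤ y r
  shift-≤ {p = suc p} _ h r = h (ℕ.m≤m+n r (p ℕ.* r))

  sq-nonNeg′ : ∀ (y : ℕ → Carrier) → NonNeg (λ r → y r * y r)
  sq-nonNeg′ y r = sq-nonNeg (y r)

  sq-antitone : ∀ {y} → NonNeg y → Antitone y → Antitone (λ r → y r * y r)
  sq-antitone h a {m} {n} m≤n = sq-mono (h n) (a m≤n)

  𝕊-cong : ∀ {w y z} ps → (∀ r → y r ≡ z r) → 𝕊 w ps y ≡ 𝕊 w ps z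
  𝕊-cong [] h = h 1
  𝕊-cong {w} (p ∷ ps) h = cong₂ _+_ (𝕊-cong ps h) (cong (w p *_) (𝕊-cong ps (λ r → h (p ℕ.* r))))

  𝕊-mono : ∀ {w y z} ps → NonNeg w → (∀ r → y r ≤ z r) → 𝕊 w ps y ≤ 𝕊 w ps z
  𝕊-mono [] hw h = h 1
  𝕊-mono (p ∷ ps) hw h = +-mono-≤ (𝕊-mono ps hw h) (*-monoˡ (hw p) (𝕊-mono ps hw (λ r → h (p ℕ.* r))))

  𝕊-nonNeg : ∀ {w y} ps → NonNeg w → NonNeg y → 0# ≤ 𝕊 w ps y
  𝕊-nonNeg [] hw h = h 1
  𝕊-nonNeg (p ∷ ps) hw h = 0≤+ (𝕊-nonNeg ps hw h) (*-nonNeg (hw p) (𝕊-nonNeg ps hw (shift-nonNeg p h)))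

  𝕊-linear : ∀ {w} ps c y z → 𝕊 w ps (λ r → y r + c * z r) ≡ 𝕊 w ps y + c * 𝕊 w ps z
  𝕊-linear [] c y z = refl
  𝕊-linear {w} (p ∷ ps) c y z = trans
    (cong₂ (λ s t → s + w p * t) (𝕊-linear ps c y z) (𝕊-linear ps c (shift p y) (shift p z)))
    (solve 6 (λ c w a b d e → a :+ c :* b :+ w :* (d :+ c :* e) := a :+ w :* d :+ c :* (b :+ w :* e)) refl
      c (w p) (𝕊 w ps y) (𝕊 w ps z) (𝕊 w ps (shift p y)) (𝕊 w ps (shift p z)))

  𝕊-scale : ∀ {w} ps c y → 𝕊 w ps (λ r → c * y r) ≡ c * 𝕊 w ps y
  𝕊-scale [] c y = refl
  𝕊-scale {w} (p ∷ ps) c y = trans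
    (cong₂ (λ s t → s + w p * t) (𝕊-scale ps c y) (𝕊-scale ps c (shift p y)))
    (solve 4 (λ c w a b → c :* a :+ w :* (c :* b) := c :* (a :+ w :* b)) refl c (w p) (𝕊 w ps y) (𝕊 w ps (shift p y)))

  𝕊-weight-mono : ∀ {w w′ y} {ps} → NonNeg w → NonNeg y → All (λ p → w p ≤ w′ p) ps → 𝕊 w ps y ≤ 𝕊 w′ ps y
  𝕊-weight-mono hw hy [] = ≤-refl
  𝕊-weight-mono {ps = p ∷ ps} hw hy (h ∷ hs) = +-mono-≤ (𝕊-weight-mono hw hy hs)
    (*-mono (hw p) (≤-trans (𝕊-nonNeg ps hw (shift-nonNeg p hy)) r) h r)
    where
    r = 𝕊-weight-mono hw (shift-nonNeg p hy) hs

  𝕊-weight-0 : ∀ {w y} ps → (∀ p → w p ≡ 0#) → 𝕊 w ps y ≡ y 1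
  𝕊-weight-0 [] h = refl
  𝕊-weight-0 {w} {y} (p ∷ ps) h = trans (cong₂ (λ s t → s + t * 𝕊 w ps (shift p y)) (𝕊-weight-0 ps h) (h p))
    (solve 2 (λ a b → a :+ con (ℤ.+ 0) :* b := a) refl (y 1) (𝕊 w ps (shift p y)))
    where import Data.Integer as ℤ

  𝕊-shift-≤ : ∀ {w y} ps {p} → 1 ℕ.≤ p → NonNeg w → Antitone y → 𝕊 w ps (shift p y) ≤ 𝕊 w ps y
  𝕊-shift-≤ ps hp hw h = 𝕊-mono ps hw (shift-≤ hp h)

  -- A single prime factor of an iterated sum: the two variables may share p.
  𝕊𝕊-step : ∀ a b p ps Q → 𝕊 a (p ∷ ps) (λ r → 𝕊 b (p ∷ ps) (shift r Q)) ≡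
    𝕊 a ps (λ r → 𝕊 b ps (shift r Q)) + (a p + b p) * 𝕊 a ps (λ r → 𝕊 b ps (shift r (shift p Q)))
      + a p * b p * 𝕊 a ps (λ r → 𝕊 b ps (shift r (shift p (shift p Q))))
  𝕊𝕊-step a b p ps Q = trans (cong₂ (λ s t → s + a p * t)
      (trans (𝕊-linear ps (b p) (λ r → 𝕊 b ps (shift r Q)) (λ r → 𝕊 b ps (shift p (shift r Q)))) (cong (λ t → D Q + b p * t) e₁))
      (trans (𝕊-linear ps (b p) (λ r → 𝕊 b ps (shift (p ℕ.* r) Q)) (λ r → 𝕊 b ps (shift p (shift (p ℕ.* r) Q)))) (cong₂ (λ s t → s + b p * t) e₂ e₃)))
    (solve 5 (λ a b x y z → x :+ b :* y :+ a :* (y :+ b :* z) := x :+ (a :+ b) :* y :+ a :* b :* z) refl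
      (a p) (b p) (D Q) (D (shift p Q)) (D (shift p (shift p Q))))
    where
    D : (ℕ → Carrier) → Carrier
    D Q = 𝕊 a ps (λ r → 𝕊 b ps (shift r Q))
    l₁ : ∀ p r m → r ℕ.* (p ℕ.* m) ≡ p ℕ.* (r ℕ.* m)
    l₁ = ℕ-ring
    l₂ : ∀ p r m → p ℕ.* r ℕ.* (p ℕ.* m) ≡ p ℕ.* (p ℕ.* (r ℕ.* m))
    l₂ = ℕ-ring
    e₁ : 𝕊 a ps (λ r → 𝕊 b ps (shift p (shift r Q))) ≡ D (shift p Q)
    e₁ = 𝕊-cong ps (λ r → 𝕊-cong ps (λ m → cong Q (l₁ p r m)))
    e₂ : 𝕊 a ps (λ r → 𝕊 b ps (shift (p ℕ.* r) Q)) ≡ D (shift p Q)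
    e₂ = 𝕊-cong ps (λ r → 𝕊-cong ps (λ m → cong Q (ℕ.*-assoc p r m)))
    e₃ : 𝕊 a ps (λ r → 𝕊 b ps (shift p (shift (p ℕ.* r) Q))) ≡ D (shift p (shift p Q))
    e₃ = 𝕊-cong ps (λ r → 𝕊-cong ps (λ m → cong Q (l₂ p r m)))

  -- Π c ps = ∏_p (1 + c(p))
  Π : (ℕ → Carrier) → List ℕ → Carrier
  Π c [] = 1#
  Π c (p ∷ ps) = (1# + c p) * Π c ps

  Π-nonNeg : ∀ {c} ps → NonNeg c → 0# ≤ Π c ps
  Π-nonNeg [] h = 0≤1
  Π-nonNeg (p ∷ ps) h = *-nonNeg (0≤+ 0≤1 (h p)) (Π-nonNeg ps h)

  module _ {a b : ℕ → Carrier} (ha : NonNeg a) (hb : NonNeg b) where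

    0≤ab : ∀ p → 0# ≤ a p * b p
    0≤ab p = *-nonNeg (ha p) (hb p)

    0≤a+b : ∀ p → 0# ≤ a p + b p
    0≤a+b p = 0≤+ (ha p) (hb p)

    -- A number weighted by a + b splits into a part weighted by a and a coprime part weighted by b.
    -- The right side has these pairs and in addition the pairs with a common prime, which
    -- contribute nonnegatively.
    𝕊-+≤𝕊𝕊 : ∀ ps {Q} → NonNeg Q → 𝕊 (λ p → a p + b p) ps Q ≤ 𝕊 a ps (λ r → 𝕊 b ps (shift r Q))
    𝕊-+≤𝕊𝕊 [] {Q} hQ = ≤-reflexive (cong Q refl)
    𝕊-+≤𝕊𝕊 (p ∷ ps) {Q} hQ = ≤-trans (≤-trans
      (+-mono-≤ (𝕊-+≤𝕊𝕊 ps hQ) (*-monoˡ (0≤a+b p) (𝕊-+≤𝕊𝕊 ps (shift-nonNeg p hQ))))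
      (x≤x+y (*-nonNeg (0≤ab p) (𝕊-nonNeg ps ha (λ r → 𝕊-nonNeg ps hb (λ m → hQ _)))))) (≤-reflexive (sym (𝕊𝕊-step a b p ps Q)))

    -- For a pair sharing `p` the argument contains p². As `Q` decreases, both copies may be dropped
    -- from it, and what remains of `p` is the factor 1 + a(p) b(p).
    𝕊𝕊≤𝕊-+ : ∀ {ps} {Q} → All (1 ℕ.≤_) ps → NonNeg Q → Antitone Q →
               𝕊 a ps (λ r → 𝕊 b ps (shift r Q)) ≤ Π (λ p → a p * b p) ps * 𝕊 (λ p → a p + b p) ps Q
    𝕊𝕊≤𝕊-+ {[]} {Q} [] hQ aQ = ≤-reflexive (sym (*-identityˡ (Q 1)))
    𝕊𝕊≤𝕊-+ {p ∷ ps} {Q} (hp ∷ hps) hQ aQ = begin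
      𝕊 a (p ∷ ps) (λ r → 𝕊 b (p ∷ ps) (shift r Q))
        ≡⟨ 𝕊𝕊-step a b p ps Q ⟩
      D Q + (a p + b p) * D (shift p Q) + a p * b p * D (shift p (shift p Q))
        ≤⟨ +-mono-≤ (+-mono-≤ i₁ (*-monoˡ (0≤a+b p) i₂)) (*-monoˡ (0≤ab p) (≤-trans i₃ i₁)) ⟩
      P * s + (a p + b p) * (P * t) + a p * b p * (P * s)
        ≤⟨ x≤x+y (*-nonNeg (*-nonNeg (0≤ab p) (0≤a+b p)) (*-nonNeg 0≤P 0≤t)) ⟩
      P * s + (a p + b p) * (P * t) + a p * b p * (P * s) + a p * b p * (a p + b p) * (P * t)
        ≡⟨ solve 5 (λ a b P s t → P :* s :+ (a :+ b) :* (P :* t) :+ a :* b :* (P :* s) :+ a :* b :* (a :+ b) :* (P :* t)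
                               := (:1 :+ a :* b) :* P :* (s :+ (a :+ b) :* t)) refl (a p) (b p) P s t ⟩
      (1# + a p * b p) * P * (s + (a p + b p) * t) ∎
      where
      open ≤-Reasoning
      D : (ℕ → Carrier) → Carrier
      D Q = 𝕊 a ps (λ r → 𝕊 b ps (shift r Q))
      P = Π (λ p → a p * b p) ps
      0≤P = Π-nonNeg ps 0≤ab
      s = 𝕊 (λ p → a p + b p) ps Q
      t = 𝕊 (λ p → a p + b p) ps (shift p Q)
      0≤t = 𝕊-nonNeg ps 0≤a+b (shift-nonNeg p hQ)
      i₁ : D Q ≤ P * s
      i₁ = 𝕊𝕊≤𝕊-+ hps hQ aQ
      i₂ : D (shift p Q) ≤ P * t
      i₂ = 𝕊𝕊≤𝕊-+ hps (shift-nonNeg p hQ) (shift-antitone p aQ)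
      i₃ : D (shift p (shift p Q)) ≤ D Q
      i₃ = 𝕊-mono ps ha (λ r → 𝕊-mono ps hb (λ m →
        ≤-trans (shift-≤ hp (shift-antitone p aQ) (r ℕ.* m)) (shift-≤ hp aQ (r ℕ.* m))))

    -- The part of the variable weighted by b is dropped from the argument of the decreasing `Q`, so
    -- its weights separate as a product. Applied with b of order 1/p², where that product
    -- converges.
    𝕊-+≤Π𝕊 : ∀ {ps} {Q} → All (1 ℕ.≤_) ps → NonNeg Q → Antitone Q →
              𝕊 (λ p → a p + b p) ps Q ≤ Π b ps * 𝕊 a ps Q
    𝕊-+≤Π𝕊 {[]} {Q} [] hQ aQ = ≤-reflexive (sym (*-identityˡ (Q 1)))
    𝕊-+≤Π𝕊 {p ∷ ps} {Q} (hp ∷ hps) hQ aQ = begin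
      𝕊 ab ps Q + (a p + b p) * 𝕊 ab ps (shift p Q)
        ≡⟨ solve 4 (λ s t a b → s :+ (a :+ b) :* t := s :+ a :* t :+ b :* t) refl (𝕊 ab ps Q) (𝕊 ab ps (shift p Q)) (a p) (b p) ⟩
      𝕊 ab ps Q + a p * 𝕊 ab ps (shift p Q) + b p * 𝕊 ab ps (shift p Q)
        ≤⟨ +-mono-≤ (+-mono-≤ i₁ (*-monoˡ (ha p) i₂)) (*-monoˡ (hb p) (≤-trans (𝕊-shift-≤ ps hp 0≤a+b aQ) i₁)) ⟩
      P * s + a p * (P * t) + b p * (P * s)
        ≤⟨ x≤x+y (*-nonNeg (*-nonNeg (hb p) (ha p)) (*-nonNeg (Π-nonNeg ps hb) (𝕊-nonNeg ps ha (shift-nonNeg p hQ)))) ⟩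
      P * s + a p * (P * t) + b p * (P * s) + b p * a p * (P * t)
        ≡⟨ solve 5 (λ a b P s t → P :* s :+ a :* (P :* t) :+ b :* (P :* s) :+ b :* a :* (P :* t)
                               := (:1 :+ b) :* P :* (s :+ a :* t)) refl (a p) (b p) P s t ⟩
      (1# + b p) * P * (s + a p * t) ∎
      where
      open ≤-Reasoning
      ab : ℕ → Carrier
      ab p = a p + b p
      P = Π b ps
      s = 𝕊 a ps Q
      t = 𝕊 a ps (shift p Q)
      i₁ : 𝕊 ab ps Q ≤ P * s
      i₁ = 𝕊-+≤Π𝕊 hps hQ aQ
      i₂ : 𝕊 ab ps (shift p Q) ≤ P * t
      i₂ = 𝕊-+≤Π𝕊 hps (shift-nonNeg p hQ) (shift-antitone p aQ)

  -- Both continuations are required, with `p` left out of the modulus and with `p` multiplied in,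
  -- so each prime is new for every modulus that the induction can reach.
  Valid : (ℕ → ℕ → Set) → ℕ → List ℕ → Set
  Valid Fresh q [] = ⊤
  Valid Fresh q (p ∷ ps) = Fresh q p × Valid Fresh q ps × Valid Fresh (q ℕ.* p) ps

  -- Selberg weights in the orthogonal basis, and their second moments.

  -- The functions χ_p = α(p) − (1 + α(p)) 1[p hits n] have mean zero when p hits
  -- with probability α/(1+α), so the products χ_s are orthogonal, and
  -- Λ ps y n = Σ_s y(s) χ_s(n).
  module Weights (α : ℕ → Carrier) (0≤α : NonNeg α) where

    -- The coefficients that `p` leaves behind when it does not hit, as χ_p then equals α(p). On a
    -- hit χ_p is -1.
    mix : ℕ → (ℕ → Carrier) → ℕ → Carrier
    mix p y r = y r + α p * y (p ℕ.* r)

    G : List ℕ → (ℕ → Carrier) → Carrier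
    G = 𝕊 α

    G-mix : ∀ p ps y → G ps (mix p y) ≡ G (p ∷ ps) y
    G-mix p ps y = 𝕊-linear ps (α p) y (shift p y)

    -- Every hit costs a factor 1 + α(p). This absorbs it, so the same shape of error bound holds
    -- after each prime.
    G-shift-≤ : ∀ {p} ps {y} → 1 ℕ.≤ p → Antitone y → (1# + α p) * G ps (shift p y) ≤ G (p ∷ ps) y
    G-shift-≤ {p} ps {y} hp ay = begin
      (1# + α p) * G ps (shift p y) ≡⟨ solve 2 (λ a g → (:1 :+ a) :* g := g :+ a :* g) refl (α p) (G ps (shift p y)) ⟩
      G ps (shift p y) + α p * G ps (shift p y) ≤⟨ +-monoˡ-≤ _ (𝕊-shift-≤ ps hp 0≤α ay) ⟩
      G ps y + α p * G ps (shift p y) ∎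
      where open ≤-Reasoning

    module Model (g : ℕ → Carrier) where

      -- The expected value of the product of two weights if the primes hit independently with
      -- probabilities `g`. The recursion is that of `Λ-product` with the indicator replaced by its
      -- mean.
      E : List ℕ → (ℕ → Carrier) → (ℕ → Carrier) → Carrier
      E [] y z = y 1 * z 1
      E (p ∷ ps) y z = E ps (mix p y) (mix p z) + g p *
        ((1# + α p) * (1# + α p) * E ps (shift p y) (shift p z)
         - (1# + α p) * (E ps (mix p y) (shift p z) + E ps (shift p y) (mix p z)))

      E-cong : ∀ ps {y y′ z z′} → (∀ r → y r ≡ y′ r) → (∀ r → z r ≡ z′ r) → E ps y z ≡ E ps y′ z′
      E-cong [] h k = cong₂ _*_ (h 1) (k 1)
      E-cong (p ∷ ps) {y} {y′} {z} {z′} h k = cong₂ _+_ (E-cong ps mh mk)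
        (cong (g p *_) (cong₂ _-_ (cong (_ *_) (E-cong ps sh sk)) (cong ((1# + α p) *_) (cong₂ _+_ (E-cong ps mh sk) (E-cong ps sh mk)))))
        where
        sh = λ r → h (p ℕ.* r)
        sk = λ r → k (p ℕ.* r)
        mh : ∀ r → mix p y r ≡ mix p y′ r
        mh r = cong₂ (λ s t → s + α p * t) (h r) (sh r)
        mk : ∀ r → mix p z r ≡ mix p z′ r
        mk r = cong₂ (λ s t → s + α p * t) (k r) (sk r)

      private
        mix-linear : ∀ p c y y′ r → mix p (λ r → y r + c * y′ r) r ≡ mix p y r + c * mix p y′ r
        mix-linear p c y y′ r = solve 6 (λ a c s t u v → s :+ c :* t :+ a :* (u :+ c :* v) := s :+ a :* u :+ c :* (t :+ a :* v)) refl
          (α p) c (y r) (y′ r) (y (p ℕ.* r)) (y′ (p ℕ.* r))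

      E-linearˡ : ∀ ps c y y′ z → E ps (λ r → y r + c * y′ r) z ≡ E ps y z + c * E ps y′ z
      E-linearˡ [] c y y′ z = solve 4 (λ a c b z → (a :+ c :* b) :* z := a :* z :+ c :* (b :* z)) refl (y 1) c (y′ 1) (z 1)
      E-linearˡ (p ∷ ps) c y y′ z = trans
        (cong₂ (λ s t → s + g p * t) (m (mix p z))
          (cong₂ (λ s t → (1# + α p) * (1# + α p) * s - (1# + α p) * t) (E-linearˡ ps c (shift p y) (shift p y′) (shift p z))
            (cong₂ _+_ (m (shift p z)) (E-linearˡ ps c (shift p y) (shift p y′) (mix p z)))))
        (solve 11 (λ c g a A A′ B B′ C C′ D D′ →
          A :+ c :* A′ :+ g :* (a :* a :* (B :+ c :* B′) :- a :* (C :+ c :* C′ :+ (D :+ c :* D′)))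
          := A :+ g :* (a :* a :* B :- a :* (C :+ D)) :+ c :* (A′ :+ g :* (a :* a :* B′ :- a :* (C′ :+ D′)))) refl
          c (g p) (1# + α p) (E ps (mix p y) (mix p z)) (E ps (mix p y′) (mix p z)) (E ps (shift p y) (shift p z)) (E ps (shift p y′) (shift p z))
          (E ps (mix p y) (shift p z)) (E ps (mix p y′) (shift p z)) (E ps (shift p y) (mix p z)) (E ps (shift p y′) (mix p z)))
        where
        m : ∀ w → E ps (mix p (λ r → y r + c * y′ r)) w ≡ E ps (mix p y) w + c * E ps (mix p y′) w
        m w = trans (E-cong ps (mix-linear p c y y′) (λ _ → refl)) (E-linearˡ ps c (mix p y) (mix p y′) w)

      E-comm : ∀ ps y z → E ps y z ≡ E ps z y
      E-comm [] y z = *-comm (y 1) (z 1)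
      E-comm (p ∷ ps) y z = cong₂ _+_ (E-comm ps _ _) (cong (g p *_) (cong₂ _-_ (cong (_ *_) (E-comm ps _ _))
        (cong ((1# + α p) *_) (trans (cong₂ _+_ (E-comm ps _ _) (E-comm ps _ _)) (+-comm _ _)))))

      E-linearʳ : ∀ ps c y z z′ → E ps y (λ r → z r + c * z′ r) ≡ E ps y z + c * E ps y z′
      E-linearʳ ps c y z z′ = trans (E-comm ps y _) (trans (E-linearˡ ps c z z′ y) (cong₂ (λ s t → s + c * t) (E-comm ps z y) (E-comm ps z′ y)))

      E-sq : ∀ ps c y z → let w = λ r → y r + c * z r in
             E ps w w ≡ E ps y y + (c + c) * E ps y z + c * c * E ps z z
      E-sq ps c y z = trans (E-linearˡ ps c y z _)
        (trans (cong₂ (λ s t → s + c * t) (E-linearʳ ps c y y z) (trans (E-linearʳ ps c z y z) (cong (_+ c * E ps z z) (E-comm ps z y))))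
          (solve 4 (λ c a b d → a :+ c :* b :+ c :* (b :+ c :* d) := a :+ (c :+ c) :* b :+ c :* c :* d) refl c (E ps y y) (E ps y z) (E ps z z)))

      -- Splitting off p: χ_p has mean m = α − γ and variance γ(1 + m), where γ = g(1 + α).
      E-diagonal : ∀ p ps y (m γ : Carrier) → γ ≡ g p * (1# + α p) → m ≡ α p - γ →
        let w = λ r → y r + m * y (p ℕ.* r) in
        E (p ∷ ps) y y ≡ E ps w w + γ * (1# + m) * E ps (shift p y) (shift p y)
      E-diagonal p ps y m γ refl refl = begin
        E ps u u + g p * ((1# + α p) * (1# + α p) * C - (1# + α p) * (E ps u yₚ + E ps yₚ u))
          ≡⟨ cong₂ (λ s t → s + g p * ((1# + α p) * (1# + α p) * C - (1# + α p) * t)) (E-sq ps (α p) y yₚ)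
               (cong₂ _+_ (E-linearˡ ps (α p) y yₚ yₚ) (trans (E-linearʳ ps (α p) yₚ y yₚ) (cong (_+ α p * C) (E-comm ps yₚ y)))) ⟩
        A + (α p + α p) * B + α p * α p * C + g p * ((1# + α p) * (1# + α p) * C - (1# + α p) * ((B + α p * C) + (B + α p * C)))
          ≡⟨ solve 5 (λ a g A B C →
               A :+ (a :+ a) :* B :+ a :* a :* C :+ g :* ((:1 :+ a) :* (:1 :+ a) :* C :- (:1 :+ a) :* ((B :+ a :* C) :+ (B :+ a :* C)))
               := A :+ ((a :- g :* (:1 :+ a)) :+ (a :- g :* (:1 :+ a))) :* B :+ (a :- g :* (:1 :+ a)) :* (a :- g :* (:1 :+ a)) :* C
                  :+ g :* (:1 :+ a) :* (:1 :+ (a :- g :* (:1 :+ a))) :* C) refl (α p) (g p) A B C ⟩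
        A + (m + m) * B + m * m * C + γ * (1# + m) * C
          ≡⟨ cong (_+ γ * (1# + m) * C) (sym (E-sq ps m y yₚ)) ⟩
        E ps w w + γ * (1# + m) * C ∎
        where
        open ≡-Reasoning
        yₚ = shift p y
        u = mix p y
        A = E ps y y
        B = E ps y yₚ
        C = E ps yₚ yₚ
        w : ℕ → Carrier
        w r = y r + m * y (p ℕ.* r)

    -- T bounds the modulus: y is supported on r with c r ≤ T.
    record Good (T c : ℕ) (y : ℕ → Carrier) : Set where
      field
        nonNeg : NonNeg y
        antitone : Antitone y
        support : ∀ r → T ℕ.< c ℕ.* r → y r ≡ 0#
    open Good

    Good-shift : ∀ {T c y} p → Good T c y → Good T (c ℕ.* p) (shift p y)
    Good-shift {T} {c} p h = record
      { nonNeg = shift-nonNeg p (nonNeg h) ; antitone = shift-antitone p (antitone h)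
      ; support = λ r l → support h (p ℕ.* r) (subst (T ℕ.<_) (ℕ.*-assoc c p r) l) }

    Good-mix : ∀ {T c y} p → 1 ℕ.≤ p → Good T c y → Good T c (mix p y)
    Good-mix {T} {c} {y} (suc p) _ h = record
      { nonNeg = λ r → 0≤+ (nonNeg h r) (*-nonNeg (0≤α (suc p)) (nonNeg h _))
      ; antitone = λ l → +-mono-≤ (antitone h l) (*-monoˡ (0≤α (suc p)) (antitone h (ℕ.*-monoʳ-≤ (suc p) l)))
      ; support = λ r l → trans (cong₂ (λ s t → s + α (suc p) * t) (support h r l)
          (support h (suc p ℕ.* r) (ℕ.<-≤-trans l (ℕ.*-monoʳ-≤ c (ℕ.m≤m+n r (p ℕ.* r))))))
          (solve 1 (λ a → con (pos 0) :+ a :* con (pos 0) := con (pos 0)) refl (α (suc p))) }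

    module Hits (Hit : ℕ → ℕ → Set) (hit? : ∀ p n → Dec (Hit p n)) where

      χ : ℕ → ℕ → Carrier
      χ p n = α p - (1# + α p) * 𝟙 (hit? p n)

      Λ : List ℕ → (ℕ → Carrier) → ℕ → Carrier
      Λ [] y n = y 1
      Λ (p ∷ ps) y n = Λ ps y n + χ p n * Λ ps (shift p y) n

      Λ-linear : ∀ ps c y z n → Λ ps (λ r → y r + c * z r) n ≡ Λ ps y n + c * Λ ps z n
      Λ-linear [] c y z n = refl
      Λ-linear (p ∷ ps) c y z n = trans
        (cong₂ (λ s t → s + χ p n * t) (Λ-linear ps c y z n) (Λ-linear ps c (shift p y) (shift p z) n))
        (solve 6 (λ c w a b d e → a :+ c :* b :+ w :* (d :+ c :* e) := a :+ w :* d :+ c :* (b :+ w :* e)) refl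
          c (χ p n) (Λ ps y n) (Λ ps z n) (Λ ps (shift p y) n) (Λ ps (shift p z) n))

      -- Since an indicator is its own square, a product of two weights is linear in the indicator
      -- of `p`. Hence `p` enters the modulus only once, and moduli stay squarefree away from W.
      Λ-product : ∀ p ps y z n → Λ (p ∷ ps) y n * Λ (p ∷ ps) z n ≡
        Λ ps (mix p y) n * Λ ps (mix p z) n + 𝟙 (hit? p n) *
          ((1# + α p) * (1# + α p) * (Λ ps (shift p y) n * Λ ps (shift p z) n)
           - (1# + α p) * (Λ ps (mix p y) n * Λ ps (shift p z) n + Λ ps (shift p y) n * Λ ps (mix p z) n))
      Λ-product p ps y z n = begin
        (Ly + χ p n * Lyₚ) * (Lz + χ p n * Lzₚ)
          ≡⟨ solve 6 (λ a t y yp z zp → (y :+ (a :- (:1 :+ a) :* t) :* yp) :* (z :+ (a :- (:1 :+ a) :* t) :* zp)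
               := (y :+ a :* yp) :* (z :+ a :* zp) :+ ((:1 :+ a) :* (:1 :+ a) :* (yp :* zp) :* (t :* t)
                   :- t :* ((:1 :+ a) :* ((y :+ a :* yp) :* zp :+ yp :* (z :+ a :* zp))))) refl (α p) t Ly Lyₚ Lz Lzₚ ⟩
        (Ly + α p * Lyₚ) * (Lz + α p * Lzₚ) + ((1# + α p) * (1# + α p) * (Lyₚ * Lzₚ) * (t * t)
          - t * ((1# + α p) * ((Ly + α p * Lyₚ) * Lzₚ + Lyₚ * (Lz + α p * Lzₚ))))
          ≡⟨ cong₂ _+_ (cong₂ _*_ (sym My) (sym Mz)) (cong₂ (λ s v → (1# + α p) * (1# + α p) * (Lyₚ * Lzₚ) * s - t * ((1# + α p) * v)) (𝟙-idem (hit? p n))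
               (cong₂ _+_ (cong (_* Lzₚ) (sym My)) (cong (Lyₚ *_) (sym Mz)))) ⟩
        my * mz + ((1# + α p) * (1# + α p) * (Lyₚ * Lzₚ) * t - t * ((1# + α p) * (my * Lzₚ + Lyₚ * mz)))
          ≡⟨ solve 5 (λ a t x b c → x :+ ((:1 :+ a) :* (:1 :+ a) :* b :* t :- t :* ((:1 :+ a) :* c))
               := x :+ t :* ((:1 :+ a) :* (:1 :+ a) :* b :- (:1 :+ a) :* c)) refl (α p) t (my * mz) (Lyₚ * Lzₚ) (my * Lzₚ + Lyₚ * mz) ⟩
        my * mz + t * ((1# + α p) * (1# + α p) * (Lyₚ * Lzₚ) - (1# + α p) * (my * Lzₚ + Lyₚ * mz)) ∎
        where
        open ≡-Reasoning
        Ly = Λ ps y n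
        Lz = Λ ps z n
        Lyₚ = Λ ps (shift p y) n
        Lzₚ = Λ ps (shift p z) n
        my = Λ ps (mix p y) n
        mz = Λ ps (mix p z) n
        t = 𝟙 (hit? p n)
        My : my ≡ Ly + α p * Lyₚ
        My = Λ-linear ps (α p) y (shift p y) n
        Mz : mz ≡ Lz + α p * Lzₚ
        Mz = Λ-linear ps (α p) z (shift p z) n

      -- A sequence a on 1..N whose sums over the residue classes that occur are
      -- D(q) up to e(q). Only the shifts in hs contribute to the hits.
      module Distribution
        (N W T k : ℕ) (a : ℕ → Carrier) (hs : List ℕ) (len : length hs ℕ.≤ k)
        (D e δ : ℕ → Carrier) (0≤e : NonNeg e)
        (Fresh : ℕ → ℕ → Set) (Adm : ℕ → ℕ → Set)
        (fresh⇒1≤ : ∀ {q p} → Fresh q p → 1 ℕ.≤ p)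
        (base : ∀ {q v} → Adm q v → q ℕ.≤ T ℕ.* T → ∑ N (λ n → 𝟙 (W ℕ.* q ∣? ℕ.∣ n - v ∣) * a n) ≈[ e q ] D q)
        (D-step : ∀ {q p} → Fresh q p → D (q ℕ.* p) ≡ D q * δ p)
        (hits : ∀ {q p} → Fresh q p → ∀ n → 1 ℕ.≤ n → a n * 𝟙 (hit? p n) ≡ a n * ∑[ hs ] (λ h → 𝟙 (p ∣? n ℕ.+ h)))
        (refine : ∀ {q v p} → Adm q v → Fresh q p → All (λ h → ∃ λ v′ → Adm (q ℕ.* p) v′ ×
          (∀ n → 𝟙 (W ℕ.* q ∣? ℕ.∣ n - v ∣) * 𝟙 (p ∣? n ℕ.+ h) ≡ 𝟙 (W ℕ.* (q ℕ.* p) ∣? ℕ.∣ n - v′ ∣))) hs)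
        where

        g : ℕ → Carrier
        g p = ι (length hs) * δ p

        open Model g public

        X : List ℕ → (ℕ → Carrier) → (ℕ → Carrier) → ℕ → ℕ → Carrier
        X ps y z q v = ∑ N (λ n → 𝟙 (W ℕ.* q ∣? ℕ.∣ n - v ∣) * (a n * (Λ ps y n * Λ ps z n)))

        -- Cut off at T², the largest modulus that a product of two weights supported up to T can
        -- produce.
        error : ℕ → Carrier
        error q = e q * 𝟙 (q ℕ.≤? T ℕ.* T)

        error-nonNeg : NonNeg error
        error-nonNeg q = *-nonNeg (0≤e q) (𝟙-nonNeg (q ℕ.≤? T ℕ.* T))

        -- A prime that enters the modulus does so through one of three products, both factors
        -- shifted or only one, and through at most `k` classes. A modulus with ω primes is thus
        -- counted at most (3k)^ω times.
        3k : ℕ → Carrier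
        3k _ = ι 3 * ι k

        0≤3k : NonNeg 3k
        0≤3k _ = *-nonNeg (0≤ι 3) (0≤ι k)

        Err : List ℕ → ℕ → Carrier
        Err ps q = 𝕊 3k ps (shift q error)

        Err-nonNeg : ∀ ps q → 0# ≤ Err ps q
        Err-nonNeg ps q = 𝕊-nonNeg ps 0≤3k (λ r → error-nonNeg _)

        -- If the modulus exceeds T², then `c` or `c′` exceeds `T` and one of the two values
        -- vanishes by its support condition; otherwise the hypothesis on the classes applies.
        X-base : ∀ {y z c c′ q v} → Good T c y → Good T c′ z → q ℕ.≤ c ℕ.* c′ → Adm q v →
          X [] y z q v ≈[ y 1 * z 1 * error (q ℕ.* 1) ] D q * (y 1 * z 1)
        X-base {y} {z} {c} {c′} {q} {v} gy gz hq adm = subst (λ s → s ≈[ y 1 * z 1 * error (q ℕ.* 1) ] D q * (y 1 * z 1)) (sym eq)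
          (main (q ℕ.≤? T ℕ.* T) refl)
          where
          t = ∑ N (λ n → 𝟙 (W ℕ.* q ∣? ℕ.∣ n - v ∣) * a n)
          eq : X [] y z q v ≡ y 1 * z 1 * t
          eq = trans (∑-cong N (λ n _ _ → solve 3 (λ i a w → i :* (a :* w) := w :* (i :* a)) refl (𝟙 (W ℕ.* q ∣? ℕ.∣ n - v ∣)) (a n) (y 1 * z 1)))
                     (∑-scale N (y 1 * z 1) _)
          0≤yz = *-nonNeg (nonNeg gy 1) (nonNeg gz 1)
          main : ∀ d → (q ℕ.≤? T ℕ.* T) ≡ d → y 1 * z 1 * t ≈[ y 1 * z 1 * error (q ℕ.* 1) ] D q * (y 1 * z 1)
          main (yes l) e′ = subst₂ (λ s u → y 1 * z 1 * t ≈[ y 1 * z 1 * s ] u)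
            (sym (trans (cong error (ℕ.*-identityʳ q)) (trans (cong (λ s → e q * 𝟙 s) e′) (*-identityʳ (e q)))))
            (*-comm (y 1 * z 1) (D q)) (≈-scale 0≤yz (base adm l))
          main (no ¬l) _ = subst₂ (λ s u → s ≈[ y 1 * z 1 * error (q ℕ.* 1) ] u)
            (sym (trans (cong (_* t) yz≡0) (zeroˡ t))) (sym (trans (cong (D q *_) yz≡0) (zeroʳ (D q))))
            (≈-weaken (*-nonNeg 0≤yz (error-nonNeg _)) ≈-refl)
            where
            yz≡0 : y 1 * z 1 ≡ 0#
            yz≡0 with T ℕ.<? c | T ℕ.<? c′
            ... | yes l | _ = trans (cong (_* z 1) (support gy 1 (subst (T ℕ.<_) (sym (ℕ.*-identityʳ c)) l))) (zeroˡ (z 1))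
            ... | no _ | yes l = trans (cong (y 1 *_) (support gz 1 (subst (T ℕ.<_) (sym (ℕ.*-identityʳ c′)) l))) (zeroʳ (y 1))
            ... | no l | no l′ = contradiction (ℕ.≤-trans hq (ℕ.*-mono-≤ (ℕ.≮⇒≥ l) (ℕ.≮⇒≥ l′))) ¬l

        -- In `Λ-product` the indicator of a hit is the sum of those of the individual shifts, and
        -- each of these refines the class modulo `W * q` to one of the classes in `vs`.
        X-step : ∀ {p q v} ps y z → Fresh q p → (vs : All (λ h → ∃ λ v′ → Adm (q ℕ.* p) v′ ×
          (∀ n → 𝟙 (W ℕ.* q ∣? ℕ.∣ n - v ∣) * 𝟙 (p ∣? n ℕ.+ h) ≡ 𝟙 (W ℕ.* (q ℕ.* p) ∣? ℕ.∣ n - v′ ∣))) hs) →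
          ∀ {e d} → (∀ v′ → Adm (q ℕ.* p) v′ →
            ((1# + α p) * (1# + α p) * X ps (shift p y) (shift p z) (q ℕ.* p) v′
             - (1# + α p) * (X ps (mix p y) (shift p z) (q ℕ.* p) v′ + X ps (shift p y) (mix p z) (q ℕ.* p) v′)) ≈[ e ] d) →
          ∀ {e′ d′} → X ps (mix p y) (mix p z) q v ≈[ e′ ] d′ →
          X (p ∷ ps) y z q v ≈[ e′ + ι (length hs) * e ] d′ + ι (length hs) * d
        X-step {p} {q} {v} ps y z fr vs {e} {d} cl {e′} {d′} main =
          subst (λ s → s ≈[ e′ + ι (length hs) * e ] d′ + ι (length hs) * d) (sym eq) (≈-+ main (∑[]-≈ (All.map one vs)))
          where
          A = 1# + α p
          I : ℕ → Carrier
          I n = 𝟙 (W ℕ.* q ∣? ℕ.∣ n - v ∣)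
          ξ : ℕ → Carrier
          ξ n = A * A * (Λ ps (shift p y) n * Λ ps (shift p z) n)
              - A * (Λ ps (mix p y) n * Λ ps (shift p z) n + Λ ps (shift p y) n * Λ ps (mix p z) n)
          term : ℕ → ℕ → Carrier
          term n h = I n * 𝟙 (p ∣? n ℕ.+ h) * (a n * ξ n)
          eq : X (p ∷ ps) y z q v ≡ X ps (mix p y) (mix p z) q v + ∑[ hs ] (λ h → ∑ N (λ n → term n h))
          eq = trans (∑-cong N pointwise) (trans (∑-+ N _ _) (cong (X ps (mix p y) (mix p z) q v +_) (∑-swap N hs term)))
            where
            pointwise : ∀ n → 1 ℕ.≤ n → n ℕ.≤ N → I n * (a n * (Λ (p ∷ ps) y n * Λ (p ∷ ps) z n)) ≡
              I n * (a n * (Λ ps (mix p y) n * Λ ps (mix p z) n)) + ∑[ hs ] (term n)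
            pointwise n 1≤n _ = begin
              I n * (a n * (Λ (p ∷ ps) y n * Λ (p ∷ ps) z n))
                ≡⟨ cong (λ t → I n * (a n * t)) (Λ-product p ps y z n) ⟩
              I n * (a n * (m + 𝟙 (hit? p n) * ξ n))
                ≡⟨ solve 5 (λ i a m t x → i :* (a :* (m :+ t :* x)) := i :* (a :* m) :+ i :* ((a :* t) :* x)) refl (I n) (a n) m (𝟙 (hit? p n)) (ξ n) ⟩
              I n * (a n * m) + I n * ((a n * 𝟙 (hit? p n)) * ξ n)
                ≡⟨ cong (λ t → I n * (a n * m) + I n * (t * ξ n)) (hits fr n 1≤n) ⟩
              I n * (a n * m) + I n * ((a n * s) * ξ n)
                ≡⟨ cong (I n * (a n * m) +_) (solve 4 (λ i a s x → i :* ((a :* s) :* x) := (i :* (a :* x)) :* s) refl (I n) (a n) s (ξ n)) ⟩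
              I n * (a n * m) + (I n * (a n * ξ n)) * s
                ≡⟨ cong (I n * (a n * m) +_) (trans (sym (∑[]-scale hs (I n * (a n * ξ n)) (λ h → 𝟙 (p ∣? n ℕ.+ h)))) (reorder hs)) ⟩
              I n * (a n * m) + ∑[ hs ] (term n) ∎
              where
              open ≡-Reasoning
              m = Λ ps (mix p y) n * Λ ps (mix p z) n
              s = ∑[ hs ] (λ h → 𝟙 (p ∣? n ℕ.+ h))
              reorder : ∀ hs → ∑[ hs ] (λ h → (I n * (a n * ξ n)) * 𝟙 (p ∣? n ℕ.+ h)) ≡ ∑[ hs ] (term n)
              reorder [] = refl
              reorder (h ∷ hs) = cong₂ _+_ (solve 3 (λ i b t → i :* b :* t := i :* t :* b) refl (I n) (a n * ξ n) (𝟙 (p ∣? n ℕ.+ h))) (reorder hs)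
          one : ∀ {h} → (∃ λ v′ → Adm (q ℕ.* p) v′ × (∀ n → I n * 𝟙 (p ∣? n ℕ.+ h) ≡ 𝟙 (W ℕ.* (q ℕ.* p) ∣? ℕ.∣ n - v′ ∣))) →
                ∑ N (λ n → term n h) ≈[ e ] d
          one {h} (v′ , adm , c) = subst (λ s → s ≈[ e ] d) (sym (trans (∑-cong N (λ n _ _ → pointwise n)) collect)) (cl v′ adm)
            where
            J : ℕ → Carrier
            J n = 𝟙 (W ℕ.* (q ℕ.* p) ∣? ℕ.∣ n - v′ ∣)
            f₁ f₂ f₃ : ℕ → Carrier
            f₁ n = J n * (a n * (Λ ps (shift p y) n * Λ ps (shift p z) n))
            f₂ n = J n * (a n * (Λ ps (mix p y) n * Λ ps (shift p z) n))
            f₃ n = J n * (a n * (Λ ps (shift p y) n * Λ ps (mix p z) n))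
            pointwise : ∀ n → term n h ≡ A * A * f₁ n + (- A) * (f₂ n + f₃ n)
            pointwise n = trans (cong (_* (a n * ξ n)) (c n))
              (solve 6 (λ j a A u v w → j :* (a :* (A :* A :* u :- A :* (v :+ w))) := A :* A :* (j :* (a :* u)) :+ (:- A) :* (j :* (a :* v) :+ j :* (a :* w))) refl
                (J n) (a n) A (Λ ps (shift p y) n * Λ ps (shift p z) n) (Λ ps (mix p y) n * Λ ps (shift p z) n) (Λ ps (shift p y) n * Λ ps (mix p z) n))
            collect : ∑ N (λ n → A * A * f₁ n + (- A) * (f₂ n + f₃ n)) ≡ A * A * ∑ N f₁ - A * (∑ N f₂ + ∑ N f₃)
            collect = trans (∑-linear N (- A) (λ n → A * A * f₁ n) (λ n → f₂ n + f₃ n))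
              (trans (cong₂ (λ s t → s + (- A) * t) (∑-scale N (A * A) f₁) (∑-+ N f₂ f₃))
                (solve 3 (λ A x y → A :* A :* x :+ (:- A) :* y := A :* A :* x :- A :* y) refl A (∑ N f₁) (∑ N f₂ + ∑ N f₃)))

        -- Induction over the primes. The bound `q ≤ c * c′` survives because a hit multiplies `q`
        -- by `p` and at least one of `c`, `c′` with it; this is what keeps all moduli below the
        -- level.
        X-estimate : ∀ ps {y z c c′ q v} → Valid Fresh q ps → Good T c y → Good T c′ z → q ℕ.≤ c ℕ.* c′ → Adm q v →
          X ps y z q v ≈[ G ps y * G ps z * Err ps q ] D q * E ps y z
        X-estimate [] _ gy gz hq adm = X-base gy gz hq adm
        X-estimate (p ∷ ps) {y} {z} {c} {c′} {q} {v} (fr , val , val′) gy gz hq adm =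
          ≈-weaken bound (≈-subst refl eqD (X-step ps y z fr (refine adm fr) class
            (X-estimate ps val (Good-mix p hp gy) (Good-mix p hp gz) hq adm)))
          where
          hp = fresh⇒1≤ fr
          A = 1# + α p
          0≤A = 0≤+ 0≤1 (0≤α p)
          yₚ = shift p y
          zₚ = shift p z
          my = mix p y
          mz = mix p z
          qp = q ℕ.* p
          Γy = G (p ∷ ps) y
          Γz = G (p ∷ ps) z
          s = Err ps qp
          0≤s : 0# ≤ s
          0≤s = Err-nonNeg ps qp
          0≤G : ∀ {c y} → Good T c y → 0# ≤ G ps y
          0≤G g = 𝕊-nonNeg ps 0≤α (nonNeg g)
          h₁ : qp ℕ.≤ c ℕ.* p ℕ.* (c′ ℕ.* p)
          h₁ = ℕ.≤-trans (ℕ.*-monoˡ-≤ p hq) (subst (ℕ._≤ c ℕ.* p ℕ.* (c′ ℕ.* p)) (l c c′ p)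
            (ℕ.*-monoʳ-≤ (c ℕ.* p) (subst (ℕ._≤ c′ ℕ.* p) (ℕ.*-identityʳ c′) (ℕ.*-monoʳ-≤ c′ hp))))
            where
            l : ∀ c c′ p → c ℕ.* p ℕ.* c′ ≡ c ℕ.* c′ ℕ.* p
            l = ℕ-ring
          h₂ : qp ℕ.≤ c ℕ.* (c′ ℕ.* p)
          h₂ = subst (qp ℕ.≤_) (ℕ.*-assoc c c′ p) (ℕ.*-monoˡ-≤ p hq)
          h₃ : qp ℕ.≤ c ℕ.* p ℕ.* c′
          h₃ = subst (qp ℕ.≤_) (l c c′ p) (ℕ.*-monoˡ-≤ p hq)
            where
            l : ∀ c c′ p → c ℕ.* c′ ℕ.* p ≡ c ℕ.* p ℕ.* c′
            l = ℕ-ring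
          e₀ d₀ : Carrier
          e₀ = A * A * (G ps yₚ * G ps zₚ * s) + A * (G ps my * G ps zₚ * s + G ps yₚ * G ps mz * s)
          d₀ = A * A * (D qp * E ps yₚ zₚ) - A * (D qp * E ps my zₚ + D qp * E ps yₚ mz)
          class : ∀ v′ → Adm qp v′ → (A * A * X ps yₚ zₚ qp v′ - A * (X ps my zₚ qp v′ + X ps yₚ mz qp v′)) ≈[ e₀ ] d₀
          class v′ adm′ = ≈-+ (≈-scale (*-nonNeg 0≤A 0≤A) (X-estimate ps val′ (Good-shift p gy) (Good-shift p gz) h₁ adm′))
            (≈-neg (≈-scale 0≤A (≈-+ (X-estimate ps val′ (Good-mix p hp gy) (Good-shift p gz) h₂ adm′)
                                     (X-estimate ps val′ (Good-shift p gy) (Good-mix p hp gz) h₃ adm′))))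
          eqD : D q * E ps my mz + ι (length hs) * d₀ ≡ D q * E (p ∷ ps) y z
          eqD = trans (cong (λ t → D q * E ps my mz + ι (length hs) * (A * A * (t * E ps yₚ zₚ) - A * (t * E ps my zₚ + t * E ps yₚ mz))) (D-step fr))
            (solve 8 (λ D d l A a b c m → D :* m :+ l :* (A :* A :* (D :* d :* a) :- A :* (D :* d :* b :+ D :* d :* c))
                := D :* (m :+ l :* d :* (A :* A :* a :- A :* (b :+ c)))) refl
              (D q) (δ p) (ι (length hs)) A (E ps yₚ zₚ) (E ps my zₚ) (E ps yₚ mz) (E ps my mz))
          gy≤ : A * G ps yₚ ≤ Γy
          gy≤ = G-shift-≤ ps hp (antitone gy)
          gz≤ : A * G ps zₚ ≤ Γz
          gz≤ = G-shift-≤ ps hp (antitone gz)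
          0≤Ayₚ = *-nonNeg 0≤A (0≤G (Good-shift p gy))
          0≤Azₚ = *-nonNeg 0≤A (0≤G (Good-shift p gz))
          0≤Γy = ≤-trans 0≤Ayₚ gy≤
          0≤Γz = ≤-trans 0≤Azₚ gz≤
          e₀≤ : e₀ ≤ ι 3 * (Γy * Γz * s)
          e₀≤ = begin
            e₀ ≡⟨ solve 6 (λ A gy gz my mz s → A :* A :* (gy :* gz :* s) :+ A :* (my :* gz :* s :+ gy :* mz :* s)
                   := (A :* gy) :* (A :* gz) :* s :+ (my :* (A :* gz) :* s :+ (A :* gy) :* mz :* s)) refl A (G ps yₚ) (G ps zₚ) (G ps my) (G ps mz) s ⟩
            (A * G ps yₚ) * (A * G ps zₚ) * s + (G ps my * (A * G ps zₚ) * s + (A * G ps yₚ) * G ps mz * s)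
              ≤⟨ +-mono-≤ (*-monoʳ 0≤s (*-mono 0≤Ayₚ 0≤Γz gy≤ gz≤))
                   (+-mono-≤ (*-monoʳ 0≤s (*-mono (0≤G (Good-mix p hp gy)) 0≤Γz (≤-reflexive (G-mix p ps y)) gz≤))
                             (*-monoʳ 0≤s (*-mono 0≤Ayₚ 0≤Γz gy≤ (≤-reflexive (G-mix p ps z))))) ⟩
            Γy * Γz * s + (Γy * Γz * s + Γy * Γz * s)
              ≡⟨ solve 1 (λ x → x :+ (x :+ x) := con (pos 3) :* x) refl (Γy * Γz * s) ⟩
            ι 3 * (Γy * Γz * s) ∎
            where open ≤-Reasoning
          bound : G ps my * G ps mz * Err ps q + ι (length hs) * e₀ ≤ Γy * Γz * Err (p ∷ ps) q
          bound = begin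
            G ps my * G ps mz * Err ps q + ι (length hs) * e₀
              ≤⟨ +-mono-≤ (≤-reflexive (cong₂ (λ s t → s * t * Err ps q) (G-mix p ps y) (G-mix p ps z)))
                          (*-mono (0≤ι (length hs)) (*-nonNeg (0≤ι 3) (*-nonNeg (*-nonNeg 0≤Γy 0≤Γz) 0≤s)) (ι-mono len) e₀≤) ⟩
            Γy * Γz * Err ps q + ι k * (ι 3 * (Γy * Γz * s))
              ≡⟨ solve 4 (λ x a k s → x :* a :+ k :* (con (pos 3) :* (x :* s)) := x :* (a :+ con (pos 3) :* k :* s)) refl (Γy * Γz) (Err ps q) (ι k) s ⟩
            Γy * Γz * (Err ps q + ι 3 * ι k * s)
              ≡⟨ cong (λ t → Γy * Γz * (Err ps q + ι 3 * ι k * t)) (𝕊-cong ps (λ r → cong error (ℕ.*-assoc q p r))) ⟩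
            Γy * Γz * Err (p ∷ ps) q ∎
            where open ≤-Reasoning

  -- Evaluation of the expected second moment.

  module ModelBounds (α : ℕ → Carrier) (0≤α : NonNeg α) (g : ℕ → Carrier) where
    open Weights α 0≤α
    open Model g

    -- Under the hypothesis the mean of χ_p is zero and its variance is α(p), so `E-diagonal` leaves
    -- no cross terms.
    E-orthogonal : ∀ {ps} y → All (λ p → g p * (1# + α p) ≡ α p) ps → E ps y y ≡ 𝕊 α ps (λ r → y r * y r)
    E-orthogonal {[]} y [] = refl
    E-orthogonal {p ∷ ps} y (h ∷ hs) = trans (E-diagonal p ps y 0# (α p) (sym h) (sym (-‿inverseʳ (α p))))
      (cong₂ _+_ (trans (E-cong ps vanish vanish) (E-orthogonal y hs))
        (cong₂ _*_ (solve 1 (λ a → a :* (:1 :+ con (pos 0)) := a) refl (α p)) (E-orthogonal (shift p y) hs)))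
      where
      vanish : ∀ r → y r + 0# * y (p ℕ.* r) ≡ y r
      vanish r = solve 2 (λ a b → a :+ con (pos 0) :* b := a) refl (y r) (y (p ℕ.* r))

    -- For primes the means are not zero, and the form is a sum of squares of inner sums over m with
    -- weight 1/m. A mean of at least 1/p lets the inner sum absorb `p`. For the terms with `p` in
    -- the outer variable the inner sum may contain `p` again; that costs (1 + 1/p)², which the
    -- variance is assumed to cover.
    E-lower : ∀ {ps} {y w} → NonNeg y → Antitone y → NonNeg w →
      All (λ p → 1 ℕ.≤ p × ρ p ≤ α p - g p * (1# + α p) ×
        w p * ((1# + ρ p) * (1# + ρ p)) ≤ g p * (1# + α p) * (1# + (α p - g p * (1# + α p)))) ps →
      𝕊 w ps (λ r → 𝕊 ρ ps (shift r y) * 𝕊 ρ ps (shift r y)) ≤ E ps y y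
    E-lower {[]} {y} hy ay hw [] = ≤-refl
    E-lower {p ∷ ps} {y} {w} hy ay hw ((hp , ρ≤ , w≤) ∷ hs) = begin
      𝕊 w ps (λ r → sq (t (p ∷ ps) (shift r y))) + w p * 𝕊 w ps (λ r → sq (t (p ∷ ps) (shift (p ℕ.* r) y)))
        ≤⟨ +-mono-≤ (𝕊-mono ps hw first) (*-monoˡ (hw p) (𝕊-mono ps hw second)) ⟩
      𝕊 w ps (λ r → sq (t ps (shift r y⁺))) + w p * 𝕊 w ps (λ r → c * sq (t ps (shift r yₚ)))
        ≡⟨ cong (λ x → 𝕊 w ps (λ r → sq (t ps (shift r y⁺))) + x)
             (trans (cong (w p *_) (𝕊-scale ps c _)) (sym (*-assoc (w p) c _))) ⟩
      𝕊 w ps (λ r → sq (t ps (shift r y⁺))) + w p * c * 𝕊 w ps (λ r → sq (t ps (shift r yₚ)))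
        ≤⟨ +-mono-≤ (E-lower hy⁺ ay⁺ hw hs) (*-mono (*-nonNeg (hw p) (sq-nonNeg _)) (≤-trans below (E-lower hyₚ ayₚ hw hs)) w≤ (E-lower hyₚ ayₚ hw hs)) ⟩
      E ps y⁺ y⁺ + γ * (1# + m) * E ps yₚ yₚ
        ≡⟨ sym (E-diagonal p ps y m γ refl refl) ⟩
      E (p ∷ ps) y y ∎
      where
      open ≤-Reasoning
      sq : Carrier → Carrier
      sq x = x * x
      t : List ℕ → (ℕ → Carrier) → Carrier
      t = 𝕊 ρ
      c = sq (1# + ρ p)
      γ = g p * (1# + α p)
      m = α p - γ
      0≤m : 0# ≤ m
      0≤m = ≤-trans (0≤ρ p) ρ≤
      yₚ = shift p y
      y⁺ : ℕ → Carrier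
      y⁺ r = y r + m * y (p ℕ.* r)
      hyₚ = shift-nonNeg p hy
      ayₚ = shift-antitone {y} p ay
      hy⁺ : NonNeg y⁺
      hy⁺ r = 0≤+ (hy r) (*-nonNeg 0≤m (hy _))
      ay⁺ : Antitone y⁺
      ay⁺ l = +-mono-≤ (ay l) (*-monoˡ 0≤m (ayₚ l))
      l₁ : ∀ p r m → r ℕ.* (p ℕ.* m) ≡ p ℕ.* (r ℕ.* m)
      l₁ = ℕ-ring
      below : 0# ≤ 𝕊 w ps (λ r → sq (t ps (shift r yₚ)))
      below = 𝕊-nonNeg ps hw (λ r → sq-nonNeg _)
      first : ∀ r → sq (t (p ∷ ps) (shift r y)) ≤ sq (t ps (shift r y⁺))
      first r = sq-mono (𝕊-nonNeg (p ∷ ps) 0≤ρ (λ _ → hy _))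
        (≤-trans (≤-reflexive (sym (𝕊-linear ps (ρ p) (shift r y) (shift p (shift r y)))))
          (𝕊-mono ps 0≤ρ (λ s → +-monoʳ-≤ _ (*-mono (0≤ρ p) (hy _) ρ≤ (≤-reflexive (cong y (l₁ p r s)))))))
      second : ∀ r → sq (t (p ∷ ps) (shift (p ℕ.* r) y)) ≤ c * sq (t ps (shift r yₚ))
      second r = ≤-trans (sq-mono (𝕊-nonNeg (p ∷ ps) 0≤ρ (λ _ → hy _)) bound)
        (≤-reflexive (solve 2 (λ a b → (a :* b) :* (a :* b) := (a :* a) :* (b :* b)) refl (1# + ρ p) (t ps (shift r yₚ))))
        where
        bound : t (p ∷ ps) (shift (p ℕ.* r) y) ≤ (1# + ρ p) * t ps (shift r yₚ)
        bound = ≤-trans (+-mono-≤ (≤-reflexive e) (*-monoˡ (0≤ρ p) (≤-trans (𝕊-shift-≤ ps hp 0≤ρ (shift-antitone {y} (p ℕ.* r) ay)) (≤-reflexive e))))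
          (≤-reflexive (solve 2 (λ a b → b :+ a :* b := (:1 :+ a) :* b) refl (ρ p) (t ps (shift r yₚ))))
          where
          e : t ps (shift (p ℕ.* r) y) ≡ t ps (shift r yₚ)
          e = 𝕊-cong ps (λ s → cong y (ℕ.*-assoc p r s))

  𝕊-mono⁺ : ∀ {w y z} {ps} → All (1 ℕ.≤_) ps → NonNeg w → (∀ r → 1 ℕ.≤ r → y r ≤ z r) → 𝕊 w ps y ≤ 𝕊 w ps z
  𝕊-mono⁺ [] hw h = h 1 ℕ.≤-refl
  𝕊-mono⁺ {ps = p ∷ ps} (hp ∷ hps) hw h = +-mono-≤ (𝕊-mono⁺ hps hw h) (*-monoˡ (hw p) (𝕊-mono⁺ hps hw (λ r hr → h (p ℕ.* r) (ℕ.*-mono-≤ hp hr))))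

  -- Weights k/p as k-fold iterated sums with weight 1/p.

  Op : Set
  Op = (ℕ → Carrier) → ℕ → Carrier

  iter : Op → ℕ → Op
  iter U zero Q = Q
  iter U (suc k) Q = iter U k (U Q)

  record Cut (R : ℕ) (Q : ℕ → Carrier) : Set where
    field
      nonNeg : NonNeg Q
      antitone : Antitone Q
      support : ∀ n → R ℕ.< n → Q n ≡ 0#

  Cut-shift : ∀ {R Q r} → 1 ℕ.≤ r → Cut R Q → Cut R (shift r Q)
  Cut-shift {r = suc r} _ c = record
    { nonNeg = shift-nonNeg (suc r) (Cut.nonNeg c) ; antitone = shift-antitone (suc r) (Cut.antitone c)
    ; support = λ n l → Cut.support c (suc r ℕ.* n) (ℕ.<-≤-trans l (ℕ.m≤m+n n (r ℕ.* n))) }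

  Cut-sq : ∀ {R Q} → Cut R Q → Cut R (λ r → Q r * Q r)
  Cut-sq c = record { nonNeg = sq-nonNeg′ _ ; antitone = sq-antitone (Cut.nonNeg c) (Cut.antitone c)
    ; support = λ n l → trans (cong (λ t → t * t) (Cut.support c n l)) (zeroˡ 0#) }

  module Iterates (ps : List ℕ) (1≤ps : All (1 ℕ.≤_) ps) where

    𝕋 : Op
    𝕋 Q r = 𝕊 ρ ps (shift r Q)

    weight : ℕ → ℕ → Carrier
    weight k p = ι k * ρ p

    0≤weight : ∀ k → NonNeg (weight k)
    0≤weight k p = *-nonNeg (0≤ι k) (0≤ρ p)

    𝕋-nonNeg : ∀ {Q} → NonNeg Q → NonNeg (𝕋 Q)
    𝕋-nonNeg h r = 𝕊-nonNeg ps 0≤ρ (λ m → h _)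

    𝕋-antitone : ∀ {Q} → Antitone Q → Antitone (𝕋 Q)
    𝕋-antitone h l = 𝕊-mono ps 0≤ρ (λ m → h (ℕ.*-monoˡ-≤ m l))

    weight-suc : ∀ k p → weight (suc k) p ≡ weight k p + ρ p
    weight-suc k p = trans (cong (_* ρ p) (ι-suc k)) (solve 2 (λ k r → (:1 :+ k) :* r := k :* r :+ r) refl (ι k) (ρ p))

    -- There are k^ω(r) ways to write a squarefree r as an ordered product of k factors, and each of
    -- them is a term of the iterated sum.
    𝕊-weight≤iter : ∀ k {Q} → NonNeg Q → 𝕊 (weight k) ps Q ≤ iter 𝕋 k Q 1
    𝕊-weight≤iter zero {Q} h = ≤-reflexive (𝕊-weight-0 ps (λ p → zeroˡ (ρ p)))
    𝕊-weight≤iter (suc k) {Q} h = begin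
      𝕊 (weight (suc k)) ps Q ≤⟨ 𝕊-weight-mono (0≤weight (suc k)) h (All.universal (λ p → ≤-reflexive (weight-suc k p)) ps) ⟩
      𝕊 (λ p → weight k p + ρ p) ps Q ≤⟨ 𝕊-+≤𝕊𝕊 (0≤weight k) 0≤ρ ps h ⟩
      𝕊 (weight k) ps (𝕋 Q) ≤⟨ 𝕊-weight≤iter k (𝕋-nonNeg h) ⟩
      iter 𝕋 k (𝕋 Q) 1 ∎
      where open ≤-Reasoning

    -- The iterated sum also contains tuples with common prime factors. Adding one variable to k
    -- earlier ones costs ∏ (1 + k/p²) for these, by `𝕊𝕊≤𝕊-+`.
    loss : ℕ → Carrier
    loss zero = 1#
    loss (suc k) = loss k * Π (λ p → weight k p * ρ p) ps

    loss-nonNeg : ∀ k → 0# ≤ loss k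
    loss-nonNeg zero = 0≤1
    loss-nonNeg (suc k) = *-nonNeg (loss-nonNeg k) (Π-nonNeg ps (λ p → *-nonNeg (0≤weight k p) (0≤ρ p)))

    iter≤𝕊-weight : ∀ k {Q} → NonNeg Q → Antitone Q → iter 𝕋 k Q 1 ≤ loss k * 𝕊 (weight k) ps Q
    iter≤𝕊-weight zero {Q} h a = ≤-reflexive (sym (trans (*-identityˡ _) (𝕊-weight-0 ps (λ p → zeroˡ (ρ p)))))
    iter≤𝕊-weight (suc k) {Q} h a = begin
      iter 𝕋 k (𝕋 Q) 1 ≤⟨ iter≤𝕊-weight k (𝕋-nonNeg h) (𝕋-antitone a) ⟩
      loss k * 𝕊 (weight k) ps (𝕋 Q) ≤⟨ *-monoˡ (loss-nonNeg k) (𝕊𝕊≤𝕊-+ (0≤weight k) 0≤ρ 1≤ps h a) ⟩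
      loss k * (π * 𝕊 (λ p → weight k p + ρ p) ps Q) ≤⟨ *-monoˡ (loss-nonNeg k) (*-monoˡ (Π-nonNeg ps (λ p → *-nonNeg (0≤weight k p) (0≤ρ p)))
                                                              (𝕊-weight-mono (λ p → 0≤+ (0≤weight k p) (0≤ρ p)) h (All.universal (λ p → ≤-reflexive (sym (weight-suc k p))) ps))) ⟩
      loss k * (π * 𝕊 (weight (suc k)) ps Q) ≡⟨ sym (*-assoc (loss k) π _) ⟩
      loss k * π * 𝕊 (weight (suc k)) ps Q ∎
      where
      open ≤-Reasoning
      π = Π (λ p → weight k p * ρ p) ps

    iter-mono : ∀ k {Q Q′} → (∀ r → 1 ℕ.≤ r → Q r ≤ Q′ r) → ∀ r → 1 ℕ.≤ r → iter 𝕋 k Q r ≤ iter 𝕋 k Q′ r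
    iter-mono zero h = h
    iter-mono (suc k) h = iter-mono k (λ r hr → 𝕊-mono⁺ 1≤ps 0≤ρ (λ m hm → h (r ℕ.* m) (ℕ.*-mono-≤ hr hm)))

    iter-scale : ∀ k c Q r → iter 𝕋 k (λ r → c * Q r) r ≡ c * iter 𝕋 k Q r
    iter-scale zero c Q r = refl
    iter-scale (suc k) c Q r = trans (iter-cong k (λ r → 𝕊-scale ps c (shift r Q)) r) (iter-scale k c (𝕋 Q) r)
      where
      iter-cong : ∀ k {Q Q′} → (∀ r → Q r ≡ Q′ r) → ∀ r → iter 𝕋 k Q r ≡ iter 𝕋 k Q′ r
      iter-cong zero h r = h r
      iter-cong (suc k) h r = iter-cong k (λ r → 𝕊-cong ps (λ m → h (r ℕ.* m))) r

    module Compare (R : ℕ) (U : Op) (U-cut : ∀ {Q} → Cut R Q → Cut R (U Q)) where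

      iter-upper : ∀ {μ} → 0# ≤ μ → (∀ {Q} → Cut R Q → ∀ r → 1 ℕ.≤ r → 𝕋 Q r ≤ μ * U Q r) →
        ∀ k {Q} → Cut R Q → ∀ r → 1 ℕ.≤ r → iter 𝕋 k Q r ≤ μ ^ k * iter U k Q r
      iter-upper {μ} hμ h zero {Q} c r hr = ≤-reflexive (sym (*-identityˡ (Q r)))
      iter-upper {μ} hμ h (suc k) {Q} c r hr = begin
        iter 𝕋 k (𝕋 Q) r ≤⟨ iter-mono k (h c) r hr ⟩
        iter 𝕋 k (λ r → μ * U Q r) r ≡⟨ iter-scale k μ (U Q) r ⟩
        μ * iter 𝕋 k (U Q) r ≤⟨ *-monoˡ hμ (iter-upper hμ h k (U-cut c) r hr) ⟩
        μ * (μ ^ k * iter U k (U Q) r) ≡⟨ sym (*-assoc μ (μ ^ k) _) ⟩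
        μ ^ suc k * iter U (suc k) Q r ∎
        where open ≤-Reasoning

      iter-lower : ∀ {μ B} → 0# ≤ μ → 0# ≤ B → (∀ {Q} → Cut R Q → ∀ r → 1 ℕ.≤ r → μ * U Q r ≤ B * 𝕋 Q r) →
        ∀ k {Q} → Cut R Q → ∀ r → 1 ℕ.≤ r → μ ^ k * iter U k Q r ≤ B ^ k * iter 𝕋 k Q r
      iter-lower {μ} {B} hμ hB h zero {Q} c r hr = ≤-refl
      iter-lower {μ} {B} hμ hB h (suc k) {Q} c r hr = begin
        μ * μ ^ k * iter U k (U Q) r ≡⟨ *-assoc μ (μ ^ k) _ ⟩
        μ * (μ ^ k * iter U k (U Q) r) ≤⟨ *-monoˡ hμ (iter-lower hμ hB h k (U-cut c) r hr) ⟩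
        μ * (B ^ k * iter 𝕋 k (U Q) r) ≡⟨ solve 3 (λ a b c → a :* (b :* c) := b :* (a :* c)) refl μ (B ^ k) (iter 𝕋 k (U Q) r) ⟩
        B ^ k * (μ * iter 𝕋 k (U Q) r) ≡⟨ cong (B ^ k *_) (sym (iter-scale k μ (U Q) r)) ⟩
        B ^ k * iter 𝕋 k (λ r → μ * U Q r) r ≤⟨ *-monoˡ (^-nonNeg k hB) (iter-mono k (h c) r hr) ⟩
        B ^ k * iter 𝕋 k (λ r → B * 𝕋 Q r) r ≡⟨ cong (B ^ k *_) (iter-scale k B (𝕋 Q) r) ⟩
        B ^ k * (B * iter 𝕋 k (𝕋 Q) r) ≡⟨ solve 3 (λ a b c → a :* (b :* c) := b :* a :* c) refl (B ^ k) B (iter 𝕋 k (𝕋 Q) r) ⟩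
        B ^ suc k * iter 𝕋 (suc k) Q r ∎
        where open ≤-Reasoning

  -- From squarefree products to sums over the integers prime to W.

  ∑-multiples-exact : ∀ p M (f : ℕ → Carrier) → 1 ℕ.≤ p → ∑ (M ℕ.* p) (λ n → 𝟙 (p ∣? n) * f n) ≡ ∑ M (λ m → f (p ℕ.* m))
  ∑-multiples-exact p zero f hp = refl
  ∑-multiples-exact p@(suc p-1) (suc M) f hp = begin
    ∑ (p ℕ.+ M ℕ.* p) ψ ≡⟨ cong (λ t → ∑ (suc t) ψ) (ℕ.+-comm p-1 (M ℕ.* p)) ⟩
    ∑ (M ℕ.* p ℕ.+ p-1) ψ + ψ (suc (M ℕ.* p ℕ.+ p-1))
      ≡⟨ cong₂ _+_ (trans (gap p-1 ℕ.≤-refl) (∑-multiples-exact p M f hp))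
           (trans (cong ψ (trans (sym (ℕ.+-suc (M ℕ.* p) p-1)) (trans (ℕ.+-comm (M ℕ.* p) p) (ℕ.*-comm (suc M) p))))
             (trans (cong (_* f (p ℕ.* suc M)) (𝟙-yes (p ∣? p ℕ.* suc M) (m∣m*n (suc M)))) (*-identityˡ _))) ⟩
    ∑ M (λ m → f (p ℕ.* m)) + f (p ℕ.* suc M) ∎
    where
    open ≡-Reasoning
    ψ : ℕ → Carrier
    ψ n = 𝟙 (p ∣? n) * f n
    gap : ∀ j → j ℕ.≤ p-1 → ∑ (M ℕ.* p ℕ.+ j) ψ ≡ ∑ (M ℕ.* p) ψ
    gap zero _ = cong (λ t → ∑ t ψ) (ℕ.+-identityʳ (M ℕ.* p))
    gap (suc j) l = trans (cong (λ t → ∑ t ψ) (ℕ.+-suc (M ℕ.* p) j))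
      (trans (cong₂ _+_ (gap j (ℕ.<⇒≤ l)) (trans (cong (_* f (suc (M ℕ.* p ℕ.+ j))) (𝟙-no (p ∣? suc (M ℕ.* p ℕ.+ j)) nd)) (zeroˡ _)))
        (+-identityʳ _))
      where
      nd : ¬ p ∣ suc (M ℕ.* p ℕ.+ j)
      nd d = contradiction (∣⇒≤ (∣m+n∣m⇒∣n (subst (p ∣_) (sym (ℕ.+-suc (M ℕ.* p) j)) d) (n∣m*n M))) (ℕ.<⇒≱ (ℕ.s≤s l))

  ∑-support : ∀ {R N f} → R ℕ.≤ N → (∀ n → R ℕ.< n → f n ≡ 0#) → ∑ N f ≡ ∑ R f
  ∑-support {R} {N} {f} R≤N h = go (ℕ.≤⇒≤′ R≤N)
    where
    go : ∀ {N} → R ℕ.≤′ N → ∑ N f ≡ ∑ R f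
    go ℕ.≤′-refl = refl
    go (ℕ.≤′-step {N} l) = trans (cong₂ _+_ (go l) (h (suc N) (ℕ.s≤s (ℕ.≤′⇒≤ l)))) (+-identityʳ _)

  ∑-multiples : ∀ p R (f : ℕ → Carrier) → 1 ℕ.≤ p → (∀ n → R ℕ.< n → f n ≡ 0#) → ∑ R (λ n → 𝟙 (p ∣? n) * f n) ≡ ∑ R (λ m → f (p ℕ.* m))
  ∑-multiples p@(suc p-1) R f hp h = trans (sym (∑-support (ℕ.m≤m*n R p) (λ n l → trans (cong (𝟙 (p ∣? n) *_) (h n l)) (zeroʳ _))))
    (∑-multiples-exact p R f hp)

  remove : ℕ → (ℕ → Carrier) → ℕ → Carrier
  remove p θ n = θ n * (1# - 𝟙 (p ∣? n))

  remove-nonNeg : ∀ {θ} p → NonNeg θ → NonNeg (remove p θ)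
  remove-nonNeg p h n = *-nonNeg (h n) (≤⇒0≤- (𝟙≤1 (p ∣? n)))

  remove-≤ : ∀ {θ} p → NonNeg θ → ∀ n → remove p θ n ≤ θ n
  remove-≤ {θ} p h n = ≤-trans (*-monoˡ (h n) (0≤-⇒≤ (subst (0# ≤_) (solve 1 (λ t → t := :1 :- (:1 :- t)) refl (𝟙 (p ∣? n))) (𝟙-nonNeg (p ∣? n)))))
    (≤-reflexive (*-identityʳ (θ n)))

  -- θ is the indicator of the integers prime to everything sieved out so far,
  -- and ignores the primes still to come.
  data Free : List ℕ → (ℕ → Carrier) → Set where
    done : ∀ {θ} → θ 1 ≡ 1# → Free [] θ
    next : ∀ {p ps θ} → 2 ℕ.≤ p → (∀ n → θ (p ℕ.* n) ≡ θ n) → Free ps (remove p θ) → Free (p ∷ ps) θ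

  -- Each subset product is one of the integers on the right, and distinct subsets give distinct
  -- integers. In the induction the multiples of `p` are split off by complete multiplicativity, and
  -- squarefreeness is relaxed by `remove-≤`.
  𝕊≤∑ : ∀ {w ω : ℕ → Carrier} → NonNeg w → NonNeg ω → ω 1 ≡ 1# → (∀ p n → ω (p ℕ.* n) ≡ w p * ω n) →
    ∀ R {ps θ Q} → 1 ℕ.≤ R → NonNeg θ → Free ps θ → NonNeg Q → (∀ n → R ℕ.< n → Q n ≡ 0#) →
    𝕊 w ps Q ≤ ∑ R (λ n → θ n * (Q n * ω n))
  𝕊≤∑ {w} {ω} hw hω ω1 ω* R {θ = θ} {Q} 1≤R hθ (done h) hQ sQ =
    ≤-trans (≤-reflexive (sym e)) (∑-extend 1≤R (λ n → *-nonNeg (hθ n) (*-nonNeg (hQ n) (hω n))))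
    where
    e : 0# + θ 1 * (Q 1 * ω 1) ≡ Q 1
    e = trans (cong₂ (λ s t → 0# + s * (Q 1 * t)) h ω1) (solve 1 (λ q → con (pos 0) :+ :1 :* (q :* :1) := q) refl (Q 1))
  𝕊≤∑ {w} {ω} hw hω ω1 ω* R {p ∷ ps} {θ} {Q} 1≤R hθ (next hp hθp fr) hQ sQ = begin
    𝕊 w ps Q + w p * 𝕊 w ps (shift p Q)
      ≤⟨ +-mono-≤ (𝕊≤∑ hw hω ω1 ω* R 1≤R hθ′ fr hQ sQ) (*-monoˡ (hw p) (≤-trans (𝕊≤∑ hw hω ω1 ω* R 1≤R hθ′ fr (shift-nonNeg p hQ) (sₚ p hp))
           (∑-mono R (λ n _ _ → *-monoʳ (*-nonNeg (hQ _) (hω n)) (remove-≤ p hθ n))))) ⟩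
    ∑ R (λ n → θ′ n * (Q n * ω n)) + w p * ∑ R (λ n → θ n * (Q (p ℕ.* n) * ω n))
      ≡⟨ cong (∑ R (λ n → θ′ n * (Q n * ω n)) +_) (sym (trans (∑-multiples p R _ (ℕ.<⇒≤ hp) vanish) (trans (∑-cong R (λ n _ _ → term n)) (∑-scale R (w p) _)))) ⟩
    ∑ R (λ n → θ′ n * (Q n * ω n)) + ∑ R (λ n → 𝟙 (p ∣? n) * (θ n * (Q n * ω n)))
      ≡⟨ sym (∑-+ R _ _) ⟩
    ∑ R (λ n → θ′ n * (Q n * ω n) + 𝟙 (p ∣? n) * (θ n * (Q n * ω n)))
      ≡⟨ ∑-cong R (λ n _ _ → solve 3 (λ t i x → t :* (:1 :- i) :* x :+ i :* (t :* x) := t :* x) refl (θ n) (𝟙 (p ∣? n)) (Q n * ω n)) ⟩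
    ∑ R (λ n → θ n * (Q n * ω n)) ∎
    where
    open ≤-Reasoning
    θ′ = remove p θ
    hθ′ : NonNeg θ′
    hθ′ = remove-nonNeg p hθ
    sₚ : ∀ p → 2 ℕ.≤ p → ∀ n → R ℕ.< n → Q (p ℕ.* n) ≡ 0#
    sₚ (suc p) _ n l = sQ (suc p ℕ.* n) (ℕ.<-≤-trans l (ℕ.m≤m+n n (p ℕ.* n)))
    vanish : ∀ n → R ℕ.< n → θ n * (Q n * ω n) ≡ 0#
    vanish n l = trans (cong (λ t → θ n * (t * ω n)) (sQ n l)) (solve 2 (λ a b → a :* (con (pos 0) :* b) := con (pos 0)) refl (θ n) (ω n))
    term : ∀ n → θ (p ℕ.* n) * (Q (p ℕ.* n) * ω (p ℕ.* n)) ≡ w p * (θ n * (Q (p ℕ.* n) * ω n))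
    term n = trans (cong₂ (λ s t → s * (Q (p ℕ.* n) * t)) (hθp n) (ω* p n))
      (solve 4 (λ t q a b → t :* (q :* (a :* b)) := a :* (t :* (q :* b))) refl (θ n) (Q (p ℕ.* n)) (w p) (ω n))

  module Rough (R : ℕ) (1≤R : 1 ℕ.≤ R) where

    A : (ℕ → Carrier) → (ℕ → Carrier) → Carrier
    A θ Q = ∑ R (λ n → θ n * (Q n * ρ n))

    -- Stronger than `Free`: the list of primes must be exhaustive up to R, so that only 1 survives
    -- in the end. This is what a bound in the opposite direction needs.
    data Sieving : List ℕ → (ℕ → Carrier) → Set where
      done : ∀ {θ} → θ 1 ≡ 1# → (∀ n → 2 ℕ.≤ n → n ℕ.≤ R → θ n ≡ 0#) → Sieving [] θ
      next : ∀ {p ps θ} → 2 ℕ.≤ p → (∀ n → θ (p ℕ.* n) ≡ θ n) → Sieving ps (remove p θ) → Sieving (p ∷ ps) θ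

    A-nonNeg : ∀ {θ Q} → NonNeg θ → NonNeg Q → 0# ≤ A θ Q
    A-nonNeg h k = ∑-nonNeg R (λ n → *-nonNeg (h n) (*-nonNeg (k n) (0≤ρ n)))

    A-split : ∀ {p θ Q} → 2 ℕ.≤ p → (∀ n → θ (p ℕ.* n) ≡ θ n) → Cut R Q → A θ Q ≡ A (remove p θ) Q + ρ p * A θ (shift p Q)
    A-split {p} {θ} {Q} hp hθ c = begin
      A θ Q
        ≡⟨ ∑-cong R (λ n _ _ → solve 3 (λ t i x → t :* x := t :* (:1 :- i) :* x :+ i :* (t :* x)) refl (θ n) (𝟙 (p ∣? n)) (Q n * ρ n)) ⟩
      ∑ R (λ n → remove p θ n * (Q n * ρ n) + 𝟙 (p ∣? n) * (θ n * (Q n * ρ n)))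
        ≡⟨ ∑-+ R _ _ ⟩
      A (remove p θ) Q + ∑ R (λ n → 𝟙 (p ∣? n) * (θ n * (Q n * ρ n)))
        ≡⟨ cong (A (remove p θ) Q +_) (trans (∑-multiples p R _ (ℕ.<⇒≤ hp) vanish) (trans (∑-cong R (λ n _ _ → term n)) (∑-scale R (ρ p) _))) ⟩
      A (remove p θ) Q + ρ p * A θ (shift p Q) ∎
      where
      open ≡-Reasoning
      vanish : ∀ n → R ℕ.< n → θ n * (Q n * ρ n) ≡ 0#
      vanish n l = trans (cong (λ t → θ n * (t * ρ n)) (Cut.support c n l)) (solve 2 (λ a b → a :* (con (pos 0) :* b) := con (pos 0)) refl (θ n) (ρ n))
      term : ∀ n → θ (p ℕ.* n) * (Q (p ℕ.* n) * ρ (p ℕ.* n)) ≡ ρ p * (θ n * (Q (p ℕ.* n) * ρ n))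
      term n = trans (cong₂ (λ s t → s * (Q (p ℕ.* n) * t)) (hθ n) (ρ-* p n))
        (solve 4 (λ t q a b → t :* (q :* (a :* b)) := a :* (t :* (q :* b))) refl (θ n) (Q (p ℕ.* n)) (ρ p) (ρ n))

    -- The integers on the left need not be squarefree. Splitting twice by `p` isolates the terms
    -- divisible by p², at most x = 1/p² times the whole since `Q` decreases; and 1/(1 - x) ≤ 1 + 2x
    -- because x ≤ 1/2.
    A≤𝕊 : ∀ {ps θ Q} → NonNeg θ → Sieving ps θ → Cut R Q → A θ Q ≤ Π (λ p → ι 2 * (ρ p * ρ p)) ps * 𝕊 ρ ps Q
    A≤𝕊 {Q = Q} hθ (done {θ} h k) c = ≤-reflexive (trans (trans (∑-support′ 1≤R {ℕ.≤-refl}) e) (sym (*-identityˡ (Q 1))))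
      where
      ψ : ℕ → Carrier
      ψ n = θ n * (Q n * ρ n)
      ∑-support′ : ∀ {N} → 1 ℕ.≤ N → {l : N ℕ.≤ R} → ∑ N ψ ≡ ∑ 1 ψ
      ∑-support′ {suc zero} _ = refl
      ∑-support′ {suc (suc N)} _ {l} = trans (cong₂ _+_ (∑-support′ {suc N} (ℕ.s≤s ℕ.z≤n) {ℕ.<⇒≤ l})
        (trans (cong (_* (Q (suc (suc N)) * ρ (suc (suc N)))) (k (suc (suc N)) (ℕ.s≤s (ℕ.s≤s ℕ.z≤n)) l)) (zeroˡ _))) (+-identityʳ _)
      e : 0# + θ 1 * (Q 1 * ρ 1) ≡ Q 1
      e = trans (cong₂ (λ s t → 0# + s * (Q 1 * t)) h ρ1) (solve 1 (λ q → con (pos 0) :+ :1 :* (q :* :1) := q) refl (Q 1))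
    A≤𝕊 {p ∷ ps} {θ} {Q} hθ (next hp h s) c = begin
      a
        ≤⟨ 0≤-⇒≤ (subst (0# ≤_) (solve 2 (λ x a → x :* (:1 :- con (pos 2) :* x) :* a := (:1 :+ con (pos 2) :* x) :* (a :- x :* a) :- a) refl x a) (*-nonNeg (*-nonNeg 0≤x 0≤1-2x) 0≤a)) ⟩
      (1# + ι 2 * x) * (a - x * a)
        ≤⟨ *-monoˡ 0≤1+2x main ⟩
      (1# + ι 2 * x) * (π * 𝕊 ρ ps Q + ρ p * (π * 𝕊 ρ ps (shift p Q)))
        ≡⟨ solve 5 (λ c π s r t → c :* (π :* s :+ r :* (π :* t)) := c :* π :* (s :+ r :* t)) refl (1# + ι 2 * x) π (𝕊 ρ ps Q) (ρ p) (𝕊 ρ ps (shift p Q)) ⟩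
      (1# + ι 2 * x) * π * (𝕊 ρ ps Q + ρ p * 𝕊 ρ ps (shift p Q)) ∎
      where
      open ≤-Reasoning
      1≤p = ℕ.<⇒≤ hp
      x = ρ p * ρ p
      a = A θ Q
      π = Π (λ p → ι 2 * (ρ p * ρ p)) ps
      0≤a = A-nonNeg {θ} {Q} hθ (Cut.nonNeg c)
      0≤x : 0# ≤ x
      0≤x = sq-nonNeg (ρ p)
      0≤1+2x = 0≤+ 0≤1 (*-nonNeg (0≤ι 2) 0≤x)
      ρ≤1 : ρ p ≤ 1#
      ρ≤1 = subst (ρ p ≤_) ρ1 (ρ-antitone ℕ.≤-refl 1≤p)
      0≤1-2x : 0# ≤ 1# - ι 2 * x
      0≤1-2x = ≤⇒0≤- (begin
        ι 2 * (ρ p * ρ p) ≤⟨ *-monoˡ (0≤ι 2) (*-mono (0≤ρ p) 0≤1 (ρ-antitone (ℕ.s≤s ℕ.z≤n) hp) ρ≤1) ⟩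
        ι 2 * (ρ 2 * 1#) ≡⟨ cong (ι 2 *_) (*-identityʳ (ρ 2)) ⟩
        ι 2 * ρ 2 ≡⟨ ρ-inverse {2} (ℕ.s≤s ℕ.z≤n) ⟩
        1# ∎)
      cₚ = Cut-shift 1≤p c
      A-shift² : A θ (shift p (shift p Q)) ≤ a
      A-shift² = ∑-mono R (λ n _ _ → *-monoˡ (hθ n) (*-monoʳ (0≤ρ n)
        (≤-trans (shift-≤ 1≤p (Cut.antitone cₚ) n) (shift-≤ 1≤p (Cut.antitone c) n))))
      main : a - x * a ≤ π * 𝕊 ρ ps Q + ρ p * (π * 𝕊 ρ ps (shift p Q))
      main = begin
        a - x * a
          ≤⟨ +-monoʳ-≤ a (neg-≤ (*-monoˡ 0≤x A-shift²)) ⟩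
        a - x * A θ (shift p (shift p Q))
          ≡⟨ cong (λ t → t - x * A θ (shift p (shift p Q))) (trans (A-split hp h c) (cong (λ t → A (remove p θ) Q + ρ p * t) (A-split hp h cₚ))) ⟩
        A (remove p θ) Q + ρ p * (A (remove p θ) (shift p Q) + ρ p * A θ (shift p (shift p Q))) - x * A θ (shift p (shift p Q))
          ≡⟨ solve 4 (λ u v r t → u :+ r :* (v :+ r :* t) :- r :* r :* t := u :+ r :* v) refl (A (remove p θ) Q) (A (remove p θ) (shift p Q)) (ρ p) (A θ (shift p (shift p Q))) ⟩
        A (remove p θ) Q + ρ p * A (remove p θ) (shift p Q)
          ≤⟨ +-mono-≤ (A≤𝕊 (remove-nonNeg p hθ) s c) (*-monoˡ (0≤ρ p) (A≤𝕊 (remove-nonNeg p hθ) s cₚ)) ⟩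
        π * 𝕊 ρ ps Q + ρ p * (π * 𝕊 ρ ps (shift p Q)) ∎

  -- Harmonic sums and the mass of the units between powers of X.

  ∑-append : ∀ a b f → ∑ (a ℕ.+ b) f ≡ ∑ a f + ∑ b (λ i → f (a ℕ.+ i))
  ∑-append a zero f = trans (cong (λ t → ∑ t f) (ℕ.+-identityʳ a)) (sym (+-identityʳ _))
  ∑-append a (suc b) f = trans (cong (λ t → ∑ t f) (ℕ.+-suc a b))
    (trans (cong₂ _+_ (∑-append a b f) (cong f (sym (ℕ.+-suc a b)))) (+-assoc _ _ _))

  ∑-blocks : ∀ B u f → ∑ (B ℕ.* u) f ≡ ∑ B (λ b → ∑ u (λ i → f (ℕ.pred b ℕ.* u ℕ.+ i)))
  ∑-blocks zero u f = refl
  ∑-blocks (suc B) u f = trans (cong (λ t → ∑ t f) (ℕ.+-comm u (B ℕ.* u))) (trans (∑-append (B ℕ.* u) u f) (cong (_+ ∑ u (λ i → f (B ℕ.* u ℕ.+ i))) (∑-blocks B u f)))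

  ℋ : ℕ → Carrier
  ℋ n = ∑ n ρ

  0≤ℋ : ∀ n → 0# ≤ ℋ n
  0≤ℋ n = ∑-nonNeg n 0≤ρ

  ℋ-mono : ∀ {m n} → m ℕ.≤ n → ℋ m ≤ ℋ n
  ℋ-mono l = ∑-extend l 0≤ρ

  ℋ≤ι : ∀ n → ℋ n ≤ ι n
  ℋ≤ι n = ≤-trans (∑-mono n (λ m 1≤m _ → subst (ρ m ≤_) ρ1 (ρ-antitone ℕ.≤-refl 1≤m)))
    (≤-reflexive (trans (∑-const n 1#) (*-identityʳ (ι n))))

  ι*ρ[*] : ∀ u m → 1 ℕ.≤ u → ι u * ρ (u ℕ.* m) ≡ ρ m
  ι*ρ[*] u m hu = trans (cong (ι u *_) (ρ-* u m)) (trans (sym (*-assoc (ι u) (ρ u) (ρ m))) (trans (cong (_* ρ m) (ρ-inverse hu)) (*-identityˡ (ρ m))))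

  -- Σ_{u<b≤(M+1)u} 1/b lies between H(M+1) − 1 and H(M).
  segment-upper : ∀ u M → 1 ℕ.≤ u → ∑ (M ℕ.* u) (λ i → ρ (u ℕ.+ i)) ≤ ℋ M
  segment-upper u M hu = ≤-trans (≤-reflexive (∑-blocks M u _)) (∑-mono M block)
    where
    block : ∀ b → 1 ℕ.≤ b → b ℕ.≤ M → ∑ u (λ i → ρ (u ℕ.+ (ℕ.pred b ℕ.* u ℕ.+ i))) ≤ ρ b
    block (suc b) _ _ = ≤-trans (∑-mono u (λ i _ _ → ρ-antitone (ℕ.*-mono-≤ hu (ℕ.s≤s (ℕ.z≤n {b}))) (le i)))
      (≤-reflexive (trans (∑-const u _) (ι*ρ[*] u (suc b) hu)))
      where
      l : ∀ u b i → u ℕ.* suc b ℕ.+ i ≡ u ℕ.+ (b ℕ.* u ℕ.+ i)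
      l = ℕ-ring
      le : ∀ i → u ℕ.* suc b ℕ.≤ u ℕ.+ (b ℕ.* u ℕ.+ i)
      le i = subst (u ℕ.* suc b ℕ.≤_) (l u b i) (ℕ.m≤m+n _ i)

  segment-lower : ∀ u M → 1 ℕ.≤ u → ℋ (suc M) ≤ 1# + ∑ (M ℕ.* u) (λ i → ρ (u ℕ.+ i))
  segment-lower u M hu = ≤-trans (≤-reflexive (trans (∑-append 1 M ρ) (cong (_+ ∑ M (λ i → ρ (suc i))) (trans (+-identityˡ (ρ 1)) ρ1))))
    (+-monoʳ-≤ 1# (≤-trans (∑-mono M block) (≤-reflexive (sym (∑-blocks M u _)))))
    where
    block : ∀ b → 1 ℕ.≤ b → b ℕ.≤ M → ρ (suc b) ≤ ∑ u (λ i → ρ (u ℕ.+ (ℕ.pred b ℕ.* u ℕ.+ i)))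
    block (suc b) _ _ = ≤-trans (≤-reflexive (sym (trans (∑-const u _) (ι*ρ[*] u (suc (suc b)) hu))))
      (∑-mono u (λ i _ i≤u → ρ-antitone (ℕ.≤-trans hu (ℕ.m≤m+n u _)) (le i i≤u)))
      where
      l : ∀ u b → u ℕ.+ (b ℕ.* u ℕ.+ u) ≡ u ℕ.* suc (suc b)
      l = ℕ-ring
      le : ∀ i → i ℕ.≤ u → u ℕ.+ (b ℕ.* u ℕ.+ i) ℕ.≤ u ℕ.* suc (suc b)
      le i h = subst (u ℕ.+ (b ℕ.* u ℕ.+ i) ℕ.≤_) (l u b) (ℕ.+-monoʳ-≤ u (ℕ.+-monoʳ-≤ (b ℕ.* u) h))

  ℋ-* : ∀ M u → 1 ℕ.≤ u → ℋ (suc M ℕ.* u) ≤ ℋ u + ℋ M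
  ℋ-* M u hu = ≤-trans (≤-reflexive (∑-append u (M ℕ.* u) ρ)) (+-monoʳ-≤ (ℋ u) (segment-upper u M hu))

  1≤^ : ∀ X j → 1 ℕ.≤ X → 1 ℕ.≤ X ℕ.^ j
  1≤^ X zero h = ℕ.≤-refl
  1≤^ X (suc j) h = ℕ.*-mono-≤ h (1≤^ X j h)

  -- The substitute for log X^K = K log X. It is the only form in which the size of log N in terms
  -- of V enters.
  ℋ-^ : ∀ X K → 1 ℕ.≤ X → ℋ (X ℕ.^ K) ≤ 1# + ι K * ℋ X
  ℋ-^ X zero h = ≤-reflexive (trans (trans (+-identityˡ (ρ 1)) ρ1) (solve 1 (λ v → :1 := :1 :+ con (pos 0) :* v) refl (ℋ X)))
  ℋ-^ (suc X) (suc K) h = ≤-trans (ℋ-* X (suc X ℕ.^ K) (1≤^ (suc X) K h))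
    (≤-trans (+-mono-≤ (ℋ-^ (suc X) K h) (ℋ-mono (ℕ.n≤1+n X)))
      (≤-reflexive (trans (solve 2 (λ k v → :1 :+ k :* v :+ v := :1 :+ (:1 :+ k) :* v) refl (ι K) (ℋ (suc X))) (cong (λ t → 1# + t * ℋ (suc X)) (sym (ι-suc K))))))

  -- θ is W-periodic with c units per period, and X is a multiple of W.
  module Mass (W x c : ℕ) (1≤W : 1 ℕ.≤ W) (1≤x : 1 ℕ.≤ x) (θ : ℕ → Carrier) (0≤θ : NonNeg θ)
              (periodic : ∀ b i → θ (b ℕ.* W ℕ.+ i) ≡ θ i) (total-θ : ∑ W θ ≡ ι c) where

    X : ℕ
    X = x ℕ.* W

    1≤X : 1 ℕ.≤ X
    1≤X = ℕ.*-mono-≤ 1≤x 1≤W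

    -- `κ` is the density φ(W)/W. The reciprocals of the units in any one cell (X^j, X^(j+1)] sum to
    -- about κ log X; `μ⁻` and `μ⁺` enclose this for all cells at once, at the price of terms of
    -- size W that V will dominate.
    V κ μ⁺ μ⁻ : Carrier
    V = ℋ X
    κ = ι c * ρ W
    μ⁺ = κ * (V + (1# + ι W))
    μ⁻ = κ * (V - ι W)

    0≤κ : 0# ≤ κ
    0≤κ = *-nonNeg (0≤ι c) (0≤ρ W)

    mass : ℕ → Carrier
    mass n = θ n * ρ n

    block : ℕ → Carrier
    block b = ∑ W (λ i → mass (b ℕ.* W ℕ.+ i))

    κρ : ∀ b → ι c * ρ (b ℕ.* W) ≡ κ * ρ b
    κρ b = trans (cong (ι c *_) (trans (ρ-* b W) (*-comm (ρ b) (ρ W)))) (sym (*-assoc (ι c) (ρ W) (ρ b)))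

    weighted : ∀ b r → ∑ W (λ i → θ (b ℕ.* W ℕ.+ i) * r) ≡ ι c * r
    weighted b r = trans (∑-cong W (λ i _ _ → trans (*-comm _ r) (cong (r *_) (periodic b i))))
      (trans (∑-scale W r θ) (trans (*-comm r _) (cong (_* r) total-θ)))

    -- A block of `W` consecutive integers has `c` units, each with reciprocal at least that of the
    -- right end of the block.
    block-lower : ∀ b → κ * ρ (suc b) ≤ block b
    block-lower b = ≤-trans (≤-reflexive (trans (sym (κρ (suc b))) (sym (weighted b _))))
      (∑-mono W (λ i 1≤i i≤W → *-monoˡ (0≤θ _) (ρ-antitone (ℕ.≤-trans 1≤i (ℕ.m≤n+m i (b ℕ.* W)))
        (subst (b ℕ.* W ℕ.+ i ℕ.≤_) (ℕ.+-comm (b ℕ.* W) W) (ℕ.+-monoʳ-≤ (b ℕ.* W) i≤W)))))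

    block-upper : ∀ b → 1 ℕ.≤ b → block b ≤ κ * ρ b
    block-upper b 1≤b = ≤-trans (∑-mono W (λ i _ _ → *-monoˡ (0≤θ _) (ρ-antitone (ℕ.*-mono-≤ 1≤b 1≤W) (ℕ.m≤m+n (b ℕ.* W) i))))
      (≤-reflexive (trans (weighted b _) (κρ b)))

    -- The first block has no positive left end, so its reciprocals are bounded by 1; the resulting
    -- count `c` equals κ W. This is the origin of the term W in `μ⁺`.
    block-0 : block 0 ≤ κ * ι W
    block-0 = ≤-trans (∑-mono W (λ i 1≤i _ → *-monoˡ (0≤θ i) (subst (ρ i ≤_) ρ1 (ρ-antitone ℕ.≤-refl 1≤i))))
      (≤-reflexive (trans (weighted 0 1#) (trans (cong (ι c *_) (sym (trans (*-comm (ρ W) (ι W)) (ρ-inverse 1≤W)))) (sym (*-assoc (ι c) (ρ W) (ι W))))))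

    cell : ℕ → Carrier
    cell zero = ∑ X mass
    cell (suc j) = ∑ (ℕ.pred X ℕ.* X ℕ.^ suc j) (λ i → mass (X ℕ.^ suc j ℕ.+ i))

    private
      ℋX-split : V ≤ ℋ x + ι W
      ℋX-split = go W 1≤W
        where
        go : ∀ W → 1 ℕ.≤ W → ℋ (x ℕ.* W) ≤ ℋ x + ι W
        go (suc W) _ = ≤-trans (≤-reflexive (cong ℋ (ℕ.*-comm x (suc W)))) (≤-trans (ℋ-* W x 1≤x) (+-monoʳ-≤ (ℋ x) (≤-trans (ℋ≤ι W) (ι-mono (ℕ.n≤1+n W)))))

      x≤X : x ℕ.≤ X
      x≤X = subst (ℕ._≤ X) (ℕ.*-identityʳ x) (ℕ.*-monoʳ-≤ x 1≤W)

      move : ∀ {a b c} → a ≤ b + c → a - c ≤ b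
      move {a} {b} {c} h = 0≤-⇒≤ (subst (0# ≤_) (solve 3 (λ a b c → b :+ c :- a := b :- (a :- c)) refl a b c) (≤⇒0≤- h))

      blocks₀ : ∀ x → ∑ (x ℕ.* W) mass ≡ ∑ x (λ b → block (ℕ.pred b))
      blocks₀ x = ∑-blocks x W mass

      cell₀-upper : ∀ x → ∑ (suc x) (λ b → block (ℕ.pred b)) ≤ κ * (ι W + ℋ x)
      cell₀-upper zero = ≤-trans (≤-reflexive (+-identityˡ _)) (≤-trans block-0 (*-monoˡ 0≤κ (x≤x+y ≤-refl)))
      cell₀-upper (suc x) = ≤-trans (+-mono-≤ (cell₀-upper x) (block-upper (suc x) (ℕ.s≤s ℕ.z≤n)))
        (≤-reflexive (solve 4 (λ k w h r → k :* (w :+ h) :+ k :* r := k :* (w :+ (h :+ r))) refl κ (ι W) (ℋ x) (ρ (suc x))))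

      cell₀-lower : ∀ x → κ * ℋ x ≤ ∑ x (λ b → block (ℕ.pred b))
      cell₀-lower zero = ≤-reflexive (zeroʳ κ)
      cell₀-lower (suc x) = ≤-trans (≤-reflexive (distribˡ κ (ℋ x) (ρ (suc x)))) (+-mono-≤ (cell₀-lower x) (block-lower x))

      M = ℕ.pred X

      sucM : suc M ≡ X
      sucM = ℕ.suc-pred X ⦃ ℕ.>-nonZero 1≤X ⦄

      module _ (j : ℕ) where
        u = x ℕ.* X ℕ.^ j

        1≤u : 1 ℕ.≤ u
        1≤u = ℕ.*-mono-≤ 1≤x (1≤^ X j 1≤X)

        cell-blocks : cell (suc j) ≡ ∑ (M ℕ.* u) (λ b → block (u ℕ.+ ℕ.pred b))
        cell-blocks = trans (cong₂ ∑′ eq eq) (trans (cong (λ t → ∑ t (λ i → mass (u ℕ.* W ℕ.+ i))) (sym (ℕ.*-assoc M u W)))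
          (trans (∑-blocks (M ℕ.* u) W _) (∑-cong (M ℕ.* u) (λ b _ _ → ∑-cong W (λ i _ _ → cong mass (l₂ u W (ℕ.pred b) i))))))
          where
          ∑′ : ℕ → ℕ → Carrier
          ∑′ s t = ∑ (M ℕ.* s) (λ i → mass (t ℕ.+ i))
          l₁ : ∀ x W z → x ℕ.* W ℕ.* z ≡ x ℕ.* z ℕ.* W
          l₁ = ℕ-ring
          eq : X ℕ.^ suc j ≡ u ℕ.* W
          eq = l₁ x W (X ℕ.^ j)
          l₂ : ∀ u W b i → u ℕ.* W ℕ.+ (b ℕ.* W ℕ.+ i) ≡ (u ℕ.+ b) ℕ.* W ℕ.+ i
          l₂ = ℕ-ring

        ∑-pred : ∀ n (f : ℕ → Carrier) → NonNeg f → ∑ n (λ b → f (ℕ.pred b)) ≤ f 0 + ∑ n f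
        ∑-pred zero f h = ≤-trans (h 0) (≤-reflexive (sym (+-identityʳ (f 0))))
        ∑-pred (suc n) f h = ≤-trans (go n) (+-monoʳ-≤ (f 0) (x≤x+y (h (suc n))))
          where
          go : ∀ n → ∑ (suc n) (λ b → f (ℕ.pred b)) ≤ f 0 + ∑ n f
          go zero = ≤-reflexive (+-comm 0# (f 0))
          go (suc n) = ≤-trans (+-monoˡ-≤ (f (suc n)) (go n)) (≤-reflexive (+-assoc (f 0) (∑ n f) (f (suc n))))

        cellₛ-upper : cell (suc j) ≤ κ * (1# + V)
        cellₛ-upper = begin
          cell (suc j) ≡⟨ cell-blocks ⟩
          ∑ (M ℕ.* u) (λ b → block (u ℕ.+ ℕ.pred b)) ≤⟨ ∑-mono (M ℕ.* u) (λ b _ _ → block-upper (u ℕ.+ ℕ.pred b) (ℕ.≤-trans 1≤u (ℕ.m≤m+n u _))) ⟩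
          ∑ (M ℕ.* u) (λ b → κ * ρ (u ℕ.+ ℕ.pred b)) ≡⟨ ∑-scale (M ℕ.* u) κ _ ⟩
          κ * ∑ (M ℕ.* u) (λ b → ρ (u ℕ.+ ℕ.pred b)) ≤⟨ *-monoˡ 0≤κ (∑-pred (M ℕ.* u) (λ b → ρ (u ℕ.+ b)) (λ b → 0≤ρ (u ℕ.+ b))) ⟩
          κ * (ρ (u ℕ.+ 0) + ∑ (M ℕ.* u) (λ b → ρ (u ℕ.+ b)))
            ≤⟨ *-monoˡ 0≤κ (+-mono-≤ (subst (ρ (u ℕ.+ 0) ≤_) ρ1 (ρ-antitone ℕ.≤-refl (ℕ.≤-trans 1≤u (ℕ.m≤m+n u 0))))
                 (≤-trans (segment-upper u M 1≤u) (ℋ-mono (ℕ.≤-trans (ℕ.n≤1+n M) (ℕ.≤-reflexive sucM))))) ⟩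
          κ * (1# + V) ∎
          where open ≤-Reasoning

        cellₛ-lower : κ * (V - 1#) ≤ cell (suc j)
        cellₛ-lower = begin
          κ * (V - 1#) ≤⟨ *-monoˡ 0≤κ (move (≤-trans (≤-reflexive (cong ℋ (sym sucM))) (≤-trans (segment-lower u M 1≤u) (≤-reflexive (+-comm 1# _))))) ⟩
          κ * ∑ (M ℕ.* u) (λ b → ρ (u ℕ.+ b)) ≡⟨ sym (∑-scale (M ℕ.* u) κ _) ⟩
          ∑ (M ℕ.* u) (λ b → κ * ρ (u ℕ.+ b)) ≤⟨ ∑-mono (M ℕ.* u) low ⟩
          ∑ (M ℕ.* u) (λ b → block (u ℕ.+ ℕ.pred b)) ≡⟨ sym cell-blocks ⟩
          cell (suc j) ∎
          where
          open ≤-Reasoning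
          low : ∀ b → 1 ℕ.≤ b → b ℕ.≤ M ℕ.* u → κ * ρ (u ℕ.+ b) ≤ block (u ℕ.+ ℕ.pred b)
          low (suc b) _ _ = subst (λ t → κ * ρ t ≤ block (u ℕ.+ b)) (sym (ℕ.+-suc u b)) (block-lower (u ℕ.+ b))

    cell-upper : ∀ j → cell j ≤ μ⁺
    cell-upper zero = ≤-trans (≤-reflexive (blocks₀ x)) (≤-trans (up x 1≤x) (*-monoˡ 0≤κ (≤-trans (+-mono-≤ (x≤y+x 0≤1) (ℋ-mono x≤X)) (≤-reflexive (+-comm (1# + ι W) V)))))
      where
      up : ∀ x → 1 ℕ.≤ x → ∑ x (λ b → block (ℕ.pred b)) ≤ κ * (ι W + ℋ x)
      up (suc x) _ = ≤-trans (cell₀-upper x) (*-monoˡ 0≤κ (+-monoʳ-≤ (ι W) (ℋ-mono (ℕ.n≤1+n x))))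
    cell-upper (suc j) = ≤-trans (cellₛ-upper j) (*-monoˡ 0≤κ (≤-trans (≤-reflexive (+-comm 1# V)) (+-monoʳ-≤ V (x≤x+y (0≤ι W)))))

    cell-lower : ∀ j → μ⁻ ≤ cell j
    cell-lower zero = ≤-trans (*-monoˡ 0≤κ (move ℋX-split)) (≤-trans (cell₀-lower x) (≤-reflexive (sym (blocks₀ x))))
    cell-lower (suc j) = ≤-trans (*-monoˡ 0≤κ (+-monoʳ-≤ V (neg-≤ (1≤ι 1≤W)))) (cellₛ-lower j)

    private
      X^-suc : ∀ j → X ℕ.^ suc j ≡ X ℕ.^ j ℕ.+ M ℕ.* X ℕ.^ j
      X^-suc j = cong (ℕ._* X ℕ.^ j) (sym sucM)

    module _ {Q : ℕ → Carrier} (aQ : Antitone Q) where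

      private
        ψ : ℕ → Carrier
        ψ n = θ n * (Q n * ρ n)
        swap : ∀ n → ψ n ≡ Q n * mass n
        swap n = solve 3 (λ t q r → t :* (q :* r) := q :* (t :* r)) refl (θ n) (Q n) (ρ n)
        0≤mass : NonNeg mass
        0≤mass n = *-nonNeg (0≤θ n) (0≤ρ n)

      part : ℕ → Carrier
      part zero = ∑ X ψ
      part (suc j) = ∑ (M ℕ.* X ℕ.^ suc j) (λ i → ψ (X ℕ.^ suc j ℕ.+ i))

      parts : ∀ J → ∑ (X ℕ.^ suc J) ψ ≡ ∑ (suc J) (λ j → part (ℕ.pred j))
      parts zero = trans (cong (λ t → ∑ t ψ) (ℕ.*-identityʳ X)) (sym (+-identityˡ _))
      parts (suc J) = trans (cong (λ t → ∑ t ψ) (X^-suc (suc J))) (trans (∑-append (X ℕ.^ suc J) _ ψ) (cong (_+ part (suc J)) (parts J)))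

      part-upper : NonNeg Q → ∀ j → part j ≤ μ⁺ * Q (X ℕ.^ j)
      part-upper hQ j = ≤-trans (go j) (≤-trans (*-monoˡ (hQ _) (cell-upper j)) (≤-reflexive (*-comm _ μ⁺)))
        where
        go : ∀ j → part j ≤ Q (X ℕ.^ j) * cell j
        go zero = ≤-trans (∑-mono X (λ n 1≤n _ → ≤-trans (≤-reflexive (swap n)) (*-monoʳ (0≤mass n) (aQ 1≤n)))) (≤-reflexive (∑-scale X (Q 1) mass))
        go (suc j) = ≤-trans (∑-mono (M ℕ.* X ℕ.^ suc j) (λ i _ _ → ≤-trans (≤-reflexive (swap _)) (*-monoʳ (0≤mass _) (aQ (ℕ.m≤m+n (X ℕ.^ suc j) i)))))
          (≤-reflexive (∑-scale (M ℕ.* X ℕ.^ suc j) (Q (X ℕ.^ suc j)) _))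

      part-lower : NonNeg Q → ∀ j → μ⁻ * Q (X ℕ.^ suc j) ≤ part j
      part-lower hQ j = ≤-trans (≤-reflexive (*-comm μ⁻ _)) (≤-trans (*-monoˡ (hQ _) (cell-lower j)) (go j))
        where
        go : ∀ j → Q (X ℕ.^ suc j) * cell j ≤ part j
        go zero = ≤-trans (≤-reflexive (sym (∑-scale X _ mass))) (∑-mono X (λ n _ n≤X → ≤-trans (*-monoʳ (0≤mass n) (aQ (subst (n ℕ.≤_) (sym (ℕ.*-identityʳ X)) n≤X))) (≤-reflexive (sym (swap n)))))
        go (suc j) = ≤-trans (≤-reflexive (sym (∑-scale (M ℕ.* X ℕ.^ suc j) _ _))) (∑-mono (M ℕ.* X ℕ.^ suc j) (λ i _ i≤ → ≤-trans (*-monoʳ (0≤mass _)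
          (aQ (subst (X ℕ.^ suc j ℕ.+ i ℕ.≤_) (sym (X^-suc (suc j))) (ℕ.+-monoʳ-≤ (X ℕ.^ suc j) i≤)))) (≤-reflexive (sym (swap _)))))

      -- On each cell a decreasing `Q` is replaced by its value at the left end, and in
      -- `cells-lower` at the right end. This discretisation loss does not shrink as N grows; it is
      -- controlled by the number of cells alone.
      cells-upper : NonNeg Q → ∀ J → 1 ℕ.≤ J → ∑ (X ℕ.^ J) ψ ≤ μ⁺ * ∑ J (λ j → Q (X ℕ.^ ℕ.pred j))
      cells-upper hQ (suc J) _ = ≤-trans (≤-reflexive (parts J)) (≤-trans (∑-mono (suc J) (λ j _ _ → part-upper hQ (ℕ.pred j))) (≤-reflexive (∑-scale (suc J) μ⁺ _)))

      cells-lower : NonNeg Q → ∀ J → 1 ℕ.≤ J → μ⁻ * ∑ J (λ j → Q (X ℕ.^ j)) ≤ ∑ (X ℕ.^ J) ψ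
      cells-lower hQ (suc J) _ = ≤-trans (≤-reflexive (sym (∑-scale (suc J) μ⁻ _))) (≤-trans (∑-mono (suc J) low) (≤-reflexive (sym (parts J))))
        where
        low : ∀ j → 1 ℕ.≤ j → j ℕ.≤ suc J → μ⁻ * Q (X ℕ.^ j) ≤ part (ℕ.pred j)
        low (suc j) _ _ = part-lower hQ j

  -- Bounds for the accumulated error.

  -- From w ≤ t + w²/t: the divisor weight is traded for the unweighted sum and a crude one.
  𝕊-trade : ∀ ps {w w⁻¹ f} → 0# ≤ w → 0# ≤ w⁻¹ → w * w⁻¹ ≡ 1# → NonNeg f → ∀ {s t} → 0# ≤ s → 0# ≤ t → s * t ≡ 1# →
    𝕊 (λ _ → w) ps f ≤ t * 𝕊 (λ _ → 1#) ps f + s * 𝕊 (λ _ → w * w) ps f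
  𝕊-trade [] {f = f} hw hv wv hf {s} {t} hs ht st with total 1# t
  ... | inj₁ 1≤t = ≤-trans (≤-trans (≤-reflexive (sym (*-identityˡ (f 1)))) (*-monoʳ (hf 1) 1≤t)) (x≤x+y (*-nonNeg hs (hf 1)))
  ... | inj₂ t≤1 = ≤-trans (≤-trans (≤-reflexive (sym (*-identityˡ (f 1)))) (*-monoʳ (hf 1) 1≤s)) (x≤y+x (*-nonNeg ht (hf 1)))
    where
    1≤s : 1# ≤ s
    1≤s = subst₂ _≤_ st (*-identityʳ s) (*-monoˡ hs t≤1)
  𝕊-trade (p ∷ ps) {w} {w⁻¹} {f} hw hv wv hf {s} {t} hs ht st = ≤-trans
    (+-mono-≤ (𝕊-trade ps hw hv wv hf hs ht st) (*-monoˡ hw (𝕊-trade ps hw hv wv (shift-nonNeg p hf) (*-nonNeg hs hw) (*-nonNeg ht hv) st′)))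
    (≤-reflexive (trans (solve 8 (λ s t w v a b c d → t :* a :+ s :* b :+ w :* (t :* v :* c :+ s :* w :* d) := t :* a :+ s :* b :+ (t :* (w :* v) :* c :+ s :* (w :* w) :* d)) refl
        s t w w⁻¹ a b c d) (trans (cong (λ z → t * a + s * b + (t * z * c + s * (w * w) * d)) wv)
        (solve 7 (λ s t w a b c d → t :* a :+ s :* b :+ (t :* :1 :* c :+ s :* (w :* w) :* d) := t :* (a :+ :1 :* c) :+ s :* (b :+ w :* w :* d)) refl s t w a b c d))))
    where
    a = 𝕊 (λ _ → 1#) ps f
    b = 𝕊 (λ _ → w * w) ps f
    c = 𝕊 (λ _ → 1#) ps (shift p f)
    d = 𝕊 (λ _ → w * w) ps (shift p f)
    st′ : s * w * (t * w⁻¹) ≡ 1#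
    st′ = trans (solve 4 (λ s w t v → s :* w :* (t :* v) := (s :* t) :* (w :* v)) refl s w t w⁻¹) (trans (cong₂ _*_ st wv) (*-identityˡ 1#))

  𝕊-factor : ∀ {Fresh : ℕ → ℕ → Set} {η b w I : ℕ → Carrier} → NonNeg w → NonNeg I → NonNeg b →
    (∀ {q p} → Fresh q p → η (q ℕ.* p) ≤ η q * b p) →
    ∀ ps {q} → Valid Fresh q ps → 𝕊 w ps (λ r → η (q ℕ.* r) * I r) ≤ η q * 𝕊 (λ p → w p * b p) ps I
  𝕊-factor {η = η} {I = I} hw hI hb h [] {q} _ = ≤-reflexive (cong (λ t → η t * I 1) (ℕ.*-identityʳ q))
  𝕊-factor {η = η} {b} {w} {I} hw hI hb h (p ∷ ps) {q} (fr , v , v′) = begin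
    𝕊 w ps (λ r → η (q ℕ.* r) * I r) + w p * 𝕊 w ps (λ r → η (q ℕ.* (p ℕ.* r)) * I (p ℕ.* r))
      ≤⟨ +-mono-≤ (𝕊-factor {η = η} {b} hw hI hb h ps v) (*-monoˡ (hw p) (≤-trans
           (≤-reflexive (𝕊-cong ps (λ r → cong (λ t → η t * I (p ℕ.* r)) (sym (ℕ.*-assoc q p r))))) (𝕊-factor {η = η} {b} hw (shift-nonNeg p hI) hb h ps v′))) ⟩
    η q * s + w p * (η (q ℕ.* p) * u)
      ≤⟨ +-monoʳ-≤ (η q * s) (*-monoˡ (hw p) (*-monoʳ (𝕊-nonNeg ps (λ p → *-nonNeg (hw p) (hb p)) (shift-nonNeg p hI)) (h fr))) ⟩
    η q * s + w p * (η q * b p * u)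
      ≡⟨ solve 5 (λ e s w b u → e :* s :+ w :* (e :* b :* u) := e :* (s :+ w :* b :* u)) refl (η q) s (w p) (b p) u ⟩
    η q * (s + w p * b p * u) ∎
    where
    open ≤-Reasoning
    s = 𝕊 (λ p → w p * b p) ps I
    u = 𝕊 (λ p → w p * b p) ps (shift p I)

  module Powers (ps : List ℕ) (1≤ps : All (1 ℕ.≤_) ps) (free : Free ps (λ _ → 1#)) (T : ℕ) (1≤T : 1 ℕ.≤ T) where
    open Iterates ps 1≤ps

    I : ℕ → Carrier
    I r = 𝟙 (r ℕ.≤? T)

    I-nonNeg : NonNeg I
    I-nonNeg r = 𝟙-nonNeg (r ℕ.≤? T)

    I-support : ∀ n → T ℕ.< n → I n ≡ 0#
    I-support n l = 𝟙-no (n ℕ.≤? T) (ℕ.<⇒≱ l)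

    𝕊-ρ≤ℋ : 𝕊 ρ ps I ≤ ℋ T
    𝕊-ρ≤ℋ = ≤-trans (𝕊≤∑ 0≤ρ 0≤ρ ρ1 ρ-* T 1≤T (λ _ → 0≤1) free I-nonNeg I-support)
      (∑-mono T (λ n _ _ → ≤-trans (≤-reflexive (*-identityˡ _)) (≤-trans (*-monoʳ (0≤ρ n) (𝟙≤1 (n ℕ.≤? T))) (≤-reflexive (*-identityˡ (ρ n))))))

    -- A product is at most T only if both of its factors are, so the indicator is submultiplicative
    -- and each iteration contributes at most the factor `ℋ T`.
    𝕋-I : ∀ r → 1 ℕ.≤ r → 𝕋 I r ≤ ℋ T * I r
    𝕋-I r hr = ≤-trans (𝕊-mono⁺ {z = λ m → I r * I m} 1≤ps 0≤ρ pointwise)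
      (≤-trans (≤-reflexive (𝕊-scale ps (I r) I)) (≤-trans (*-monoˡ (I-nonNeg r) 𝕊-ρ≤ℋ) (≤-reflexive (*-comm (I r) (ℋ T)))))
      where
      pointwise : ∀ m → 1 ℕ.≤ m → I (r ℕ.* m) ≤ I r * I m
      pointwise m hm = ≤-trans (≤-reflexive (sym (𝟙-idem (r ℕ.* m ℕ.≤? T))))
        (*-mono (I-nonNeg (r ℕ.* m)) (I-nonNeg m) (𝟙-mono (r ℕ.* m ℕ.≤? T) (r ℕ.≤? T) (λ l → ℕ.≤-trans (subst (ℕ._≤ r ℕ.* m) (ℕ.*-identityʳ r) (ℕ.*-monoʳ-≤ r hm)) l))
          (𝟙-mono (r ℕ.* m ℕ.≤? T) (m ℕ.≤? T) (λ l → ℕ.≤-trans (subst (ℕ._≤ r ℕ.* m) (ℕ.*-identityˡ m) (ℕ.*-monoˡ-≤ m hr)) l)))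

    iter-I : ∀ k → iter 𝕋 k I 1 ≤ ℋ T ^ k
    iter-I zero = 𝟙≤1 (1 ℕ.≤? T)
    iter-I (suc k) = ≤-trans (iter-mono k 𝕋-I 1 ℕ.≤-refl) (≤-trans (≤-reflexive (iter-scale k (ℋ T) I 1)) (*-monoˡ (0≤ℋ T) (iter-I k)))

    𝕊-weight≤ℋ : ∀ k → 𝕊 (weight k) ps I ≤ ℋ T ^ k
    𝕊-weight≤ℋ k = ≤-trans (𝕊-weight≤iter k I-nonNeg) (iter-I k)

    G-bound : ∀ {α y} k → NonNeg α → All (λ p → α p ≤ weight k p) ps → NonNeg y → Antitone y → (∀ r → T ℕ.< r → y r ≡ 0#) →
      𝕊 α ps y ≤ y 1 * ℋ T ^ k
    G-bound {α} {y} k hα h hy ay sy = begin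
      𝕊 α ps y ≤⟨ 𝕊-mono⁺ 1≤ps hα pointwise ⟩
      𝕊 α ps (λ r → y 1 * I r) ≡⟨ 𝕊-scale ps (y 1) I ⟩
      y 1 * 𝕊 α ps I ≤⟨ *-monoˡ (hy 1) (≤-trans (𝕊-weight-mono hα I-nonNeg h) (𝕊-weight≤ℋ k)) ⟩
      y 1 * ℋ T ^ k ∎
      where
      open ≤-Reasoning
      pointwise : ∀ r → 1 ℕ.≤ r → y r ≤ y 1 * I r
      pointwise r hr with r ℕ.≤? T
      ... | yes _ = ≤-trans (ay hr) (≤-reflexive (sym (*-identityʳ (y 1))))
      ... | no l = ≤-trans (≤-reflexive (sy r (ℕ.≰⇒> l))) (≤-reflexive (sym (zeroʳ (y 1))))

    -- The errors carry the weight (3k)^ω, but the hypotheses bound only their plain sum. Trading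
    -- replaces the weighted sum by `t` times the plain one and `s` times one with the squared
    -- weight; the latter is bounded trivially through `η` and is a power of a logarithm. The
    -- parameters are chosen at the very end, which takes the place of Cauchy-Schwarz.
    Err-bound : ∀ {Fresh : ℕ → ℕ → Set} {e η : ℕ → Carrier} k → 1 ℕ.≤ k → Valid Fresh 1 ps → NonNeg e →
      (∀ q → 1 ℕ.≤ q → q ℕ.≤ T → e q ≤ η q) → (∀ {q p} → Fresh q p → η (q ℕ.* p) ≤ η q * (ι 2 * ρ p)) → 0# ≤ η 1 →
      ∀ {s t} → 0# ≤ s → 0# ≤ t → s * t ≡ 1# →
      𝕊 (λ _ → ι 3 * ι k) ps (λ q → e (1 ℕ.* q) * I (1 ℕ.* q)) ≤ t * ∑ T e + s * (η 1 * ℋ T ^ (18 ℕ.* (k ℕ.* k)))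
    Err-bound {e = e} {η} k 1≤k val he e≤ η-step 0≤η {s} {t} hs ht st = begin
      𝕊 (λ _ → w) ps (λ q → e (1 ℕ.* q) * I (1 ℕ.* q))
        ≡⟨ 𝕊-cong ps (λ q → cong (λ r → e r * I r) (ℕ.*-identityˡ q)) ⟩
      𝕊 (λ _ → w) ps err
        ≤⟨ 𝕊-trade ps hw (0≤ρ 3k) w⁻¹ 0≤err hs ht st ⟩
      t * 𝕊 (λ _ → 1#) ps err + s * 𝕊 (λ _ → w * w) ps err
        ≤⟨ +-mono-≤ (*-monoˡ ht sum) (*-monoˡ hs crude) ⟩
      t * ∑ T e + s * (η 1 * ℋ T ^ (18 ℕ.* (k ℕ.* k))) ∎
      where
      open ≤-Reasoning
      3k = 3 ℕ.* k
      w = ι 3 * ι k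
      hw = *-nonNeg (0≤ι 3) (0≤ι k)
      w⁻¹ : w * ρ 3k ≡ 1#
      w⁻¹ = trans (cong (_* ρ 3k) (sym (ι-* 3 k))) (ρ-inverse (ℕ.≤-trans 1≤k (ℕ.m≤m+n k _)))
      err : ℕ → Carrier
      err q = e q * I q
      0≤err : NonNeg err
      0≤err q = *-nonNeg (he q) (I-nonNeg q)
      sum : 𝕊 (λ _ → 1#) ps err ≤ ∑ T e
      sum = ≤-trans (𝕊≤∑ (λ _ → 0≤1) (λ _ → 0≤1) refl (λ _ _ → sym (*-identityˡ 1#)) T 1≤T (λ _ → 0≤1) free 0≤err
          (λ n l → trans (cong (e n *_) (I-support n l)) (zeroʳ (e n))))
        (∑-mono T (λ n _ _ → ≤-trans (≤-reflexive (solve 2 (λ e i → :1 :* (e :* i :* :1) := e :* i) refl (e n) (I n)))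
          (≤-trans (*-monoˡ (he n) (𝟙≤1 (n ℕ.≤? T))) (≤-reflexive (*-identityʳ (e n))))))
      pointwise : ∀ q → 1 ℕ.≤ q → err q ≤ η (1 ℕ.* q) * I q
      pointwise q hq with q ℕ.≤? T
      ... | yes l = *-monoʳ 0≤1 (≤-trans (e≤ q hq l) (≤-reflexive (cong η (sym (ℕ.*-identityˡ q)))))
      ... | no _ = ≤-reflexive (trans (zeroʳ (e q)) (sym (zeroʳ _)))
      -- The squared weight contributes 9 k², and the decay 2/p of `η` the factor 2.
      c = 18 ℕ.* (k ℕ.* k)
      weights : ∀ p → w * w * (ι 2 * ρ p) ≡ weight c p
      weights p = trans (solve 2 (λ k r → con (pos 3) :* k :* (con (pos 3) :* k) :* (con (pos 2) :* r) := con (pos 18) :* (k :* k) :* r) refl (ι k) (ρ p))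
        (cong (_* ρ p) (trans (cong (ι 18 *_) (sym (ι-* k k))) (sym (ι-* 18 (k ℕ.* k)))))
      crude : 𝕊 (λ _ → w * w) ps err ≤ η 1 * ℋ T ^ c
      crude = begin
        𝕊 (λ _ → w * w) ps err ≤⟨ 𝕊-mono⁺ 1≤ps (λ _ → sq-nonNeg w) pointwise ⟩
        𝕊 (λ _ → w * w) ps (λ r → η (1 ℕ.* r) * I r) ≤⟨ 𝕊-factor {η = η} (λ _ → sq-nonNeg w) I-nonNeg (λ p → *-nonNeg (0≤ι 2) (0≤ρ p)) η-step ps val ⟩
        η 1 * 𝕊 (λ p → w * w * (ι 2 * ρ p)) ps I ≤⟨ *-monoˡ 0≤η (≤-trans (𝕊-weight-mono (λ p → *-nonNeg (sq-nonNeg w) (*-nonNeg (0≤ι 2) (0≤ρ p))) I-nonNeg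
                                                               (All.universal (λ p → ≤-reflexive (weights p)) ps)) (𝕊-weight≤ℋ c)) ⟩
        η 1 * ℋ T ^ c ∎


  -- Counting in residue classes.

  private
    residue : ℕ → ℕ → ℕ → Carrier
    residue M v n = 𝟙 (M ∣? ℕ.∣ n - v ∣)

    shift-M : ∀ M n v → Cong M (n ℕ.+ M) v → Cong M n v
    shift-M M n v (s , t , e) = suc s , t , trans (l n M s) e
      where
      l : ∀ n M s → n ℕ.+ suc s ℕ.* M ≡ n ℕ.+ M ℕ.+ s ℕ.* M
      l = ℕ-ring

    unshift-M : ∀ M n v → Cong M n v → Cong M (n ℕ.+ M) v
    unshift-M M n v (s , t , e) = s , suc t , trans (l₁ n M s) (trans (cong (ℕ._+ M) e) (l₂ v M t))
      where
      l₁ : ∀ n M s → n ℕ.+ M ℕ.+ s ℕ.* M ≡ n ℕ.+ s ℕ.* M ℕ.+ M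
      l₁ = ℕ-ring
      l₂ : ∀ v M t → v ℕ.+ t ℕ.* M ℕ.+ M ≡ v ℕ.+ suc t ℕ.* M
      l₂ = ℕ-ring

    residue-periodic : ∀ M v n → residue M v (n ℕ.+ M) ≡ residue M v n
    residue-periodic M v n = 𝟙-cong (M ∣? _) (M ∣? _)
      (λ d → Cong⇒∣ n v (shift-M M n v (∣⇒Cong (n ℕ.+ M) v d))) (λ d → Cong⇒∣ (n ℕ.+ M) v (unshift-M M n v (∣⇒Cong n v d)))

    -- Sliding the window by one exchanges its first term for the one `M` places further on, which
    -- has the same value.
    window : ∀ M v b → ∑ M (λ i → residue M v (b ℕ.+ i)) ≡ ∑ M (residue M v)
    window M v zero = refl
    window M v (suc b) = trans cancel (window M v b)
      where
      f : ℕ → Carrier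
      f = residue M v
      -- both windows extend to b+1, …, b+M+1
      e₁ : ∀ n → ∑ (suc n) (λ i → f (b ℕ.+ i)) ≡ f (b ℕ.+ 1) + ∑ n (λ i → f (suc b ℕ.+ i))
      e₁ n = trans (∑-append 1 n _) (cong₂ _+_ (+-identityˡ _) (∑-cong n (λ i _ _ → cong f (ℕ.+-suc b i))))
      cancel : ∑ M (λ i → f (suc b ℕ.+ i)) ≡ ∑ M (λ i → f (b ℕ.+ i))
      cancel = begin
        s ≡⟨ solve 2 (λ s t → s := t :+ s :- t) refl s (f (b ℕ.+ 1)) ⟩
        f (b ℕ.+ 1) + s - f (b ℕ.+ 1) ≡⟨ cong (_- f (b ℕ.+ 1)) (sym (e₁ M)) ⟩
        s′ + f (b ℕ.+ suc M) - f (b ℕ.+ 1) ≡⟨ cong (λ t → s′ + t - f (b ℕ.+ 1)) (trans (cong f (l b M)) (residue-periodic M v (b ℕ.+ 1))) ⟩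
        s′ + f (b ℕ.+ 1) - f (b ℕ.+ 1) ≡⟨ solve 2 (λ s t → s :+ t :- t := s) refl s′ (f (b ℕ.+ 1)) ⟩
        s′ ∎
        where
        open ≡-Reasoning
        s = ∑ M (λ i → f (suc b ℕ.+ i))
        s′ = ∑ M (λ i → f (b ℕ.+ i))
        l : ∀ b M → b ℕ.+ suc M ≡ b ℕ.+ 1 ℕ.+ M
        l = ℕ-ring

    window-start : ∀ M v → 1 ℕ.≤ M → ∑ M (λ i → residue M v (v ℕ.+ i)) ≡ 1#
    window-start (suc M) v _ = trans (cong₂ _+_ (vanish M ℕ.≤-refl) (𝟙-yes (suc M ∣? _) (Cong⇒∣ (v ℕ.+ suc M) v (0 , 1 , trans (ℕ.+-identityʳ _) (cong (v ℕ.+_) (sym (ℕ.+-identityʳ (suc M)))))))) (+-identityˡ 1#)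
      where
      vanish : ∀ m → m ℕ.≤ M → ∑ m (λ i → residue (suc M) v (v ℕ.+ i)) ≡ 0#
      vanish zero _ = refl
      vanish (suc m) l = trans (cong₂ _+_ (vanish m (ℕ.<⇒≤ l)) (𝟙-no (suc M ∣? _) nd)) (+-identityˡ 0#)
        where
        nd : ¬ suc M ∣ ℕ.∣ v ℕ.+ suc m - v ∣
        nd d = contradiction (∣⇒≤ (subst (suc M ∣_) (trans (ℕ.∣-∣-comm (v ℕ.+ suc m) v) (ℕ.∣m-m+n∣≡n v (suc m))) d)) (ℕ.<⇒≱ (ℕ.s≤s l))

  residue-window : ∀ {M} v b → 1 ℕ.≤ M → ∑ M (λ i → 𝟙 (M ∣? ℕ.∣ b ℕ.+ i - v ∣)) ≡ 1#
  residue-window {M} v b 1≤M = trans (window M v b) (trans (sym (window M v v)) (window-start M v 1≤M))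

  residue-count : ∀ {M} N v → 1 ℕ.≤ M → ∑ N (λ n → 𝟙 (M ∣? ℕ.∣ n - v ∣)) ≈[ 1# ] ι N * ρ M
  residue-count {M@(suc _)} N v 1≤M = upper , lower
    where
    f : ℕ → Carrier
    f n = 𝟙 (M ∣? ℕ.∣ n - v ∣)
    B r : ℕ
    B = N / M
    r = N % M
    0≤f : NonNeg f
    0≤f n = 𝟙-nonNeg (M ∣? ℕ.∣ n - v ∣)
    full : ∀ B → ∑ (B ℕ.* M) f ≡ ι B
    full B = trans (∑-blocks B M f) (trans (∑-cong B (λ b _ _ → residue-window v (ℕ.pred b ℕ.* M) 1≤M)) (trans (∑-const B 1#) (*-identityʳ (ι B))))
    N≡ : N ≡ B ℕ.* M ℕ.+ r
    N≡ = trans (m≡m%n+[m/n]*n N M) (ℕ.+-comm r (B ℕ.* M))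
    scaled : ∀ B → ι (B ℕ.* M) * ρ M ≡ ι B
    scaled B = trans (cong (_* ρ M) (ι-* B M)) (trans (*-assoc (ι B) (ι M) (ρ M)) (trans (cong (ι B *_) (ρ-inverse 1≤M)) (*-identityʳ (ι B))))
    BM≤N : B ℕ.* M ℕ.≤ N
    BM≤N = subst (B ℕ.* M ℕ.≤_) (sym N≡) (ℕ.m≤m+n (B ℕ.* M) r)
    N≤ : N ℕ.≤ suc B ℕ.* M
    N≤ = subst₂ ℕ._≤_ (sym N≡) (ℕ.+-comm (B ℕ.* M) M) (ℕ.+-monoʳ-≤ (B ℕ.* M) (ℕ.<⇒≤ (m%n<n N M)))
    upper : ∑ N f ≤ ι N * ρ M + 1#
    upper = begin
      ∑ N f ≤⟨ ∑-extend N≤ 0≤f ⟩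
      ∑ (suc B ℕ.* M) f ≡⟨ trans (full (suc B)) (trans (ι-suc B) (+-comm 1# (ι B))) ⟩
      ι B + 1# ≡⟨ cong (_+ 1#) (sym (scaled B)) ⟩
      ι (B ℕ.* M) * ρ M + 1# ≤⟨ +-monoˡ-≤ 1# (*-monoʳ (0≤ρ M) (ι-mono BM≤N)) ⟩
      ι N * ρ M + 1# ∎
      where open ≤-Reasoning
    lower : ι N * ρ M ≤ ∑ N f + 1#
    lower = begin
      ι N * ρ M ≤⟨ *-monoʳ (0≤ρ M) (ι-mono N≤) ⟩
      ι (suc B ℕ.* M) * ρ M ≡⟨ trans (scaled (suc B)) (trans (ι-suc B) (+-comm 1# (ι B))) ⟩
      ι B + 1# ≡⟨ cong (_+ 1#) (sym (full B)) ⟩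
      ∑ (B ℕ.* M) f + 1# ≤⟨ +-monoˡ-≤ 1# (∑-extend BM≤N 0≤f) ⟩
      ∑ N f + 1# ∎
      where open ≤-Reasoning


  ∑[]-++ : ∀ {A : Set} (xs ys : List A) (f : A → Carrier) → ∑[ xs ++ ys ] f ≡ ∑[ xs ] f + ∑[ ys ] f
  ∑[]-++ [] ys f = sym (+-identityˡ _)
  ∑[]-++ (x ∷ xs) ys f = trans (cong (f x +_) (∑[]-++ xs ys f)) (sym (+-assoc (f x) _ _))

  ∑-filter : ∀ {P : ℕ → Set} (P? : Decidable P) N (f : ℕ → Carrier) → ∑[ filter P? [1⋯ N ] ] f ≡ ∑ N (λ n → 𝟙 (P? n) * f n)
  ∑-filter P? zero f = refl
  ∑-filter P? (suc N) f = begin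
    ∑[ filter P? [1⋯ suc N ] ] f
      ≡⟨ cong (λ xs → ∑[ filter P? xs ] f) (sym (List.applyUpTo-∷ʳ suc N)) ⟩
    ∑[ filter P? ([1⋯ N ] ++ suc N ∷ []) ] f
      ≡⟨ cong (λ xs → ∑[ xs ] f) (List.filter-++ P? [1⋯ N ] (suc N ∷ [])) ⟩
    ∑[ filter P? [1⋯ N ] ++ filter P? (suc N ∷ []) ] f
      ≡⟨ ∑[]-++ (filter P? [1⋯ N ]) _ f ⟩
    ∑[ filter P? [1⋯ N ] ] f + ∑[ filter P? (suc N ∷ []) ] f
      ≡⟨ cong₂ _+_ (∑-filter P? N f) last ⟩
    ∑ N (λ n → 𝟙 (P? n) * f n) + 𝟙 (P? (suc N)) * f (suc N) ∎
    where
    open ≡-Reasoning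
    last : ∑[ filter P? (suc N ∷ []) ] f ≡ 𝟙 (P? (suc N)) * f (suc N)
    last with P? (suc N)
    ... | yes _ = trans (+-identityʳ _) (sym (*-identityˡ _))
    ... | no _ = sym (zeroˡ _)

  ι-length : ∀ {A : Set} (xs : List A) → ι (length xs) ≡ ∑[ xs ] (λ _ → 1#)
  ι-length [] = refl
  ι-length (x ∷ xs) = trans (ι-suc (length xs)) (cong (1# +_) (ι-length xs))


  -- Units modulo W, Euler's function and the list of sieving primes.

  unit : ℕ → ℕ → Carrier
  unit M n = 𝟙 (coprime? n M)

  unit-nonNeg : ∀ M → NonNeg (unit M)
  unit-nonNeg M n = 𝟙-nonNeg (coprime? n M)

  ∑-unit : ∀ M → ∑ M (unit M) ≡ ι (φ M)
  ∑-unit M = sym (trans (ι-length (filter (λ a → coprime? a M) [1⋯ M ])) (trans (∑-filter (λ a → coprime? a M) M (λ _ → 1#)) (∑-cong M (λ n _ _ → *-identityʳ _))))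

  unit-periodic : ∀ M b i → unit M (b ℕ.* M ℕ.+ i) ≡ unit M i
  unit-periodic M b i = 𝟙-cong (coprime? _ M) (coprime? i M)
    (λ c {d} (d∣i , d∣M) → c (∣m∣n⇒∣m+n (∣n⇒∣m*n b d∣M) d∣i , d∣M))
    (λ c {d} (d∣ , d∣M) → c (∣m+n∣m⇒∣n d∣ (∣n⇒∣m*n b d∣M) , d∣M))

  unit-prime : ∀ M {p} → Prime p → ¬ p ∣ M → ∀ n → unit M (p ℕ.* n) ≡ unit M n
  unit-prime M {p} pp ¬p∣M n = 𝟙-cong (coprime? _ M) (coprime? n M)
    (λ c {d} (d∣n , d∣M) → c (∣n⇒∣m*n p d∣n , d∣M))
    (λ c {d} (d∣pn , d∣M) → c (Coprime.coprime-divisor (λ {e} (e∣d , e∣p) → prime-coprime pp ¬p∣M (∣-trans e∣d d∣M , e∣p)) d∣pn , d∣M))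

  private
    unit-*prime : ∀ M {p} → Prime p → ∀ n → unit (M ℕ.* p) n ≡ unit M n * (1# - 𝟙 (p ∣? n))
    unit-*prime M {p} pp n with p ∣? n
    ... | yes p∣n = trans (𝟙-no (coprime? n (M ℕ.* p)) (λ c → coprime⇒¬∣ pp c p∣n (n∣m*n M)))
                          (solve 1 (λ t → con (pos 0) := t :* (:1 :- :1)) refl (unit M n))
    ... | no ¬p∣n = trans (𝟙-cong (coprime? n (M ℕ.* p)) (coprime? n M)
        (λ c {d} (d∣n , d∣M) → c (d∣n , ∣m⇒∣m*n p d∣M))
        (λ c {d} (d∣n , d∣Mp) → c (d∣n , Coprime.coprime-divisor (λ {e} (e∣d , e∣p) → prime-coprime pp ¬p∣n (∣-trans e∣d d∣n , e∣p)) (subst (d ∣_) (ℕ.*-comm M p) d∣Mp))))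
        (solve 1 (λ t → t := t :* (:1 :- con (pos 0))) refl (unit M n))

    -- Count the units modulo `M` in p periods, which gives p φ(M), and take away the multiples of
    -- `p` among them; as `p` is a unit these correspond to one period. Only one new prime at a time
    -- is ever needed.
    ι-φ : ∀ M {p} → Prime p → ¬ p ∣ M → ι (φ (M ℕ.* p)) ≡ ι (φ M) * (ι p - 1#)
    ι-φ M {p} pp ¬p∣M = begin
      ι (φ (M ℕ.* p)) ≡⟨ sym (∑-unit (M ℕ.* p)) ⟩
      ∑ (M ℕ.* p) (unit (M ℕ.* p)) ≡⟨ ∑-cong (M ℕ.* p) (λ n _ _ → trans (unit-*prime M pp n)
                                                                  (solve 2 (λ u t → u :* (:1 :- t) := u :+ (:- :1) :* (t :* u)) refl (unit M n) (𝟙 (p ∣? n)))) ⟩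
      ∑ (M ℕ.* p) (λ n → unit M n + (- 1#) * (𝟙 (p ∣? n) * unit M n))
        ≡⟨ ∑-linear (M ℕ.* p) (- 1#) (unit M) _ ⟩
      ∑ (M ℕ.* p) (unit M) + (- 1#) * ∑ (M ℕ.* p) (λ n → 𝟙 (p ∣? n) * unit M n)
        ≡⟨ cong₂ (λ s t → s + (- 1#) * t) all multiples ⟩
      ι p * ι (φ M) + (- 1#) * ι (φ M) ≡⟨ solve 2 (λ p f → p :* f :+ (:- :1) :* f := f :* (p :- :1)) refl (ι p) (ι (φ M)) ⟩
      ι (φ M) * (ι p - 1#) ∎
      where
      open ≡-Reasoning
      all : ∑ (M ℕ.* p) (unit M) ≡ ι p * ι (φ M)
      all = trans (cong (λ t → ∑ t (unit M)) (ℕ.*-comm M p)) (trans (∑-blocks p M (unit M))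
        (trans (∑-cong p (λ b _ _ → trans (∑-cong M (λ i _ _ → unit-periodic M (ℕ.pred b) i)) (∑-unit M))) (∑-const p (ι (φ M)))))
      multiples : ∑ (M ℕ.* p) (λ n → 𝟙 (p ∣? n) * unit M n) ≡ ι (φ M)
      multiples = trans (∑-multiples-exact p M (unit M) (prime≥1 pp)) (trans (∑-cong M (λ n _ _ → unit-prime M pp ¬p∣M n)) (∑-unit M))

  ι-injective : ∀ {m n} → ι m ≡ ι n → m ≡ n
  ι-injective {zero} {zero} e = refl
  ι-injective {zero} {suc n} e = contradiction (sym e) (ι≢0 {suc n} (ℕ.s≤s ℕ.z≤n))
  ι-injective {suc m} {zero} e = contradiction e (ι≢0 {suc m} (ℕ.s≤s ℕ.z≤n))
  ι-injective {suc m} {suc n} e = cong suc (ι-injective (trans (sym (c m)) (trans (cong (_- 1#) (trans (sym (ι-suc m)) (trans e (ι-suc n)))) (c n))))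
    where
    c : ∀ m → 1# + ι m - 1# ≡ ι m
    c m = solve 1 (λ t → :1 :+ t :- :1 := t) refl (ι m)

  ι-∸ : ∀ {m n} → n ℕ.≤ m → ι (m ℕ.∸ n) ≡ ι m - ι n
  ι-∸ {m} {n} l = trans (solve 2 (λ a b → a := a :+ b :- b) refl (ι (m ℕ.∸ n)) (ι n)) (cong (_- ι n) (trans (sym (ι-+ (m ℕ.∸ n) n)) (cong ι (ℕ.m∸n+n≡m l))))

  φ-*prime : ∀ M {p} → Prime p → ¬ p ∣ M → φ (M ℕ.* p) ≡ φ M ℕ.* (p ℕ.∸ 1)
  φ-*prime M {p} pp ¬p∣M = ι-injective (trans (ι-φ M pp ¬p∣M) (trans (cong (ι (φ M) *_) (sym (ι-∸ (prime≥1 pp)))) (sym (ι-* (φ M) (p ℕ.∸ 1)))))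

  1≤φ : ∀ M → 1 ℕ.≤ M → 1 ℕ.≤ φ M
  1≤φ M 1≤M = 1≤-from (≤-trans (≤-reflexive (sym (trans (+-identityˡ _) (𝟙-yes (coprime? 1 M) (Coprime.1-coprimeTo M)))))
    (≤-trans (∑-extend 1≤M (unit-nonNeg M)) (≤-reflexive (∑-unit M))))
    where
    1≤-from : ∀ {n} → 1# ≤ ι n → 1 ℕ.≤ n
    1≤-from {zero} h = ⊥-elim (1≢0 (antisym h 0≤1))
    1≤-from {suc n} h = ℕ.s≤s ℕ.z≤n

  Fresh : ℕ → ℕ → ℕ → ℕ → ℕ → Set
  Fresh W z R q p = Prime p × ¬ p ∣ W ℕ.* q × z ℕ.< p × p ℕ.≤ R

  -- All prime factors of the modulus are at most `b`, and the next prime exceeds `b`; multiplying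
  -- by it keeps this invariant for the new bound.
  primesAbove-valid : ∀ W z R b n q → (∀ {p} → Prime p → p ∣ W ℕ.* q → p ℕ.≤ b) → z ℕ.≤ b → b ℕ.+ n ℕ.≤ R →
    Valid (Fresh W z R) q (primesAbove b n)
  primesAbove-valid W z R b zero q sm z≤b le = tt
  primesAbove-valid W z R b (suc n) q sm z≤b le with prime? (suc b)
  ... | no _ = primesAbove-valid W z R (suc b) n q (λ pp d → ℕ.m≤n⇒m≤1+n (sm pp d)) (ℕ.m≤n⇒m≤1+n z≤b) (subst (ℕ._≤ R) (ℕ.+-suc b n) le)
  ... | yes pp = (pp , (λ d → contradiction (sm pp d) ℕ.1+n≰n) , ℕ.s≤s z≤b , ℕ.≤-trans (ℕ.≤-trans (ℕ.s≤s (ℕ.m≤m+n b n)) (ℕ.≤-reflexive (sym (ℕ.+-suc b n)))) le) ,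
    primesAbove-valid W z R (suc b) n q (λ pp d → ℕ.m≤n⇒m≤1+n (sm pp d)) (ℕ.m≤n⇒m≤1+n z≤b) le′ ,
    primesAbove-valid W z R (suc b) n (q ℕ.* suc b) smooth (ℕ.m≤n⇒m≤1+n z≤b) le′
    where
    le′ = subst (ℕ._≤ R) (ℕ.+-suc b n) le
    smooth : ∀ {p} → Prime p → p ∣ W ℕ.* (q ℕ.* suc b) → p ℕ.≤ suc b
    smooth {p} pp d with euclidsLemma (W ℕ.* q) (suc b) pp (subst (p ∣_) (sym (ℕ.*-assoc W q (suc b))) d)
    ... | inj₁ d = ℕ.m≤n⇒m≤1+n (sm pp d)
    ... | inj₂ d = ∣⇒≤ d

  private
    remove-1 : ∀ {θ p} → Prime p → θ 1 ≡ 1# → remove p θ 1 ≡ 1#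
    remove-1 {θ} {p} pp h = trans (cong₂ (λ s t → s * (1# - t)) h (𝟙-no (p ∣? 1) (λ d → contradiction (∣⇒≤ d) (ℕ.<⇒≱ (prime≥2 pp)))))
      (solve 0 (:1 :* (:1 :- con (pos 0)) := :1) refl)

    remove-prime : ∀ {θ p p′} → Prime p → Prime p′ → p ≢ p′ → (∀ n → θ (p′ ℕ.* n) ≡ θ n) → ∀ n → remove p θ (p′ ℕ.* n) ≡ remove p θ n
    remove-prime {θ} {p} {p′} pp pp′ ne h n = cong₂ (λ s t → s * (1# - t)) (h n) (𝟙-cong (p ∣? p′ ℕ.* n) (p ∣? n) to (∣n⇒∣m*n p′))
      where
      to : p ∣ p′ ℕ.* n → p ∣ n
      to d with euclidsLemma p′ n pp d
      ... | inj₁ d = contradiction (prime∣prime pp pp′ d) ne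
      ... | inj₂ d = d

  primesAbove-free : ∀ b n {θ} → θ 1 ≡ 1# → (∀ {p} → Prime p → b ℕ.< p → ∀ m → θ (p ℕ.* m) ≡ θ m) → Free (primesAbove b n) θ
  primesAbove-free b zero h k = done h
  primesAbove-free b (suc n) {θ} h k with prime? (suc b)
  ... | no _ = primesAbove-free (suc b) n h (λ pp l → k pp (ℕ.<⇒≤ l))
  ... | yes pp = next (prime≥2 pp) (k pp ℕ.≤-refl) (primesAbove-free (suc b) n (remove-1 {θ} pp h)
                   (λ pp′ l → remove-prime pp pp′ (ℕ.<⇒≢ l) (k pp′ (ℕ.<⇒≤ l))))

  module _ (R : ℕ) (1≤R : 1 ℕ.≤ R) where
    open Rough R 1≤R

    -- Any m with 2 ≤ m ≤ R has a prime divisor of at most R. Since `b + n` is R, that prime was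
    -- either excluded at the start or removed on the way.
    primesAbove-sieving : ∀ b n {θ} → b ℕ.+ n ≡ R → θ 1 ≡ 1# → (∀ {p} → Prime p → b ℕ.< p → ∀ m → θ (p ℕ.* m) ≡ θ m) →
      (∀ {p} → Prime p → p ℕ.≤ b → ∀ m → p ∣ m → θ m ≡ 0#) → Sieving (primesAbove b n) θ
    primesAbove-sieving b zero eq h k s = done h λ m 2≤m m≤R → let p , pp , d = primeDivisor m 2≤m in
      s pp (ℕ.≤-trans (∣⇒≤ {n = m} ⦃ ℕ.>-nonZero (ℕ.<⇒≤ 2≤m) ⦄ d) (ℕ.≤-trans m≤R (ℕ.≤-reflexive (trans (sym eq) (ℕ.+-identityʳ b))))) m d
    primesAbove-sieving b (suc n) {θ} eq h k s with prime? (suc b)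
    ... | no ¬pp = primesAbove-sieving (suc b) n (trans (sym (ℕ.+-suc b n)) eq) h (λ pp l → k pp (ℕ.<⇒≤ l))
                     (λ pp l → s pp (ℕ.≤-pred (ℕ.≤∧≢⇒< l λ { refl → ¬pp pp })))
    ... | yes pp = next (prime≥2 pp) (k pp ℕ.≤-refl) (primesAbove-sieving (suc b) n (trans (sym (ℕ.+-suc b n)) eq) (remove-1 {θ} pp h)
                     (λ pp′ l → remove-prime pp pp′ (ℕ.<⇒≢ l) (k pp′ (ℕ.<⇒≤ l))) kill)
      where
      kill : ∀ {p} → Prime p → p ℕ.≤ suc b → ∀ m → p ∣ m → remove (suc b) θ m ≡ 0#
      kill {p} pp′ l m d with p ℕ.≟ suc b
      ... | yes refl = trans (cong (λ t → θ m * (1# - t)) (𝟙-yes (suc b ∣? m) d)) (solve 1 (λ t → t :* (:1 :- :1) := con (pos 0)) refl (θ m))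
      ... | no ne = trans (cong (_* (1# - 𝟙 (suc b ∣? m))) (s pp′ (ℕ.≤-pred (ℕ.≤∧≢⇒< l ne)) m d)) (zeroˡ _)

  ρ-diff : ∀ b → 1 ℕ.≤ b → ρ b - ρ (suc b) ≡ ρ b * ρ (suc b)
  ρ-diff b 1≤b = begin
    r - x ≡⟨ cong₂ _-_ (sym (*-identityʳ r)) (sym (*-identityˡ x)) ⟩
    r * 1# - 1# * x ≡⟨ cong₂ (λ s t → r * s - t * x) (sym (trans (cong (_* x) (sym (ι-suc b))) (ρ-inverse {suc b} (ℕ.s≤s ℕ.z≤n)))) (sym (ρ-inverse 1≤b)) ⟩
    r * ((1# + ι b) * x) - ι b * r * x ≡⟨ solve 3 (λ r x b → r :* ((:1 :+ b) :* x) :- b :* r :* x := r :* x) refl r x (ι b) ⟩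
    r * x ∎
    where
    open ≡-Reasoning
    r = ρ b
    x = ρ (suc b)

  -- Telescoping 1/n² ≤ 1/(n−1) − 1/n.
  Π-bound : ∀ C b n → C ℕ.≤ b → 1 ℕ.≤ b → Π (λ p → ι C * (ρ p * ρ p)) (primesAbove b n) * (1# - ι C * ρ b) ≤ 1#
  Π-bound C b zero C≤b 1≤b = ≤-trans (≤-reflexive (*-identityˡ _)) (0≤-⇒≤ (subst (0# ≤_) (solve 1 (λ t → t := :1 :- (:1 :- t)) refl (ι C * ρ b)) (*-nonNeg (0≤ι C) (0≤ρ b))))
  Π-bound C b (suc n) C≤b 1≤b with prime? (suc b)
  ... | no _ = ≤-trans (*-monoˡ (Π-nonNeg (primesAbove (suc b) n) (λ p → *-nonNeg (0≤ι C) (sq-nonNeg (ρ p))))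
      (+-monoʳ-≤ 1# (neg-≤ (*-monoˡ (0≤ι C) (ρ-antitone 1≤b (ℕ.n≤1+n b)))))) (Π-bound C (suc b) n (ℕ.m≤n⇒m≤1+n C≤b) (ℕ.s≤s ℕ.z≤n))
  ... | yes _ = begin
    (1# + ι C * (x * x)) * P * (1# - ι C * ρ b) ≡⟨ solve 3 (λ a P c → a :* P :* c := P :* (a :* c)) refl (1# + ι C * (x * x)) P (1# - ι C * ρ b) ⟩
    P * ((1# + ι C * (x * x)) * (1# - ι C * ρ b)) ≤⟨ *-monoˡ 0≤P step ⟩
    P * (1# - ι C * x) ≤⟨ Π-bound C (suc b) n (ℕ.m≤n⇒m≤1+n C≤b) (ℕ.s≤s ℕ.z≤n) ⟩
    1# ∎
    where
    open ≤-Reasoning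
    x = ρ (suc b)
    P = Π (λ p → ι C * (ρ p * ρ p)) (primesAbove (suc b) n)
    0≤P = Π-nonNeg (primesAbove (suc b) n) (λ p → *-nonNeg (0≤ι C) (sq-nonNeg (ρ p)))
    r = ρ b
    c = ι C
    step : (1# + c * (x * x)) * (1# - c * r) ≤ 1# - c * x
    step = 0≤-⇒≤ (≤-trans (0≤+ (*-nonNeg (*-nonNeg (0≤ι C) (0≤ρ (suc b))) (*-nonNeg (0≤ρ b) (0≤ρ (suc b)))) (*-nonNeg (*-nonNeg (sq-nonNeg c) (sq-nonNeg x)) (0≤ρ b)))
      (begin
        c * x * (r * x) + c * c * (x * x) * r ≡⟨ cong (λ t → c * x * t + c * c * (x * x) * r) (sym (ρ-diff b 1≤b)) ⟩
        c * x * (r - x) + c * c * (x * x) * r ≡⟨ solve 3 (λ c r x → c :* x :* (r :- x) :+ c :* c :* (x :* x) :* r := c :* (r :* x) :- c :* (x :* x) :+ c :* c :* (x :* x) :* r) refl c r x ⟩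
        c * (r * x) - c * (x * x) + c * c * (x * x) * r ≡⟨ cong (λ t → c * t - c * (x * x) + c * c * (x * x) * r) (sym (ρ-diff b 1≤b)) ⟩
        c * (r - x) - c * (x * x) + c * c * (x * x) * r ≡⟨ solve 3 (λ c r x → c :* (r :- x) :- c :* (x :* x) :+ c :* c :* (x :* x) :* r := :1 :- c :* x :- (:1 :+ c :* (x :* x)) :* (:1 :- c :* r)) refl c r x ⟩
        1# - c * x - (1# + c * (x * x)) * (1# - c * r) ∎))

  ρ-ratio : ∀ {p m} c → 1 ℕ.≤ m → 1 ℕ.≤ p → p ℕ.≤ c ℕ.* m → ρ m ≤ ι c * ρ p
  ρ-ratio {p} {m} c 1≤m 1≤p l = subst₂ _≤_
    (trans (cong (_* ρ m) (trans (*-comm (ρ p) (ι p)) (ρ-inverse 1≤p))) (*-identityˡ (ρ m)))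
    (trans (cong (λ t → ρ p * t * ρ m) (ι-* c m)) (trans (solve 4 (λ r c m s → r :* (c :* m) :* s := c :* r :* (m :* s)) refl (ρ p) (ι c) (ι m) (ρ m))
      (trans (cong (ι c * ρ p *_) (ρ-inverse 1≤m)) (*-identityʳ _))))
    (*-monoʳ (0≤ρ m) (*-monoˡ (0≤ρ p) (ι-mono l)))

  -- The choice of α and the local densities.

  module PrimeWeights (k : ℕ) (1≤k : 1 ℕ.≤ k) where

    -- With hitting probability k/p this is the odds of a hit, which makes χ_p have mean zero over
    -- the integers. The condition p > 2k keeps it within a factor 2 of k/p.
    α : ℕ → Carrier
    α p = ι k * ρ (p ℕ.∸ k)

    0≤α : NonNeg α
    0≤α p = *-nonNeg (0≤ι k) (0≤ρ (p ℕ.∸ k))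

    module _ {p : ℕ} (2k<p : 2 ℕ.* k ℕ.< p) where

      private
        m = p ℕ.∸ k
        k≤p : k ℕ.≤ p
        k≤p = ℕ.≤-trans (ℕ.m≤m+n k (k ℕ.+ 0)) (ℕ.<⇒≤ 2k<p)
        1≤p : 1 ℕ.≤ p
        1≤p = ℕ.≤-trans 1≤k k≤p
        p≡m+k : p ≡ m ℕ.+ k
        p≡m+k = sym (ℕ.m∸n+n≡m k≤p)
        k≤m : k ℕ.≤ m
        k≤m = ℕ.+-cancelʳ-≤ k k m (subst₂ ℕ._≤_ (cong (k ℕ.+_) (ℕ.+-identityʳ k)) p≡m+k (ℕ.<⇒≤ 2k<p))
        1≤m : 1 ℕ.≤ m
        1≤m = ℕ.≤-trans 1≤k k≤m
        p≤2m : p ℕ.≤ 2 ℕ.* m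
        p≤2m = subst₂ ℕ._≤_ (sym p≡m+k) (cong (m ℕ.+_) (sym (ℕ.+-identityʳ m))) (ℕ.+-monoʳ-≤ m k≤m)
        2≤p : 2 ℕ.≤ p
        2≤p = ℕ.≤-trans (ℕ.*-monoʳ-≤ 2 1≤k) (ℕ.<⇒≤ 2k<p)
        ιp : ι p ≡ ι m + ι k
        ιp = trans (cong ι p≡m+k) (ι-+ m k)
        n = p ℕ.∸ 1
        1≤n : 1 ℕ.≤ n
        1≤n = ℕ.∸-monoˡ-≤ 1 2≤p
        ιn : ι n ≡ ι m + ι k - 1#
        ιn = trans (ι-∸ 1≤p) (cong (_- 1#) ιp)
        mm : ι m * ρ m ≡ 1#
        mm = ρ-inverse 1≤m
        pp : ι p * ρ p ≡ 1#
        pp = ρ-inverse 1≤p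
        nn : ι n * ρ n ≡ 1#
        nn = ρ-inverse 1≤n

      1+α : 1# + α p ≡ ι p * ρ m
      1+α = trans (cong (_+ ι k * ρ m) (sym mm)) (trans (sym (distribʳ (ρ m) (ι m) (ι k))) (cong (_* ρ m) (sym ιp)))

      α≤2k : α p ≤ ι (2 ℕ.* k) * ρ p
      α≤2k = ≤-trans (*-monoˡ (0≤ι k) (ρ-ratio 2 1≤m 1≤p p≤2m)) (≤-reflexive (trans (solve 2 (λ k r → k :* (con (pos 2) :* r) := con (pos 2) :* k :* r) refl (ι k) (ρ p)) (cong (_* ρ p) (sym (ι-* 2 k)))))

      α≤ : α p ≤ ι k * ρ p + ι (2 ℕ.* (k ℕ.* k)) * (ρ p * ρ p)
      α≤ = begin
        ι k * ρ m ≡⟨ cong (ι k *_) ρm ⟩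
        ι k * (ρ p + ι k * ρ p * ρ m) ≤⟨ *-monoˡ (0≤ι k) (+-monoʳ-≤ (ρ p) (*-monoˡ (*-nonNeg (0≤ι k) (0≤ρ p)) (ρ-ratio 2 1≤m 1≤p p≤2m))) ⟩
        ι k * (ρ p + ι k * ρ p * (ι 2 * ρ p)) ≡⟨ solve 2 (λ k r → k :* (r :+ k :* r :* (con (pos 2) :* r)) := k :* r :+ con (pos 2) :* (k :* k) :* (r :* r)) refl (ι k) (ρ p) ⟩
        ι k * ρ p + ι 2 * (ι k * ι k) * (ρ p * ρ p) ≡⟨ cong (λ t → ι k * ρ p + t * (ρ p * ρ p)) (trans (cong (ι 2 *_) (sym (ι-* k k))) (sym (ι-* 2 (k ℕ.* k)))) ⟩
        ι k * ρ p + ι (2 ℕ.* (k ℕ.* k)) * (ρ p * ρ p) ∎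
        where
        open ≤-Reasoning
        ρm : ρ m ≡ ρ p + ι k * ρ p * ρ m
        ρm = trans (sym (*-identityˡ (ρ m))) (trans (cong (_* ρ m) (trans (sym pp) (cong (_* ρ p) ιp)))
          (trans (solve 4 (λ m k r s → (m :+ k) :* r :* s := r :* (m :* s) :+ k :* r :* s) refl (ι m) (ι k) (ρ p) (ρ m))
            (cong (_+ ι k * ρ p * ρ m) (trans (cong (ρ p *_) mm) (*-identityʳ (ρ p))))))

      -- k/p is the hitting probability of k residue classes ...
      γ-all : ι k * ρ p * (1# + α p) ≡ α p
      γ-all = trans (cong (ι k * ρ p *_) 1+α) (trans (solve 4 (λ k r p s → k :* r :* (p :* s) := k :* s :* (p :* r)) refl (ι k) (ρ p) (ι p) (ρ m))
        (trans (cong (ι k * ρ m *_) pp) (*-identityʳ _)))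

      -- ... and (k−1)/(p−1) that of k−1 reduced ones.
      module _ {l : ℕ} (k≡ : k ≡ suc l) where

        private
          γ = ι l * ρ n * (1# + α p)
          ιk : ι k ≡ 1# + ι l
          ιk = trans (cong ι k≡) (ι-suc l)

        -- Over n with n + h prime only k - 1 of the p - 1 reduced classes hit, and the mean of χ_p
        -- becomes 1/(p - 1). This is where the inner sums with weight about 1/m come from.
        mean : α p - γ ≡ ρ n
        mean = begin
          ι k * ρ m - ι l * ρ n * (1# + α p)
            ≡⟨ cong (λ t → ι k * ρ m - ι l * ρ n * t) 1+α ⟩
          ι k * ρ m - ι l * ρ n * (ι p * ρ m)
            ≡⟨ cong (λ t → ι k * ρ m * t - ι l * ρ n * (ι p * ρ m)) (sym nn) ∙ ⟩
          ι k * ρ m * (ι n * ρ n) - ι l * ρ n * (ι p * ρ m)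
            ≡⟨ cong₂ (λ s t → ι k * ρ m * (s * ρ n) - ι l * ρ n * (t * ρ m)) ιn ιp ⟩
          ι k * ρ m * ((ι m + ι k - 1#) * ρ n) - ι l * ρ n * ((ι m + ι k) * ρ m)
            ≡⟨ cong (λ t → t * ρ m * ((ι m + t - 1#) * ρ n) - ι l * ρ n * ((ι m + t) * ρ m)) ιk ⟩
          (1# + ι l) * ρ m * ((ι m + (1# + ι l) - 1#) * ρ n) - ι l * ρ n * ((ι m + (1# + ι l)) * ρ m)
            ≡⟨ solve 4 (λ l s m r → (:1 :+ l) :* s :* ((m :+ (:1 :+ l) :- :1) :* r) :- l :* r :* ((m :+ (:1 :+ l)) :* s) := m :* s :* r) refl (ι l) (ρ m) (ι m) (ρ n) ⟩
          ι m * ρ m * ρ n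
            ≡⟨ trans (cong (_* ρ n) mm) (*-identityˡ (ρ n)) ⟩
          ρ n ∎
          where
          open ≡-Reasoning
          infix 0 _∙
          _∙ : ι k * ρ m * 1# - ι l * ρ n * (ι p * ρ m) ≡ ι k * ρ m * (ι n * ρ n) - ι l * ρ n * (ι p * ρ m) →
               ι k * ρ m - ι l * ρ n * (ι p * ρ m) ≡ ι k * ρ m * (ι n * ρ n) - ι l * ρ n * (ι p * ρ m)
          _∙ e = trans (cong (_- ι l * ρ n * (ι p * ρ m)) (sym (*-identityʳ (ι k * ρ m)))) e

        ρ≤mean : ρ p ≤ α p - γ
        ρ≤mean = ≤-trans (ρ-antitone 1≤n (ℕ.m∸n≤m p 1)) (≤-reflexive (sym mean))

        variance : ι l * ρ p * ((1# + ρ p) * (1# + ρ p)) ≤ γ * (1# + (α p - γ))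
        variance = begin
          ι l * ρ p * ((1# + ρ p) * (1# + ρ p))
            ≤⟨ *-mono (*-nonNeg (0≤ι l) (0≤ρ p)) (sq-nonNeg _) (*-monoˡ (0≤ι l) (ρ-antitone 1≤m (ℕ.m∸n≤m p k))) (sq-mono (0≤+ 0≤1 (0≤ρ p)) (+-monoʳ-≤ 1# (ρ-antitone 1≤n (ℕ.m∸n≤m p 1)))) ⟩
          ι l * ρ m * ((1# + ρ n) * (1# + ρ n))
            ≡⟨ cong (λ t → ι l * ρ m * (t * (1# + ρ n))) 1+ρn ⟩
          ι l * ρ m * (ι p * ρ n * (1# + ρ n))
            ≡⟨ solve 5 (λ l s p r t → l :* s :* (p :* r :* t) := l :* r :* (p :* s) :* t) refl (ι l) (ρ m) (ι p) (ρ n) (1# + ρ n) ⟩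
          ι l * ρ n * (ι p * ρ m) * (1# + ρ n)
            ≡⟨ cong₂ (λ s t → ι l * ρ n * s * (1# + t)) (sym 1+α) (sym mean) ⟩
          γ * (1# + (α p - γ)) ∎
          where
          open ≤-Reasoning
          1+ρn : 1# + ρ n ≡ ι p * ρ n
          1+ρn = trans (cong (_+ ρ n) (sym nn)) (trans (solve 2 (λ n r → n :* r :+ r := (n :+ :1) :* r) refl (ι n) (ρ n))
            (cong (_* ρ n) (trans (cong (_+ 1#) (ι-∸ 1≤p)) (solve 1 (λ p → p :- :1 :+ :1 := p) refl (ι p)))))

  ≤1-* : ∀ {a b} → 0# ≤ a → 0# ≤ b → a ≤ 1# → b ≤ 1# → a * b ≤ 1#
  ≤1-* ha hb a≤1 b≤1 = ≤-trans (*-mono ha 0≤1 a≤1 b≤1) (≤-reflexive (*-identityˡ 1#))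

  ≤1-^ : ∀ {a} n → 0# ≤ a → a ≤ 1# → a ^ n ≤ 1#
  ≤1-^ zero ha a≤1 = ≤-refl
  ≤1-^ (suc n) ha a≤1 = ≤1-* ha (^-nonNeg n ha) a≤1 (≤1-^ n ha a≤1)

  *-^ : ∀ a b n → (a * b) ^ n ≡ a ^ n * b ^ n
  *-^ a b zero = sym (*-identityˡ 1#)
  *-^ a b (suc n) = trans (cong (a * b *_) (*-^ a b n)) (solve 4 (λ a b c d → a :* b :* (c :* d) := a :* c :* (b :* d)) refl a b (a ^ n) (b ^ n))

  -- Upper and lower bounds for the two main terms.

  -- W = 2 · 1 · 3 ⋯ z with z = 2j+1, X a multiple of W, R = X^J; ps is the list of primes in (z, R].
  module Config (l j x J : ℕ) (1≤j : 1 ℕ.≤ j) (1≤x : 1 ℕ.≤ x) (1≤J : 1 ℕ.≤ J)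
                (large : 2 ℕ.* (suc l ℕ.* suc l) ℕ.≤ 1 ℕ.+ 2 ℕ.* j) where

    k W z : ℕ
    k = suc l
    W = 2 ℕ.* odd j
    z = 1 ℕ.+ 2 ℕ.* j

    1≤W : 1 ℕ.≤ W
    1≤W = ℕ.*-mono-≤ {1} {2} (ℕ.s≤s ℕ.z≤n) (1≤odd j)

    1≤z : 1 ℕ.≤ z
    1≤z = ℕ.s≤s ℕ.z≤n

    open Mass W x (φ W) 1≤W 1≤x (unit W) (unit-nonNeg W) (unit-periodic W) (∑-unit W) public
    open PrimeWeights k (ℕ.s≤s ℕ.z≤n) public

    R : ℕ
    R = X ℕ.^ J

    1≤R : 1 ℕ.≤ R
    1≤R = 1≤^ X J 1≤X

    z≤R : z ℕ.≤ R
    z≤R = ℕ.≤-trans (j≤odd j) (ℕ.≤-trans (ℕ.m≤m+n (odd j) _) (ℕ.≤-trans (subst (W ℕ.≤_) refl (subst (ℕ._≤ X) (ℕ.*-identityˡ W) (ℕ.*-monoˡ-≤ W 1≤x)))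
      (subst (ℕ._≤ R) (ℕ.*-identityʳ X) (ℕ.^-monoʳ-≤ X ⦃ ℕ.>-nonZero 1≤X ⦄ 1≤J))))

    ps : List ℕ
    ps = primesAbove z (R ℕ.∸ z)

    W-smooth : ∀ {p} → Prime p → p ∣ W → p ℕ.≤ z
    W-smooth = 2*odd-smooth j 1≤j

    valid : Valid (Fresh W z R) 1 ps
    valid = primesAbove-valid W z R z (R ℕ.∸ z) 1 (λ {p} pp d → W-smooth pp (subst (p ∣_) (ℕ.*-identityʳ W) d)) ℕ.≤-refl (ℕ.≤-reflexive (ℕ.m+[n∸m]≡n z≤R))

    free : ∀ {θ} → θ 1 ≡ 1# → (∀ {p} → Prime p → z ℕ.< p → ∀ m → θ (p ℕ.* m) ≡ θ m) → Free ps θ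
    free = primesAbove-free z (R ℕ.∸ z)

    unit-1 : unit W 1 ≡ 1#
    unit-1 = 𝟙-yes (coprime? 1 W) (Coprime.1-coprimeTo W)

    unit-large : ∀ {p} → Prime p → z ℕ.< p → ∀ m → unit W (p ℕ.* m) ≡ unit W m
    unit-large pp z<p = unit-prime W pp (λ d → contradiction (W-smooth pp d) (ℕ.<⇒≱ z<p))

    sieving : Rough.Sieving R 1≤R ps (unit W)
    sieving = primesAbove-sieving R 1≤R z (R ℕ.∸ z) (ℕ.m+[n∸m]≡n z≤R) unit-1 unit-large
      (λ pp l m d → 𝟙-no (coprime? m W) (λ c → coprime⇒¬∣ pp c d (∣2*odd j pp l)))

    2k≤z : 2 ℕ.* k ℕ.≤ z
    2k≤z = ℕ.≤-trans (ℕ.*-monoʳ-≤ 2 (ℕ.m≤m*n k k)) large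

    largePrimes : All (λ p → 2 ℕ.* k ℕ.< p) ps
    largePrimes = All.map (λ (pp , l) → ℕ.≤-<-trans 2k≤z l) (primesAbove-All z (R ℕ.∸ z))

    1≤ps : All (1 ℕ.≤_) ps
    1≤ps = All.map (λ l → ℕ.≤-trans (ℕ.s≤s ℕ.z≤n) l) largePrimes

    -- q = 1 − 2k²/z bounds the inverses of all the convergent products.
    C : ℕ
    C = 2 ℕ.* (k ℕ.* k)

    q : Carrier
    q = 1# - ι C * ρ z

    0≤q : 0# ≤ q
    0≤q = ≤⇒0≤- (≤-trans (*-monoʳ (0≤ρ z) (ι-mono large)) (≤-reflexive (ρ-inverse 1≤z)))

    Πq≤1 : ∀ c {f} → c ℕ.≤ C → (∀ p → f p ≡ ι c * (ρ p * ρ p)) → Π f ps * q ≤ 1#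
    Πq≤1 c {f} c≤C h = ≤-trans (*-monoʳ 0≤q (Π-mono ps)) (Π-bound C z (R ℕ.∸ z) large 1≤z)
      where
      Π-mono : ∀ ps → Π f ps ≤ Π (λ p → ι C * (ρ p * ρ p)) ps
      Π-mono [] = ≤-refl
      Π-mono (p ∷ ps) = *-mono (0≤+ 0≤1 (subst (0# ≤_) (sym (h p)) (*-nonNeg (0≤ι c) (sq-nonNeg (ρ p))))) (Π-nonNeg ps (λ p → *-nonNeg (0≤ι C) (sq-nonNeg (ρ p))))
        (+-monoʳ-≤ 1# (≤-trans (≤-reflexive (h p)) (*-monoʳ (sq-nonNeg (ρ p)) (ι-mono c≤C)))) (Π-mono ps)

    open Iterates ps 1≤ps public
    open Rough R 1≤R using (A; A≤𝕊)

    -- The operator `𝕋` after discretisation: values at the left ends of the cells, and at their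
    -- right ends, without the factor for the mass of a cell.
    U⁺ U⁻ : Op
    U⁺ Q r = ∑ J (λ i → Q (r ℕ.* X ℕ.^ ℕ.pred i))
    U⁻ Q r = ∑ J (λ i → Q (r ℕ.* X ℕ.^ i))

    private
      U-cut : ∀ (f : ℕ → ℕ) → (∀ i → 1 ℕ.≤ f i) → ∀ {Q} → Cut R Q → Cut R (λ r → ∑ J (λ i → Q (r ℕ.* f i)))
      U-cut f hf {Q} c = record
        { nonNeg = λ r → ∑-nonNeg J (λ i → Cut.nonNeg c _)
        ; antitone = λ l → ∑-mono J (λ i _ _ → Cut.antitone c (ℕ.*-monoˡ-≤ (f i) l))
        ; support = λ n l → trans (∑-cong J (λ i _ _ → Cut.support c (n ℕ.* f i) (ℕ.<-≤-trans l (subst (ℕ._≤ n ℕ.* f i) (ℕ.*-identityʳ n) (ℕ.*-monoʳ-≤ n (hf i)))))) (∑-0 J) }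

    U⁺-cut : ∀ {Q} → Cut R Q → Cut R (U⁺ Q)
    U⁺-cut = U-cut (λ i → X ℕ.^ ℕ.pred i) (λ i → 1≤^ X (ℕ.pred i) 1≤X)

    U⁻-cut : ∀ {Q} → Cut R Q → Cut R (U⁻ Q)
    U⁻-cut = U-cut (λ i → X ℕ.^ i) (λ i → 1≤^ X i 1≤X)

    0≤μ⁺ : 0# ≤ μ⁺
    0≤μ⁺ = *-nonNeg 0≤κ (0≤+ (0≤ℋ X) (0≤+ 0≤1 (0≤ι W)))

    𝕋≤U⁺ : ∀ {Q} → Cut R Q → ∀ r → 1 ℕ.≤ r → 𝕋 Q r ≤ μ⁺ * U⁺ Q r
    𝕋≤U⁺ {Q} c r 1≤r = ≤-trans (𝕊≤∑ 0≤ρ 0≤ρ ρ1 ρ-* R 1≤R (unit-nonNeg W) (free unit-1 unit-large) (Cut.nonNeg cᵣ) (Cut.support cᵣ))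
      (cells-upper (Cut.antitone cᵣ) (Cut.nonNeg cᵣ) J 1≤J)
      where cᵣ = Cut-shift 1≤r c

    B : Carrier
    B = Π (λ p → ι 2 * (ρ p * ρ p)) ps

    0≤B : 0# ≤ B
    0≤B = Π-nonNeg ps (λ p → *-nonNeg (0≤ι 2) (sq-nonNeg (ρ p)))

    U⁻≤𝕋 : ∀ {Q} → Cut R Q → ∀ r → 1 ℕ.≤ r → μ⁻ * U⁻ Q r ≤ B * 𝕋 Q r
    U⁻≤𝕋 {Q} c r 1≤r = ≤-trans (cells-lower (Cut.antitone cᵣ) (Cut.nonNeg cᵣ) J 1≤J) (A≤𝕊 (unit-nonNeg W) sieving cᵣ)
      where cᵣ = Cut-shift 1≤r c

    module _ {y : ℕ → Carrier} (cy : Cut R y) where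

      -- The combinatorial factors of the two main terms. For `P⁺` there are `k` iterations on the
      -- squared weight; for `P⁻` one inside the square and `l` = k - 1 outside, hence k + 1 powers
      -- of the mass against k.
      P⁺ P⁻ : Carrier
      P⁺ = iter U⁺ k (λ r → y r * y r) 1
      P⁻ = iter U⁻ l (λ r → U⁻ y r * U⁻ y r) 1

      open Weights α 0≤α using (module Model)

      -- The form is exactly diagonal. The excess of α over k/p is of order 1/p² and gives a
      -- convergent product, which one factor `q` cancels; the rest is k iterated sums over cells.
      main-upper : q * Model.E (λ p → ι k * ρ p) ps y y ≤ μ⁺ ^ k * P⁺
      main-upper = begin
        q * Model.E (λ p → ι k * ρ p) ps y y
          ≡⟨ cong (q *_) (ModelBounds.E-orthogonal α 0≤α (λ p → ι k * ρ p) y (All.map γ-all largePrimes)) ⟩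
        q * 𝕊 α ps y²
          ≤⟨ *-monoˡ 0≤q (𝕊-weight-mono 0≤α (sq-nonNeg′ y) (All.map α≤ largePrimes)) ⟩
        q * 𝕊 (λ p → weight k p + ι C * (ρ p * ρ p)) ps y²
          ≤⟨ *-monoˡ 0≤q (𝕊-+≤Π𝕊 (0≤weight k) (λ p → *-nonNeg (0≤ι C) (sq-nonNeg (ρ p))) 1≤ps (sq-nonNeg′ y) (Cut.antitone cy²)) ⟩
        q * (π * 𝕊 (weight k) ps y²)
          ≡⟨ solve 3 (λ q p s → q :* (p :* s) := p :* q :* s) refl q π (𝕊 (weight k) ps y²) ⟩
        π * q * 𝕊 (weight k) ps y²
          ≤⟨ *-monoʳ (𝕊-nonNeg ps (0≤weight k) (sq-nonNeg′ y)) (Πq≤1 C ℕ.≤-refl (λ p → refl)) ⟩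
        1# * 𝕊 (weight k) ps y²
          ≡⟨ *-identityˡ _ ⟩
        𝕊 (weight k) ps y²
          ≤⟨ 𝕊-weight≤iter k (sq-nonNeg′ y) ⟩
        iter 𝕋 k y² 1
          ≤⟨ Compare.iter-upper R U⁺ U⁺-cut 0≤μ⁺ 𝕋≤U⁺ k cy² 1 ℕ.≤-refl ⟩
        μ⁺ ^ k * P⁺ ∎
        where
        open ≤-Reasoning
        y² : ℕ → Carrier
        y² r = y r * y r
        cy² : Cut R y²
        cy² = Cut-sq cy
        π = Π (λ p → ι C * (ρ p * ρ p)) ps

      loss-q : ∀ m → m ℕ.≤ l → loss m * q ^ m ≤ 1#
      loss-q zero _ = ≤-reflexive (*-identityˡ 1#)
      loss-q (suc m) m≤l = ≤-trans (≤-reflexive (solve 4 (λ a b c d → a :* b :* (c :* d) := a :* d :* (b :* c)) refl (loss m) (Π (λ p → weight m p * ρ p) ps) q (q ^ m)))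
        (≤1-* (*-nonNeg (loss-nonNeg m) (^-nonNeg m 0≤q)) (*-nonNeg (Π-nonNeg ps (λ p → *-nonNeg (0≤weight m p) (0≤ρ p))) 0≤q)
          (loss-q m (ℕ.<⇒≤ m≤l)) (Πq≤1 m (ℕ.≤-trans (ℕ.<⇒≤ m≤l) (ℕ.≤-trans (ℕ.n≤1+n l) (ℕ.≤-trans (ℕ.m≤m*n k k) (ℕ.m≤m+n (k ℕ.* k) _)))) (λ p → *-assoc (ι m) (ρ p) (ρ p))))

      -- Each comparison with cells loses a factor `B`, twice inside the square and `l` times
      -- outside, and returning from the iterated sum to the weight l/p loses `loss l`. The exponent
      -- of `q` counts these convergent products: 2 + l of the first kind and l of the second.
      main-lower : 0# ≤ μ⁻ → q ^ (l ℕ.+ (2 ℕ.+ l)) * (μ⁻ ^ (2 ℕ.+ l) * P⁻) ≤ Model.E (λ p → ι l * ρ (p ℕ.∸ 1)) ps y y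
      main-lower 0≤μ = begin
        q ^ (l ℕ.+ (2 ℕ.+ l)) * (μ⁻ ^ (2 ℕ.+ l) * P⁻)
          ≤⟨ *-monoˡ (^-nonNeg (l ℕ.+ (2 ℕ.+ l)) 0≤q) chain ⟩
        q ^ (l ℕ.+ (2 ℕ.+ l)) * (B ^ (2 ℕ.+ l) * (loss l * e))
          ≡⟨ trans (cong (_* (B ^ (2 ℕ.+ l) * (loss l * e))) (^-+ q l (2 ℕ.+ l)))
               (solve 5 (λ a b c d e → a :* b :* (c :* (d :* e)) := (d :* a) :* (c :* b) :* e) refl (q ^ l) (q ^ (2 ℕ.+ l)) (B ^ (2 ℕ.+ l)) (loss l) e) ⟩
        loss l * q ^ l * (B ^ (2 ℕ.+ l) * q ^ (2 ℕ.+ l)) * e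
          ≤⟨ *-monoʳ 0≤e (≤1-* (*-nonNeg (loss-nonNeg l) (^-nonNeg l 0≤q)) (*-nonNeg (^-nonNeg (2 ℕ.+ l) 0≤B) (^-nonNeg (2 ℕ.+ l) 0≤q)) (loss-q l ℕ.≤-refl)
               (≤-trans (≤-reflexive (sym (*-^ B q (2 ℕ.+ l)))) (≤1-^ (2 ℕ.+ l) (*-nonNeg 0≤B 0≤q) (Πq≤1 2 (ℕ.*-mono-≤ {2} {2} ℕ.≤-refl (ℕ.s≤s (ℕ.z≤n {l ℕ.+ l ℕ.* k}))) (λ p → refl))))) ⟩
        1# * e
          ≡⟨ *-identityˡ e ⟩
        e
          ≤⟨ ModelBounds.E-lower α 0≤α (λ p → ι l * ρ (p ℕ.∸ 1)) (Cut.nonNeg cy) (Cut.antitone cy) (0≤weight l)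
               (All.map (λ h → ℕ.≤-trans (ℕ.s≤s ℕ.z≤n) h , ρ≤mean h refl , variance h refl) largePrimes) ⟩
        Model.E (λ p → ι l * ρ (p ℕ.∸ 1)) ps y y ∎
        where
        open ≤-Reasoning
        ^-+ : ∀ x m n → x ^ (m ℕ.+ n) ≡ x ^ m * x ^ n
        ^-+ x zero n = sym (*-identityˡ _)
        ^-+ x (suc m) n = trans (cong (x *_) (^-+ x m n)) (sym (*-assoc x _ _))
        u² t² : ℕ → Carrier
        u² r = U⁻ y r * U⁻ y r
        t² r = 𝕋 y r * 𝕋 y r
        e = 𝕊 (weight l) ps t²
        0≤e : 0# ≤ e
        0≤e = 𝕊-nonNeg ps (0≤weight l) (sq-nonNeg′ (𝕋 y))
        cu² = Cut-sq (U⁻-cut cy)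
        squares : ∀ r → 1 ℕ.≤ r → μ⁻ * μ⁻ * u² r ≤ B * B * t² r
        squares r 1≤r = ≤-trans (≤-reflexive (sq* μ⁻ (U⁻ y r))) (≤-trans (sq-mono (*-nonNeg 0≤μ (Cut.nonNeg (U⁻-cut cy) r)) (U⁻≤𝕋 cy r 1≤r)) (≤-reflexive (sym (sq* B (𝕋 y r)))))
          where
          sq* : ∀ a b → a * a * (b * b) ≡ (a * b) * (a * b)
          sq* = solve 2 (λ a b → a :* a :* (b :* b) := (a :* b) :* (a :* b)) refl
        chain : μ⁻ ^ (2 ℕ.+ l) * P⁻ ≤ B ^ (2 ℕ.+ l) * (loss l * e)
        chain = begin
          μ⁻ * (μ⁻ * μ⁻ ^ l) * P⁻ ≡⟨ solve 3 (λ m n p → m :* (m :* n) :* p := m :* m :* (n :* p)) refl μ⁻ (μ⁻ ^ l) P⁻ ⟩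
          μ⁻ * μ⁻ * (μ⁻ ^ l * P⁻) ≤⟨ *-monoˡ (sq-nonNeg μ⁻) (Compare.iter-lower R U⁻ U⁻-cut 0≤μ 0≤B U⁻≤𝕋 l cu² 1 ℕ.≤-refl) ⟩
          μ⁻ * μ⁻ * (B ^ l * iter 𝕋 l u² 1) ≡⟨ solve 3 (λ m b i → m :* (b :* i) := b :* (m :* i)) refl (μ⁻ * μ⁻) (B ^ l) (iter 𝕋 l u² 1) ⟩
          B ^ l * (μ⁻ * μ⁻ * iter 𝕋 l u² 1) ≤⟨ *-monoˡ (^-nonNeg l 0≤B) (≤-trans (≤-reflexive (sym (iter-scale l (μ⁻ * μ⁻) u² 1)))
                                                   (≤-trans (iter-mono l squares 1 ℕ.≤-refl) (≤-reflexive (iter-scale l (B * B) t² 1)))) ⟩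
          B ^ l * (B * B * iter 𝕋 l t² 1) ≤⟨ *-monoˡ (^-nonNeg l 0≤B) (*-monoˡ (sq-nonNeg B)
                                                   (iter≤𝕊-weight l (sq-nonNeg′ (𝕋 y)) (sq-antitone (𝕋-nonNeg (Cut.nonNeg cy)) (𝕋-antitone (Cut.antitone cy))))) ⟩
          B ^ l * (B * B * (loss l * e)) ≡⟨ solve 3 (λ b c e → c :* (b :* b :* e) := b :* (b :* c) :* e) refl B (B ^ l) (loss l * e) ⟩
          B ^ (2 ℕ.+ l) * (loss l * e) ∎

  -- The three sums: over all integers, with λ, and over primes.

  min : Carrier → Carrier → Carrier
  min x y with total x y
  ... | inj₁ _ = x
  ... | inj₂ _ = y

  min≤ˡ : ∀ x y → min x y ≤ x
  min≤ˡ x y with total x y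
  ... | inj₁ _ = ≤-refl
  ... | inj₂ h = h

  min≤ʳ : ∀ x y → min x y ≤ y
  min≤ʳ x y with total x y
  ... | inj₁ h = h
  ... | inj₂ _ = ≤-refl

  min-nonNeg : ∀ {x y} → 0# ≤ x → 0# ≤ y → 0# ≤ min x y
  min-nonNeg {x} {y} hx hy with total x y
  ... | inj₁ _ = hx
  ... | inj₂ _ = hy

  min-≈ : ∀ {s d x y} → s ≈[ x ] d → s ≈[ y ] d → s ≈[ min x y ] d
  min-≈ {x = x} {y} a b with total x y
  ... | inj₁ _ = a
  ... | inj₂ _ = b

  -- If n + h is a prime above R, no sieving prime divides it, so the shift `h` drops out of the
  -- possible hits.
  delete : ∀ {h : ℕ} {hs} → h ∈ hs → List ℕ
  delete {hs = _ ∷ hs} (here _) = hs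
  delete {hs = h ∷ _} (there m) = h ∷ delete m

  length-delete : ∀ {h hs} (m : h ∈ hs) → suc (length (delete m)) ≡ length hs
  length-delete (here _) = refl
  length-delete (there m) = cong suc (length-delete m)

  ∑-delete : ∀ {h hs} (m : h ∈ hs) (f : ℕ → Carrier) → ∑[ hs ] f ≡ f h + ∑[ delete m ] f
  ∑-delete (here refl) f = refl
  ∑-delete {h} {h′ ∷ hs} (there m) f = trans (cong (f h′ +_) (∑-delete m f)) (solve 3 (λ a b c → a :+ (b :+ c) := b :+ (a :+ c)) refl (f h′) (f h) (∑[ delete m ] f))

  delete-≢ : ∀ {h hs} (m : h ∈ hs) → AllPairs _≢_ hs → All (_≢ h) (delete m)
  delete-≢ (here refl) (n ∷ _) = All.map (λ a b → a (sym b)) n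
  delete-≢ (there m) (n ∷ ns) = All.lookup n m ∷ delete-≢ m ns

  delete-All : ∀ {h hs} {P : ℕ → Set} (m : h ∈ hs) → All P hs → All P (delete m)
  delete-All (here _) (_ ∷ ps) = ps
  delete-All (there m) (p ∷ ps) = p ∷ delete-All m ps

  -- At most one shift is hit, so the indicator of a hit is the sum of the indicators.
  𝟙-any : ∀ {P : ℕ → Set} (P? : ∀ h → Dec (P h)) hs (d : Dec (Any P hs)) → AllPairs (λ h h′ → P h → ¬ P h′) hs → 𝟙 d ≡ ∑[ hs ] (λ h → 𝟙 (P? h))
  𝟙-any P? [] d _ = 𝟙-no d λ ()
  𝟙-any {P} P? (h ∷ hs) d (n ∷ ns) with P? h
  ... | yes p = trans (𝟙-yes d (here p)) (sym (trans (cong (1# +_) (none hs n)) (+-identityʳ 1#)))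
    where
    none : ∀ hs → All (λ h′ → P h → ¬ P h′) hs → ∑[ hs ] (λ h → 𝟙 (P? h)) ≡ 0#
    none [] _ = refl
    none (h′ ∷ hs) (n ∷ ns) = trans (cong₂ _+_ (𝟙-no (P? h′) (n p)) (none hs ns)) (+-identityʳ 0#)
  ... | no ¬p = trans (trans (𝟙-cong d (any? P? hs) (λ { (here p) → contradiction p ¬p ; (there a) → a }) there) (𝟙-any P? hs (any? P? hs) ns)) (sym (+-identityˡ _))

  module SieveSums (l j x J : ℕ) (1≤j : 1 ℕ.≤ j) (1≤x : 1 ℕ.≤ x) (1≤J : 1 ℕ.≤ J)
              (large : 2 ℕ.* (suc l ℕ.* suc l) ℕ.≤ 1 ℕ.+ 2 ℕ.* j) (hs : List ℕ) (distinct : AllPairs _≢_ hs)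
              (hs≤z : All (ℕ._≤ 1 ℕ.+ 2 ℕ.* j) hs) (len : length hs ≡ suc l) where
    open Config l j x J 1≤j 1≤x 1≤J large public

    Hit : ℕ → ℕ → Set
    Hit p n = Any (λ h → p ∣ n ℕ.+ h) hs

    hit? : ∀ p n → Dec (Hit p n)
    hit? p n = any? (λ h → p ∣? n ℕ.+ h) hs

    open Weights α 0≤α public using (module Hits; module Model; Good)
    open Hits Hit hit? public using (Λ; module Distribution)

    Fr : ℕ → ℕ → Set
    Fr = Fresh W z R

    -- A difference of shifts is at most z and nonzero, hence not divisible by a prime above z.
    apart : ∀ {p h h′} → z ℕ.< p → h ℕ.≤ z → h′ ℕ.≤ z → h ≢ h′ → ¬ p ∣ ℕ.∣ h - h′ ∣
    apart {p} {h} {h′} z<p h≤ h′≤ ne d with ℕ.∣ h - h′ ∣ in eq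
    ... | zero = ne (ℕ.∣m-n∣≡0⇒m≡n eq)
    ... | suc m = contradiction (ℕ.≤-trans (∣⇒≤ d) (subst (ℕ._≤ z) eq (ℕ.≤-trans (ℕ.∣m-n∣≤m⊔n h h′) (ℕ.⊔-lub h≤ h′≤)))) (ℕ.<⇒≱ z<p)

    exclusive : ∀ {p h h′} → z ℕ.< p → h ℕ.≤ z → h′ ℕ.≤ z → h ≢ h′ → ∀ {n} → p ∣ n ℕ.+ h → ¬ p ∣ n ℕ.+ h′
    exclusive {p} {h} {h′} z<p h≤ h′≤ ne {n} a b = apart z<p h≤ h′≤ ne
      (Cong⇒∣ h h′ (∣+⇒Cong {a = h} {h′} {n} (subst (p ∣_) (ℕ.+-comm n h) a) (subst (p ∣_) (ℕ.+-comm n h′) b)))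

    hit-sum : ∀ {p} → z ℕ.< p → ∀ n → 𝟙 (hit? p n) ≡ ∑[ hs ] (λ h → 𝟙 (p ∣? n ℕ.+ h))
    hit-sum {p} z<p n = 𝟙-any (λ h → p ∣? n ℕ.+ h) hs (hit? p n) (go hs≤z distinct)
      where
      go : ∀ {hs} → All (ℕ._≤ z) hs → AllPairs _≢_ hs → AllPairs (λ h h′ → p ∣ n ℕ.+ h → ¬ p ∣ n ℕ.+ h′) hs
      go [] [] = []
      go (b ∷ bs) (d ∷ ds) = both bs d ∷ go bs ds
        where
        both : ∀ {hs} → All (ℕ._≤ z) hs → All (_ ≢_) hs → All (λ h′ → p ∣ n ℕ.+ _ → ¬ p ∣ n ℕ.+ h′) hs
        both [] [] = []
        both (b′ ∷ bs′) (n ∷ ns) = exclusive z<p b b′ n ∷ both bs′ ns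

    1≤Wq : ∀ {q} → 1 ℕ.≤ q → 1 ℕ.≤ W ℕ.* q
    1≤Wq 1≤q = ℕ.*-mono-≤ 1≤W 1≤q

    fresh-coprime : ∀ {q p} → Fr q p → Coprime (W ℕ.* q) p
    fresh-coprime (pp , ¬d , _) = prime-coprime pp ¬d

    refine-class : ∀ {q p} v h → Fr q p → ∃ λ v′ → W ℕ.* q ∣ ℕ.∣ v′ - v ∣ × p ∣ v′ ℕ.+ h ×
      (∀ n → 𝟙 (W ℕ.* q ∣? ℕ.∣ n - v ∣) * 𝟙 (p ∣? n ℕ.+ h) ≡ 𝟙 (W ℕ.* (q ℕ.* p) ∣? ℕ.∣ n - v′ ∣))
    refine-class {q} {p} v h fr@(pp , _) =
      let v′ , c , d , to , from = crt (prime≥1 pp) (fresh-coprime fr) v h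
          assoc = ℕ.*-assoc W q p in
      v′ , c , d , λ n → 𝟙-× (W ℕ.* q ∣? ℕ.∣ n - v ∣) (p ∣? n ℕ.+ h) (W ℕ.* (q ℕ.* p) ∣? ℕ.∣ n - v′ ∣)
        (λ a b → subst (_∣ ℕ.∣ n - v′ ∣) assoc (to n a b)) (λ a → from n (subst (_∣ ℕ.∣ n - v′ ∣) (sym assoc) a))

    TT : ℕ
    TT = R ℕ.* R

    1≤TT : 1 ℕ.≤ TT
    1≤TT = ℕ.*-mono-≤ 1≤R 1≤R

    open Powers ps 1≤ps (free refl (λ _ _ _ → refl)) TT 1≤TT using (G-bound; Err-bound)

    hh : Carrier
    hh = ℋ TT

    c₀ : ℕ
    c₀ = 18 ℕ.* (k ℕ.* k)

    -- The total error, for the sum S of the errors of the classes and their crude bound η.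
    ℰ : Carrier → Carrier → Carrier → Carrier → Carrier → Carrier
    ℰ y₁ s t S η = (y₁ * hh ^ (2 ℕ.* k)) * (y₁ * hh ^ (2 ℕ.* k)) * (t * S + s * (η * hh ^ c₀))

    module _ {y : ℕ → Carrier} (cy : Cut R y) {s t : Carrier} (0≤s : 0# ≤ s) (0≤t : 0# ≤ t) (st : s * t ≡ 1#) where

      S : ℕ → ℕ → (ℕ → Carrier) → Carrier
      S N v a = ∑ N (λ n → 𝟙 (W ℕ.* 1 ∣? ℕ.∣ n - v ∣) * (a n * (Λ ps y n * Λ ps y n)))

      -- The common frame of the three sums. `e` is the error that is small on average over the
      -- moduli; `η` bounds it modulus by modulus, decays like 2/p with each prime, and enters only
      -- the crude half of `Err-bound`.
      estimate : ∀ N a hs′ (len′ : length hs′ ℕ.≤ k) (D e δ η : ℕ → Carrier) (Adm : ℕ → ℕ → Set) → NonNeg e →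
        (∀ {q v} → Adm q v → q ℕ.≤ TT → ∑ N (λ n → 𝟙 (W ℕ.* q ∣? ℕ.∣ n - v ∣) * a n) ≈[ e q ] D q) →
        (∀ {q p} → Fr q p → D (q ℕ.* p) ≡ D q * δ p) →
        (∀ {q p} → Fr q p → ∀ n → 1 ℕ.≤ n → a n * 𝟙 (hit? p n) ≡ a n * ∑[ hs′ ] (λ h → 𝟙 (p ∣? n ℕ.+ h))) →
        (∀ {q v p} → Adm q v → Fr q p → All (λ h → ∃ λ v′ → Adm (q ℕ.* p) v′ ×
          (∀ n → 𝟙 (W ℕ.* q ∣? ℕ.∣ n - v ∣) * 𝟙 (p ∣? n ℕ.+ h) ≡ 𝟙 (W ℕ.* (q ℕ.* p) ∣? ℕ.∣ n - v′ ∣))) hs′) →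
        (∀ q → 1 ℕ.≤ q → q ℕ.≤ TT → e q ≤ η q) → (∀ {q p} → Fr q p → η (q ℕ.* p) ≤ η q * (ι 2 * ρ p)) → 0# ≤ η 1 →
        ∀ {v} → Adm 1 v → S N v a ≈[ ℰ (y 1) s t (∑ TT e) (η 1) ] D 1 * Model.E (λ p → ι (length hs′) * δ p) ps y y
      estimate N a hs′ len′ D e δ η Adm 0≤e base D-step hits refine e≤η η-step 0≤η adm =
        ≈-weaken bound (X-estimate ps valid good good ℕ.≤-refl adm)
        where
        open Distribution N W R k a hs′ len′ D e δ 0≤e Fr Adm (λ (pp , _) → prime≥1 pp) base D-step hits refine using (X-estimate; Err; Err-nonNeg)
        good : Good R 1 y
        good = record { nonNeg = Cut.nonNeg cy ; antitone = Cut.antitone cy ; support = λ r l → Cut.support cy r (subst (R ℕ.<_) (ℕ.*-identityˡ r) l) }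
        g = 𝕊 α ps y
        R≤TT : R ℕ.≤ TT
        R≤TT = ℕ.m≤m*n R R ⦃ ℕ.>-nonZero 1≤R ⦄
        g≤ : g ≤ y 1 * hh ^ (2 ℕ.* k)
        g≤ = G-bound (2 ℕ.* k) 0≤α (All.map α≤2k largePrimes) (Cut.nonNeg cy) (Cut.antitone cy) (λ r l → Cut.support cy r (ℕ.≤-<-trans R≤TT l))
        0≤g : 0# ≤ g
        0≤g = 𝕊-nonNeg ps 0≤α (Cut.nonNeg cy)
        0≤g′ = ≤-trans 0≤g g≤
        bound : g * g * Err ps 1 ≤ ℰ (y 1) s t (∑ TT e) (η 1)
        bound = *-mono (*-nonNeg 0≤g 0≤g) (≤-trans (Err-nonNeg ps 1) err) (*-mono 0≤g 0≤g′ g≤ g≤) err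
          where
          err : Err ps 1 ≤ t * ∑ TT e + s * (η 1 * hh ^ c₀)
          err = Err-bound k (ℕ.s≤s ℕ.z≤n) valid 0≤e e≤η η-step 0≤η 0≤s 0≤t st

      private
        hh-nonNeg : ∀ m → 0# ≤ hh ^ m
        hh-nonNeg m = ^-nonNeg m (0≤ℋ TT)

      ℰ-mono : ∀ {S S′ η η′} → S ≤ S′ → η ≤ η′ → ℰ (y 1) s t S η ≤ ℰ (y 1) s t S′ η′
      ℰ-mono hS hη = *-monoˡ (sq-nonNeg _) (+-mono-≤ (*-monoˡ 0≤t hS) (*-monoˡ 0≤s (*-monoʳ (hh-nonNeg c₀) hη)))

      private
        ρ-Wqp : ∀ q p → ρ (W ℕ.* (q ℕ.* p)) ≡ ρ (W ℕ.* q) * ρ p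
        ρ-Wqp q p = trans (cong ρ (sym (ℕ.*-assoc W q p))) (ρ-* (W ℕ.* q) p)

        ρ≤2ρ : ∀ p → ρ p ≤ ι 2 * ρ p
        ρ≤2ρ p = ≤-trans (x≤x+y (0≤ρ p)) (≤-reflexive (solve 1 (λ r → r :+ r := con (pos 2) :* r) refl (ρ p)))

        ρ-step : ∀ c {q p} → 0# ≤ c → c * ρ (W ℕ.* (q ℕ.* p)) ≤ c * ρ (W ℕ.* q) * (ι 2 * ρ p)
        ρ-step c {q} {p} 0≤c = ≤-trans (≤-reflexive (trans (cong (c *_) (ρ-Wqp q p)) (sym (*-assoc c _ _)))) (*-monoˡ (*-nonNeg 0≤c (0≤ρ (W ℕ.* q))) (ρ≤2ρ p))

        ρ≤1 : ∀ n → ρ n ≤ 1#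
        ρ≤1 zero = 0≤1
        ρ≤1 (suc n) = subst (ρ (suc n) ≤_) ρ1 (ρ-antitone {1} {suc n} ℕ.≤-refl (ℕ.s≤s ℕ.z≤n))

        1≤Nρ : ∀ {N q} → W ℕ.* TT ℕ.≤ N → 1 ℕ.≤ q → q ℕ.≤ TT → 1# ≤ ι N * ρ (W ℕ.* q)
        1≤Nρ {N} {q} big 1≤q q≤ = ≤-trans (≤-reflexive (sym (ρ-inverse (1≤Wq 1≤q)))) (*-monoʳ (0≤ρ (W ℕ.* q)) (ι-mono (ℕ.≤-trans (ℕ.*-monoʳ-≤ W q≤) big)))

        1≤qp : ∀ {q p} → 1 ℕ.≤ q → Fr q p → 1 ℕ.≤ q ℕ.* p
        1≤qp 1≤q (pp , _) = ℕ.*-mono-≤ 1≤q (prime≥1 pp)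

        refine-all : ∀ {q v p} → 1 ℕ.≤ q → Fr q p → All (λ h → ∃ λ v′ → 1 ℕ.≤ q ℕ.* p ×
          (∀ n → 𝟙 (W ℕ.* q ∣? ℕ.∣ n - v ∣) * 𝟙 (p ∣? n ℕ.+ h) ≡ 𝟙 (W ℕ.* (q ℕ.* p) ∣? ℕ.∣ n - v′ ∣))) hs
        refine-all {v = v} 1≤q fr = All.universal (λ h → let v′ , _ , _ , c = refine-class v h fr in v′ , 1≤qp 1≤q fr , c) hs

        D1 : ∀ c → c * ρ (W ℕ.* 1) ≡ c * ρ W
        D1 c = cong (λ t → c * ρ t) (ℕ.*-identityʳ W)

      count : ∀ N v → W ℕ.* TT ℕ.≤ N → S N v (λ _ → 1#) ≈[ ℰ (y 1) s t (ι TT) (ι N) ] ι N * ρ W * Model.E (λ p → ι k * ρ p) ps y y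
      count N v big = subst (λ m → S N v (λ _ → 1#) ≈[ ℰ (y 1) s t (ι TT) (ι N) ] ι N * ρ W * Model.E (λ p → ι m * ρ p) ps y y) len
        (≈-subst refl (cong (_* Model.E (λ p → ι (length hs) * ρ p) ps y y) (D1 (ι N)))
        (≈-weaken (ℰ-mono (≤-reflexive (trans (∑-const TT 1#) (*-identityʳ _))) (≤-trans (*-monoˡ (0≤ι N) (ρ≤1 (W ℕ.* 1))) (≤-reflexive (*-identityʳ (ι N)))))
        (estimate N (λ _ → 1#) hs (ℕ.≤-reflexive len) (λ q → ι N * ρ (W ℕ.* q)) (λ _ → 1#) ρ (λ q → ι N * ρ (W ℕ.* q)) (λ q _ → 1 ℕ.≤ q) (λ _ → 0≤1)
          (λ 1≤q _ → ≈-subst (∑-cong N (λ n _ _ → sym (*-identityʳ _))) refl (residue-count N _ (1≤Wq 1≤q)))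
          (λ {q} {p} _ → trans (cong (ι N *_) (ρ-Wqp q p)) (sym (*-assoc (ι N) _ _)))
          (λ (pp , _ , z<p , _) n _ → cong (1# *_) (hit-sum z<p n))
          refine-all
          (λ q 1≤q q≤ → 1≤Nρ big 1≤q q≤)
          (λ _ → ρ-step (ι N) (0≤ι N))
          (*-nonNeg (0≤ι N) (0≤ρ (W ℕ.* 1))) ℕ.≤-refl)))

      private
        -- |Σ 1[n in class] a(n)| ≤ c (N/M + 1)
        crude : ∀ {M} N v (a : ℕ → Carrier) {c} → 1 ℕ.≤ M → 0# ≤ c → (∀ n → 1 ℕ.≤ n → n ℕ.≤ N → a n ≈[ c ] 0#) →
          ∑ N (λ n → 𝟙 (M ∣? ℕ.∣ n - v ∣) * a n) ≈[ c * (ι N * ρ M + 1#) ] 0#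
        crude {M} N v a {c} 1≤M 0≤c h =
          ≤-trans (≤-trans (∑-mono N (λ n l m → *-monoˡ (𝟙-nonNeg (M ∣? ℕ.∣ n - v ∣)) (≤-trans (proj₁ (h n l m)) (≤-reflexive (+-identityˡ c)))))
            (≤-trans (≤-reflexive (trans (∑-cong N (λ n _ _ → *-comm _ c)) (∑-scale N c _))) (*-monoˡ 0≤c (proj₁ (residue-count N v 1≤M))))) (≤-reflexive (sym (+-identityˡ _))) ,
          ≤-trans (subst (0# ≤_) (∑-linear N c _ _) (∑-nonNeg′ N (λ n l m → subst (0# ≤_) (solve 3 (λ i a c → i :* (a :+ c) := i :* a :+ c :* i) refl (𝟙 (M ∣? ℕ.∣ n - v ∣)) (a n) c)
              (*-nonNeg (𝟙-nonNeg (M ∣? ℕ.∣ n - v ∣)) (proj₂ (h n l m))))))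
            (+-monoʳ-≤ _ (*-monoˡ 0≤c (proj₁ (residue-count N v 1≤M))))
          where
          ∑-nonNeg′ : ∀ N {f} → (∀ n → 1 ℕ.≤ n → n ℕ.≤ N → 0# ≤ f n) → 0# ≤ ∑ N f
          ∑-nonNeg′ N h = subst (_≤ ∑ N _) (∑-0 N) (∑-mono N h)

        double : ∀ {N q c} → W ℕ.* TT ℕ.≤ N → 1 ℕ.≤ q → q ℕ.≤ TT → 0# ≤ c → c * (ι N * ρ (W ℕ.* q) + 1#) ≤ c * (ι 2 * ι N) * ρ (W ℕ.* q)
        double {N} {q} {c} big 1≤q q≤ 0≤c = ≤-trans (*-monoˡ 0≤c (+-monoʳ-≤ _ (1≤Nρ big 1≤q q≤)))
          (≤-reflexive (solve 3 (λ c n r → c :* (n :* r :+ n :* r) := c :* (con (pos 2) :* n) :* r) refl c (ι N) (ρ (W ℕ.* q))))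

      -- There is no main term, so D is zero. The error is the smaller of the one from the
      -- distribution of the sequence and the trivial one: the first is used for its sum, the second
      -- for its decay.
      signed : ∀ N v (a e : ℕ → Carrier) → W ℕ.* TT ℕ.≤ N → NonNeg e → (∀ n → a n ≈[ 1# ] 0#) →
        (∀ q v → 1 ℕ.≤ q → q ℕ.≤ TT → ∑ N (λ n → 𝟙 (W ℕ.* q ∣? ℕ.∣ n - v ∣) * a n) ≈[ e q ] 0#) →
        S N v a ≈[ ℰ (y 1) s t (∑ TT e) (ι 2 * ι N) ] 0#
      signed N v a e big 0≤e a≤1 cl = ≈-subst refl (zeroˡ _)
        (≈-weaken (ℰ-mono (∑-mono TT (λ q _ _ → min≤ˡ (e q) (η q))) (≤-trans (*-monoˡ 0≤2N (ρ≤1 (W ℕ.* 1))) (≤-reflexive (trans (*-identityʳ _) (*-identityˡ _)))))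
        (estimate N a hs (ℕ.≤-reflexive len) (λ _ → 0#) (λ q → min (e q) (η q)) ρ η (λ q _ → 1 ℕ.≤ q) (λ q → min-nonNeg (0≤e q) (*-nonNeg 0≤2N (0≤ρ (W ℕ.* q))))
          (λ {q} {v} 1≤q q≤ → min-≈ (cl q v 1≤q q≤) (≈-weaken (double big 1≤q q≤ 0≤1) (crude N v a (1≤Wq 1≤q) 0≤1 (λ n _ _ → a≤1 n))))
          (λ _ → sym (zeroˡ _))
          (λ (pp , _ , z<p , _) n _ → cong (a n *_) (hit-sum z<p n))
          refine-all
          (λ q _ _ → min≤ʳ (e q) (η q))
          (λ _ → ρ-step (1# * (ι 2 * ι N)) 0≤2N)
          (*-nonNeg 0≤2N (0≤ρ (W ℕ.* 1))) ℕ.≤-refl))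
        where
        η : ℕ → Carrier
        η q = 1# * (ι 2 * ι N) * ρ (W ℕ.* q)
        0≤2N = *-nonNeg 0≤1 (*-nonNeg (0≤ι 2) (0≤ι N))

      module Primes {h : ℕ} (h∈ : h ∈ hs) (N : ℕ) (big : W ℕ.* TT ℕ.≤ N) (lp : ℕ → Carrier) (L : Carrier) (0≤L : 0# ≤ L)
        (lp≤L : ∀ m → 1 ℕ.≤ m → m ℕ.≤ N ℕ.+ h → lp m ≈[ L ] 0#) (e : ℕ → Carrier) (0≤e : NonNeg e)
        (cl : ∀ q a → 1 ℕ.≤ q → q ℕ.≤ TT → Coprime a (W ℕ.* q) →
          ∑ (N ℕ.+ h) (λ m → 𝟙 (W ℕ.* q ∣? ℕ.∣ m - a ∣) * (𝟙 (prime? m) * lp m)) ≈[ e q ] ι (N ℕ.+ h) * ρ (φ (W ℕ.* q))) where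

        -- Primes up to R are left out so that no sieving prime can equal n + h. They are few, and
        -- `small` accounts for them.
        a : ℕ → Carrier
        a n = 𝟙 (R ℕ.<? n ℕ.+ h) * (𝟙 (prime? (n ℕ.+ h)) * lp (n ℕ.+ h))

        private
          N′ = N ℕ.+ h
          h≤z : h ℕ.≤ z
          h≤z = All.lookup hs≤z h∈

          D η small e′ : ℕ → Carrier
          D q = ι N′ * ρ (φ (W ℕ.* q))
          η q = L * (ι 2 * ι N) * ρ (W ℕ.* q) + D q
          small q = L * (ι R * ρ (W ℕ.* q) + 1#)
          e′ q = min (e q + small q) (η q)

          0≤D : NonNeg D
          0≤D q = *-nonNeg (0≤ι N′) (0≤ρ (φ (W ℕ.* q)))
          0≤2LN = *-nonNeg 0≤L (*-nonNeg (0≤ι 2) (0≤ι N))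
          0≤small : NonNeg small
          0≤small q = *-nonNeg 0≤L (0≤+ (*-nonNeg (0≤ι R) (0≤ρ (W ℕ.* q))) 0≤1)
          0≤η : NonNeg η
          0≤η q = 0≤+ (*-nonNeg 0≤2LN (0≤ρ (W ℕ.* q))) (0≤D q)

          weight≤ : ∀ {P Q : Set} (d : Dec P) (d′ : Dec Q) {x} → x ≈[ L ] 0# → 𝟙 d * (𝟙 d′ * x) ≈[ L ] 0#
          weight≤ (yes _) (yes _) {x} b = ≈-subst (sym (trans (*-identityˡ _) (*-identityˡ x))) refl b
          weight≤ (yes _) (no _) {x} b = ≈-subst (sym (trans (*-identityˡ _) (zeroˡ x))) refl (≈-weaken 0≤L ≈-refl)
          weight≤ (no _) d′ {x} b = ≈-subst (sym (zeroˡ _)) refl (≈-weaken 0≤L ≈-refl)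

          trivial : ∀ {q v} → 1 ℕ.≤ q → q ℕ.≤ TT → ∑ N (λ n → 𝟙 (W ℕ.* q ∣? ℕ.∣ n - v ∣) * a n) ≈[ η q ] D q
          trivial {q} {v} 1≤q q≤ = ≤-trans (proj₁ b) (≤-trans (+-mono-≤ (0≤D q) (x≤x+y (0≤D q))) ≤-refl) ,
            ≤-trans (≤-trans (≤-reflexive (sym (+-identityˡ (D q)))) (+-monoˡ-≤ (D q) (proj₂ b))) (≤-reflexive (+-assoc _ _ _))
            where
            b = ≈-weaken (double big 1≤q q≤ 0≤L) (crude N v a (1≤Wq 1≤q) 0≤L (λ n 1≤n n≤N →
              weight≤ (R ℕ.<? n ℕ.+ h) (prime? (n ℕ.+ h)) (lp≤L (n ℕ.+ h) (ℕ.≤-trans 1≤n (ℕ.m≤m+n n h)) (ℕ.+-monoˡ-≤ h n≤N))))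

          -- Shift by h, and restore the primes up to R.
          class : ∀ {q v} → 1 ℕ.≤ q → q ℕ.≤ TT → Coprime (v ℕ.+ h) (W ℕ.* q) → ∑ N (λ n → 𝟙 (W ℕ.* q ∣? ℕ.∣ n - v ∣) * a n) ≈[ e q + small q ] D q
          class {q} {v} 1≤q q≤ cop = ≈-subst (sym eq) (trans (cong (λ t → D q + t) neg0) (+-identityʳ (D q))) (≈-+ (cl q (v ℕ.+ h) 1≤q q≤ cop) (≈-neg low))
            where
            M = W ℕ.* q
            I f : ℕ → Carrier
            I m = 𝟙 (M ∣? ℕ.∣ m - (v ℕ.+ h) ∣)
            f m = 𝟙 (prime? m) * lp m
            neg0 : - 0# ≡ 0#
            neg0 = trans (sym (+-identityˡ _)) (-‿inverseʳ 0#)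
            g : ℕ → Carrier
            g m = I m * (𝟙 (m ℕ.≤? R) * f m)
            h≤R = ℕ.≤-trans h≤z z≤R
            R≤N′ : R ℕ.≤ N′
            R≤N′ = ℕ.≤-trans (ℕ.m≤m*n R R ⦃ ℕ.>-nonZero 1≤R ⦄) (ℕ.≤-trans (subst (ℕ._≤ W ℕ.* TT) (ℕ.*-identityˡ TT) (ℕ.*-monoˡ-≤ TT 1≤W)) (ℕ.≤-trans big (ℕ.m≤m+n N h)))
            low : ∑ N′ g ≈[ small q ] 0#
            low = ≈-subst (sym (∑-support R≤N′ (λ m l → trans (cong (λ t → I m * (t * f m)) (𝟙-no (m ℕ.≤? R) (ℕ.<⇒≱ l))) (solve 2 (λ i f → i :* (con (pos 0) :* f) := con (pos 0)) refl (I m) (f m))))) refl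
              (crude R (v ℕ.+ h) (λ m → 𝟙 (m ℕ.≤? R) * f m) (1≤Wq 1≤q) 0≤L (λ m 1≤m m≤R → weight≤ (m ℕ.≤? R) (prime? m) (lp≤L m 1≤m (ℕ.≤-trans m≤R R≤N′))))
            b : ℕ → Carrier
            b m = I m * (𝟙 (R ℕ.<? m) * f m)
            split : ∀ m → b m ≡ I m * f m + (- 1#) * g m
            split m = trans (cong (λ t → I m * (t * f m)) flip) (solve 3 (λ i f t → i :* ((:1 :- t) :* f) := i :* f :+ (:- :1) :* (i :* (t :* f))) refl (I m) (f m) (𝟙 (m ℕ.≤? R)))
              where
              flip : 𝟙 (R ℕ.<? m) ≡ 1# - 𝟙 (m ℕ.≤? R)
              flip with m ℕ.≤? R
              ... | yes l = trans (𝟙-no (R ℕ.<? m) (ℕ.≤⇒≯ l)) (sym (-‿inverseʳ 1#))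
              ... | no l = trans (𝟙-yes (R ℕ.<? m) (ℕ.≰⇒> l)) (sym (trans (cong (1# +_) neg0) (+-identityʳ 1#)))
            b-small : ∀ m → m ℕ.≤ h → b m ≡ 0#
            b-small m l = trans (cong (λ t → I m * (t * f m)) (𝟙-no (R ℕ.<? m) (ℕ.≤⇒≯ (ℕ.≤-trans l h≤R)))) (solve 2 (λ i f → i :* (con (pos 0) :* f) := con (pos 0)) refl (I m) (f m))
            eq : ∑ N (λ n → 𝟙 (M ∣? ℕ.∣ n - v ∣) * a n) ≡ ∑ N′ (λ m → I m * f m) + - ∑ N′ g
            eq = begin
              ∑ N (λ n → 𝟙 (M ∣? ℕ.∣ n - v ∣) * a n)
                ≡⟨ ∑-cong N (λ n _ _ → trans (cong (λ t → 𝟙 (M ∣? t) * a n) (dist n)) (cong b (ℕ.+-comm n h))) ⟩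
              ∑ N (λ n → b (h ℕ.+ n))
                ≡⟨ sym (trans (cong (_+ ∑ N (λ n → b (h ℕ.+ n))) (trans (∑-cong h (λ m _ l → b-small m l)) (∑-0 h))) (+-identityˡ _)) ⟩
              ∑ h b + ∑ N (λ n → b (h ℕ.+ n))
                ≡⟨ trans (sym (∑-append h N b)) (cong (λ t → ∑ t b) (ℕ.+-comm h N)) ⟩
              ∑ N′ b
                ≡⟨ trans (∑-cong N′ (λ m _ _ → split m)) (∑-linear N′ (- 1#) _ g) ⟩
              ∑ N′ (λ m → I m * f m) + (- 1#) * ∑ N′ g
                ≡⟨ cong (∑ N′ (λ m → I m * f m) +_) (solve 1 (λ g → (:- :1) :* g := :- g) refl (∑ N′ g)) ⟩
              ∑ N′ (λ m → I m * f m) + - ∑ N′ g ∎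
              where
              open ≡-Reasoning
              dist : ∀ n → ℕ.∣ n - v ∣ ≡ ℕ.∣ n ℕ.+ h - (v ℕ.+ h) ∣
              dist n = sym (trans (cong₂ ℕ.∣_-_∣ (ℕ.+-comm n h) (ℕ.+-comm v h)) (ℕ.∣m+n-m+o∣≡∣n-o∣ h n v))

          Adm : ℕ → ℕ → Set
          Adm q v = 1 ℕ.≤ q × Coprime (v ℕ.+ h) (W ℕ.* q)

          D-step : ∀ {q p} → Fr q p → D (q ℕ.* p) ≡ D q * ρ (p ℕ.∸ 1)
          D-step {q} {p} (pp , ¬d , _) = trans (cong (ι N′ *_) (trans (cong ρ (trans (cong φ (sym (ℕ.*-assoc W q p))) (φ-*prime (W ℕ.* q) pp ¬d))) (ρ-* (φ (W ℕ.* q)) (p ℕ.∸ 1))))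
            (sym (*-assoc (ι N′) _ _))

          η-step : ∀ {q p} → Fr q p → η (q ℕ.* p) ≤ η q * (ι 2 * ρ p)
          η-step {q} {p} fr@(pp , _) = ≤-trans (+-mono-≤ (ρ-step (L * (ι 2 * ι N)) 0≤2LN) (≤-trans (≤-reflexive (D-step fr))
            (*-monoˡ (0≤D q) (ρ-ratio 2 (ℕ.∸-monoˡ-≤ 1 (prime≥2 pp)) (prime≥1 pp) (two (prime≥2 pp)))))) (≤-reflexive (sym (distribʳ _ _ _)))
            where
            two : ∀ {p} → 2 ℕ.≤ p → p ℕ.≤ 2 ℕ.* (p ℕ.∸ 1)
            two {suc p} (ℕ.s≤s 1≤p) = subst (ℕ._≤ 2 ℕ.* p) (ℕ.+-comm p 1) (ℕ.+-monoʳ-≤ p (ℕ.≤-trans 1≤p (ℕ.m≤m+n p 0)))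

          hits : ∀ {q p} → Fr q p → ∀ n → 1 ℕ.≤ n → a n * 𝟙 (hit? p n) ≡ a n * ∑[ delete h∈ ] (λ h → 𝟙 (p ∣? n ℕ.+ h))
          hits {q} {p} (pp , _ , z<p , p≤R) n _ = trans (cong (a n *_) (trans (hit-sum z<p n) (∑-delete h∈ (λ h → 𝟙 (p ∣? n ℕ.+ h)))))
            (trans (distribˡ (a n) _ _) (trans (cong (_+ a n * s′) vanish) (+-identityˡ _)))
            where
            s′ = ∑[ delete h∈ ] (λ h → 𝟙 (p ∣? n ℕ.+ h))
            vanish : a n * 𝟙 (p ∣? n ℕ.+ h) ≡ 0#
            vanish with R ℕ.<? n ℕ.+ h | prime? (n ℕ.+ h)
            ... | no _ | d = trans (cong (_* 𝟙 (p ∣? n ℕ.+ h)) (zeroˡ _)) (zeroˡ _)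
            ... | yes l | no _ = solve 2 (λ x t → :1 :* (con (pos 0) :* x) :* t := con (pos 0)) refl (lp (n ℕ.+ h)) (𝟙 (p ∣? n ℕ.+ h))
            ... | yes l | yes pn = trans (cong (1# * (1# * lp (n ℕ.+ h)) *_) (𝟙-no (p ∣? n ℕ.+ h) (λ d → ℕ.<⇒≢ (ℕ.≤-<-trans p≤R l) (prime∣prime pp pn d)))) (zeroʳ _)

          -- The class has to stay reduced for n + h. If `p` divides v′ + h′ for another shift h′,
          -- then `exclusive` says that it does not divide v′ + h.
          refine : ∀ {q v p} → Adm q v → Fr q p → All (λ h′ → ∃ λ v′ → Adm (q ℕ.* p) v′ ×
            (∀ n → 𝟙 (W ℕ.* q ∣? ℕ.∣ n - v ∣) * 𝟙 (p ∣? n ℕ.+ h′) ≡ 𝟙 (W ℕ.* (q ℕ.* p) ∣? ℕ.∣ n - v′ ∣))) (delete h∈)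
          refine {q} {v} {p} (1≤q , cop) fr@(pp , _ , z<p , _) = All.zipWith (λ {h′} (h′≤z , h′≢h) →
            let v′ , c , d , i = refine-class v h′ fr in
            v′ , (1≤qp 1≤q fr , λ {b} → coprime′ v′ c (exclusive z<p h′≤z h≤z h′≢h {v′} d) {b}) , i) (delete-All h∈ hs≤z , delete-≢ h∈ distinct)
            where
            coprime′ : ∀ v′ → W ℕ.* q ∣ ℕ.∣ v′ - v ∣ → ¬ p ∣ v′ ℕ.+ h → Coprime (v′ ℕ.+ h) (W ℕ.* (q ℕ.* p))
            coprime′ v′ c nd {d} (d∣ , d∣M) = cop {d} (Cong-divisor {h = h} (Cong-weaken d∣Wq (∣⇒Cong v v′ (subst (W ℕ.* q ∣_) (ℕ.∣-∣-comm v′ v) c))) d∣ , d∣Wq)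
              where
              d∣Wq : d ∣ W ℕ.* q
              d∣Wq = Coprime.coprime-divisor (λ (e∣d , e∣p) → prime-coprime pp nd (∣-trans e∣d d∣ , e∣p)) (subst (d ∣_) (trans (sym (ℕ.*-assoc W q p)) (ℕ.*-comm (W ℕ.* q) p)) d∣M)

          sum-small : ∑ TT e′ ≤ ∑ TT e + L * (ι R * hh + ι TT)
          sum-small = ≤-trans (∑-mono TT (λ q 1≤q _ → ≤-trans (min≤ˡ (e q + small q) (η q)) (+-monoʳ-≤ (e q) (*-monoˡ 0≤L (+-monoˡ-≤ 1# (*-monoˡ (0≤ι R) (ρ-antitone 1≤q (subst (ℕ._≤ W ℕ.* q) (ℕ.*-identityˡ q) (ℕ.*-monoˡ-≤ q 1≤W)))))))))
            (≤-reflexive (trans (∑-linear TT L e _) (cong (λ t → ∑ TT e + L * t) (trans (∑-+ TT _ _) (cong₂ _+_ (∑-scale TT (ι R) ρ) (trans (∑-const TT 1#) (*-identityʳ _)))))))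

          η1 : η 1 ≤ L * (ι 2 * ι N) + ι N′
          η1 = +-mono-≤ (≤-trans (*-monoˡ 0≤2LN (ρ≤1 (W ℕ.* 1))) (≤-reflexive (*-identityʳ _))) (≤-trans (*-monoˡ (0≤ι N′) (ρ≤1 (φ (W ℕ.* 1)))) (≤-reflexive (*-identityʳ _)))

        primes : ∀ {v} → Coprime (v ℕ.+ h) W →
          S N v a ≈[ ℰ (y 1) s t (∑ TT e + L * (ι R * hh + ι TT)) (L * (ι 2 * ι N) + ι N′) ] ι N′ * ρ (φ W) * Model.E (λ p → ι l * ρ (p ℕ.∸ 1)) ps y y
        primes {v} cop = subst (λ m → S N v a ≈[ ℰ (y 1) s t (∑ TT e + L * (ι R * hh + ι TT)) (L * (ι 2 * ι N) + ι N′) ] ι N′ * ρ (φ W) * Model.E (λ p → ι m * ρ (p ℕ.∸ 1)) ps y y)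
          (ℕ.suc-injective (trans (length-delete h∈) len))
          (≈-subst refl (cong (λ m → ι N′ * ρ (φ m) * Model.E (λ p → ι (length (delete h∈)) * ρ (p ℕ.∸ 1)) ps y y) (ℕ.*-identityʳ W))
          (≈-weaken (ℰ-mono sum-small η1)
          (estimate N a (delete h∈) (ℕ.≤-trans (ℕ.n≤1+n _) (ℕ.≤-reflexive (trans (length-delete h∈) len))) D e′ (λ p → ρ (p ℕ.∸ 1)) η Adm
            (λ q → min-nonNeg (0≤+ (0≤e q) (0≤small q)) (0≤η q))
            (λ (1≤q , cop) q≤ → min-≈ (class 1≤q q≤ cop) (trivial 1≤q q≤))
            D-step hits refine (λ q _ _ → min≤ʳ (e q + small q) (η q)) η-step (0≤η 1)
            (ℕ.≤-refl , subst (Coprime (v ℕ.+ h)) (sym (ℕ.*-identityʳ W)) cop))))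

  -- Values of the weight at the powers of X.

  private
    reverse : ∀ i (f : ℕ → Carrier) → ∑ (suc i) (λ t → f (i ℕ.∸ ℕ.pred t)) ≡ ∑ (suc i) (λ t → f (ℕ.pred t))
    reverse zero f = refl
    reverse (suc i) f = trans (∑-append 1 (suc i) _) (trans (cong₂ _+_ (+-identityˡ _) (trans (∑-cong (suc i) step) (reverse i f))) (+-comm _ _))
      where
      step : ∀ t → 1 ℕ.≤ t → t ℕ.≤ suc i → f (suc i ℕ.∸ t) ≡ f (i ℕ.∸ ℕ.pred t)
      step (suc t) _ _ = refl

    ι-pre⁺ : ∀ f i → ι (pre⁺ f i) ≡ ∑ (suc i) (λ t → ι (f (ℕ.pred t)))
    ι-pre⁺ f zero = sym (+-identityˡ _)
    ι-pre⁺ f (suc i) = trans (ι-+ (pre⁺ f i) (f (suc i))) (cong (_+ ι (f (suc i))) (ι-pre⁺ f i))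

    ι-pre⁻ : ∀ f i → ι (pre⁻ f i) ≡ ∑ i (λ t → ι (f (ℕ.pred t)))
    ι-pre⁻ f zero = refl
    ι-pre⁻ f (suc i) = trans (ι-+ (pre⁻ f i) (f i)) (cong (_+ ι (f i)) (ι-pre⁻ f i))

  -- The weights are only needed at powers of X; i counts down from X^J.
  module Values (X J : ℕ) (2≤X : 2 ℕ.≤ X) where

    private
      1≤X : 1 ℕ.≤ X
      1≤X = ℕ.<⇒≤ 2≤X
      R = X ℕ.^ J

    at : ℕ → ℕ
    at i = X ℕ.^ (J ℕ.∸ i)

    U⁺ U⁻ : Op
    U⁺ Q r = ∑ J (λ i → Q (r ℕ.* X ℕ.^ ℕ.pred i))
    U⁻ Q r = ∑ J (λ i → Q (r ℕ.* X ℕ.^ i))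

    private
      at-* : ∀ {i} t → i ℕ.≤ J → t ℕ.≤ i → at i ℕ.* X ℕ.^ t ≡ at (i ℕ.∸ t)
      at-* {i} t i≤J t≤i = trans (sym (ℕ.^-distribˡ-+-* X (J ℕ.∸ i) t)) (cong (X ℕ.^_) (ℕ.+-cancelʳ-≡ (i ℕ.∸ t) _ _
        (trans (ℕ.+-assoc (J ℕ.∸ i) t (i ℕ.∸ t)) (trans (cong (J ℕ.∸ i ℕ.+_) (ℕ.m+[n∸m]≡n t≤i)) (trans (ℕ.m∸n+n≡m i≤J) (sym (ℕ.m∸n+n≡m (ℕ.≤-trans (ℕ.m∸n≤m i t) i≤J))))))))

      beyond : ∀ {i} t → i ℕ.≤ J → i ℕ.< t → R ℕ.< at i ℕ.* X ℕ.^ t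
      beyond {i} t i≤J i<t = subst (R ℕ.<_) (ℕ.^-distribˡ-+-* X (J ℕ.∸ i) t)
        (ℕ.^-monoʳ-< X 2≤X (ℕ.≤-trans (ℕ.≤-reflexive (trans (cong suc (sym (ℕ.m∸n+n≡m i≤J))) (sym (ℕ.+-suc (J ℕ.∸ i) i)))) (ℕ.+-monoʳ-≤ (J ℕ.∸ i) i<t)))

    -- Multiplying X^(J - i) by X^t lowers the index to i - t, so summing over t is summing over all
    -- smaller indices; terms with t > i lie beyond R and vanish.
    U⁺-values : ∀ {Q f} → Cut R Q → (∀ i → i ℕ.≤ J → Q (at i) ≤ ι (f i)) → ∀ i → i ℕ.≤ J → U⁺ Q (at i) ≤ ι (pre⁺ f i)
    U⁺-values {Q} {f} c h i i≤J = begin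
      ∑ J g ≤⟨ cut (ℕ.≤-total J (suc i)) ⟩
      ∑ (suc i) g ≤⟨ ∑-mono (suc i) bound ⟩
      ∑ (suc i) (λ t → ι (f (i ℕ.∸ ℕ.pred t))) ≡⟨ reverse i (λ t → ι (f t)) ⟩
      ∑ (suc i) (λ t → ι (f (ℕ.pred t))) ≡⟨ sym (ι-pre⁺ f i) ⟩
      ι (pre⁺ f i) ∎
      where
      open ≤-Reasoning
      g : ℕ → Carrier
      g t = Q (at i ℕ.* X ℕ.^ ℕ.pred t)
      cut : J ℕ.≤ suc i Data.Sum.⊎ suc i ℕ.≤ J → ∑ J g ≤ ∑ (suc i) g
      cut (inj₁ l) = ∑-extend l (λ t → Cut.nonNeg c _)
      cut (inj₂ l) = ≤-reflexive (∑-support l (λ { (suc t) (ℕ.s≤s i<t) → Cut.support c _ (beyond t i≤J i<t) }))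
      bound : ∀ t → 1 ℕ.≤ t → t ℕ.≤ suc i → g t ≤ ι (f (i ℕ.∸ ℕ.pred t))
      bound (suc t) _ (ℕ.s≤s t≤i) = ≤-trans (≤-reflexive (cong Q (at-* t i≤J t≤i))) (h (i ℕ.∸ t) (ℕ.≤-trans (ℕ.m∸n≤m i t) i≤J))

    U⁻-values : ∀ {Q f} → NonNeg Q → (∀ i → i ℕ.≤ J → ι (f i) ≤ Q (at i)) → ∀ i → i ℕ.≤ J → ι (pre⁻ f i) ≤ U⁻ Q (at i)
    U⁻-values {Q} {f} hQ h zero _ = ∑-nonNeg J (λ t → hQ _)
    U⁻-values {Q} {f} hQ h (suc i) i≤J = begin
      ι (pre⁻ f (suc i)) ≡⟨ ι-pre⁻ f (suc i) ⟩
      ∑ (suc i) (λ t → ι (f (ℕ.pred t))) ≡⟨ sym (reverse i (λ t → ι (f t))) ⟩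
      ∑ (suc i) (λ t → ι (f (i ℕ.∸ ℕ.pred t))) ≤⟨ ∑-mono (suc i) bound ⟩
      ∑ (suc i) g ≤⟨ ∑-extend i≤J (λ t → hQ _) ⟩
      ∑ J g ∎
      where
      open ≤-Reasoning
      g : ℕ → Carrier
      g t = Q (at (suc i) ℕ.* X ℕ.^ t)
      bound : ∀ t → 1 ℕ.≤ t → t ℕ.≤ suc i → ι (f (i ℕ.∸ ℕ.pred t)) ≤ g t
      bound (suc t) _ t≤i = ≤-trans (h (i ℕ.∸ t) (ℕ.≤-trans (ℕ.≤-trans (ℕ.m∸n≤m i t) (ℕ.n≤1+n i)) i≤J)) (≤-reflexive (cong Q (sym (at-* (suc t) i≤J t≤i))))

    iter⁺-values : (∀ {Q} → Cut R Q → Cut R (U⁺ Q)) → ∀ k {Q f} → Cut R Q → (∀ i → i ℕ.≤ J → Q (at i) ≤ ι (f i)) →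
      ∀ i → i ℕ.≤ J → iter U⁺ k Q (at i) ≤ ι (iterℕ pre⁺ k f i)
    iter⁺-values cut zero c h = h
    iter⁺-values cut (suc k) c h = iter⁺-values cut k (cut c) (U⁺-values c h)

    iter⁻-values : ∀ k {Q f} → NonNeg Q → (∀ i → i ℕ.≤ J → ι (f i) ≤ Q (at i)) → ∀ i → i ℕ.≤ J → ι (iterℕ pre⁻ k f i) ≤ iter U⁻ k Q (at i)
    iter⁻-values zero c h = h
    iter⁻-values (suc k) c h = iter⁻-values k (λ r → ∑-nonNeg J (λ t → c _)) (U⁻-values c h)

    square⁺ : ∀ {Q f} → NonNeg Q → (∀ i → i ℕ.≤ J → Q (at i) ≤ ι (f i)) → ∀ i → i ℕ.≤ J → Q (at i) * Q (at i) ≤ ι (square f i)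
    square⁺ {f = f} hQ h i l = ≤-trans (sq-mono (hQ _) (h i l)) (≤-reflexive (sym (ι-* (f i) (f i))))

    square⁻ : ∀ {Q : ℕ → Carrier} {f} → (∀ i → i ℕ.≤ J → ι (f i) ≤ Q (at i)) → ∀ i → i ℕ.≤ J → ι (square f i) ≤ Q (at i) * Q (at i)
    square⁻ {f = f} h i l = ≤-trans (≤-reflexive (ι-* (f i) (f i))) (sq-mono (0≤ι (f i)) (h i l))

    module _ (d : ℕ → ℕ) where

      -- A step function that rises by `d t` as its argument falls to X^(J - t). It is decreasing
      -- for any choice of `d`, and its values at the powers of X are prefix sums.
      y : ℕ → Carrier
      y n = ∑ (suc J) (λ t → ι (d (ℕ.pred t)) * 𝟙 (n ℕ.≤? at (ℕ.pred t)))

      y-cut : Cut R y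
      y-cut = record
        { nonNeg = λ n → ∑-nonNeg (suc J) (λ t → *-nonNeg (0≤ι (d (ℕ.pred t))) (𝟙-nonNeg (n ℕ.≤? at (ℕ.pred t))))
        ; antitone = λ {m} {n} l → ∑-mono (suc J) (λ t _ _ → *-monoˡ (0≤ι (d (ℕ.pred t))) (𝟙-mono (n ℕ.≤? at (ℕ.pred t)) (m ℕ.≤? at (ℕ.pred t)) (ℕ.≤-trans l)))
        ; support = λ n l → trans (∑-cong (suc J) (λ t _ _ → trans (cong (ι (d (ℕ.pred t)) *_) (𝟙-no (n ℕ.≤? at (ℕ.pred t)) (λ h → ℕ.<⇒≱ l (ℕ.≤-trans h (ℕ.^-monoʳ-≤ X ⦃ ℕ.>-nonZero 1≤X ⦄ (ℕ.m∸n≤m J (ℕ.pred t))))))) (zeroʳ _))) (∑-0 (suc J)) }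

      y-at : ∀ i → i ℕ.≤ J → y (at i) ≡ ι (pre⁺ d i)
      y-at i i≤J = trans (cut (i ℕ.≟ J)) (trans (∑-cong (suc i) keep) (sym (ι-pre⁺ d i)))
        where
        g : ℕ → Carrier
        g t = ι (d (ℕ.pred t)) * 𝟙 (at i ℕ.≤? at (ℕ.pred t))
        less : ∀ {i t J} → i ℕ.< t → i ℕ.< J → J ℕ.∸ t ℕ.< J ℕ.∸ i
        less {i} {t} {J} a b = ℕ.<-≤-trans (ℕ.s≤s (ℕ.∸-monoʳ-≤ J a)) (ℕ.≤-reflexive (sym (ℕ.+-∸-assoc 1 b)))
        cut : Dec (i ≡ J) → ∑ (suc J) g ≡ ∑ (suc i) g
        cut (yes refl) = refl
        cut (no i≢J) = ∑-support (ℕ.s≤s i≤J) λ { (suc t) (ℕ.s≤s i<t) →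
          trans (cong (ι (d t) *_) (𝟙-no (at i ℕ.≤? at t) (ℕ.<⇒≱ (ℕ.^-monoʳ-< X 2≤X (less i<t (ℕ.≤∧≢⇒< i≤J i≢J)))))) (zeroʳ _) }
        keep : ∀ t → 1 ℕ.≤ t → t ℕ.≤ suc i → ι (d (ℕ.pred t)) * 𝟙 (at i ℕ.≤? at (ℕ.pred t)) ≡ ι (d (ℕ.pred t))
        keep (suc t) _ (ℕ.s≤s t≤i) = trans (cong (ι (d t) *_) (𝟙-yes (at i ℕ.≤? at t) (ℕ.^-monoʳ-≤ X ⦃ ℕ.>-nonZero 1≤X ⦄ (ℕ.∸-monoʳ-≤ J t≤i)))) (*-identityʳ _)

  -- Comparison of the main terms.

  bernoulli : ∀ {a} n → 0# ≤ a → a ≤ 1# → 1# - ι n * a ≤ (1# - a) ^ n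
  bernoulli {a} zero 0≤a a≤1 = ≤-reflexive (solve 1 (λ a → :1 :- con (pos 0) :* a := :1) refl a)
  bernoulli {a} (suc n) 0≤a a≤1 = begin
    1# - ι (suc n) * a ≡⟨ cong (λ t → 1# - t * a) (ι-suc n) ⟩
    1# - (1# + ι n) * a ≤⟨ x≤x+y (*-nonNeg (0≤ι n) (sq-nonNeg a)) ⟩
    1# - (1# + ι n) * a + ι n * (a * a) ≡⟨ solve 2 (λ n a → :1 :- (:1 :+ n) :* a :+ n :* (a :* a) := (:1 :- a) :* (:1 :- n :* a)) refl (ι n) a ⟩
    (1# - a) * (1# - ι n * a) ≤⟨ *-monoˡ (≤⇒0≤- a≤1) (bernoulli n 0≤a a≤1) ⟩
    (1# - a) * (1# - a) ^ n ∎
    where open ≤-Reasoning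

  ι-reflects-≤ : ∀ {m n} → ι m ≤ ι n → m ℕ.≤ n
  ι-reflects-≤ {m} {n} h with ℕ.≤-total m n
  ... | inj₁ l = l
  ... | inj₂ l = ℕ.≤-reflexive (ι-injective (antisym h (ι-mono l)))

  1-x≤1 : ∀ {x} → 0# ≤ x → 1# - x ≤ 1#
  1-x≤1 {x} h = 0≤-⇒≤ (subst (0# ≤_) (solve 1 (λ x → x := :1 :- (:1 :- x)) refl x) h)

  -- The numerical contradiction: all small losses are collected in r = 1 − 1/M.
  module Contradiction (l j x J : ℕ) (1≤j : 1 ℕ.≤ j) (1≤x : 1 ℕ.≤ x) (1≤J : 1 ℕ.≤ J)
      (large : 2 ℕ.* (suc l ℕ.* suc l) ℕ.≤ 1 ℕ.+ 2 ℕ.* j) where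
    open Config l j x J 1≤j 1≤x 1≤J large

    module _ {M K N : ℕ} (1≤M : 1 ℕ.≤ M) (1≤N : 1 ℕ.≤ N)
        (z-large : M ℕ.* (suc (l ℕ.+ (2 ℕ.+ l)) ℕ.* C) ℕ.≤ z) (V-large : ι (M ℕ.* (suc k ℕ.* suc W)) ≤ V) (2≤V : ι 2 ≤ V)
        {E₁ E₂ ε P⁺ P⁻ : Carrier} (0≤P⁺ : 0# ≤ P⁺) (0≤P⁻ : 0# ≤ P⁻) (0≤ε : 0# ≤ ε) (0≤E₂ : 0# ≤ E₂)
        (upper : q * E₁ ≤ μ⁺ ^ k * P⁺) (lower : q ^ (l ℕ.+ (2 ℕ.+ l)) * (μ⁻ ^ (2 ℕ.+ l) * P⁻) ≤ E₂)
        (ε≤ : ε ≤ ι N * (ρ W * ρ W ^ k))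
        (compare : ι (2 ℕ.* k) * (ι N * ρ (φ W) * E₂ - ε) ≤ (ι (suc K) * V + ι 2) * (ι N * ρ W * E₁ + (ε + ε))) where

      private
        m = l ℕ.+ (2 ℕ.+ l)
        r L w f A v a m⁻ m⁺ : Carrier
        r = 1# - ρ M
        L = ι (suc K) * V + ι 2
        w = ρ W
        f = ρ (φ W)
        A = ι N
        v = V ⁻¹
        a = ι (suc W) * v
        m⁻ = V - ι W
        m⁺ = V + (1# + ι W)

        ρM≤1 : ρ M ≤ 1#
        ρM≤1 = subst (ρ M ≤_) ρ1 (ρ-antitone ℕ.≤-refl 1≤M)
        0≤r : 0# ≤ r
        0≤r = ≤⇒0≤- ρM≤1
        r≤1 : r ≤ 1#
        r≤1 = 1-x≤1 (0≤ρ M)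
        0≤V : 0# ≤ V
        0≤V = 0≤ℋ X
        1≤V : 1# ≤ V
        1≤V = ≤-trans (ι-mono {1} {2} (ℕ.s≤s ℕ.z≤n)) 2≤V
        V≢0 : V ≢ 0#
        V≢0 = 1≤⇒≢0 1≤V
        0≤v : 0# ≤ v
        0≤v = ⁻¹-nonNeg 0≤V V≢0
        0≤L : 0# ≤ L
        0≤L = 0≤+ (*-nonNeg (0≤ι (suc K)) 0≤V) (0≤ι 2)
        0≤w : 0# ≤ w
        0≤w = 0≤ρ W
        1≤φW = 1≤φ W 1≤W

        -- M n ≤ 1/u gives n u ≤ 1/M
        small : ∀ n u {U} → 0# ≤ u → U * u ≡ 1# → ι (M ℕ.* n) ≤ U → ι n * u ≤ ρ M
        small n u {U} 0≤u Uu h = begin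
          ι n * u ≡⟨ cong (_* u) (sym (trans (cong (_* ι n) (trans (*-comm (ρ M) (ι M)) (ρ-inverse 1≤M))) (*-identityˡ (ι n)))) ⟩
          ρ M * ι M * ι n * u ≡⟨ solve 4 (λ r m n u → r :* m :* n :* u := r :* (m :* n :* u)) refl (ρ M) (ι M) (ι n) u ⟩
          ρ M * (ι M * ι n * u) ≤⟨ *-monoˡ (0≤ρ M) (≤-trans (*-monoʳ 0≤u (≤-trans (≤-reflexive (sym (ι-* M n))) h)) (≤-reflexive Uu)) ⟩
          ρ M * 1# ≡⟨ *-identityʳ (ρ M) ⟩
          ρ M ∎
          where open ≤-Reasoning

        -- By Bernoulli, a loss `u` taken `n` times still leaves 1 - 1/M when n u ≤ 1/M. It serves
        -- the convergent products, the lower cell masses and the upper cell masses, one factor `r`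
        -- for each; this is the cube in the final inequality.
        r≤-of : ∀ n u → 0# ≤ u → u ≤ 1# → ι n * u ≤ ρ M → r ≤ (1# - u) ^ n
        r≤-of n u 0≤u u≤1 h = ≤-trans (+-monoʳ-≤ 1# (neg-≤ h)) (bernoulli n 0≤u u≤1)

        r≤q : r ≤ q ^ suc m
        r≤q = r≤-of (suc m) (ι C * ρ z) (*-nonNeg (0≤ι C) (0≤ρ z)) (≤-trans (*-monoʳ (0≤ρ z) (ι-mono large)) (≤-reflexive (ρ-inverse 1≤z)))
          (≤-trans (≤-reflexive (trans (sym (*-assoc (ι (suc m)) (ι C) (ρ z))) (cong (_* ρ z) (sym (ι-* (suc m) C))))) (small (suc m ℕ.* C) (ρ z) (0≤ρ z) (ρ-inverse 1≤z) (ι-mono z-large)))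

        Va : V * a ≡ ι (suc W)
        Va = trans (solve 3 (λ V w v → V :* (w :* v) := w :* (V :* v)) refl V (ι (suc W)) v) (trans (cong (ι (suc W) *_) (⁻¹-inverseʳ V≢0)) (*-identityʳ _))

        0≤a : 0# ≤ a
        0≤a = *-nonNeg (0≤ι (suc W)) 0≤v

        ka≤ : ι (suc k) * a ≤ ρ M
        ka≤ = ≤-trans (≤-reflexive (trans (sym (*-assoc _ _ v)) (cong (_* v) (sym (ι-* (suc k) (suc W)))))) (small (suc k ℕ.* suc W) v 0≤v (⁻¹-inverseʳ V≢0) V-large)

        a≤1 : a ≤ 1#
        a≤1 = ≤-trans (≤-trans (≤-reflexive (sym (*-identityˡ a))) (*-monoʳ 0≤a (1≤ι {suc k} (ℕ.s≤s ℕ.z≤n)))) (≤-trans ka≤ ρM≤1)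

        0≤1-a : 0# ≤ 1# - a
        0≤1-a = ≤⇒0≤- a≤1

        V[1-a]≤m⁻ : V * (1# - a) ≤ m⁻
        V[1-a]≤m⁻ = ≤-trans (≤-reflexive (trans (solve 2 (λ V a → V :* (:1 :- a) := V :- V :* a) refl V a) (cong (λ t → V - t) Va))) (+-monoʳ-≤ V (neg-≤ (ι-mono (ℕ.n≤1+n W))))

        m⁺≡ : m⁺ ≡ V * (1# + a)
        m⁺≡ = sym (trans (solve 2 (λ V a → V :* (:1 :+ a) := V :+ V :* a) refl V a) (cong (V +_) (trans Va (ι-suc W))))

        0≤m⁻ : 0# ≤ m⁻
        0≤m⁻ = ≤-trans (*-nonNeg 0≤V 0≤1-a) V[1-a]≤m⁻

        0≤μ⁻′ : 0# ≤ μ⁻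
        0≤μ⁻′ = *-nonNeg 0≤κ 0≤m⁻

        0≤m⁺ : 0# ≤ m⁺
        0≤m⁺ = 0≤+ 0≤V (0≤+ 0≤1 (0≤ι W))

        r≤[1-a] : r ≤ (1# - a) ^ suc k
        r≤[1-a] = r≤-of (suc k) a 0≤a a≤1 ka≤

        Vr≤m⁻ : V ^ suc k * r ≤ m⁻ ^ suc k
        Vr≤m⁻ = ≤-trans (*-monoˡ (^-nonNeg (suc k) 0≤V) r≤[1-a]) (≤-trans (≤-reflexive (sym (*-^ V (1# - a) (suc k)))) (^-mono (suc k) (*-nonNeg 0≤V 0≤1-a) V[1-a]≤m⁻))

        rm⁺≤V : r * m⁺ ^ k ≤ V ^ k
        rm⁺≤V = begin
          r * m⁺ ^ k ≡⟨ cong (λ t → r * t ^ k) m⁺≡ ⟩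
          r * (V * (1# + a)) ^ k ≡⟨ cong (r *_) (*-^ V (1# + a) k) ⟩
          r * (V ^ k * (1# + a) ^ k) ≤⟨ *-monoʳ (*-nonNeg (^-nonNeg k 0≤V) (^-nonNeg k 0≤1+a)) (≤-trans r≤[1-a]
                                                            (≤-trans (*-monoʳ (^-nonNeg k 0≤1-a) (1-x≤1 0≤a)) (≤-reflexive (*-identityˡ _)))) ⟩
          (1# - a) ^ k * (V ^ k * (1# + a) ^ k) ≡⟨ solve 3 (λ b c d → b :* (c :* d) := c :* (b :* d)) refl ((1# - a) ^ k) (V ^ k) ((1# + a) ^ k) ⟩
          V ^ k * ((1# - a) ^ k * (1# + a) ^ k) ≤⟨ *-monoˡ (^-nonNeg k 0≤V) (≤-trans (≤-reflexive (sym (*-^ (1# - a) (1# + a) k))) (≤1-^ k (*-nonNeg 0≤1-a 0≤1+a) diff)) ⟩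
          V ^ k * 1# ≡⟨ *-identityʳ _ ⟩
          V ^ k ∎
          where
          open ≤-Reasoning
          0≤1+a = 0≤+ 0≤1 0≤a
          diff : (1# - a) * (1# + a) ≤ 1#
          diff = ≤-trans (≤-reflexive (solve 1 (λ a → (:1 :- a) :* (:1 :+ a) := :1 :- a :* a) refl a)) (1-x≤1 (sq-nonNeg a))

        c₁ c₂ : Carrier
        c₁ = ι (2 ℕ.* k)
        c₂ = c₁ + (L + L)

        0≤c₁ : 0# ≤ c₁
        0≤c₁ = 0≤ι (2 ℕ.* k)
        0≤c₂ : 0# ≤ c₂
        0≤c₂ = 0≤+ 0≤c₁ (0≤+ 0≤L 0≤L)

        rearranged : c₁ * (A * f * E₂) ≤ L * (A * w * E₁) + c₂ * ε
        rearranged = 0≤-⇒≤ (subst (0# ≤_) (solve 5 (λ c L e₂ e₁ ε → L :* (e₁ :+ (ε :+ ε)) :- c :* (e₂ :- ε) := L :* e₁ :+ (c :+ (L :+ L)) :* ε :- c :* e₂) refl c₁ L (A * f * E₂) (A * w * E₁) ε) (≤⇒0≤- compare))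

        κ^k D : Carrier
        κ^k = κ ^ k
        D = A * w * κ^k

        w≤κ : w ≤ κ
        w≤κ = ≤-trans (≤-reflexive (sym (*-identityˡ w))) (*-monoʳ 0≤w (1≤ι 1≤φW))

        w≢0 : w ≢ 0#
        w≢0 e = 1≢0 (trans (sym (ρ-inverse 1≤W)) (trans (cong (ι W *_) e) (zeroʳ _)))

        κ≢0 : κ ≢ 0#
        κ≢0 = *-≢0 (ι≢0 1≤φW) w≢0

        ^-≢0 : ∀ {x} n → x ≢ 0# → x ^ n ≢ 0#
        ^-≢0 zero h = 1≢0
        ^-≢0 (suc n) h = *-≢0 h (^-≢0 n h)

        0≤D : 0# ≤ D
        0≤D = *-nonNeg (*-nonNeg (0≤ι N) 0≤w) (^-nonNeg k 0≤κ)

        fκ : f * κ ≡ w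
        fκ = trans (sym (*-assoc f (ι (φ W)) w)) (trans (cong (_* w) (trans (*-comm f _) (ρ-inverse 1≤φW))) (*-identityˡ w))

        -- The prime side has density 1/φ(W) and one more power of κ than the other side. Since
        -- κ/φ(W) = 1/W, both sides have the common factor `D`, and cancelling it removes N and the
        -- densities of W.
        scaled : D * (c₁ * r * m⁻ ^ suc k * P⁻) ≤ D * (L * m⁺ ^ k * P⁺ + c₂)
        scaled = begin
          D * (c₁ * r * m⁻ ^ suc k * P⁻)
            ≡⟨ cong (λ t → A * t * κ^k * (c₁ * r * m⁻ ^ suc k * P⁻)) (sym fκ) ⟩
          A * (f * κ) * κ^k * (c₁ * r * m⁻ ^ suc k * P⁻)
            ≡⟨ solve 8 (λ A f κ K c r m P → A :* (f :* κ) :* K :* (c :* r :* m :* P) := c :* (A :* f :* (r :* ((κ :* K) :* m :* P)))) refl A f κ κ^k c₁ r (m⁻ ^ suc k) P⁻ ⟩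
          c₁ * (A * f * (r * (κ ^ suc k * m⁻ ^ suc k * P⁻)))
            ≡⟨ cong (λ t → c₁ * (A * f * (r * (t * P⁻)))) (sym (*-^ κ m⁻ (suc k))) ⟩
          c₁ * (A * f * (r * (μ⁻ ^ suc k * P⁻)))
            ≤⟨ *-monoˡ 0≤c₁ (*-monoˡ (*-nonNeg (0≤ι N) (0≤ρ (φ W))) (≤-trans (*-monoʳ 0≤μP r≤q) (≤-trans (≤-reflexive (*-assoc q (q ^ m) _)) (*-monoˡ 0≤q lower)))) ⟩
          c₁ * (A * f * (q * E₂))
            ≡⟨ solve 4 (λ c b q e → c :* (b :* (q :* e)) := q :* (c :* (b :* e))) refl c₁ (A * f) q E₂ ⟩
          q * (c₁ * (A * f * E₂))
            ≤⟨ *-monoˡ 0≤q rearranged ⟩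
          q * (L * (A * w * E₁) + c₂ * ε)
            ≡⟨ solve 6 (λ q L b e c ε → q :* (L :* (b :* e) :+ c :* ε) := L :* b :* (q :* e) :+ q :* (c :* ε)) refl q L (A * w) E₁ c₂ ε ⟩
          L * (A * w) * (q * E₁) + q * (c₂ * ε)
            ≤⟨ +-mono-≤ (*-monoˡ (*-nonNeg 0≤L (*-nonNeg (0≤ι N) 0≤w)) upper) (≤-trans (*-monoʳ (*-nonNeg 0≤c₂ 0≤ε) (1-x≤1 (*-nonNeg (0≤ι C) (0≤ρ z)))) (≤-reflexive (*-identityˡ _))) ⟩
          L * (A * w) * (μ⁺ ^ k * P⁺) + c₂ * ε
            ≤⟨ +-mono-≤ (≤-reflexive (cong (λ t → L * (A * w) * (t * P⁺)) (*-^ κ m⁺ k))) (*-monoˡ 0≤c₂ (≤-trans ε≤ (*-monoˡ (0≤ι N) (*-monoˡ 0≤w (^-mono k 0≤w w≤κ))))) ⟩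
          L * (A * w) * (κ^k * m⁺ ^ k * P⁺) + c₂ * (A * (w * κ^k))
            ≡⟨ solve 7 (λ L A w K m P c → L :* (A :* w) :* (K :* m :* P) :+ c :* (A :* (w :* K)) := A :* w :* K :* (L :* m :* P :+ c)) refl L A w κ^k (m⁺ ^ k) P⁺ c₂ ⟩
          D * (L * m⁺ ^ k * P⁺ + c₂) ∎
          where
          open ≤-Reasoning
          0≤μP : 0# ≤ μ⁻ ^ suc k * P⁻
          0≤μP = *-nonNeg (^-nonNeg (suc k) 0≤μ⁻′) 0≤P⁻

        core : c₁ * r * m⁻ ^ suc k * P⁻ ≤ L * m⁺ ^ k * P⁺ + c₂
        core = *-cancelˡ-≤ 0≤D (*-≢0 (*-≢0 (ι≢0 1≤N) w≢0) (^-≢0 k κ≢0)) scaled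

        c₃ : Carrier
        c₃ = ι (2 ℕ.+ K)

        L≤ : L ≤ c₃ * V
        L≤ = ≤-trans (+-monoʳ-≤ _ 2≤V) (≤-reflexive (trans (solve 2 (λ k v → k :* v :+ v := (:1 :+ k) :* v) refl (ι (suc K)) V) (cong (_* V) (sym (ι-suc (suc K))))))

        1≤V^ : ∀ n → 1# ≤ V ^ n
        1≤V^ zero = ≤-refl
        1≤V^ (suc n) = ≤-trans (≤-reflexive (sym (*-identityˡ 1#))) (*-mono 0≤1 (^-nonNeg n 0≤V) 1≤V (1≤V^ n))

        c₂≤ : c₂ ≤ V ^ suc k * (c₁ + (c₃ + c₃))
        c₂≤ = begin
          c₁ + (L + L) ≤⟨ +-mono-≤ (≤-trans (≤-reflexive (sym (*-identityˡ c₁))) (*-monoʳ 0≤c₁ 1≤V)) (+-mono-≤ L≤ L≤) ⟩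
          V * c₁ + (c₃ * V + c₃ * V) ≡⟨ solve 3 (λ V c d → V :* c :+ (d :* V :+ d :* V) := V :* (c :+ (d :+ d))) refl V c₁ c₃ ⟩
          V * (c₁ + (c₃ + c₃)) ≤⟨ *-monoʳ (0≤+ 0≤c₁ (0≤+ (0≤ι (2 ℕ.+ K)) (0≤ι (2 ℕ.+ K)))) (≤-trans (≤-reflexive (sym (*-identityʳ V))) (*-monoˡ 0≤V (1≤V^ k))) ⟩
          V ^ suc k * (c₁ + (c₃ + c₃)) ∎
          where open ≤-Reasoning

        final : V ^ suc k * (c₁ * (r * r * r) * P⁻) ≤ V ^ suc k * (c₃ * P⁺ + (c₁ + (c₃ + c₃)))
        final = begin
          V ^ suc k * (c₁ * (r * r * r) * P⁻)
            ≡⟨ solve 4 (λ U c r P → U :* (c :* (r :* r :* r) :* P) := r :* (c :* r :* (U :* r) :* P)) refl (V ^ suc k) c₁ r P⁻ ⟩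
          r * (c₁ * r * (V ^ suc k * r) * P⁻)
            ≤⟨ *-monoˡ 0≤r (*-monoʳ 0≤P⁻ (*-monoˡ (*-nonNeg 0≤c₁ 0≤r) Vr≤m⁻)) ⟩
          r * (c₁ * r * m⁻ ^ suc k * P⁻)
            ≤⟨ *-monoˡ 0≤r core ⟩
          r * (L * m⁺ ^ k * P⁺ + c₂)
            ≡⟨ solve 5 (λ r L m P c → r :* (L :* m :* P :+ c) := L :* (r :* m) :* P :+ r :* c) refl r L (m⁺ ^ k) P⁺ c₂ ⟩
          L * (r * m⁺ ^ k) * P⁺ + r * c₂
            ≤⟨ +-mono-≤ (*-monoʳ 0≤P⁺ (*-mono 0≤L (^-nonNeg k 0≤V) L≤ rm⁺≤V)) (≤-trans (≤-trans (*-monoʳ 0≤c₂ r≤1) (≤-reflexive (*-identityˡ c₂))) c₂≤) ⟩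
          c₃ * V * V ^ k * P⁺ + V ^ suc k * (c₁ + (c₃ + c₃))
            ≡⟨ solve 5 (λ c V U P d → c :* V :* U :* P :+ V :* U :* d := V :* U :* (c :* P :+ d)) refl c₃ V (V ^ k) P⁺ (c₁ + (c₃ + c₃)) ⟩
          V ^ suc k * (c₃ * P⁺ + (c₁ + (c₃ + c₃))) ∎
          where open ≤-Reasoning

        reduced : c₁ * (r * r * r) * P⁻ ≤ c₃ * P⁺ + (c₁ + (c₃ + c₃))
        reduced = *-cancelˡ-≤ (^-nonNeg (suc k) 0≤V) (^-≢0 (suc k) V≢0) final

        M-1 = M ℕ.∸ 1

        Mr : ι M * r ≡ ι M-1
        Mr = trans (solve 2 (λ m s → m :* (:1 :- s) := m :- m :* s) refl (ι M) (ρ M)) (trans (cong (λ t → ι M - t) (ρ-inverse 1≤M)) (sym (ι-∸ 1≤M)))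

      numeric : ∀ n⁺ n⁻ → P⁺ ≤ ι n⁺ → ι n⁻ ≤ P⁻ →
        2 ℕ.* k ℕ.* (M-1 ℕ.* M-1 ℕ.* M-1) ℕ.* n⁻ ℕ.≤ M ℕ.* M ℕ.* M ℕ.* ((2 ℕ.+ K) ℕ.* n⁺ ℕ.+ (2 ℕ.* k ℕ.+ ((2 ℕ.+ K) ℕ.+ (2 ℕ.+ K))))
      numeric n⁺ n⁻ h⁺ h⁻ = ι-reflects-≤ (begin
        ι (2 ℕ.* k ℕ.* (M-1 ℕ.* M-1 ℕ.* M-1) ℕ.* n⁻)
          ≡⟨ trans (ι-* (2 ℕ.* k ℕ.* (M-1 ℕ.* M-1 ℕ.* M-1)) n⁻) (cong (_* ι n⁻) (trans (ι-* (2 ℕ.* k) (M-1 ℕ.* M-1 ℕ.* M-1)) (cong (c₁ *_) (trans (ι-* (M-1 ℕ.* M-1) M-1) (cong (_* ι M-1) (ι-* M-1 M-1)))))) ⟩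
        c₁ * (ι M-1 * ι M-1 * ι M-1) * ι n⁻
          ≡⟨ cong (λ t → c₁ * (t * t * t) * ι n⁻) (sym Mr) ⟩
        c₁ * (ι M * r * (ι M * r) * (ι M * r)) * ι n⁻
          ≡⟨ solve 4 (λ c m r n → c :* (m :* r :* (m :* r) :* (m :* r)) :* n := m :* m :* m :* (c :* (r :* r :* r) :* n)) refl c₁ (ι M) r (ι n⁻) ⟩
        ι M * ι M * ι M * (c₁ * (r * r * r) * ι n⁻)
          ≤⟨ *-monoˡ 0≤M³ (≤-trans (*-monoˡ (*-nonNeg 0≤c₁ (*-nonNeg (*-nonNeg 0≤r 0≤r) 0≤r)) h⁻) (≤-trans reduced (+-monoˡ-≤ _ (*-monoˡ (0≤ι (2 ℕ.+ K)) h⁺)))) ⟩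
        ι M * ι M * ι M * (c₃ * ι n⁺ + (c₁ + (c₃ + c₃)))
          ≡⟨ sym (trans (ι-* (M ℕ.* M ℕ.* M) _) (cong₂ _*_ (trans (ι-* (M ℕ.* M) M) (cong (_* ι M) (ι-* M M)))
               (trans (ι-+ ((2 ℕ.+ K) ℕ.* n⁺) _) (cong₂ _+_ (ι-* (2 ℕ.+ K) n⁺) (trans (ι-+ (2 ℕ.* k) _) (cong (c₁ +_) (ι-+ (2 ℕ.+ K) (2 ℕ.+ K)))))))) ⟩
        ι (M ℕ.* M ℕ.* M ℕ.* ((2 ℕ.+ K) ℕ.* n⁺ ℕ.+ (2 ℕ.* k ℕ.+ ((2 ℕ.+ K) ℕ.+ (2 ℕ.+ K))))) ∎)
        where
        open ≤-Reasoning
        0≤M³ = *-nonNeg (*-nonNeg (0≤ι M) (0≤ι M)) (0≤ι M)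

  -- Choice of the error parameters, and the sieve inequality.

  ∑[]-lower : ∀ {A : Set} {xs : List A} {f : A → Carrier} {B} → All (λ x → B ≤ f x) xs → ι (length xs) * B ≤ ∑[ xs ] f
  ∑[]-lower {B = B} [] = ≤-reflexive (zeroˡ B)
  ∑[]-lower {xs = x ∷ xs} {B = B} (h ∷ hs) = ≤-trans (≤-reflexive (trans (cong (_* B) (ι-suc (length xs))) (solve 2 (λ n b → (:1 :+ n) :* b := b :+ n :* b) refl (ι (length xs)) B)))
    (+-mono-≤ h (∑[]-lower hs))

  module Conclude (l j x J : ℕ) (1≤j : 1 ℕ.≤ j) (1≤x : 1 ℕ.≤ x) (1≤J : 1 ℕ.≤ J)
      (large : 2 ℕ.* (suc l ℕ.* suc l) ℕ.≤ 1 ℕ.+ 2 ℕ.* j) (hs : List ℕ) (distinct : AllPairs _≢_ hs)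
      (hs≤z : All (ℕ._≤ 1 ℕ.+ 2 ℕ.* j) hs) (len : length hs ≡ suc l) (d : ℕ → ℕ) where
    open SieveSums l j x J 1≤j 1≤x 1≤J large hs distinct hs≤z len

    2≤X : 2 ℕ.≤ X
    2≤X = ℕ.≤-trans (ℕ.*-monoʳ-≤ 2 (1≤odd j)) (subst (ℕ._≤ X) (ℕ.*-identityˡ W) (ℕ.*-monoˡ-≤ W 1≤x))

    open Values X J 2≤X using (y; y-cut; y-at; at; iter⁺-values; iter⁻-values; square⁺; square⁻; U⁻-values)

    Y₀ n⁺ n⁻ : ℕ
    Y₀ = pre⁺ d J
    n⁺ = iterℕ pre⁺ k (square (pre⁺ d)) J
    n⁻ = iterℕ pre⁻ l (square (pre⁻ (pre⁺ d))) J

    private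
      yd : ℕ → Carrier
      yd = y d
      cy : Cut R yd
      cy = y-cut d
      at-J : at J ≡ 1
      at-J = cong (X ℕ.^_) (ℕ.n∸n≡0 J)
      y1 : yd 1 ≡ ι Y₀
      y1 = trans (cong yd (sym at-J)) (y-at d J ℕ.≤-refl)
      P⁺≤ : P⁺ cy ≤ ι n⁺
      P⁺≤ = subst (λ t → iter U⁺ k (λ r → yd r * yd r) t ≤ ι n⁺) at-J
        (iter⁺-values U⁺-cut k (Cut-sq cy) (square⁺ {f = pre⁺ d} (Cut.nonNeg cy) (λ i h → ≤-reflexive (y-at d i h))) J ℕ.≤-refl)
      ≤P⁻ : ι n⁻ ≤ P⁻ cy
      ≤P⁻ = subst (λ t → ι n⁻ ≤ iter U⁻ l (λ r → U⁻ yd r * U⁻ yd r) t) at-J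
        (iter⁻-values l (sq-nonNeg′ (U⁻ yd)) (square⁻ {Q = U⁻ yd} {f = pre⁻ (pre⁺ d)} (U⁻-values {f = pre⁺ d} (Cut.nonNeg cy) (λ i h → ≤-reflexive (sym (y-at d i h))))) J ℕ.≤-refl)
      iter-nonNeg : ∀ (U : Op) → (∀ {Q} → NonNeg Q → NonNeg (U Q)) → ∀ k {Q} → NonNeg Q → NonNeg (iter U k Q)
      iter-nonNeg U h zero c = c
      iter-nonNeg U h (suc k) c = iter-nonNeg U h k (h c)
      0≤P⁺ : 0# ≤ P⁺ cy
      0≤P⁺ = iter-nonNeg U⁺ (λ c r → ∑-nonNeg J (λ i → c _)) k (sq-nonNeg′ yd) 1
      0≤P⁻ : 0# ≤ P⁻ cy
      0≤P⁻ = ≤-trans (0≤ι n⁻) ≤P⁻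

    module _ (K N M : ℕ) (1≤M : 1 ℕ.≤ M) (big : W ℕ.* TT ℕ.≤ N) (v : ℕ) (coprime-v : All (λ h → Coprime (v ℕ.+ h) W) hs)
        (z-large : M ℕ.* (suc (l ℕ.+ (2 ℕ.+ l)) ℕ.* C) ℕ.≤ z) (V-large : ι (M ℕ.* (suc k ℕ.* suc W)) ≤ V)
        (numeric< : M ℕ.* M ℕ.* M ℕ.* ((2 ℕ.+ K) ℕ.* n⁺ ℕ.+ (2 ℕ.* k ℕ.+ ((2 ℕ.+ K) ℕ.+ (2 ℕ.+ K)))) ℕ.< 2 ℕ.* k ℕ.* ((M ℕ.∸ 1) ℕ.* (M ℕ.∸ 1) ℕ.* (M ℕ.∸ 1)) ℕ.* n⁻)
        (H : ℕ) (1≤H : 1 ℕ.≤ H) (hh≤H : hh ≤ ι H) (L≤H : ι (suc K) * V + ι 2 ≤ ι H) (1≤Y₀ : 1 ℕ.≤ Y₀) where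

      -- The errors must not exceed N/W^(k+1), which is `ε`. With trade parameter `τ` the crude half
      -- of an error is at most half of that, and the averaged half is so as soon as the sum of the
      -- errors is at most N divided by `Zℕ`. The number `H` bounds all logarithms involved.
      Wk Qℕ τ Zℕ : ℕ
      Wk = W ℕ.^ suc k
      Qℕ = (Y₀ ℕ.* H ℕ.^ (2 ℕ.* k)) ℕ.* (Y₀ ℕ.* H ℕ.^ (2 ℕ.* k))
      τ = 2 ℕ.* Wk ℕ.* Qℕ ℕ.* (4 ℕ.* H ℕ.* H ℕ.^ c₀)
      Zℕ = 2 ℕ.* Wk ℕ.* Qℕ ℕ.* τ

      L ε s t : Carrier
      L = ι (suc K) * V + ι 2
      ε = ι N * (ρ W * ρ W ^ k)
      s = ρ τ
      t = ι τ

      private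
        1≤Wk : 1 ℕ.≤ Wk
        1≤Wk = 1≤^ W (suc k) 1≤W
        1≤Q : 1 ℕ.≤ Qℕ
        1≤Q = ℕ.*-mono-≤ one one
          where one = ℕ.*-mono-≤ 1≤Y₀ (1≤^ H (2 ℕ.* k) 1≤H)
        1≤τ : 1 ℕ.≤ τ
        1≤τ = ℕ.*-mono-≤ (ℕ.*-mono-≤ (ℕ.*-mono-≤ {1} {2} (ℕ.s≤s ℕ.z≤n) 1≤Wk) 1≤Q) (ℕ.*-mono-≤ (ℕ.*-mono-≤ {1} {4} (ℕ.s≤s ℕ.z≤n) 1≤H) (1≤^ H c₀ 1≤H))
        1≤N : 1 ℕ.≤ N
        1≤N = ℕ.≤-trans (ℕ.*-mono-≤ 1≤W 1≤TT) big
        st : s * t ≡ 1#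
        st = trans (*-comm s t) (ρ-inverse 1≤τ)
        0≤s = 0≤ρ τ
        0≤t = 0≤ι τ
        ι-^ : ∀ m n → ι (m ℕ.^ n) ≡ ι m ^ n
        ι-^ m zero = refl
        ι-^ m (suc n) = trans (ι-* m (m ℕ.^ n)) (cong (ι m *_) (ι-^ m n))
        0≤hh : 0# ≤ hh
        0≤hh = 0≤ℋ TT
        hh^≤ : ∀ n → hh ^ n ≤ ι (H ℕ.^ n)
        hh^≤ n = ≤-trans (^-mono n 0≤hh hh≤H) (≤-reflexive (sym (ι-^ H n)))
        0≤V = 0≤ℋ X
        0≤L : 0# ≤ L
        0≤L = 0≤+ (*-nonNeg (0≤ι (suc K)) 0≤V) (0≤ι 2)
        h≤N : ∀ {h} → h ∈ hs → h ℕ.≤ N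
        h≤N m = ℕ.≤-trans (All.lookup hs≤z m) (ℕ.≤-trans z≤R (ℕ.≤-trans (ℕ.m≤m*n R R ⦃ ℕ.>-nonZero 1≤R ⦄) (ℕ.≤-trans (subst (ℕ._≤ W ℕ.* TT) (ℕ.*-identityˡ TT) (ℕ.*-monoˡ-≤ TT 1≤W)) big)))

      error≤ε : ∀ {S η} → 0# ≤ S → 0# ≤ η → ι Zℕ * S ≤ ι N → η ≤ ι (4 ℕ.* H ℕ.* N) → ℰ (yd 1) s t S η ≤ ε
      error≤ε {S} {η} 0≤S 0≤η hS hη = *-cancelˡ-≤ {ι Wk} (0≤ι Wk) (ι≢0 1≤Wk) (*-cancelˡ-≤ {ι 2} (0≤ι 2) (ι≢0 {2} (ℕ.s≤s ℕ.z≤n)) (begin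
        ι 2 * (ι Wk * ℰ (yd 1) s t S η)
          ≤⟨ *-monoˡ (0≤ι 2) (*-monoˡ (0≤ι Wk) ℰ≤) ⟩
        ι 2 * (ι Wk * (ι Qℕ * (t * S + s * (ι (4 ℕ.* H ℕ.* N) * ι (H ℕ.^ c₀)))))
          ≡⟨ solve 7 (λ w q t S s a b → con (pos 2) :* (w :* (q :* (t :* S :+ s :* (a :* b)))) := con (pos 2) :* w :* q :* t :* S :+ s :* (con (pos 2) :* w :* q :* (a :* b))) refl
               (ι Wk) (ι Qℕ) t S s (ι (4 ℕ.* H ℕ.* N)) (ι (H ℕ.^ c₀)) ⟩
        ι 2 * ι Wk * ι Qℕ * t * S + s * (ι 2 * ι Wk * ι Qℕ * (ι (4 ℕ.* H ℕ.* N) * ι (H ℕ.^ c₀)))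
          ≡⟨ cong₂ (λ u z → u * S + s * z) (sym eZ) eτ ⟩
        ι Zℕ * S + s * (t * ι N)
          ≤⟨ +-mono-≤ hS (≤-reflexive (trans (sym (*-assoc s t (ι N))) (trans (cong (_* ι N) st) (*-identityˡ (ι N))))) ⟩
        ι N + ι N
          ≡⟨ solve 1 (λ n → n :+ n := con (pos 2) :* (n :* :1)) refl (ι N) ⟩
        ι 2 * (ι N * 1#)
          ≡⟨ cong (λ u → ι 2 * (ι N * u)) (sym wk) ⟩
        ι 2 * (ι N * (ι Wk * (ρ W * ρ W ^ k)))
          ≡⟨ solve 3 (λ n w r → con (pos 2) :* (n :* (w :* r)) := con (pos 2) :* (w :* (n :* r))) refl (ι N) (ι Wk) (ρ W * ρ W ^ k) ⟩
        ι 2 * (ι Wk * ε) ∎))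
        where
        open ≤-Reasoning
        eZ : ι Zℕ ≡ ι 2 * ι Wk * ι Qℕ * t
        eZ = trans (ι-* (2 ℕ.* Wk ℕ.* Qℕ) τ) (cong (_* t) (trans (ι-* (2 ℕ.* Wk) Qℕ) (cong (_* ι Qℕ) (ι-* 2 Wk))))
        lN : ∀ a h n b → a ℕ.* (4 ℕ.* h ℕ.* n ℕ.* b) ≡ a ℕ.* (4 ℕ.* h ℕ.* b) ℕ.* n
        lN = ℕ-ring
        eτ : ι 2 * ι Wk * ι Qℕ * (ι (4 ℕ.* H ℕ.* N) * ι (H ℕ.^ c₀)) ≡ t * ι N
        eτ = trans (cong₂ _*_ (sym (trans (ι-* (2 ℕ.* Wk) Qℕ) (cong (_* ι Qℕ) (ι-* 2 Wk)))) (sym (ι-* (4 ℕ.* H ℕ.* N) (H ℕ.^ c₀))))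
          (trans (sym (ι-* (2 ℕ.* Wk ℕ.* Qℕ) _)) (trans (cong ι (lN (2 ℕ.* Wk ℕ.* Qℕ) H N (H ℕ.^ c₀))) (ι-* τ N)))
        wk : ι Wk * (ρ W * ρ W ^ k) ≡ 1#
        wk = go (suc k)
          where
          go : ∀ n → ι (W ℕ.^ n) * ρ W ^ n ≡ 1#
          go zero = *-identityˡ 1#
          go (suc n) = trans (cong (_* ρ W ^ suc n) (ι-* W (W ℕ.^ n))) (trans (solve 4 (λ a b c d → a :* b :* (c :* d) := (a :* c) :* (b :* d)) refl (ι W) (ι (W ℕ.^ n)) (ρ W) (ρ W ^ n))
            (trans (cong₂ _*_ (ρ-inverse 1≤W) (go n)) (*-identityˡ 1#)))
        0≤g : 0# ≤ yd 1 * hh ^ (2 ℕ.* k)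
        0≤g = *-nonNeg (Cut.nonNeg cy 1) (^-nonNeg (2 ℕ.* k) 0≤hh)
        g≤ : yd 1 * hh ^ (2 ℕ.* k) ≤ ι (Y₀ ℕ.* H ℕ.^ (2 ℕ.* k))
        g≤ = ≤-trans (*-mono (Cut.nonNeg cy 1) (0≤ι (H ℕ.^ (2 ℕ.* k))) (≤-reflexive y1) (hh^≤ (2 ℕ.* k))) (≤-reflexive (sym (ι-* Y₀ (H ℕ.^ (2 ℕ.* k)))))
        ℰ≤ : ℰ (yd 1) s t S η ≤ ι Qℕ * (t * S + s * (ι (4 ℕ.* H ℕ.* N) * ι (H ℕ.^ c₀)))
        ℰ≤ = *-mono (*-nonNeg 0≤g 0≤g) (0≤+ (*-nonNeg 0≤t 0≤S) (*-nonNeg 0≤s (*-nonNeg (0≤ι (4 ℕ.* H ℕ.* N)) (0≤ι (H ℕ.^ c₀)))))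
          (≤-trans (*-mono 0≤g (≤-trans 0≤g g≤) g≤ g≤) (≤-reflexive (sym (ι-* (Y₀ ℕ.* H ℕ.^ (2 ℕ.* k)) (Y₀ ℕ.* H ℕ.^ (2 ℕ.* k))))))
          (+-monoʳ-≤ (t * S) (*-monoˡ 0≤s (*-mono 0≤η (0≤ι (H ℕ.^ c₀)) hη (hh^≤ c₀))))

      module _ (room : Zℕ ℕ.* (4 ℕ.* (H ℕ.* H) ℕ.* TT) ℕ.≤ N)
          (a : ℕ → Carrier) (a≤1 : ∀ n → a n ≈[ 1# ] 0#) (eB : ℕ → Carrier) (0≤eB : NonNeg eB)
          (clB : ∀ q v → 1 ℕ.≤ q → q ℕ.≤ TT → ∑ N (λ n → 𝟙 (W ℕ.* q ∣? ℕ.∣ n - v ∣) * a n) ≈[ eB q ] 0#)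
          (smallB : ι (2 ℕ.* Zℕ) * ∑ TT eB ≤ ι N)
          (lp eA : ℕ → ℕ → Carrier) (lp≤L : ∀ h → h ∈ hs → ∀ m → 1 ℕ.≤ m → m ℕ.≤ N ℕ.+ h → lp h m ≈[ L ] 0#) (0≤eA : ∀ h → NonNeg (eA h))
          (clA : ∀ h → h ∈ hs → ∀ q a → 1 ℕ.≤ q → q ℕ.≤ TT → Coprime a (W ℕ.* q) →
            ∑ (N ℕ.+ h) (λ m → 𝟙 (W ℕ.* q ∣? ℕ.∣ m - a ∣) * (𝟙 (prime? m) * lp h m)) ≈[ eA h q ] ι (N ℕ.+ h) * ρ (φ (W ℕ.* q)))
          (smallA : ∀ h → h ∈ hs → ι (2 ℕ.* Zℕ) * ∑ TT (eA h) ≤ ι N)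
          (pointwise : ∀ n → 1 ℕ.≤ n → ι 2 * ∑[ hs ] (λ h → 𝟙 (R ℕ.<? n ℕ.+ h) * 𝟙 (prime? (n ℕ.+ h))) ≤ 1# + a n) where

        private
          E₁ E₂ : Carrier
          E₁ = Model.E (λ p → ι k * ρ p) ps yd yd
          E₂ = Model.E (λ p → ι l * ρ (p ℕ.∸ 1)) ps yd yd

          SS : (ℕ → Carrier) → Carrier
          SS b = S cy 0≤s 0≤t st N v b

          halves : ∀ {x y} → ι (2 ℕ.* Zℕ) * x ≤ ι N → ι (2 ℕ.* Zℕ) * y ≤ ι N → ι Zℕ * (x + y) ≤ ι N
          halves {x} {y} hx hy = *-cancelˡ-≤ {ι 2} (0≤ι 2) (ι≢0 {2} (ℕ.s≤s ℕ.z≤n)) (≤-trans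
            (≤-reflexive (trans (solve 3 (λ z x y → con (pos 2) :* (z :* (x :+ y)) := (con (pos 2) :* z) :* x :+ (con (pos 2) :* z) :* y) refl (ι Zℕ) x y)
              (cong (λ u → u * x + u * y) (sym (ι-* 2 Zℕ))))) (≤-trans (+-mono-≤ hx hy) (≤-reflexive (solve 1 (λ n → n :+ n := con (pos 2) :* n) refl (ι N)))))

          half : ∀ {x} → 0# ≤ x → ι (2 ℕ.* Zℕ) * x ≤ ι N → ι Zℕ * x ≤ ι N
          half {x} 0≤x hx = ≤-trans (*-monoʳ 0≤x (ι-mono (ℕ.m≤m+n Zℕ _))) hx

          room′ : ι (2 ℕ.* Zℕ) * ι (2 ℕ.* (H ℕ.* H) ℕ.* TT) ≤ ι N
          room′ = ≤-trans (≤-reflexive (trans (sym (ι-* (2 ℕ.* Zℕ) _)) (cong ι (lem Zℕ (H ℕ.* H) TT)))) (ι-mono room)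
            where
            lem : ∀ z h t → 2 ℕ.* z ℕ.* (2 ℕ.* h ℕ.* t) ≡ z ℕ.* (4 ℕ.* h ℕ.* t)
            lem = ℕ-ring

          TT≤ : ι TT ≤ ι (2 ℕ.* (H ℕ.* H) ℕ.* TT)
          TT≤ = ι-mono (subst (ℕ._≤ 2 ℕ.* (H ℕ.* H) ℕ.* TT) (ℕ.*-identityˡ TT) (ℕ.*-monoˡ-≤ TT (ℕ.*-mono-≤ {1} {2} (ℕ.s≤s ℕ.z≤n) (ℕ.*-mono-≤ 1≤H 1≤H))))

          N≤4HN : ∀ c → c ℕ.≤ 4 → ι (c ℕ.* N) ≤ ι (4 ℕ.* H ℕ.* N)
          N≤4HN c c≤4 = ι-mono (ℕ.*-monoˡ-≤ N (subst (ℕ._≤ 4 ℕ.* H) (ℕ.*-identityʳ c) (ℕ.*-mono-≤ c≤4 1≤H)))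

          upper₁ : SS (λ _ → 1#) ≤ ι N * ρ W * E₁ + ε
          upper₁ = ≤-trans (proj₁ (count cy 0≤s 0≤t st N v big)) (+-monoʳ-≤ _ (error≤ε (0≤ι TT) (0≤ι N)
            (half (0≤ι TT) (≤-trans (*-monoˡ (0≤ι (2 ℕ.* Zℕ)) TT≤) room′)) (subst (λ u → ι u ≤ ι (4 ℕ.* H ℕ.* N)) (ℕ.*-identityˡ N) (N≤4HN 1 (ℕ.s≤s ℕ.z≤n)))))

          upperₐ : SS a ≤ ε
          upperₐ = ≤-trans (proj₁ (signed cy 0≤s 0≤t st N v a eB big 0≤eB a≤1 clB)) (≤-trans (≤-reflexive (+-identityˡ _))
            (error≤ε (∑-nonNeg TT 0≤eB) (*-nonNeg (0≤ι 2) (0≤ι N)) (half (∑-nonNeg TT 0≤eB) smallB) (≤-trans (≤-reflexive (sym (ι-* 2 N))) (N≤4HN 2 (ℕ.s≤s (ℕ.s≤s ℕ.z≤n))))))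

          0≤μ⁻ : 0# ≤ μ⁻
          0≤μ⁻ = *-nonNeg 0≤κ (≤⇒0≤- (≤-trans (ι-mono (ℕ.≤-trans (ℕ.n≤1+n W) (ℕ.≤-trans (ℕ.m≤n*m (suc W) (suc k)) (ℕ.m≤n*m (suc k ℕ.* suc W) M ⦃ ℕ.>-nonZero 1≤M ⦄)))) V-large))

          lower′ : q ^ (l ℕ.+ (2 ℕ.+ l)) * (μ⁻ ^ (2 ℕ.+ l) * P⁻ cy) ≤ E₂
          lower′ = main-lower cy 0≤μ⁻

          0≤E₂ : 0# ≤ E₂
          0≤E₂ = ≤-trans (*-nonNeg (^-nonNeg (l ℕ.+ (2 ℕ.+ l)) 0≤q) (*-nonNeg (^-nonNeg (2 ℕ.+ l) 0≤μ⁻) 0≤P⁻)) lower′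

          2≤V : ι 2 ≤ V
          2≤V = ≤-trans (ι-mono (ℕ.≤-trans (ℕ.≤-trans (ℕ.s≤s (ℕ.s≤s ℕ.z≤n)) (ℕ.m≤m*n (suc k) (suc W))) (ℕ.m≤n*m (suc k ℕ.* suc W) M ⦃ ℕ.>-nonZero 1≤M ⦄))) V-large

          b : ℕ → ℕ → Carrier
          b h n = 𝟙 (R ℕ.<? n ℕ.+ h) * (𝟙 (prime? (n ℕ.+ h)) * lp h (n ℕ.+ h))

          lower₂ : ∀ {h} → h ∈ hs → ι N * ρ (φ W) * E₂ - ε ≤ SS (b h)
          lower₂ {h} h∈ = begin
            ι N * ρ (φ W) * E₂ - ε
              ≤⟨ +-mono-≤ (*-monoʳ 0≤E₂ (*-monoʳ (0≤ρ (φ W)) (ι-mono (ℕ.m≤m+n N h)))) (neg-≤ err) ⟩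
            ι N′ * ρ (φ W) * E₂ - e₂
              ≤⟨ 0≤-⇒≤ (subst (0# ≤_) (solve 3 (λ d s e → s :+ e :- d := s :- (d :- e)) refl (ι N′ * ρ (φ W) * E₂) (SS (b h)) e₂) (≤⇒0≤- (proj₂ est))) ⟩
            SS (b h) ∎
            where
            open ≤-Reasoning
            N′ = N ℕ.+ h
            est = SieveSums.Primes.primes l j x J 1≤j 1≤x 1≤J large hs distinct hs≤z len cy 0≤s 0≤t st h∈ N big (lp h) L 0≤L (lp≤L h h∈) (eA h) (0≤eA h) (clA h h∈) {v} (All.lookup coprime-v h∈)
            S₂ = ∑ TT (eA h) + L * (ι R * hh + ι TT)
            η₂ = L * (ι 2 * ι N) + ι N′
            e₂ = ℰ (yd 1) s t S₂ η₂
            0≤tail = *-nonNeg 0≤L (0≤+ (*-nonNeg (0≤ι R) 0≤hh) (0≤ι TT))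
            tail≤ : L * (ι R * hh + ι TT) ≤ ι (2 ℕ.* (H ℕ.* H) ℕ.* TT)
            tail≤ = begin
              L * (ι R * hh + ι TT) ≤⟨ *-mono 0≤L (0≤+ (*-nonNeg (0≤ι TT) (0≤ι H)) (*-nonNeg (0≤ι TT) (0≤ι H))) L≤H
                                                 (+-mono-≤ (*-mono (0≤ι R) (0≤ι H) (ι-mono (ℕ.m≤m*n R R ⦃ ℕ.>-nonZero 1≤R ⦄)) hh≤H) (≤-trans (≤-reflexive (sym (*-identityʳ _))) (*-monoˡ (0≤ι TT) (1≤ι 1≤H)))) ⟩
              ι H * (ι TT * ι H + ι TT * ι H) ≡⟨ solve 2 (λ h t → h :* (t :* h :+ t :* h) := con (pos 2) :* (h :* h) :* t) refl (ι H) (ι TT) ⟩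
              ι 2 * (ι H * ι H) * ι TT ≡⟨ sym (trans (ι-* (2 ℕ.* (H ℕ.* H)) TT) (cong (_* ι TT) (trans (ι-* 2 (H ℕ.* H)) (cong (ι 2 *_) (ι-* H H))))) ⟩
              ι (2 ℕ.* (H ℕ.* H) ℕ.* TT) ∎
            η≤ : η₂ ≤ ι (4 ℕ.* H ℕ.* N)
            η≤ = begin
              L * (ι 2 * ι N) + ι N′ ≤⟨ +-mono-≤ (*-monoʳ (*-nonNeg (0≤ι 2) (0≤ι N)) L≤H) (≤-trans (≤-reflexive (ι-+ N h)) (≤-trans (+-monoʳ-≤ (ι N) (ι-mono (h≤N h∈)))
                                                 (≤-trans (≤-reflexive (solve 1 (λ n → n :+ n := :1 :* (con (pos 2) :* n)) refl (ι N))) (*-monoʳ (*-nonNeg (0≤ι 2) (0≤ι N)) (1≤ι 1≤H))))) ⟩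
              ι H * (ι 2 * ι N) + ι H * (ι 2 * ι N) ≡⟨ solve 2 (λ h n → h :* (con (pos 2) :* n) :+ h :* (con (pos 2) :* n) := con (pos 4) :* h :* n) refl (ι H) (ι N) ⟩
              ι 4 * ι H * ι N ≡⟨ sym (trans (ι-* (4 ℕ.* H) N) (cong (_* ι N) (ι-* 4 H))) ⟩
              ι (4 ℕ.* H ℕ.* N) ∎
            err : e₂ ≤ ε
            err = error≤ε (0≤+ (∑-nonNeg TT (0≤eA h)) 0≤tail) (0≤+ (*-nonNeg 0≤L (*-nonNeg (0≤ι 2) (0≤ι N))) (0≤ι N′))
              (halves (smallA h h∈) (≤-trans (*-monoˡ (0≤ι (2 ℕ.* Zℕ)) tail≤) room′)) η≤

          I Λ² : ℕ → Carrier
          I n = 𝟙 (W ℕ.* 1 ∣? ℕ.∣ n - v ∣)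
          Λ² n = Λ ps yd n * Λ ps yd n

          -- The logarithmic weights are bounded by `L` term by term, after which the inequality
          -- between primes and λ is multiplied by the nonnegative square of the sieve weight and
          -- summed.
          total≤ : ι 2 * ∑[ hs ] (λ h → SS (b h)) ≤ L * (SS (λ _ → 1#) + SS a)
          total≤ = begin
            ι 2 * ∑[ hs ] (λ h → SS (b h))
              ≡⟨ trans (cong (ι 2 *_) (sym (∑-swap N hs (λ n h → I n * (b h n * Λ² n))))) (sym (∑-scale N (ι 2) _)) ⟩
            ∑ N (λ n → ι 2 * ∑[ hs ] (λ h → I n * (b h n * Λ² n)))
              ≤⟨ ∑-mono N each ⟩
            ∑ N (λ n → L * (I n * (1# * Λ² n) + I n * (a n * Λ² n)))
              ≡⟨ trans (∑-scale N L _) (cong (L *_) (∑-+ N _ _)) ⟩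
            L * (SS (λ _ → 1#) + SS a) ∎
            where
            open ≤-Reasoning
            each : ∀ n → 1 ℕ.≤ n → n ℕ.≤ N → ι 2 * ∑[ hs ] (λ h → I n * (b h n * Λ² n)) ≤ L * (I n * (1# * Λ² n) + I n * (a n * Λ² n))
            each n 1≤n n≤N = begin
              ι 2 * ∑[ hs ] (λ h → I n * (b h n * Λ² n))
                ≤⟨ *-monoˡ (0≤ι 2) (bounded (All.tabulate (λ h∈ → h∈))) ⟩
              ι 2 * (L * (I n * Λ² n) * ∑[ hs ] c)
                ≡⟨ solve 3 (λ m g s → con (pos 2) :* (m :* g :* s) := m :* (g :* (con (pos 2) :* s))) refl L (I n * Λ² n) (∑[ hs ] c) ⟩
              L * (I n * Λ² n * (ι 2 * ∑[ hs ] c))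
                ≤⟨ *-monoˡ 0≤L (*-monoˡ 0≤IΛ (pointwise n 1≤n)) ⟩
              L * (I n * Λ² n * (1# + a n))
                ≡⟨ cong (L *_) (solve 3 (λ i g a → i :* g :* (:1 :+ a) := i :* (:1 :* g) :+ i :* (a :* g)) refl (I n) (Λ² n) (a n)) ⟩
              L * (I n * (1# * Λ² n) + I n * (a n * Λ² n)) ∎
              where
              c : ℕ → Carrier
              c h = 𝟙 (R ℕ.<? n ℕ.+ h) * 𝟙 (prime? (n ℕ.+ h))
              0≤IΛ : 0# ≤ I n * Λ² n
              0≤IΛ = *-nonNeg (𝟙-nonNeg (W ℕ.* 1 ∣? ℕ.∣ n - v ∣)) (sq-nonNeg (Λ ps yd n))
              bounded : ∀ {gs} → All (_∈ hs) gs → ∑[ gs ] (λ h → I n * (b h n * Λ² n)) ≤ L * (I n * Λ² n) * ∑[ gs ] c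
              bounded [] = ≤-reflexive (sym (zeroʳ _))
              bounded {h ∷ gs} (h∈ ∷ rest) = ≤-trans (+-mono-≤ one (bounded rest)) (≤-reflexive (sym (distribˡ _ _ _)))
                where
                one : I n * (b h n * Λ² n) ≤ L * (I n * Λ² n) * c h
                one = ≤-trans (≤-reflexive (solve 5 (λ i r p x g → i :* (r :* (p :* x) :* g) := x :* (i :* g :* (r :* p))) refl (I n) (𝟙 (R ℕ.<? n ℕ.+ h)) (𝟙 (prime? (n ℕ.+ h))) (lp h (n ℕ.+ h)) (Λ² n)))
                  (≤-trans (*-monoʳ (*-nonNeg 0≤IΛ (*-nonNeg (𝟙-nonNeg (R ℕ.<? n ℕ.+ h)) (𝟙-nonNeg (prime? (n ℕ.+ h)))))
                    (≤-trans (proj₁ (lp≤L h h∈ (n ℕ.+ h) (ℕ.≤-trans 1≤n (ℕ.m≤m+n n h)) (ℕ.+-monoˡ-≤ h n≤N))) (≤-reflexive (+-identityˡ L))))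
                    (≤-reflexive (sym (*-assoc L _ _))))

          compare : ι (2 ℕ.* k) * (ι N * ρ (φ W) * E₂ - ε) ≤ L * (ι N * ρ W * E₁ + (ε + ε))
          compare = begin
            ι (2 ℕ.* k) * B₂ ≡⟨ trans (cong (_* B₂) (ι-* 2 k)) (*-assoc (ι 2) (ι k) B₂) ⟩
            ι 2 * (ι k * B₂) ≡⟨ cong (λ m → ι 2 * (ι m * B₂)) (sym len) ⟩
            ι 2 * (ι (length hs) * B₂) ≤⟨ *-monoˡ (0≤ι 2) (∑[]-lower (All.tabulate lower₂)) ⟩
            ι 2 * ∑[ hs ] (λ h → SS (b h)) ≤⟨ total≤ ⟩
            L * (SS (λ _ → 1#) + SS a) ≤⟨ *-monoˡ 0≤L (≤-trans (+-mono-≤ upper₁ upperₐ) (≤-reflexive (+-assoc _ ε ε))) ⟩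
            L * (ι N * ρ W * E₁ + (ε + ε)) ∎
            where
            open ≤-Reasoning
            B₂ = ι N * ρ (φ W) * E₂ - ε

        absurd : ⊥
        absurd = ℕ.<⇒≱ numeric< (Contradiction.numeric l j x J 1≤j 1≤x 1≤J large {M} {K} {N} 1≤M 1≤N z-large V-large 2≤V
          0≤P⁺ 0≤P⁻ (*-nonNeg (0≤ι N) (*-nonNeg (0≤ρ W) (^-nonNeg k (0≤ρ W)))) 0≤E₂ (main-upper cy) lower′ ≤-refl compare n⁺ n⁻ P⁺≤ ≤P⁻)

  -- The sieve contradiction from distribution estimates.

  -- Rational forms of conditions (A) and (B) at level num/1000.
  PrimeLevel : ℕ → Set
  PrimeLevel num = ∀ A → ∃ λ B → ∀ N Y g → 1 ℕ.≤ g → 4 ℕ.^ g ℕ.≤ N → Y ℕ.^ 1000 ℕ.≤ N → 1 ℕ.≤ Y → ∃ λ (lp : ℕ → Carrier) → ∃ λ (e : ℕ → Carrier) → NonNeg e ×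
    (∀ m → 1 ℕ.≤ m → m ℕ.≤ N → lp m ≤ ℋ m + 1# × 0# ≤ lp m + 1#) ×
    (∀ q a → 1 ℕ.≤ q → q ℕ.≤ Y ℕ.^ num → Coprime a q → ∑ N (λ m → 𝟙 (q ∣? ℕ.∣ m - a ∣) * (𝟙 (prime? m) * lp m)) ≈[ e q ] ι N * ρ (φ q)) ×
    ι (g ℕ.^ A) * ∑ (Y ℕ.^ num) e ≤ ι (B ℕ.* N)

  SignLevel : (ℕ → Carrier) → ℕ → Set
  SignLevel lam num = ∀ A → ∃ λ B → ∀ N Y g → 1 ℕ.≤ g → 4 ℕ.^ g ℕ.≤ N → Y ℕ.^ 1000 ℕ.≤ N → 1 ℕ.≤ Y → ∃ λ (e : ℕ → Carrier) → NonNeg e ×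
    (∀ q a y → 1 ℕ.≤ q → q ℕ.≤ Y ℕ.^ num → y ℕ.≤ N → ∑ y (λ n → 𝟙 (q ∣? ℕ.∣ n - a ∣) * lam n) ≈[ e q ] 0#) ×
    ι (g ℕ.^ A) * ∑ (Y ℕ.^ num) e ≤ ι (B ℕ.* N)

  private
    n<2^n : ∀ n → n ℕ.< 2 ℕ.^ n
    n<2^n zero = ℕ.s≤s ℕ.z≤n
    n<2^n (suc n) = ℕ.≤-trans (ℕ.+-mono-≤ (ℕ.≤-trans (ℕ.s≤s ℕ.z≤n) (n<2^n n)) (n<2^n n)) (ℕ.≤-reflexive (cong (2 ℕ.^ n ℕ.+_) (sym (ℕ.+-identityʳ (2 ℕ.^ n)))))

  -- Taking g as a power 2^u makes g^e a power of two, so it is enough to have C + u e ≤ 2 · 2^u; u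
  -- is chosen even to get a product of two exponentials on the right.
  polynomial≤exponential : ∀ C e g₀ → ∃ λ g → 1 ℕ.≤ g × g₀ ℕ.≤ g × C ℕ.* g ℕ.^ e ℕ.≤ 4 ℕ.^ g
  polynomial≤exponential C e g₀ = g , 1≤^ 2 u (ℕ.s≤s ℕ.z≤n) , ℕ.≤-trans g₀≤u (ℕ.<⇒≤ (n<2^n u)) , bound
    where
    w u g : ℕ
    w = suc (C ℕ.+ e ℕ.+ g₀)
    u = w ℕ.+ w
    g = 2 ℕ.^ u
    g₀≤w : g₀ ℕ.≤ w
    g₀≤w = ℕ.m≤n⇒m≤1+n (ℕ.m≤n+m g₀ (C ℕ.+ e))
    g₀≤u : g₀ ℕ.≤ u
    g₀≤u = ℕ.≤-trans g₀≤w (ℕ.m≤m+n w w)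
    C+e≤w : C ℕ.+ e ℕ.≤ w
    C+e≤w = ℕ.m≤n⇒m≤1+n (ℕ.m≤m+n (C ℕ.+ e) g₀)
    l₁ : ∀ w e C → C ℕ.* w ℕ.+ (w ℕ.+ w) ℕ.* e ℕ.+ C ℕ.* w ≡ 2 ℕ.* (w ℕ.* (C ℕ.+ e))
    l₁ = ℕ-ring
    exponent : C ℕ.+ u ℕ.* e ℕ.≤ 2 ℕ.* g
    exponent = ℕ.≤-trans (ℕ.+-monoˡ-≤ (u ℕ.* e) (ℕ.m≤m*n C w)) (ℕ.≤-trans (ℕ.m≤m+n _ (C ℕ.* w)) (ℕ.≤-trans (ℕ.≤-reflexive (l₁ w e C))
      (ℕ.*-monoʳ-≤ 2 (ℕ.≤-trans (ℕ.*-mono-≤ (ℕ.<⇒≤ (n<2^n w)) (ℕ.≤-trans C+e≤w (ℕ.<⇒≤ (n<2^n w)))) (ℕ.≤-reflexive (sym (ℕ.^-distribˡ-+-* 2 w w)))))))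
    bound : C ℕ.* g ℕ.^ e ℕ.≤ 4 ℕ.^ g
    bound = ℕ.≤-trans (ℕ.*-monoˡ-≤ (g ℕ.^ e) (ℕ.<⇒≤ (n<2^n C))) (ℕ.≤-trans (ℕ.≤-reflexive (trans (cong (2 ℕ.^ C ℕ.*_) (ℕ.^-*-assoc 2 u e)) (sym (ℕ.^-distribˡ-+-* 2 C (u ℕ.* e)))))
      (ℕ.≤-trans (ℕ.^-monoʳ-≤ 2 exponent) (ℕ.≤-reflexive (sym (ℕ.^-*-assoc 2 2 g)))))

  -- H(4u) ≥ H(u) + 1
  ι≤ℋ : ∀ g → ι g ≤ ℋ (4 ℕ.^ g)
  ι≤ℋ zero = 0≤ℋ 1
  ι≤ℋ (suc g) = ≤-trans (≤-reflexive (ι-suc g)) (≤-trans (+-mono-≤ tail (ι≤ℋ g)) (≤-reflexive (trans (+-comm _ _) (sym (∑-append u (3 ℕ.* u) ρ)))))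
    where
    u = 4 ℕ.^ g
    r2 : ρ 2 ≡ ι 2 * ρ 4
    r2 = trans (sym (*-identityʳ (ρ 2))) (trans (cong (ρ 2 *_) (sym (ρ-inverse {2} (ℕ.s≤s ℕ.z≤n)))) (trans (solve 1 (λ r → r :* (con (pos 2) :* r) := con (pos 2) :* (r :* r)) refl (ρ 2)) (cong (ι 2 *_) (sym (ρ-* 2 2)))))
    2≤ℋ4 : ι 2 ≤ ℋ 4
    2≤ℋ4 = begin
      1# + 1# ≡⟨ cong (1# +_) (sym (ρ-inverse {2} (ℕ.s≤s ℕ.z≤n))) ⟩
      1# + ι 2 * ρ 2 ≡⟨ solve 1 (λ r → :1 :+ con (pos 2) :* r := con (pos 0) :+ :1 :+ r :+ r) refl (ρ 2) ⟩
      0# + 1# + ρ 2 + ρ 2 ≡⟨ cong₂ (λ a b → 0# + a + ρ 2 + b) (sym ρ1) (trans r2 (solve 1 (λ r → con (pos 2) :* r := r :+ r) refl (ρ 4))) ⟩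
      0# + ρ 1 + ρ 2 + (ρ 4 + ρ 4) ≤⟨ +-monoʳ-≤ _ (+-monoˡ-≤ (ρ 4) (ρ-antitone {3} {4} (ℕ.s≤s ℕ.z≤n) (ℕ.n≤1+n 3))) ⟩
      0# + ρ 1 + ρ 2 + (ρ 3 + ρ 4) ≡⟨ sym (+-assoc _ (ρ 3) (ρ 4)) ⟩
      ℋ 4 ∎
      where open ≤-Reasoning
    tail : 1# ≤ ∑ (3 ℕ.* u) (λ i → ρ (u ℕ.+ i))
    tail = 0≤-⇒≤ (subst (0# ≤_) (solve 1 (λ s → :1 :+ s :- con (pos 2) := s :- :1) refl (∑ (3 ℕ.* u) (λ i → ρ (u ℕ.+ i)))) (≤⇒0≤- (≤-trans 2≤ℋ4 (segment-lower u 3 (1≤^ 4 g (ℕ.s≤s ℕ.z≤n))))))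

  module Theorem (l : ℕ) (hs : List ℕ) (distinct : AllPairs _≢_ hs) (shape : All (λ h → 2 ∣ h × ℕ.∣ 4 - h ∣ ∣ 8 × h ℕ.≤ 12) hs)
      (len : length hs ≡ suc l) (h₀ : ℕ) (h₀≤ : h₀ ℕ.≤ 12) (num sc J M : ℕ) (num≤ : num ℕ.≤ 1000) (1≤J : 1 ℕ.≤ J) (1≤M : 1 ℕ.≤ M)
      (level : suc (J ℕ.+ J) ℕ.≤ sc ℕ.* num) (d : ℕ → ℕ) (1≤Y₀ : 1 ℕ.≤ pre⁺ d J) where

    private
      k K C m j W z : ℕ
      k = suc l
      K = sc ℕ.* 1000
      C = 2 ℕ.* (k ℕ.* k)
      m = suc (l ℕ.+ (2 ℕ.+ l))
      -- The first summand makes z so large that all convergent products together lose at most 1/M.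
      -- The 6 makes z exceed every shift, as these are at most 12.
      j = M ℕ.* (m ℕ.* C) ℕ.+ 6
      W = 2 ℕ.* odd j
      z = 1 ℕ.+ 2 ℕ.* j

      j≤z : j ℕ.≤ z
      j≤z = ℕ.m≤n⇒m≤1+n (ℕ.m≤m+n j (j ℕ.+ 0))
      z-large : M ℕ.* (m ℕ.* C) ℕ.≤ z
      z-large = ℕ.≤-trans (ℕ.m≤m+n _ 6) j≤z
      large : C ℕ.≤ z
      large = ℕ.≤-trans (ℕ.≤-trans (ℕ.m≤n*m C m) (ℕ.m≤n*m (m ℕ.* C) M ⦃ ℕ.>-nonZero 1≤M ⦄)) z-large
      6≤j : 6 ℕ.≤ j
      6≤j = ℕ.m≤n+m 6 _
      12≤z : 12 ℕ.≤ z
      12≤z = ℕ.m≤n⇒m≤1+n (ℕ.*-monoʳ-≤ 2 6≤j)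
      1≤j : 1 ℕ.≤ j
      1≤j = ℕ.≤-trans (ℕ.s≤s ℕ.z≤n) 6≤j
      z≤odd : z ℕ.≤ odd j
      z≤odd = j≤odd j
      v : ℕ
      v = odd j ℕ.∸ 4
      4≤odd : 4 ℕ.≤ odd j
      4≤odd = ℕ.≤-trans (ℕ.≤-trans (ℕ.m≤m+n 4 8) 12≤z) z≤odd
      v+4 : v ℕ.+ 4 ≡ odd j
      v+4 = ℕ.m∸n+n≡m 4≤odd
      1≤v : 1 ℕ.≤ v
      1≤v = ℕ.+-cancelʳ-≤ 4 1 v (subst (5 ℕ.≤_) (sym v+4) (ℕ.≤-trans (ℕ.≤-trans (ℕ.m≤m+n 5 7) 12≤z) z≤odd))
      hs≤z : All (ℕ._≤ z) hs
      hs≤z = All.map (λ (_ , _ , h≤) → ℕ.≤-trans h≤ 12≤z) shape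
      coprime-v : All (λ h → Coprime (v ℕ.+ h) W) hs
      coprime-v = All.map (λ {h} (e , p , _) {c} → shift-coprime j {v} {h} v+4 e p (ℕ.≤-trans 1≤v (ℕ.m≤m+n v h)) {c}) shape
      1≤W : 1 ℕ.≤ W
      1≤W = ℕ.*-mono-≤ {1} {2} (ℕ.s≤s ℕ.z≤n) (1≤odd j)

      Wk Y₀ c₀ 2k H₁ Z₁ e₀ : ℕ
      Wk = W ℕ.^ suc k
      Y₀ = pre⁺ d J
      c₀ = 18 ℕ.* (k ℕ.* k)
      2k = 2 ℕ.* k
      -- `H₁ * g` has to bound both the logarithmic weight, at most (K + 1) V + 2, and `ℋ` of R², at
      -- most 1 + 2 J V, where V ≤ (W + 5) g.
      H₁ = (suc K ℕ.+ (J ℕ.+ J)) ℕ.* (W ℕ.+ 5) ℕ.+ 2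
      -- Z = Z₁ g^e₀ when H = H₁ g
      Z₁ = 2 ℕ.* Wk ℕ.* ((Y₀ ℕ.* H₁ ℕ.^ 2k) ℕ.* (Y₀ ℕ.* H₁ ℕ.^ 2k)) ℕ.* (2 ℕ.* Wk ℕ.* ((Y₀ ℕ.* H₁ ℕ.^ 2k) ℕ.* (Y₀ ℕ.* H₁ ℕ.^ 2k)) ℕ.* (4 ℕ.* H₁ ℕ.* H₁ ℕ.^ c₀))
      e₀ = (2k ℕ.+ 2k) ℕ.+ ((2k ℕ.+ 2k) ℕ.+ suc c₀)

    module _ (numeric< : M ℕ.* M ℕ.* M ℕ.* ((2 ℕ.+ K) ℕ.* iterℕ pre⁺ k (square (pre⁺ d)) J ℕ.+ (2 ℕ.* k ℕ.+ ((2 ℕ.+ K) ℕ.+ (2 ℕ.+ K))))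
          ℕ.< 2 ℕ.* k ℕ.* ((M ℕ.∸ 1) ℕ.* (M ℕ.∸ 1) ℕ.* (M ℕ.∸ 1)) ℕ.* iterℕ pre⁻ l (square (pre⁻ (pre⁺ d))) J)
        (lam : ℕ → Carrier) (lam≤1 : ∀ n → lam n ≈[ 1# ] 0#) (levelA : PrimeLevel num) (levelB : SignLevel lam num)
        (n₀ : ℕ) (pointwise : ∀ n → n₀ ℕ.< n → ι 2 * ∑[ hs ] (λ h → 𝟙 (prime? (n ℕ.+ h))) ≤ 1# + lam (n ℕ.+ h₀)) where

      private
        -- One power of g more than `Z` has, so that the constants in front are beaten as well.
        A = suc e₀
        hypA = levelA A
        hypB = levelB A
        BA = proj₁ hypA
        BB = proj₁ hypB
        B = suc (BA ℕ.+ BB)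
        -- The four requirements on g: it exceeds `n₀` by 12 so that small n are harmless, it makes
        -- V dominate W, it beats the constants of the two conditions, and 4^g exceeds the
        -- polynomial in g that limits the error terms without averaging.
        choice = polynomial≤exponential (Z₁ ℕ.* (4 ℕ.* (H₁ ℕ.* H₁))) (e₀ ℕ.+ 2) (n₀ ℕ.+ 12 ℕ.+ M ℕ.* (suc k ℕ.* suc W) ℕ.+ 8 ℕ.* B ℕ.* Z₁)
        g = proj₁ choice
        1≤g = proj₁ (proj₂ choice)
        g₀≤g = proj₁ (proj₂ (proj₂ choice))
        room₀ = proj₂ (proj₂ (proj₂ choice))
        n₀+12≤g : n₀ ℕ.+ 12 ℕ.≤ g
        n₀+12≤g = ℕ.≤-trans (ℕ.≤-trans (ℕ.m≤m+n (n₀ ℕ.+ 12) (M ℕ.* (suc k ℕ.* suc W))) (ℕ.m≤m+n _ (8 ℕ.* B ℕ.* Z₁))) g₀≤g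
        MV≤g : M ℕ.* (suc k ℕ.* suc W) ℕ.≤ g
        MV≤g = ℕ.≤-trans (ℕ.≤-trans (ℕ.m≤n+m _ (n₀ ℕ.+ 12)) (ℕ.m≤m+n _ (8 ℕ.* B ℕ.* Z₁))) g₀≤g
        8BZ≤g : 8 ℕ.* B ℕ.* Z₁ ℕ.≤ g
        8BZ≤g = ℕ.≤-trans (ℕ.m≤n+m _ (n₀ ℕ.+ 12 ℕ.+ M ℕ.* (suc k ℕ.* suc W))) g₀≤g
        -- With X = 4^g W the harmonic number V lies between g and (W + 5) g, so that every
        -- logarithm is comparable to the integer g.
        x = 4 ℕ.^ g
        1≤x : 1 ℕ.≤ x
        1≤x = 1≤^ 4 g (ℕ.s≤s ℕ.z≤n)

        module Cn = Conclude l j x J 1≤j 1≤x 1≤J large hs distinct hs≤z len d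

        X R TT N H Y : ℕ
        X = x ℕ.* W
        R = X ℕ.^ J
        TT = R ℕ.* R
        -- As K is 1000 times `sc`, the number `Y` below satisfies Y^1000 = N exactly.
        N = X ℕ.^ K
        H = H₁ ℕ.* g
        Y = X ℕ.^ sc
        2≤X : 2 ℕ.≤ X
        2≤X = Cn.2≤X
        1≤X : 1 ℕ.≤ X
        1≤X = ℕ.<⇒≤ 2≤X
        x≤X : x ℕ.≤ X
        x≤X = ℕ.m≤m*n x W ⦃ ℕ.>-nonZero 1≤W ⦄
        W≤X : W ℕ.≤ X
        W≤X = ℕ.m≤n*m W x ⦃ ℕ.>-nonZero 1≤x ⦄
        g≤x : g ℕ.≤ x
        g≤x = ℕ.≤-trans (ℕ.<⇒≤ (n<2^n g)) (ℕ.^-monoˡ-≤ g (ℕ.s≤s (ℕ.s≤s ℕ.z≤n)))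
        X^-mono : ∀ {a b} → a ℕ.≤ b → X ℕ.^ a ℕ.≤ X ℕ.^ b
        X^-mono = ℕ.^-monoʳ-≤ X ⦃ ℕ.>-nonZero 1≤X ⦄
        TT≡ : TT ≡ X ℕ.^ (J ℕ.+ J)
        TT≡ = sym (ℕ.^-distribˡ-+-* X J J)
        X*TT≤ : X ℕ.* TT ℕ.≤ X ℕ.^ (sc ℕ.* num)
        X*TT≤ = ℕ.≤-trans (ℕ.≤-reflexive (cong (X ℕ.*_) TT≡)) (X^-mono level)
        level≤K : X ℕ.^ (sc ℕ.* num) ℕ.≤ N
        level≤K = X^-mono (ℕ.*-monoʳ-≤ sc num≤)
        X*TT≤N : X ℕ.* TT ℕ.≤ N
        X*TT≤N = ℕ.≤-trans X*TT≤ level≤K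
        big : W ℕ.* TT ℕ.≤ N
        big = ℕ.≤-trans (ℕ.*-monoˡ-≤ TT W≤X) X*TT≤N
        1≤R : 1 ℕ.≤ R
        1≤R = 1≤^ X J 1≤X
        X≤R : X ℕ.≤ R
        X≤R = subst (ℕ._≤ R) (ℕ.*-identityʳ X) (X^-mono 1≤J)
        X≤N : X ℕ.≤ N
        X≤N = ℕ.≤-trans (ℕ.m≤m*n X TT ⦃ ℕ.>-nonZero (ℕ.*-mono-≤ 1≤R 1≤R) ⦄) X*TT≤N
        12≤N : 12 ℕ.≤ N
        12≤N = ℕ.≤-trans (ℕ.≤-trans (ℕ.≤-trans (ℕ.m≤n+m 12 n₀) n₀+12≤g) (ℕ.≤-trans g≤x x≤X)) X≤N
        Y^ : ∀ n → Y ℕ.^ n ≡ X ℕ.^ (sc ℕ.* n)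
        Y^ n = ℕ.^-*-assoc X sc n
        levelY : W ℕ.* TT ℕ.≤ Y ℕ.^ num
        levelY = ℕ.≤-trans (ℕ.≤-trans (ℕ.*-monoˡ-≤ TT W≤X) X*TT≤) (ℕ.≤-reflexive (sym (Y^ num)))
        N≤N+ : ∀ h → N ℕ.≤ N ℕ.+ h
        N≤N+ = ℕ.m≤m+n N
        Y1000 : ∀ h → Y ℕ.^ 1000 ℕ.≤ N ℕ.+ h
        Y1000 h = ℕ.≤-trans (ℕ.≤-reflexive (Y^ 1000)) (N≤N+ h)
        4^g≤ : ∀ h → 4 ℕ.^ g ℕ.≤ N ℕ.+ h
        4^g≤ h = ℕ.≤-trans (ℕ.≤-trans x≤X X≤N) (N≤N+ h)
        N+h≤2N : ∀ {h} → h ℕ.≤ 12 → N ℕ.+ h ℕ.≤ 2 ℕ.* N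
        N+h≤2N h≤ = ℕ.≤-trans (ℕ.+-monoʳ-≤ N (ℕ.≤-trans h≤ 12≤N)) (ℕ.≤-reflexive (cong (N ℕ.+_) (sym (ℕ.+-identityʳ N))))

        V : Carrier
        V = ℋ X
        g≤V : ι g ≤ V
        g≤V = ≤-trans (ι≤ℋ g) (ℋ-mono x≤X)
        V-large : ι (M ℕ.* (suc k ℕ.* suc W)) ≤ V
        V-large = ≤-trans (ι-mono MV≤g) g≤V
        v₀ : ℕ
        v₀ = (W ℕ.+ 5) ℕ.* g
        V≤ : V ≤ ι v₀
        V≤ = begin
          ℋ (x ℕ.* W) ≤⟨ split x 1≤x ⟩
          ℋ W + ℋ x ≤⟨ +-mono-≤ (ℋ≤ι W) (≤-trans (ℋ-^ 4 g (ℕ.s≤s ℕ.z≤n)) (+-monoʳ-≤ 1# (*-monoˡ (0≤ι g) (ℋ≤ι 4)))) ⟩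
          ι W + (1# + ι g * ι 4) ≡⟨ sym (trans (ι-+ W (1 ℕ.+ g ℕ.* 4)) (cong (ι W +_) (trans (ι-suc (g ℕ.* 4)) (cong (1# +_) (ι-* g 4))))) ⟩
          ι (W ℕ.+ (1 ℕ.+ g ℕ.* 4)) ≤⟨ ι-mono nat ⟩
          ι v₀ ∎
          where
          open ≤-Reasoning
          split : ∀ x → 1 ℕ.≤ x → ℋ (x ℕ.* W) ≤ ℋ W + ℋ x
          split (suc x) _ = ≤-trans (ℋ-* x W 1≤W) (+-monoʳ-≤ (ℋ W) (ℋ-mono (ℕ.n≤1+n x)))
          l₁ : ∀ W g → W ℕ.* g ℕ.+ (g ℕ.+ g ℕ.* 4) ≡ (W ℕ.+ 5) ℕ.* g
          l₁ = ℕ-ring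
          nat : W ℕ.+ (1 ℕ.+ g ℕ.* 4) ℕ.≤ v₀
          nat = ℕ.≤-trans (ℕ.+-mono-≤ (ℕ.m≤m*n W g ⦃ ℕ.>-nonZero 1≤g ⦄) (ℕ.+-monoˡ-≤ (g ℕ.* 4) 1≤g)) (ℕ.≤-reflexive (l₁ W g))
        H≡ : H ≡ (suc K ℕ.* v₀ ℕ.+ (J ℕ.+ J) ℕ.* v₀) ℕ.+ 2 ℕ.* g
        H≡ = l₁ (suc K) (J ℕ.+ J) (W ℕ.+ 5) g
          where
          l₁ : ∀ a b w g → ((a ℕ.+ b) ℕ.* w ℕ.+ 2) ℕ.* g ≡ (a ℕ.* (w ℕ.* g) ℕ.+ b ℕ.* (w ℕ.* g)) ℕ.+ 2 ℕ.* g
          l₁ = ℕ-ring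
        2≤2g : 2 ℕ.≤ 2 ℕ.* g
        2≤2g = ℕ.*-monoʳ-≤ 2 1≤g
        L≤H : ι (suc K) * V + ι 2 ≤ ι H
        L≤H = ≤-trans (+-monoˡ-≤ (ι 2) (≤-trans (*-monoˡ (0≤ι (suc K)) V≤) (≤-reflexive (sym (ι-* (suc K) v₀))))) (≤-trans (≤-reflexive (sym (ι-+ (suc K ℕ.* v₀) 2)))
          (ι-mono (subst (suc K ℕ.* v₀ ℕ.+ 2 ℕ.≤_) (sym H≡) (ℕ.+-mono-≤ (ℕ.m≤m+n _ _) 2≤2g))))
        hh≤H : ℋ TT ≤ ι H
        hh≤H = ≤-trans (≤-reflexive (cong ℋ TT≡)) (≤-trans (ℋ-^ X (J ℕ.+ J) 1≤X) (≤-trans (+-monoʳ-≤ 1# (≤-trans (*-monoˡ (0≤ι (J ℕ.+ J)) V≤) (≤-reflexive (sym (ι-* (J ℕ.+ J) v₀)))))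
          (≤-trans (≤-reflexive (trans (+-comm 1# _) (sym (ι-+ ((J ℕ.+ J) ℕ.* v₀) 1)))) (ι-mono (subst ((J ℕ.+ J) ℕ.* v₀ ℕ.+ 1 ℕ.≤_) (sym H≡) (ℕ.+-mono-≤ (ℕ.m≤n+m ((J ℕ.+ J) ℕ.* v₀) (suc K ℕ.* v₀)) (ℕ.≤-trans (ℕ.s≤s ℕ.z≤n) 2≤2g)))))))
        1≤H : 1 ℕ.≤ H
        1≤H = ℕ.≤-trans 1≤g (ℕ.m≤n*m g H₁ ⦃ ℕ.>-nonZero (ℕ.≤-trans (ℕ.s≤s ℕ.z≤n) (ℕ.m≤n+m 2 _)) ⦄)

        Z : ℕ
        Z = Cn.Zℕ K N M 1≤M big v coprime-v z-large V-large numeric< H 1≤H hh≤H L≤H 1≤Y₀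
        Z≡ : Z ≡ Z₁ ℕ.* g ℕ.^ e₀
        Z≡ = begin
          2 ℕ.* Wk ℕ.* (Y₀ ℕ.* H ℕ.^ 2k ℕ.* (Y₀ ℕ.* H ℕ.^ 2k)) ℕ.* (2 ℕ.* Wk ℕ.* (Y₀ ℕ.* H ℕ.^ 2k ℕ.* (Y₀ ℕ.* H ℕ.^ 2k)) ℕ.* (4 ℕ.* H ℕ.* H ℕ.^ c₀))
            ≡⟨ cong₂ (λ a b → 2 ℕ.* Wk ℕ.* (Y₀ ℕ.* a ℕ.* (Y₀ ℕ.* a)) ℕ.* (2 ℕ.* Wk ℕ.* (Y₀ ℕ.* a ℕ.* (Y₀ ℕ.* a)) ℕ.* (4 ℕ.* H ℕ.* b))) (^-distribʳ-* 2k H₁ g) (^-distribʳ-* c₀ H₁ g) ⟩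
          2 ℕ.* Wk ℕ.* (Y₀ ℕ.* (h ℕ.* G) ℕ.* (Y₀ ℕ.* (h ℕ.* G))) ℕ.* (2 ℕ.* Wk ℕ.* (Y₀ ℕ.* (h ℕ.* G) ℕ.* (Y₀ ℕ.* (h ℕ.* G))) ℕ.* (4 ℕ.* (H₁ ℕ.* g) ℕ.* (hc ℕ.* Gc)))
            ≡⟨ lem Wk Y₀ h G H₁ g hc Gc ⟩
          Z₁ ℕ.* ((G ℕ.* G) ℕ.* ((G ℕ.* G) ℕ.* (g ℕ.* Gc)))
            ≡⟨ cong (Z₁ ℕ.*_) (sym (trans (ℕ.^-distribˡ-+-* g (2k ℕ.+ 2k) _) (cong₂ ℕ._*_ (ℕ.^-distribˡ-+-* g 2k 2k) (trans (ℕ.^-distribˡ-+-* g (2k ℕ.+ 2k) (suc c₀)) (cong (ℕ._* (g ℕ.* Gc)) (ℕ.^-distribˡ-+-* g 2k 2k)))))) ⟩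
          Z₁ ℕ.* g ℕ.^ e₀ ∎
          where
          open ≡-Reasoning
          h = H₁ ℕ.^ 2k
          G = g ℕ.^ 2k
          hc = H₁ ℕ.^ c₀
          Gc = g ℕ.^ c₀
          lem : ∀ w y h G H g hc Gc → 2 ℕ.* w ℕ.* (y ℕ.* (h ℕ.* G) ℕ.* (y ℕ.* (h ℕ.* G))) ℕ.* (2 ℕ.* w ℕ.* (y ℕ.* (h ℕ.* G) ℕ.* (y ℕ.* (h ℕ.* G))) ℕ.* (4 ℕ.* (H ℕ.* g) ℕ.* (hc ℕ.* Gc)))
            ≡ 2 ℕ.* w ℕ.* (y ℕ.* h ℕ.* (y ℕ.* h)) ℕ.* (2 ℕ.* w ℕ.* (y ℕ.* h ℕ.* (y ℕ.* h)) ℕ.* (4 ℕ.* H ℕ.* hc)) ℕ.* ((G ℕ.* G) ℕ.* ((G ℕ.* G) ℕ.* (g ℕ.* Gc)))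
          lem = ℕ-ring

        room : Z ℕ.* (4 ℕ.* (H ℕ.* H) ℕ.* TT) ℕ.≤ N
        room = ℕ.≤-trans (ℕ.≤-reflexive eq) (ℕ.≤-trans (ℕ.*-monoˡ-≤ TT (ℕ.≤-trans room₀ x≤X)) X*TT≤N)
          where
          lem : ∀ Z G H g T → Z ℕ.* G ℕ.* (4 ℕ.* (H ℕ.* g ℕ.* (H ℕ.* g)) ℕ.* T) ≡ Z ℕ.* (4 ℕ.* (H ℕ.* H)) ℕ.* (G ℕ.* (g ℕ.* (g ℕ.* 1))) ℕ.* T
          lem = ℕ-ring
          eq : Z ℕ.* (4 ℕ.* (H ℕ.* H) ℕ.* TT) ≡ Z₁ ℕ.* (4 ℕ.* (H₁ ℕ.* H₁)) ℕ.* g ℕ.^ (e₀ ℕ.+ 2) ℕ.* TT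
          eq = trans (cong (ℕ._* (4 ℕ.* (H ℕ.* H) ℕ.* TT)) Z≡) (trans (lem Z₁ (g ℕ.^ e₀) H₁ g TT) (cong (λ t → Z₁ ℕ.* (4 ℕ.* (H₁ ℕ.* H₁)) ℕ.* t ℕ.* TT) (sym (ℕ.^-distribˡ-+-* g e₀ 2))))

        8BZ≤g^A : 8 ℕ.* B ℕ.* Z ℕ.≤ g ℕ.^ A
        8BZ≤g^A = ℕ.≤-trans (ℕ.≤-reflexive (trans (cong (8 ℕ.* B ℕ.*_) Z≡) (sym (ℕ.*-assoc (8 ℕ.* B) Z₁ (g ℕ.^ e₀))))) (ℕ.*-monoˡ-≤ (g ℕ.^ e₀) 8BZ≤g)

        -- g^A S ≤ B'·2N with g^A ≥ 8BZ
        smallness : ∀ {S B′ N′} → 0# ≤ S → B′ ℕ.≤ B → N′ ℕ.≤ 2 ℕ.* N → ι (g ℕ.^ A) * S ≤ ι (B′ ℕ.* N′) → ι (4 ℕ.* Z) * S ≤ ι N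
        smallness {S} {B′} {N′} 0≤S B′≤ N′≤ h = *-cancelˡ-≤ {ι (2 ℕ.* B)} (0≤ι (2 ℕ.* B)) (ι≢0 {2 ℕ.* B} (ℕ.s≤s ℕ.z≤n)) (begin
          ι (2 ℕ.* B) * (ι (4 ℕ.* Z) * S) ≡⟨ trans (sym (*-assoc _ _ S)) (cong (_* S) (trans (sym (ι-* (2 ℕ.* B) (4 ℕ.* Z))) (cong ι (lem B Z)))) ⟩
          ι (8 ℕ.* B ℕ.* Z) * S ≤⟨ *-monoʳ 0≤S (ι-mono 8BZ≤g^A) ⟩
          ι (g ℕ.^ A) * S ≤⟨ h ⟩
          ι (B′ ℕ.* N′) ≤⟨ ι-mono (ℕ.*-mono-≤ B′≤ N′≤) ⟩
          ι (B ℕ.* (2 ℕ.* N)) ≡⟨ trans (cong ι (lem′ B N)) (ι-* (2 ℕ.* B) N) ⟩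
          ι (2 ℕ.* B) * ι N ∎)
          where
          open ≤-Reasoning
          lem : ∀ b z → 2 ℕ.* b ℕ.* (4 ℕ.* z) ≡ 8 ℕ.* b ℕ.* z
          lem = ℕ-ring
          lem′ : ∀ b n → b ℕ.* (2 ℕ.* n) ≡ 2 ℕ.* b ℕ.* n
          lem′ = ℕ-ring

        -- The sieve uses only moduli that are multiples of W; their errors are part of the full
        -- sum, which is the one the conditions bound.
        ∑-W : ∀ {e} → NonNeg e → ∑ TT (λ q → e (W ℕ.* q)) ≤ ∑ (Y ℕ.^ num) e
        ∑-W {e} 0≤e = ≤-trans (≤-reflexive (sym (∑-multiples-exact W TT e 1≤W))) (≤-trans
          (∑-mono (TT ℕ.* W) (λ n _ _ → ≤-trans (*-monoʳ (0≤e n) (𝟙≤1 (W ∣? n))) (≤-reflexive (*-identityˡ (e n)))))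
          (∑-extend (ℕ.≤-trans (ℕ.≤-reflexive (ℕ.*-comm TT W)) levelY) 0≤e))

        Wq≤ : ∀ {q} → q ℕ.≤ TT → W ℕ.* q ℕ.≤ Y ℕ.^ num
        Wq≤ q≤ = ℕ.≤-trans (ℕ.*-monoʳ-≤ W q≤) levelY

        1≤Wq : ∀ {q} → 1 ℕ.≤ q → 1 ℕ.≤ W ℕ.* q
        1≤Wq 1≤q = ℕ.*-mono-≤ 1≤W 1≤q

        dataA = λ h → proj₂ hypA (N ℕ.+ h) Y g 1≤g (4^g≤ h) (Y1000 h) (1≤^ X sc 1≤X)
        dataB = proj₂ hypB (N ℕ.+ h₀) Y g 1≤g (4^g≤ h₀) (Y1000 h₀) (1≤^ X sc 1≤X)

        lp eA : ℕ → ℕ → Carrier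
        lp h = proj₁ (dataA h)
        eA h q = proj₁ (proj₂ (dataA h)) (W ℕ.* q)

        e eB : ℕ → Carrier
        e = proj₁ dataB
        0≤e : NonNeg e
        0≤e = proj₁ (proj₂ dataB)
        eB q = e (W ℕ.* q) + e (W ℕ.* q)

        -- Shifting by `h₀` turns the sum into a difference of two sums starting at 1, one up to N +
        -- h₀ and one up to h₀. The bound for all lengths `y` covers both, with twice the error.
        clB : ∀ q v → 1 ℕ.≤ q → q ℕ.≤ TT → ∑ N (λ n → 𝟙 (W ℕ.* q ∣? ℕ.∣ n - v ∣) * lam (n ℕ.+ h₀)) ≈[ eB q ] 0#
        clB q v 1≤q q≤ = ≈-subst (sym eq) (solve 0 (con (pos 0) :+ :- con (pos 0) := con (pos 0)) refl) (≈-+ (cl (N ℕ.+ h₀) ℕ.≤-refl) (≈-neg (cl h₀ (ℕ.m≤n+m h₀ N))))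
          where
          Mq = W ℕ.* q
          f : ℕ → Carrier
          f n = 𝟙 (Mq ∣? ℕ.∣ n - (v ℕ.+ h₀) ∣) * lam n
          cl : ∀ y → y ℕ.≤ N ℕ.+ h₀ → ∑ y f ≈[ e Mq ] 0#
          cl y y≤ = proj₁ (proj₂ (proj₂ dataB)) Mq (v ℕ.+ h₀) y (1≤Wq 1≤q) (Wq≤ q≤) y≤
          dist : ∀ n → ℕ.∣ n - v ∣ ≡ ℕ.∣ n ℕ.+ h₀ - (v ℕ.+ h₀) ∣
          dist n = sym (trans (cong₂ ℕ.∣_-_∣ (ℕ.+-comm n h₀) (ℕ.+-comm v h₀)) (ℕ.∣m+n-m+o∣≡∣n-o∣ h₀ n v))
          eq : ∑ N (λ n → 𝟙 (Mq ∣? ℕ.∣ n - v ∣) * lam (n ℕ.+ h₀)) ≡ ∑ (N ℕ.+ h₀) f + - ∑ h₀ f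
          eq = trans (∑-cong N (λ n _ _ → trans (cong (λ t → 𝟙 (Mq ∣? t) * lam (n ℕ.+ h₀)) (dist n)) (cong f (ℕ.+-comm n h₀))))
            (trans (solve 2 (λ a b → b := a :+ b :+ :- a) refl (∑ h₀ f) _) (cong (_+ - ∑ h₀ f) (trans (sym (∑-append h₀ N f)) (cong (λ t → ∑ t f) (ℕ.+-comm h₀ N)))))

        smallB : ι (2 ℕ.* Z) * ∑ TT eB ≤ ι N
        smallB = ≤-trans (≤-reflexive (trans (cong (ι (2 ℕ.* Z) *_) (∑-+ TT _ _)) (trans (cong (_* (T + T)) (ι-* 2 Z)) (trans (solve 2 (λ z t → con (pos 2) :* z :* (t :+ t) := con (pos 4) :* z :* t) refl (ι Z) T) (cong (_* T) (sym (ι-* 4 Z)))))))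
          (≤-trans (*-monoˡ (0≤ι (4 ℕ.* Z)) (∑-W 0≤e)) (smallness (∑-nonNeg (Y ℕ.^ num) 0≤e) (ℕ.m≤n⇒m≤1+n (ℕ.m≤n+m BB BA)) (N+h≤2N h₀≤) (proj₂ (proj₂ (proj₂ dataB)))))
          where T = ∑ TT (λ q → e (W ℕ.* q))

        smallA : ∀ h → h ∈ hs → ι (2 ℕ.* Z) * ∑ TT (eA h) ≤ ι N
        smallA h h∈ = ≤-trans (*-mono (0≤ι (2 ℕ.* Z)) (∑-nonNeg (Y ℕ.^ num) 0≤) (ι-mono (ℕ.*-monoˡ-≤ Z {2} {4} (ℕ.s≤s (ℕ.s≤s ℕ.z≤n)))) (∑-W 0≤))
          (smallness (∑-nonNeg (Y ℕ.^ num) 0≤) (ℕ.m≤n⇒m≤1+n (ℕ.m≤m+n BA BB)) (N+h≤2N (proj₂ (proj₂ (All.lookup shape h∈)))) (proj₂ (proj₂ (proj₂ (proj₂ (proj₂ (dataA h)))))))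
          where 0≤ = proj₁ (proj₂ (proj₂ (dataA h)))

        lp≤L : ∀ h → h ∈ hs → ∀ m → 1 ℕ.≤ m → m ℕ.≤ N ℕ.+ h → lp h m ≈[ ι (suc K) * V + ι 2 ] 0#
        lp≤L h h∈ m 1≤m m≤ = ≤-trans (≤-trans (proj₁ bounds) (≤-trans (+-monoˡ-≤ 1# (≤-trans (ℋ-mono m≤X) (ℋ-^ X (suc K) 1≤X)))
            (≤-reflexive (solve 1 (λ a → :1 :+ a :+ :1 := con (pos 0) :+ (a :+ con (pos 2))) refl (ι (suc K) * V))))) ≤-refl ,
          ≤-trans (proj₂ bounds) (+-monoʳ-≤ (lp h m) (≤-trans (ι-mono {1} {2} (ℕ.s≤s ℕ.z≤n)) (x≤y+x (*-nonNeg (0≤ι (suc K)) (0≤ℋ X)))))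
          where
          bounds = proj₁ (proj₂ (proj₂ (proj₂ (dataA h)))) m 1≤m m≤
          m≤X : m ℕ.≤ X ℕ.^ suc K
          m≤X = ℕ.≤-trans m≤ (ℕ.≤-trans (N+h≤2N (proj₂ (proj₂ (All.lookup shape h∈)))) (ℕ.*-monoˡ-≤ N 2≤X))

        -- For n up to `n₀` nothing is known about primes and λ, but then n + h is at most g and
        -- hence at most R, so the cutoff makes the left side zero.
        pointwise′ : ∀ n → 1 ℕ.≤ n → ι 2 * ∑[ hs ] (λ h → 𝟙 (R ℕ.<? n ℕ.+ h) * 𝟙 (prime? (n ℕ.+ h))) ≤ 1# + lam (n ℕ.+ h₀)
        pointwise′ n _ with n₀ ℕ.<? n
        ... | yes n₀<n = ≤-trans (*-monoˡ (0≤ι 2) (∑[]-mono hs (λ h → ≤-trans (*-monoʳ (𝟙-nonNeg (prime? (n ℕ.+ h))) (𝟙≤1 (R ℕ.<? n ℕ.+ h))) (≤-reflexive (*-identityˡ _))))) (pointwise n n₀<n)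
        ... | no ¬n₀<n = ≤-trans (≤-reflexive (trans (cong (ι 2 *_) (vanish shape)) (zeroʳ (ι 2)))) (≤-trans (proj₂ (lam≤1 (n ℕ.+ h₀))) (≤-reflexive (+-comm _ 1#)))
          where
          vanish : ∀ {gs} → All (λ h → 2 ∣ h × ℕ.∣ 4 - h ∣ ∣ 8 × h ℕ.≤ 12) gs → ∑[ gs ] (λ h → 𝟙 (R ℕ.<? n ℕ.+ h) * 𝟙 (prime? (n ℕ.+ h))) ≡ 0#
          vanish [] = refl
          vanish {h ∷ gs} ((_ , _ , h≤) ∷ rest) = trans (cong₂ _+_ (trans (cong (_* 𝟙 (prime? (n ℕ.+ h))) (𝟙-no (R ℕ.<? n ℕ.+ h) (ℕ.≤⇒≯ n+h≤R))) (zeroˡ _)) (vanish rest)) (+-identityʳ 0#)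
            where
            n+h≤R : n ℕ.+ h ℕ.≤ R
            n+h≤R = ℕ.≤-trans (ℕ.+-mono-≤ (ℕ.≮⇒≥ ¬n₀<n) h≤) (ℕ.≤-trans n₀+12≤g (ℕ.≤-trans g≤x (ℕ.≤-trans x≤X X≤R)))

      contradictory : ⊥
      contradictory = Cn.absurd K N M 1≤M big v coprime-v z-large V-large numeric< H 1≤H hh≤H L≤H 1≤Y₀ room
        (λ n → lam (n ℕ.+ h₀)) (λ n → lam≤1 (n ℕ.+ h₀)) eB (λ q → 0≤+ (0≤e _) (0≤e _)) clB smallB
        lp eA lp≤L (λ h q → proj₁ (proj₂ (proj₂ (dataA h))) _)
        (λ h h∈ q a 1≤q q≤ cop → proj₁ (proj₂ (proj₂ (proj₂ (proj₂ (dataA h))))) (W ℕ.* q) a (1≤Wq 1≤q) (Wq≤ q≤) cop)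
        smallA pointwise′

  -- Truncated exponential series.

  1≤s : ∀ {n} → 1 ℕ.≤ suc n
  1≤s = ℕ.s≤s ℕ.z≤n

  -- zᵏ / k! and the partial sums of the exponential series
  T : Carrier → ℕ → Carrier
  T z zero = 1#
  T z (suc k) = T z k * (z * ρ (suc k))

  Sx : Carrier → ℕ → Carrier
  Sx z zero = 0#
  Sx z (suc n) = Sx z n + T z n


  ≈0⇒ : ∀ {x d e} → x ≈[ e ] d → x - d ≈[ e ] 0#
  ≈0⇒ {x} {d} {e} (a , b) = ≤-trans (0≤-⇒≤ (subst (0# ≤_) (solve 3 (λ x d e → d :+ e :- x := e :- (x :- d)) refl x d e) (≤⇒0≤- a))) (≤-reflexive (sym (+-identityˡ e))) ,
    subst (0# ≤_) (solve 3 (λ x d e → x :+ e :- d := x :- d :+ e) refl x d e) (≤⇒0≤- b)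

  ≈0⇐ : ∀ {x d e} → x - d ≈[ e ] 0# → x ≈[ e ] d
  ≈0⇐ {x} {d} {e} (a , b) = 0≤-⇒≤ (subst (0# ≤_) (solve 3 (λ x d e → con (pos 0) :+ e :- (x :- d) := d :+ e :- x) refl x d e) (≤⇒0≤- a)) ,
    0≤-⇒≤ (subst (0# ≤_) (solve 3 (λ x d e → x :- d :+ e := x :+ e :- d) refl x d e) b)

  ≈-sym : ∀ {x d e} → x ≈[ e ] d → d ≈[ e ] x
  ≈-sym (a , b) = b , a

  ≈-trans : ∀ {x y z e f} → x ≈[ e ] y → y ≈[ f ] z → x ≈[ e + f ] z
  ≈-trans {x} {y} {z} {e} {f} (a , b) (c , d) =
    ≤-trans a (≤-trans (+-monoˡ-≤ e c) (≤-reflexive (solve 3 (λ z f e → z :+ f :+ e := z :+ (e :+ f)) refl z f e))) ,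
    ≤-trans d (≤-trans (+-monoˡ-≤ f b) (≤-reflexive (+-assoc x e f)))

  ≈0-nonNeg : ∀ {x} → 0# ≤ x → x ≈[ x ] 0#
  ≈0-nonNeg {x} h = ≤-reflexive (sym (+-identityˡ x)) , 0≤+ h h

  -- twice c d ∓ x y is a sum of two nonnegative products
  ≈0-* : ∀ {x y c d} → x ≈[ c ] 0# → y ≈[ d ] 0# → x * y ≈[ c * d ] 0#
  ≈0-* {x} {y} {c} {d} (a , b) (a′ , b′) =
    ≤-trans (half (subst (0# ≤_) (solve 4 (λ x y c d → (c :- x) :* (y :+ d) :+ (x :+ c) :* (d :- y) := con (pos 2) :* (c :* d :- x :* y)) refl x y c d)
      (0≤+ (*-nonNeg (up a) b′) (*-nonNeg b (up a′))))) (≤-reflexive (sym (+-identityˡ _))) ,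
    low (subst (0# ≤_) (solve 4 (λ x y c d → (c :- x) :* (d :- y) :+ (x :+ c) :* (y :+ d) := con (pos 2) :* (x :* y :+ c :* d)) refl x y c d)
      (0≤+ (*-nonNeg (up a) (up a′)) (*-nonNeg b b′)))
    where
    up : ∀ {x c} → x ≤ 0# + c → 0# ≤ c - x
    up {x} {c} h = ≤⇒0≤- (≤-trans h (≤-reflexive (+-identityˡ c)))
    low : ∀ {u} → 0# ≤ ι 2 * u → 0# ≤ u
    low {u} h = *-cancelˡ-≤ (0≤ι 2) (ι≢0 {2} 1≤s) (≤-trans (≤-reflexive (zeroʳ (ι 2))) h)
    half : ∀ {u v} → 0# ≤ ι 2 * (v - u) → u ≤ v
    half h = 0≤-⇒≤ (low h)

  T-suc : ∀ z k → ι (suc k) * T z (suc k) ≡ z * T z k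
  T-suc z k = trans (solve 4 (λ n t z r → n :* (t :* (z :* r)) := (n :* r) :* (z :* t)) refl (ι (suc k)) (T z k) z (ρ (suc k)))
    (trans (cong (_* (z * T z k)) (ρ-inverse {suc k} 1≤s)) (*-identityˡ _))

  T-nonNeg : ∀ {z} k → 0# ≤ z → 0# ≤ T z k
  T-nonNeg zero h = 0≤1
  T-nonNeg (suc k) h = *-nonNeg (T-nonNeg k h) (*-nonNeg h (0≤ρ (suc k)))

  Sx-nonNeg : ∀ {z} n → 0# ≤ z → 0# ≤ Sx z n
  Sx-nonNeg zero h = ≤-refl
  Sx-nonNeg (suc n) h = 0≤+ (Sx-nonNeg n h) (T-nonNeg n h)

  Sx-extend : ∀ {z m n} → 0# ≤ z → m ℕ.≤ n → Sx z m ≤ Sx z n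
  Sx-extend {z} {m} h l = go (ℕ.≤⇒≤′ l)
    where
    go : ∀ {n} → m ℕ.≤′ n → Sx z m ≤ Sx z n
    go ℕ.≤′-refl = ≤-refl
    go (ℕ.≤′-step {n} l) = ≤-trans (go l) (x≤x+y (T-nonNeg n h))

  T-mono : ∀ {a b} k → 0# ≤ a → a ≤ b → T a k ≤ T b k
  T-mono zero h l = ≤-refl
  T-mono (suc k) h l = *-mono (T-nonNeg k h) (*-nonNeg (≤-trans h l) (0≤ρ (suc k))) (T-mono k h l) (*-monoʳ (0≤ρ (suc k)) l)

  Sx-mono : ∀ {a b} n → 0# ≤ a → a ≤ b → Sx a n ≤ Sx b n
  Sx-mono zero h l = ≤-refl
  Sx-mono (suc n) h l = +-mono-≤ (Sx-mono n h l) (T-mono n h l)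

  1≤Sx : ∀ {z n} → 0# ≤ z → 1 ℕ.≤ n → 1# ≤ Sx z n
  1≤Sx {z} h l = ≤-trans (≤-reflexive (sym (+-identityˡ 1#))) (Sx-extend h l)

  1+z≤Sx : ∀ {z n} → 0# ≤ z → 2 ℕ.≤ n → 1# + z ≤ Sx z n
  1+z≤Sx {z} h l = ≤-trans (≤-reflexive (trans (cong (λ t → 1# + t) (sym (trans (cong (z *_) ρ1) (*-identityʳ z)))) (solve 2 (λ z r → :1 :+ z :* r := con (pos 0) :+ :1 :+ :1 :* (z :* r)) refl z (ρ 1)))) (Sx-extend h l)

  Sx-0 : ∀ n → 1 ℕ.≤ n → Sx 0# n ≡ 1#
  Sx-0 (suc zero) _ = +-identityˡ 1#
  Sx-0 (suc (suc n)) _ = trans (cong₂ _+_ (Sx-0 (suc n) 1≤s) (solve 2 (λ t r → t :* (con (pos 0) :* r) := con (pos 0)) refl (T 0# n) (ρ (suc n)))) (+-identityʳ 1#)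

  T-abs : ∀ {z c} k → z ≈[ c ] 0# → T z k ≈[ T c k ] 0#
  T-abs zero h = ≈0-nonNeg 0≤1
  T-abs (suc k) h = ≈0-* (T-abs k h) (≈0-* h (≈0-nonNeg (0≤ρ (suc k))))

  private
    cancel-≈ : ∀ {n x e} → 1 ℕ.≤ n → ι n * x ≈[ ι n * e ] 0# → x ≈[ e ] 0#
    cancel-≈ {n} {x} {e} 1≤n (a , b) =
      *-cancelˡ-≤ (0≤ι n) (ι≢0 1≤n) (≤-trans a (≤-reflexive (solve 2 (λ n e → con (pos 0) :+ n :* e := n :* (con (pos 0) :+ e)) refl (ι n) e))) ,
      *-cancelˡ-≤ (0≤ι n) (ι≢0 1≤n) (≤-trans (≤-reflexive (zeroʳ (ι n))) (≤-trans b (≤-reflexive (sym (distribˡ (ι n) x e)))))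

  -- Multiplying by k + 1 turns z^(k+1)/(k+1)! into z · z^k/k!, so the difference obeys a product
  -- rule and the bound follows by induction without expanding powers.
  T-lipschitz : ∀ {a b c δ} k → a ≈[ c ] 0# → b ≈[ c ] 0# → a - b ≈[ δ ] 0# → T a (suc k) - T b (suc k) ≈[ δ * T c k ] 0#
  T-lipschitz {a} {b} {c} {δ} zero ha hb h = subst₂ (λ s t → s ≈[ t ] 0#) (trans (simp a b (ρ 1)) refl) (sym (*-identityʳ δ))
    (≈-subst (sym (trans (cong (λ r → (a - b) * r) ρ1) (*-identityʳ (a - b)))) refl h)
    where
    simp : ∀ a b r → (a - b) * r ≡ 1# * (a * r) - 1# * (b * r)
    simp = solve 3 (λ a b r → (a :- b) :* r := :1 :* (a :* r) :- :1 :* (b :* r)) refl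
  T-lipschitz {a} {b} {c} {δ} (suc k) ha hb h = cancel-≈ {suc (suc k)} 1≤s (subst₂ (λ s t → s ≈[ t ] 0#) (sym eq) (sym bound)
    (≈-subst refl (+-identityʳ 0#) (≈-+ (≈0-* ha (T-lipschitz k ha hb h)) (≈0-* (T-abs (suc k) hb) h))))
    where
    n = ι (suc (suc k))
    eq : n * (T a (suc (suc k)) - T b (suc (suc k))) ≡ a * (T a (suc k) - T b (suc k)) + T b (suc k) * (a - b)
    eq = trans (solve 3 (λ n x y → n :* (x :- y) := n :* x :- n :* y) refl n (T a (suc (suc k))) (T b (suc (suc k))))
      (trans (cong₂ _-_ (T-suc a (suc k)) (T-suc b (suc k))) (solve 4 (λ a b x y → a :* x :- b :* y := a :* (x :- y) :+ y :* (a :- b)) refl a b (T a (suc k)) (T b (suc k))))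
    bound : n * (δ * T c (suc k)) ≡ c * (δ * T c k) + T c (suc k) * δ
    bound = trans (cong (_* (δ * T c (suc k))) (ι-suc (suc k))) (trans (solve 3 (λ m d t → (:1 :+ m) :* (d :* t) := d :* (m :* t) :+ t :* d) refl (ι (suc k)) δ (T c (suc k)))
      (cong (_+ T c (suc k) * δ) (trans (cong (δ *_) (T-suc c k)) (solve 3 (λ d c t → d :* (c :* t) := c :* (d :* t)) refl δ c (T c k)))))

  Sx-lipschitz : ∀ {a b c δ} n → 0# ≤ δ → a ≈[ c ] 0# → b ≈[ c ] 0# → a ≈[ δ ] b → 0# ≤ c → Sx a n ≈[ δ * Sx c n ] Sx b n
  Sx-lipschitz {c = c} {δ} zero 0≤δ ha hb h 0≤c = ≈-weaken (≤-reflexive (sym (zeroʳ δ))) ≈-refl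
  Sx-lipschitz {c = c} {δ} (suc n) 0≤δ ha hb h 0≤c = ≈-weaken (*-monoˡ 0≤δ (x≤x+y (T-nonNeg n 0≤c))) (go n)
    where
    go : ∀ n → Sx _ (suc n) ≈[ δ * Sx c n ] Sx _ (suc n)
    go zero = ≈-weaken (≤-reflexive (sym (zeroʳ δ))) ≈-refl
    go (suc n) = ≈-weaken (≤-reflexive (sym (distribˡ δ (Sx c n) (T c n)))) (≈-+ (go n) (≈0⇐ (T-lipschitz n ha hb (≈0⇒ h))))

  -- The Cauchy product

  Sx-∑ : ∀ z n → Sx z n ≡ ∑ n (λ i → T z (ℕ.pred i))
  Sx-∑ z zero = refl
  Sx-∑ z (suc n) = cong (_+ T z n) (Sx-∑ z n)

  private
    conv : Carrier → Carrier → ℕ → Carrier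
    conv a b k = ∑ (suc k) (λ i → T a (ℕ.pred i) * T b (k ℕ.∸ ℕ.pred i))

    -- Write the factor k + 1 as i + (k + 1 - i); each part lowers one of the two exponents. This
    -- gives the binomial theorem without binomial coefficients.
    conv-suc : ∀ a b k → ι (suc k) * conv a b (suc k) ≡ (a + b) * conv a b k
    conv-suc a b k = begin
      ι (suc k) * conv a b (suc k)
        ≡⟨ sym (∑-scale (suc (suc k)) (ι (suc k)) _) ⟩
      ∑ (suc (suc k)) (λ i → ι (suc k) * (T a (ℕ.pred i) * T b (suc k ℕ.∸ ℕ.pred i)))
        ≡⟨ ∑-cong (suc (suc k)) split ⟩
      ∑ (suc (suc k)) (λ i → f i + g i)
        ≡⟨ ∑-+ (suc (suc k)) f g ⟩
      ∑ (suc (suc k)) f + ∑ (suc (suc k)) g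
        ≡⟨ cong₂ _+_ first second ⟩
      a * conv a b k + b * conv a b k
        ≡⟨ sym (distribʳ _ a b) ⟩
      (a + b) * conv a b k ∎
      where
      open ≡-Reasoning
      f g : ℕ → Carrier
      f i = ι (ℕ.pred i) * T a (ℕ.pred i) * T b (suc k ℕ.∸ ℕ.pred i)
      g i = T a (ℕ.pred i) * (ι (suc k ℕ.∸ ℕ.pred i) * T b (suc k ℕ.∸ ℕ.pred i))
      split : ∀ i → 1 ℕ.≤ i → i ℕ.≤ suc (suc k) → ι (suc k) * (T a (ℕ.pred i) * T b (suc k ℕ.∸ ℕ.pred i)) ≡ f i + g i
      split (suc i) _ (ℕ.s≤s i≤) = trans (cong (_* (T a i * T b (suc k ℕ.∸ i))) (trans (cong ι (sym (ℕ.m+[n∸m]≡n i≤))) (ι-+ i (suc k ℕ.∸ i))))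
        (solve 4 (λ m n x y → (m :+ n) :* (x :* y) := m :* x :* y :+ x :* (n :* y)) refl (ι i) (ι (suc k ℕ.∸ i)) (T a i) (T b (suc k ℕ.∸ i)))
      first : ∑ (suc (suc k)) f ≡ a * conv a b k
      first = trans (∑-append 1 (suc k) f) (trans (cong₂ _+_ (solve 2 (λ x y → con (pos 0) :+ con (pos 0) :* x :* y := con (pos 0)) refl (T a 0) (T b (suc k))) (trans (∑-cong (suc k) step) (∑-scale (suc k) a _))) (+-identityˡ _))
        where
        step : ∀ i → 1 ℕ.≤ i → i ℕ.≤ suc k → f (suc i) ≡ a * (T a (ℕ.pred i) * T b (k ℕ.∸ ℕ.pred i))
        step (suc i) _ _ = trans (cong (_* T b (k ℕ.∸ i)) (T-suc a i)) (*-assoc a _ _)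
      second : ∑ (suc (suc k)) g ≡ b * conv a b k
      second = trans (cong₂ _+_ (trans (∑-cong (suc k) step) (∑-scale (suc k) b _)) last) (+-identityʳ _)
        where
        last : g (suc (suc k)) ≡ 0#
        last = trans (cong (λ n → T a (suc k) * (ι n * T b n)) (ℕ.n∸n≡0 (suc k))) (solve 2 (λ x y → x :* (con (pos 0) :* y) := con (pos 0)) refl (T a (suc k)) (T b 0))
        step : ∀ i → 1 ℕ.≤ i → i ℕ.≤ suc k → g i ≡ b * (T a (ℕ.pred i) * T b (k ℕ.∸ ℕ.pred i))
        step (suc i) _ (ℕ.s≤s i≤k) = trans (cong (λ n → T a i * (ι n * T b n)) (ℕ.+-∸-assoc 1 i≤k)) (trans (cong (T a i *_) (T-suc b (k ℕ.∸ i)))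
          (solve 3 (λ x b y → x :* (b :* y) := b :* (x :* y)) refl (T a i) b (T b (k ℕ.∸ i))))

    binomial : ∀ a b k → T (a + b) k ≡ conv a b k
    binomial a b zero = solve 0 (:1 := con (pos 0) :+ :1 :* :1) refl
    binomial a b (suc k) = *-cancelˡ (ι≢0 {suc k} 1≤s) (trans (T-suc (a + b) k) (trans (cong ((a + b) *_) (binomial a b k)) (sym (conv-suc a b k))))

    triangle : Carrier → Carrier → ℕ → Carrier
    triangle a b m = ∑ m (λ i → T a (ℕ.pred i) * Sx b (m ℕ.∸ ℕ.pred i))

  Sx-+ : ∀ a b m → Sx (a + b) m ≡ triangle a b m
  Sx-+ a b zero = refl
  Sx-+ a b (suc m) = begin
    Sx (a + b) m + T (a + b) m ≡⟨ cong₂ _+_ (Sx-+ a b m) (binomial a b m) ⟩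
    triangle a b m + conv a b m ≡⟨ cong (_+ conv a b m) (sym (trans (cong (λ n → triangle a b m + T a m * Sx b n) (ℕ.n∸n≡0 m)) (trans (cong (triangle a b m +_) (zeroʳ _)) (+-identityʳ _)))) ⟩
    ∑ (suc m) (λ i → T a (ℕ.pred i) * Sx b (m ℕ.∸ ℕ.pred i)) + conv a b m
      ≡⟨ sym (∑-+ (suc m) _ _) ⟩
    ∑ (suc m) (λ i → T a (ℕ.pred i) * Sx b (m ℕ.∸ ℕ.pred i) + T a (ℕ.pred i) * T b (m ℕ.∸ ℕ.pred i))
      ≡⟨ ∑-cong (suc m) step ⟩
    triangle a b (suc m) ∎
    where
    open ≡-Reasoning
    step : ∀ i → 1 ℕ.≤ i → i ℕ.≤ suc m → T a (ℕ.pred i) * Sx b (m ℕ.∸ ℕ.pred i) + T a (ℕ.pred i) * T b (m ℕ.∸ ℕ.pred i) ≡ T a (ℕ.pred i) * Sx b (suc m ℕ.∸ ℕ.pred i)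
    step (suc i) _ (ℕ.s≤s i≤m) = trans (sym (distribˡ (T a i) _ _)) (cong (λ n → T a i * Sx b n) (sym (ℕ.+-∸-assoc 1 i≤m)))

  private
    -- The product of two truncations sums over a square of index pairs, the truncation for a + b
    -- over the triangle below its diagonal. The difference collects the remaining pairs by rows.
    defect : ∀ a b m → Sx a m * Sx b m - Sx (a + b) m ≡ ∑ m (λ i → T a (ℕ.pred i) * (Sx b m - Sx b (m ℕ.∸ ℕ.pred i)))
    defect a b m = trans (cong₂ (λ s t → s * Sx b m - t) (Sx-∑ a m) (Sx-+ a b m)) (sym (trans (∑-cong m (λ i _ _ → solve 3 (λ x s u → x :* (s :- u) := s :* x :+ (:- :1) :* (x :* u)) refl (T a (ℕ.pred i)) (Sx b m) (Sx b (m ℕ.∸ ℕ.pred i))))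
      (trans (∑-linear m (- 1#) _ _) (trans (cong (_+ (- 1#) * triangle a b m) (∑-scale m (Sx b m) _)) (solve 3 (λ s x t → s :* x :+ (:- :1) :* t := x :* s :- t) refl (Sx b m) (∑ m (λ i → T a (ℕ.pred i))) (triangle a b m))))))

    Sx-diff-abs : ∀ {b d} m n → m ℕ.≤ n → b ≈[ d ] 0# → Sx b n - Sx b m ≈[ Sx d n - Sx d m ] 0#
    Sx-diff-abs {b} {d} m n l h = go (ℕ.≤⇒≤′ l)
      where
      go : ∀ {n} → m ℕ.≤′ n → Sx b n - Sx b m ≈[ Sx d n - Sx d m ] 0#
      go ℕ.≤′-refl = subst₂ (λ s t → s ≈[ t ] 0#) (sym (-‿inverseʳ _)) (sym (-‿inverseʳ _)) ≈-refl
      go (ℕ.≤′-step {n} l) = subst₂ (λ s t → s ≈[ t ] 0#) (move (Sx b n) (Sx b m) (T b n)) (move (Sx d n) (Sx d m) (T d n)) (≈-subst refl (+-identityʳ 0#) (≈-+ (go l) (T-abs n h)))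
        where
        move : ∀ x y t → x - y + t ≡ x + t - y
        move = solve 3 (λ x y t → x :- y :+ t := x :+ t :- y) refl

    ∑-≈0 : ∀ n {f g} → (∀ i → f i ≈[ g i ] 0#) → ∑ n f ≈[ ∑ n g ] 0#
    ∑-≈0 zero h = ≈-refl
    ∑-≈0 (suc n) h = ≈-subst refl (+-identityʳ 0#) (≈-+ (∑-≈0 n h) (h (suc n)))

    triangle-defect : ∀ {a b c d} m → a ≈[ c ] 0# → b ≈[ d ] 0# → Sx a m * Sx b m - Sx (a + b) m ≈[ Sx c m * Sx d m - Sx (c + d) m ] 0#
    triangle-defect {a} {b} {c} {d} m ha hb = subst₂ (λ s t → s ≈[ t ] 0#) (sym (defect a b m)) (sym (defect c d m))
      (∑-≈0 m (λ i → ≈0-* (T-abs (ℕ.pred i) ha) (Sx-diff-abs (m ℕ.∸ ℕ.pred i) m (ℕ.m∸n≤m m (ℕ.pred i)) hb)))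

  Sx-+-≤ : ∀ {a b} m → 0# ≤ a → 0# ≤ b → Sx (a + b) m ≤ Sx a m * Sx b m
  Sx-+-≤ {a} {b} m 0≤a 0≤b = 0≤-⇒≤ (subst (0# ≤_) (sym (defect a b m)) (∑-nonNeg m (λ i → *-nonNeg (T-nonNeg (ℕ.pred i) 0≤a) (≤⇒0≤- (Sx-extend 0≤b (ℕ.m∸n≤m m (ℕ.pred i)))))))

  -- The square of side m lies inside the triangle of side 2m, and all terms are nonnegative.
  Sx-*-≤ : ∀ {c d} m → 0# ≤ c → 0# ≤ d → Sx c m * Sx d m ≤ Sx (c + d) (m ℕ.+ m)
  Sx-*-≤ {c} {d} m 0≤c 0≤d = begin
    Sx c m * Sx d m ≡⟨ trans (cong (_* Sx d m) (Sx-∑ c m)) (trans (*-comm _ _) (sym (∑-scale m (Sx d m) _))) ⟩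
    ∑ m (λ i → Sx d m * T c (ℕ.pred i)) ≤⟨ ∑-mono m (λ i _ i≤m → ≤-trans (≤-reflexive (*-comm _ _)) (*-monoˡ (T-nonNeg (ℕ.pred i) 0≤c) (Sx-extend 0≤d (long i i≤m)))) ⟩
    ∑ m (λ i → T c (ℕ.pred i) * Sx d (m ℕ.+ m ℕ.∸ ℕ.pred i)) ≤⟨ ∑-extend (ℕ.m≤m+n m m) (λ i → *-nonNeg (T-nonNeg (ℕ.pred i) 0≤c) (Sx-nonNeg (m ℕ.+ m ℕ.∸ ℕ.pred i) 0≤d)) ⟩
    triangle c d (m ℕ.+ m) ≡⟨ sym (Sx-+ c d (m ℕ.+ m)) ⟩
    Sx (c + d) (m ℕ.+ m) ∎
    where
    open ≤-Reasoning
    long : ∀ i → i ℕ.≤ m → m ℕ.≤ m ℕ.+ m ℕ.∸ ℕ.pred i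
    long i i≤m = ℕ.≤-trans (ℕ.≤-reflexive (sym (ℕ.m+n∸n≡m m m))) (ℕ.∸-monoʳ-≤ (m ℕ.+ m) (ℕ.≤-trans (ℕ.pred[n]≤n) i≤m))

  -- The defect at `a`, `b` is dominated by that at the absolute bounds `c`, `d`, which is a piece
  -- of the tail of the series at c + d.
  Sx-product : ∀ {a b c d} m → a ≈[ c ] 0# → b ≈[ d ] 0# → 0# ≤ c → 0# ≤ d →
    Sx a m * Sx b m ≈[ Sx (c + d) (m ℕ.+ m) - Sx (c + d) m ] Sx (a + b) m
  Sx-product m ha hb 0≤c 0≤d = ≈0⇐ (≈-weaken (+-monoˡ-≤ _ (Sx-*-≤ m 0≤c 0≤d)) (triangle-defect m ha hb))


  -- The first two terms of the binomial expansion of (a + b)^(k+1)/(k+1)!.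
  T-superadditive : ∀ {a b} k → 0# ≤ a → 0# ≤ b → T a (suc k) + b * T a k ≤ T (a + b) (suc k)
  T-superadditive {a} {b} zero 0≤a 0≤b = ≤-reflexive (trans (cong (λ r → 1# * (a * r) + b * 1#) ρ1) (trans (solve 2 (λ a b → :1 :* (a :* :1) :+ b :* :1 := :1 :* ((a :+ b) :* :1)) refl a b) (cong (λ r → 1# * ((a + b) * r)) (sym ρ1))))
  T-superadditive {a} {b} (suc k) 0≤a 0≤b = *-cancelˡ-≤ (0≤ι (suc (suc k))) (ι≢0 {suc (suc k)} 1≤s) (begin
    n * (T a (suc (suc k)) + b * T a (suc k)) ≡⟨ trans (distribˡ n _ _) (cong₂ _+_ (T-suc a (suc k)) (trans (cong (_* (b * T a (suc k))) (ι-suc (suc k)))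
                                                               (trans (solve 3 (λ m b t → (:1 :+ m) :* (b :* t) := b :* t :+ b :* (m :* t)) refl (ι (suc k)) b (T a (suc k))) (cong (λ u → b * T a (suc k) + b * u) (T-suc a k))))) ⟩
    a * T a (suc k) + (b * T a (suc k) + b * (a * T a k)) ≡⟨ solve 4 (λ a b t u → a :* t :+ (b :* t :+ b :* (a :* u)) := a :* (t :+ b :* u) :+ b :* t) refl a b (T a (suc k)) (T a k) ⟩
    a * (T a (suc k) + b * T a k) + b * T a (suc k) ≤⟨ +-mono-≤ (*-monoˡ 0≤a (T-superadditive k 0≤a 0≤b)) (*-monoˡ 0≤b (T-mono (suc k) 0≤a (x≤x+y 0≤b))) ⟩
    a * T (a + b) (suc k) + b * T (a + b) (suc k) ≡⟨ trans (sym (distribʳ _ a b)) (sym (T-suc (a + b) (suc k))) ⟩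
    n * T (a + b) (suc (suc k)) ∎)
    where
    open ≤-Reasoning
    n = ι (suc (suc k))

  Sx-superadditive : ∀ {a b} m → 0# ≤ a → 0# ≤ b → Sx a (suc m) + b * Sx a m ≤ Sx (a + b) (suc m)
  Sx-superadditive {a} {b} zero 0≤a 0≤b = ≤-reflexive (solve 1 (λ b → con (pos 0) :+ :1 :+ b :* con (pos 0) := con (pos 0) :+ :1) refl b)
  Sx-superadditive {a} {b} (suc m) 0≤a 0≤b = ≤-trans (≤-reflexive (solve 5 (λ s t b u v → s :+ t :+ b :* (u :+ v) := s :+ b :* u :+ (t :+ b :* v)) refl (Sx a (suc m)) (T a (suc m)) b (Sx a m) (T a m)))
    (+-mono-≤ (Sx-superadditive m 0≤a 0≤b) (T-superadditive m 0≤a 0≤b))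

  -- Passing from H_n to H_(n+1) multiplies the exponential by at least 1 + 1/(n + 1), which carries
  -- n + 1 to n + 2. Each step uses up one term of the truncation, whence more than n terms. It
  -- yields log (n + 1) ≤ H_n.
  suc≤Sx-ℋ : ∀ n m → n ℕ.< m → ι (suc n) ≤ Sx (ℋ n) m
  suc≤Sx-ℋ zero m l = ≤-reflexive (sym (Sx-0 m l))
  suc≤Sx-ℋ (suc n) (suc m) (ℕ.s≤s l) = begin
    ι (suc (suc n)) ≡⟨ trans (ι-suc (suc n)) (trans (+-comm 1# _) (cong (ι (suc n) +_) (sym (trans (*-comm _ _) (ρ-inverse {suc n} 1≤s))))) ⟩
    ι (suc n) + ρ (suc n) * ι (suc n) ≤⟨ +-mono-≤ (suc≤Sx-ℋ n (suc m) (ℕ.m≤n⇒m≤1+n l)) (*-monoˡ (0≤ρ (suc n)) (suc≤Sx-ℋ n m l)) ⟩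
    Sx (ℋ n) (suc m) + ρ (suc n) * Sx (ℋ n) m ≤⟨ Sx-superadditive m (0≤ℋ n) (0≤ρ (suc n)) ⟩
    Sx (ℋ n + ρ (suc n)) (suc m) ∎
    where open ≤-Reasoning

  -- The partial sum plus twice the next term does not increase, as the terms at least halve; its
  -- first value is 3.
  Sx-1≤3 : ∀ m → Sx 1# m ≤ ι 3
  Sx-1≤3 zero = 0≤ι 3
  Sx-1≤3 (suc m) = ≤-trans (x≤x+y (*-nonNeg (0≤ι 2) (T-nonNeg (suc m) 0≤1))) (go m)
    where
    go : ∀ m → Sx 1# (suc m) + ι 2 * T 1# (suc m) ≤ ι 3
    go zero = ≤-reflexive (trans (cong (λ r → 0# + 1# + ι 2 * (1# * (1# * r))) ρ1) (solve 0 (con (pos 0) :+ :1 :+ con (pos 2) :* (:1 :* (:1 :* :1)) := con (pos 3)) refl))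
    go (suc m) = ≤-trans (≤-trans (≤-reflexive (+-assoc _ _ _)) (+-monoʳ-≤ (Sx 1# (suc m)) shrink)) (go m)
      where
      t = T 1# (suc m)
      2ρ≤1 : ι 2 * ρ (suc (suc m)) ≤ 1#
      2ρ≤1 = ≤-trans (*-monoˡ (0≤ι 2) (ρ-antitone {2} {suc (suc m)} 1≤s (ℕ.s≤s 1≤s))) (≤-reflexive (ρ-inverse {2} 1≤s))
      shrink : t + ι 2 * (t * (1# * ρ (suc (suc m)))) ≤ ι 2 * t
      shrink = ≤-trans (≤-reflexive (solve 2 (λ t r → t :+ con (pos 2) :* (t :* (:1 :* r)) := t :+ t :* (con (pos 2) :* r)) refl t (ρ (suc (suc m)))))
        (≤-trans (+-monoʳ-≤ t (*-monoˡ (T-nonNeg (suc m) 0≤1) 2ρ≤1)) (≤-reflexive (solve 1 (λ t → t :+ t :* :1 := con (pos 2) :* t) refl t)))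

  Sx-ι≤4^ : ∀ g m → Sx (ι g) m ≤ ι (4 ℕ.^ g)
  Sx-ι≤4^ zero zero = 0≤1
  Sx-ι≤4^ zero (suc m) = ≤-reflexive (Sx-0 (suc m) 1≤s)
  Sx-ι≤4^ (suc g) m = begin
    Sx (ι (suc g)) m ≡⟨ cong (λ z → Sx z m) (ι-suc g) ⟩
    Sx (1# + ι g) m ≤⟨ Sx-+-≤ m 0≤1 (0≤ι g) ⟩
    Sx 1# m * Sx (ι g) m ≤⟨ *-mono (Sx-nonNeg m 0≤1) (0≤ι (4 ℕ.^ g)) (≤-trans (Sx-1≤3 m) (ι-mono {3} {4} (ℕ.n≤1+n 3))) (Sx-ι≤4^ g m) ⟩
    ι 4 * ι (4 ℕ.^ g) ≡⟨ sym (ι-* 4 (4 ℕ.^ g)) ⟩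
    ι (4 ℕ.^ suc g) ∎
    where open ≤-Reasoning

  -- Cauchy sequences, exponential and logarithm over the field.

  Seq : Set
  Seq = ℕ → Carrier

  Pos : Carrier → Set
  Pos ε = 0# ≤ ε × ε ≢ 0#

  Ev : (ℕ → Set) → Set
  Ev P = ∃ λ M → ∀ n → M ℕ.≤ n → P n

  Ev-map : ∀ {P Q : ℕ → Set} → (∀ n → P n → Q n) → Ev P → Ev Q
  Ev-map f (M , h) = M , λ n l → f n (h n l)

  Ev-× : ∀ {P Q : ℕ → Set} → Ev P → Ev Q → Ev (λ n → P n × Q n)
  Ev-× (M , h) (M′ , h′) = M ℕ.⊔ M′ , λ n l → h n (ℕ.≤-trans (ℕ.m≤m⊔n M M′) l) , h′ n (ℕ.≤-trans (ℕ.m≤n⊔m M M′) l)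

  Ev-≥ : ∀ m → Ev (m ℕ.≤_)
  Ev-≥ m = m , λ n l → l

  Pos-ι : ∀ n → 1 ℕ.≤ n → Pos (ι n)
  Pos-ι n h = 0≤ι n , ι≢0 h

  Pos-* : ∀ {x y} → Pos x → Pos y → Pos (x * y)
  Pos-* (a , b) (c , d) = *-nonNeg a c , *-≢0 b d

  Pos-ρ : ∀ n → 1 ℕ.≤ n → Pos (ρ n)
  Pos-ρ n h = 0≤ρ n , λ e → 1≢0 (trans (sym (ρ-inverse h)) (trans (cong (ι n *_) e) (zeroʳ _)))

  ½ : Carrier → Carrier
  ½ ε = ρ 2 * ε

  ½+½ : ∀ ε → ½ ε + ½ ε ≡ ε
  ½+½ ε = trans (solve 2 (λ r e → r :* e :+ r :* e := con (pos 2) :* r :* e) refl (ρ 2) ε) (trans (cong (_* ε) (ρ-inverse {2} 1≤s)) (*-identityˡ ε))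

  Pos-½ : ∀ {ε} → Pos ε → Pos (½ ε)
  Pos-½ = Pos-* (Pos-ρ 2 1≤s)

  ½≤ : ∀ {ε} → Pos ε → ½ ε ≤ ε
  ½≤ {ε} h = ≤-trans (x≤x+y (proj₁ (Pos-½ h))) (≤-reflexive (½+½ ε))

  infix 4 _⊑_
  _⊑_ : Seq → Seq → Set
  a ⊑ b = ∀ ε → Pos ε → Ev (λ n → a n ≤ b n + ε)

  Cauchy : Seq → Set
  Cauchy s = ∀ ε → Pos ε → ∃ λ M → ∀ m n → M ℕ.≤ m → M ℕ.≤ n → s m ≈[ ε ] s n

  const : Carrier → Seq
  const c _ = c

  ⊑-trans : ∀ {a b c} → a ⊑ b → b ⊑ c → a ⊑ c
  ⊑-trans {a} {b} {c} h k ε p = Ev-map (λ n (u , w) → ≤-trans u (≤-trans (+-monoˡ-≤ (½ ε) w) (≤-reflexive (trans (+-assoc (c n) (½ ε) (½ ε)) (cong (c n +_) (½+½ ε))))))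
    (Ev-× (h (½ ε) (Pos-½ p)) (k (½ ε) (Pos-½ p)))

  ⊑-pointwise : ∀ {a b} → Ev (λ n → a n ≤ b n) → a ⊑ b
  ⊑-pointwise h ε p = Ev-map (λ n l → ≤-trans l (x≤x+y (proj₁ p))) h

  const-cauchy : ∀ c → Cauchy (const c)
  const-cauchy c ε p = 0 , λ _ _ _ _ → ≈-weaken (proj₁ p) ≈-refl

  scale-cauchy : ∀ {s} c → 0# ≤ c → Cauchy s → (arch : ∀ x → ∃ λ n → x ≤ ι n) → Cauchy (λ n → c * s n)
  scale-cauchy {s} c 0≤c h arch ε p with arch c
  ... | B , c≤B with h (ρ (suc B) * ε) (Pos-* (Pos-ρ (suc B) 1≤s) p)
  ... | M , f = M , λ m n a b → ≈-weaken small (≈-scale 0≤c (f m n a b))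
    where
    small : c * (ρ (suc B) * ε) ≤ ε
    small = ≤-trans (*-monoʳ (*-nonNeg (0≤ρ (suc B)) (proj₁ p)) (≤-trans c≤B (ι-mono (ℕ.n≤1+n B)))) (≤-reflexive (trans (sym (*-assoc _ _ ε)) (trans (cong (_* ε) (ρ-inverse {suc B} 1≤s)) (*-identityˡ ε))))

  dichotomy : ∀ {a b} → Cauchy a → Cauchy b → ∀ ε → Pos ε → Ev (λ n → a n ≤ b n + ε) ⊎ (∃ λ δ → Pos δ × Ev (λ n → b n + δ ≤ a n))
  dichotomy {a} {b} ca cb ε p = split (total (a M) (b M + η₂))
    where
    -- ε = 2η₂, η₂ = 2η₁, η₁ = 2η
    η₂ η₁ η : Carrier
    η₂ = ½ ε
    η₁ = ½ η₂
    η = ½ η₁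
    pη : Pos η
    pη = Pos-½ (Pos-½ (Pos-½ p))
    Ma = proj₁ (ca η pη)
    Mb = proj₁ (cb η pη)
    M = Ma ℕ.⊔ Mb
    na : ∀ n → M ℕ.≤ n → a n ≈[ η ] a M
    na n l = proj₂ (ca η pη) n M (ℕ.≤-trans (ℕ.m≤m⊔n Ma Mb) l) (ℕ.m≤m⊔n Ma Mb)
    nb : ∀ n → M ℕ.≤ n → b n ≈[ η ] b M
    nb n l = proj₂ (cb η pη) n M (ℕ.≤-trans (ℕ.m≤n⊔m Ma Mb) l) (ℕ.m≤n⊔m Ma Mb)
    split : a M ≤ b M + η₂ ⊎ b M + η₂ ≤ a M → Ev (λ n → a n ≤ b n + ε) ⊎ (∃ λ δ → Pos δ × Ev (λ n → b n + δ ≤ a n))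
    split (inj₁ h) = inj₁ (M , λ n l → begin
      a n ≤⟨ proj₁ (na n l) ⟩
      a M + η ≤⟨ +-monoˡ-≤ η (≤-trans h (+-monoˡ-≤ η₂ (proj₂ (nb n l)))) ⟩
      b n + η + η₂ + η ≡⟨ solve 3 (λ b x y → b :+ x :+ y :+ x := b :+ ((x :+ x) :+ y)) refl (b n) η η₂ ⟩
      b n + ((η + η) + η₂) ≤⟨ +-monoʳ-≤ (b n) (+-monoˡ-≤ η₂ (≤-trans (≤-reflexive (½+½ η₁)) (½≤ (Pos-½ p)))) ⟩
      b n + (η₂ + η₂) ≡⟨ cong (b n +_) (½+½ ε) ⟩
      b n + ε ∎)
      where open ≤-Reasoning
    split (inj₂ h) = inj₂ (η₁ , Pos-½ (Pos-½ p) , M , λ n l → 0≤-⇒≤ (begin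
      0# ≤⟨ 0≤+ (0≤+ (≤⇒0≤- (proj₁ (nb n l))) (≤⇒0≤- h)) (≤⇒0≤- (proj₂ (na n l))) ⟩
      (b M + η - b n) + (a M - (b M + η₂)) + (a n + η - a M)
        ≡⟨ solve 6 (λ bM e bn aM e₂ an → (bM :+ e :- bn) :+ (aM :- (bM :+ e₂)) :+ (an :+ e :- aM) := an :- (bn :+ (e₂ :- (e :+ e)))) refl (b M) η (b n) (a M) η₂ (a n) ⟩
      a n - (b n + (η₂ - (η + η)))
        ≡⟨ cong (λ t → a n - (b n + t)) (trans (cong₂ _-_ (sym (½+½ η₂)) (½+½ η₁)) (solve 1 (λ x → x :+ x :- x := x) refl η₁)) ⟩
      a n - (b n + η₁) ∎))
      where open ≤-Reasoning

  no-gap : ∀ {a : Seq} {k m δ} → suc k ℕ.≤ m → const (ι m) ⊑ a → Pos δ → Ev (λ n → a n + δ ≤ ι (suc k)) → ⊥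
  no-gap {a} {k} {m} {δ} k<m h pδ gap = at (Ev-× (h (½ δ) (Pos-½ pδ)) gap)
    where
    at : Ev (λ n → (ι m ≤ a n + ½ δ) × (a n + δ ≤ ι (suc k))) → ⊥
    at (M , f) = proj₂ (Pos-½ pδ) (antisym (0≤-⇒≤ (≤-trans (0≤+ (≤⇒0≤- (proj₁ fM)) (0≤+ (≤⇒0≤- (proj₂ fM)) (≤⇒0≤- (ι-mono k<m))))
      (≤-reflexive (trans (cong (λ t → (a M + ½ δ - ι m) + ((ι (suc k) - (a M + t)) + (ι m - ι (suc k)))) (sym (½+½ δ)))
        (solve 4 (λ a d k m → (a :+ d :- m) :+ ((k :- (a :+ (d :+ d))) :+ (m :- k)) := con (pos 0) :- d) refl (a M) (½ δ) (ι (suc k)) (ι m)))))) (proj₁ (Pos-½ pδ)))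
      where fM = f M ℕ.≤-refl

  ≈0⇒+1≤ : ∀ {x c} → x ≈[ ι c ] 0# → x + 1# ≤ ι (suc c)
  ≈0⇒+1≤ {x} {c} b = ≤-trans (+-monoˡ-≤ 1# (proj₁ b)) (≤-reflexive (trans (solve 1 (λ c → con (pos 0) :+ c :+ :1 := :1 :+ c) refl (ι c)) (sym (ι-suc c))))

  -- Here `I` is the reciprocal of a power of log N and `C` the implied constant. The 3 comes from
  -- `inverse-bound`, and the extra 1 from the tolerance ρ G.
  level-arithmetic : ∀ {E C I : Carrier} {c N G} → 1 ℕ.≤ G → 1 ℕ.≤ N → E ≤ C * (ι N * I) + ρ G → C ≈[ ι c ] 0# → 0# ≤ I → I ≤ ι 3 * ρ G →
    ι G * E ≤ ι (suc (c ℕ.* 3) ℕ.* N)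
  level-arithmetic {E} {C} {I} {c} {N} {G} 1≤G 1≤N u w 0≤I I≤ = begin
    ι G * E ≤⟨ *-monoˡ (0≤ι G) u ⟩
    ι G * (C * (ι N * I) + ρ G) ≤⟨ *-monoˡ (0≤ι G) (+-monoˡ-≤ (ρ G) (≤-trans (*-monoʳ (*-nonNeg (0≤ι N) 0≤I) (≤-trans (proj₁ w) (≤-reflexive (+-identityˡ (ι c))))) (*-monoˡ (0≤ι c) (*-monoˡ (0≤ι N) I≤)))) ⟩
    ι G * (ι c * (ι N * (ι 3 * ρ G)) + ρ G) ≡⟨ solve 5 (λ g c n t r → g :* (c :* (n :* (t :* r)) :+ r) := (g :* r) :* (c :* (n :* t) :+ :1)) refl (ι G) (ι c) (ι N) (ι 3) (ρ G) ⟩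
    (ι G * ρ G) * (ι c * (ι N * ι 3) + 1#) ≡⟨ trans (cong (_* (ι c * (ι N * ι 3) + 1#)) (ρ-inverse 1≤G)) (*-identityˡ _) ⟩
    ι c * (ι N * ι 3) + 1# ≤⟨ +-monoʳ-≤ (ι c * (ι N * ι 3)) (1≤ι 1≤N) ⟩
    ι c * (ι N * ι 3) + ι N ≡⟨ solve 3 (λ c n t → c :* (n :* t) :+ n := (:1 :+ c :* t) :* n) refl (ι c) (ι N) (ι 3) ⟩
    (1# + ι c * ι 3) * ι N ≡⟨ sym (trans (ι-* (suc (c ℕ.* 3)) N) (cong (_* ι N) (trans (ι-suc (c ℕ.* 3)) (cong (1# +_) (ι-* c 3))))) ⟩
    ι (suc (c ℕ.* 3) ℕ.* N) ∎
    where open ≤-Reasoning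

  ≤⇒≈0 : ∀ {x ε} → x ≤ ε → - x ≤ ε → x ≈[ ε ] 0#
  ≤⇒≈0 {x} {ε} a b = ≤-trans a (≤-reflexive (sym (+-identityˡ ε))) , ≤-trans (≤⇒0≤- b) (≤-reflexive (solve 2 (λ e r → e :- :- r := r :+ e) refl ε x))

  ≈0⇒≤ : ∀ {x ε} → x ≈[ ε ] 0# → x ≤ ε × - x ≤ ε
  ≈0⇒≤ {x} {ε} (a , b) = ≤-trans a (≤-reflexive (+-identityˡ ε)) , 0≤-⇒≤ (≤-trans b (≤-reflexive (solve 2 (λ e r → r :+ e := e :- :- r) refl ε x)))

  gap-shift : ∀ {a d t} → a + d ≤ t → 0# + d ≤ t - a
  gap-shift {a} {d} {t} l = 0≤-⇒≤ (≤-trans (≤⇒0≤- l) (≤-reflexive (solve 3 (λ a d t → t :- (a :+ d) := t :- a :- (con (pos 0) :+ d)) refl a d t)))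

  x-[x-a] : ∀ x a → x - (x - a) ≡ a
  x-[x-a] = solve 2 (λ t a → t :- (t :- a) := a) refl

  module Exponential (arch : ∀ x → ∃ λ n → x ≤ ι n) (Sx-cauchy : ∀ c → Cauchy (Sx c)) where

    small : ∀ {ε} → Pos ε → ∃ λ n → ρ (suc n) ≤ ε
    small {ε} (p , ne) with arch (ε ⁻¹)
    ... | n , h = n , subst₂ _≤_ (*-identityʳ _) (trans (sym (*-assoc _ _ ε)) (trans (cong (_* ε) (trans (*-comm _ _) (ρ-inverse {suc n} 1≤s))) (*-identityˡ ε)))
      (*-monoˡ (0≤ρ (suc n)) (≤-trans (≤-reflexive (sym (⁻¹-inverseˡ ne))) (*-monoʳ p (≤-trans h (ι-mono (ℕ.n≤1+n n))))))

    bounded : ∀ {s} → Cauchy s → ∃ λ c → Ev (λ n → s n ≈[ ι c ] 0#)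
    bounded {s} cs with cs 1# (0≤1 , 1≢0)
    ... | M , f with arch (s M) | arch (- s M)
    ... | m , h | m′ , h′ = suc (m ℕ.+ m′) , M , λ n l →
      ≤-trans (proj₁ (f n M l ℕ.≤-refl)) (≤-trans (+-monoˡ-≤ 1# h) (≤-trans (≤-trans (≤-reflexive (+-comm (ι m) 1#)) (≤-trans (≤-reflexive (sym (ι-suc m))) (ι-mono (ℕ.s≤s (ℕ.m≤m+n m m′))))) (≤-reflexive (sym (+-identityˡ _))))) ,
      ≤-trans (≤-trans (0≤+ (≤⇒0≤- h′) (≤⇒0≤- (proj₂ (f n M l ℕ.≤-refl)))) (≤-reflexive (solve 3 (λ t a b → t :- :- a :+ (b :+ :1 :- a) := b :+ (:1 :+ t)) refl (ι m′) (s M) (s n))))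
        (+-monoʳ-≤ (s n) (≤-trans (≤-reflexive (sym (ι-suc m′))) (ι-mono (ℕ.s≤s (ℕ.m≤n+m m′ m)))))

    exp : Seq → Seq
    exp a n = Sx (a n) n

    tail : ∀ c {ε} → Pos ε → Ev (λ m → Sx c (m ℕ.+ m) - Sx c m ≤ ε)
    tail c {ε} p with Sx-cauchy c ε p
    ... | M , f = M , λ m l → ≤-trans (proj₁ (≈0⇒ (f (m ℕ.+ m) m (ℕ.≤-trans l (ℕ.m≤m+n m m)) l))) (≤-reflexive (+-identityˡ ε))

    exp-product : ∀ {a b c d} → Ev (λ n → a n ≈[ ι c ] 0#) → Ev (λ n → b n ≈[ ι d ] 0#) → ∀ {ε} → Pos ε → Ev (λ n → exp a n * exp b n ≈[ ε ] Sx (a n + b n) n)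
    exp-product {a} {b} {c} {d} ha hb p = Ev-map (λ n ((u , v) , t) → ≈-weaken t (Sx-product n u v (0≤ι c) (0≤ι d))) (Ev-× (Ev-× ha hb) (tail (ι c + ι d) p))

    Sx-bound : ∀ c → ∃ λ B → ∀ n → Sx (ι c) n ≤ ι B
    Sx-bound c = go (bounded (Sx-cauchy (ι c)))
      where
      go : (∃ λ B → Ev (λ n → Sx (ι c) n ≈[ ι B ] 0#)) → ∃ λ B → ∀ n → Sx (ι c) n ≤ ι B
      go (B , M , h) = B , λ n → ≤-trans (Sx-extend (0≤ι c) (ℕ.m≤m⊔n n M)) (≤-trans (proj₁ (h (n ℕ.⊔ M) (ℕ.m≤n⊔m n M))) (≤-reflexive (+-identityˡ (ι B))))

    ≈-negate : ∀ {x c : Carrier} → x ≈[ c ] 0# → - x ≈[ c ] 0#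
    ≈-negate {x} {c} h = ≈-subst refl (solve 0 (:- con (pos 0) := con (pos 0)) refl) (≈-neg h)

    -- For negative arguments exp a times exp (-a) is close to 1 while the second factor is bounded,
    -- so the first stays away from zero.
    exp-positive : ∀ {a c} → Ev (λ n → a n ≈[ ι c ] 0#) → ∃ λ κ → Pos κ × Ev (λ n → κ ≤ exp a n)
    exp-positive {a} {c} ha = go (Sx-bound c)
     where
     go : (∃ λ B → ∀ n → Sx (ι c) n ≤ ι B) → ∃ λ κ → Pos κ × Ev (λ n → κ ≤ exp a n)
     go (B , hB) = ρ (2 ℕ.* suc B) , Pos-ρ (2 ℕ.* suc B) 1≤s , Ev-map (λ n ((u , l) , pr) → main n u l pr) (Ev-× (Ev-× ha (Ev-≥ 1)) (exp-product {c = c} {c} ha (Ev-map (λ n → ≈-negate) ha) (Pos-ρ 2 1≤s)))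
      where
      κ = ρ (2 ℕ.* suc B)
      κ≤1 : κ ≤ 1#
      κ≤1 = subst (κ ≤_) ρ1 (ρ-antitone {1} {2 ℕ.* suc B} ℕ.≤-refl 1≤s)
      main : ∀ n → a n ≈[ ι c ] 0# → 1 ℕ.≤ n → exp a n * Sx (- a n) n ≈[ ρ 2 ] Sx (a n + - a n) n → κ ≤ exp a n
      main n u 1≤n pr with total 0# (a n)
      ... | inj₁ 0≤a = ≤-trans κ≤1 (1≤Sx 0≤a 1≤n)
      ... | inj₂ a≤0 = pos-case (total 0# e)
        where
        e = exp a n
        e′ = Sx (- a n) n
        0≤-a : 0# ≤ - a n
        0≤-a = ≤-trans (≤⇒0≤- a≤0) (≤-reflexive (+-identityˡ _))
        1≤e′ : 1# ≤ e′
        1≤e′ = 1≤Sx 0≤-a 1≤n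
        e′≤B : e′ ≤ ι (suc B)
        e′≤B = ≤-trans (≤-trans (Sx-mono n 0≤-a (≤-trans (proj₁ (≈-negate u)) (≤-reflexive (+-identityˡ _)))) (hB n)) (ι-mono (ℕ.n≤1+n B))
        half≤ : ρ 2 ≤ e * e′
        half≤ = 0≤-⇒≤ (subst (0# ≤_) (trans (cong (λ t → e * e′ + ρ 2 - t) (trans (trans (cong (λ t → Sx t n) (-‿inverseʳ (a n))) (Sx-0 n 1≤n)) (trans (sym (ρ-inverse {2} 1≤s)) (solve 1 (λ r → con (pos 2) :* r := r :+ r) refl (ρ 2)))))
          (solve 2 (λ x r → x :+ r :- (r :+ r) := x :- r) refl (e * e′) (ρ 2))) (≤⇒0≤- (proj₂ pr)))
        pos-case : 0# ≤ e ⊎ e ≤ 0# → κ ≤ e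
        pos-case (inj₁ 0≤e) = *-cancelˡ-≤ {ι (suc B)} (0≤ι (suc B)) (ι≢0 {suc B} 1≤s) (≤-trans (≤-reflexive (trans (cong (ι (suc B) *_) (ρ-* 2 (suc B))) (trans (solve 3 (λ b r s → b :* (r :* s) := (b :* s) :* r) refl (ι (suc B)) (ρ 2) (ρ (suc B))) (trans (cong (_* ρ 2) (ρ-inverse {suc B} 1≤s)) (*-identityˡ _)))))
          (≤-trans half≤ (≤-trans (*-monoˡ 0≤e e′≤B) (≤-reflexive (*-comm e _)))))
        pos-case (inj₂ e≤0) = contradiction (antisym (≤-trans half≤ (≤-trans (*-monoʳ (≤-trans 0≤1 1≤e′) e≤0) (≤-reflexive (zeroˡ e′)))) (0≤ρ 2)) (proj₂ (Pos-ρ 2 1≤s))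

    private
      difference : ∀ (x y : Carrier) → x + (y - x) ≡ y
      difference = solve 2 (λ x y → x :+ (y :- x) := y) refl

      diff-bounded : ∀ {a b : Seq} {c d} → Ev (λ n → a n ≈[ ι c ] 0#) → Ev (λ n → b n ≈[ ι d ] 0#) → Ev (λ n → b n - a n ≈[ ι (d ℕ.+ c) ] 0#)
      diff-bounded {c = c} {d} ha hb = Ev-map (λ n (u , v) → ≈-weaken (≤-reflexive (sym (ι-+ d c))) (≈-subst refl (+-identityʳ 0#) (≈-+ v (≈-negate u)))) (Ev-× ha hb)

    -- exp b is about exp a · exp (b - a), and the second factor is at least 1 + δ. Of the gain κ δ
    -- one half is given up for the truncation error in the product rule.
    exp-strict : ∀ {a b} → Cauchy a → Cauchy b → ∀ {δ} → Pos δ → Ev (λ n → a n + δ ≤ b n) → ∃ λ η → Pos η × Ev (λ n → exp a n + η ≤ exp b n)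
    exp-strict {a} {b} ca cb {δ} pδ gap = go (bounded ca) (bounded cb) (λ c ha → exp-positive {c = c} ha)
     where
     go : (∃ λ c → Ev (λ n → a n ≈[ ι c ] 0#)) → (∃ λ d → Ev (λ n → b n ≈[ ι d ] 0#)) →
       (∀ c → Ev (λ n → a n ≈[ ι c ] 0#) → ∃ λ κ → Pos κ × Ev (λ n → κ ≤ exp a n)) → ∃ λ η → Pos η × Ev (λ n → exp a n + η ≤ exp b n)
     go (c , ha) (d , hb) positive = go′ (positive c ha)
      where
      go′ : (∃ λ κ → Pos κ × Ev (λ n → κ ≤ exp a n)) → ∃ λ η → Pos η × Ev (λ n → exp a n + η ≤ exp b n)
      go′ (κ , pκ , hκ) = η , pη , Ev-map (λ n (((g , k) , pr) , l) → main n g k pr l)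
              (Ev-× (Ev-× (Ev-× gap hκ) (exp-product {c = c} {d ℕ.+ c} ha (diff-bounded {c = c} {d} ha hb) pη)) (Ev-≥ 2))
        where
        η = ½ (κ * δ)
        pη = Pos-½ (Pos-* pκ pδ)
        main : ∀ n → a n + δ ≤ b n → κ ≤ exp a n → exp a n * Sx (b n - a n) n ≈[ η ] Sx (a n + (b n - a n)) n → 2 ℕ.≤ n → exp a n + η ≤ exp b n
        main n g k pr l = 0≤-⇒≤ (begin
          0# ≤⟨ 0≤+ (≤⇒0≤- (proj₁ pr)) (0≤+ (≤⇒0≤- grow) (≤⇒0≤- (*-monoʳ (proj₁ pδ) k))) ⟩
          (Sx (a n + (b n - a n)) n + η - e * s) + ((e * s - e * (1# + δ)) + (e * δ - κ * δ))
            ≡⟨ cong₂ (λ t u → (t + η - e * s) + ((e * s - e * (1# + δ)) + (e * δ - u))) (cong (λ z → Sx z n) (difference (a n) (b n))) (sym (½+½ (κ * δ))) ⟩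
          (exp b n + η - e * s) + ((e * s - e * (1# + δ)) + (e * δ - (η + η)))
            ≡⟨ solve 5 (λ f h e s d → (f :+ h :- e :* s) :+ ((e :* s :- e :* (:1 :+ d)) :+ (e :* d :- (h :+ h))) := f :- (e :+ h)) refl (exp b n) η e s δ ⟩
          exp b n - (e + η) ∎)
          where
          open ≤-Reasoning
          e = exp a n
          s = Sx (b n - a n) n
          δ≤ : δ ≤ b n - a n
          δ≤ = 0≤-⇒≤ (subst (0# ≤_) (solve 3 (λ a d b → b :- (a :+ d) := b :- a :- d) refl (a n) δ (b n)) (≤⇒0≤- g))
          grow : e * (1# + δ) ≤ e * s
          grow = *-monoˡ (≤-trans (proj₁ pκ) k) (≤-trans (+-monoʳ-≤ 1# δ≤) (1+z≤Sx (≤-trans (proj₁ pδ) δ≤) l))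

    exp-reflects : ∀ {a b} → Cauchy a → Cauchy b → exp a ⊑ exp b → a ⊑ b
    exp-reflects {a} {b} ca cb h ε p = go (dichotomy ca cb ε p)
      where
      clash : (∃ λ η → Pos η × Ev (λ n → exp b n + η ≤ exp a n)) → ⊥
      clash (η , pη , g) = at (Ev-× g (h (½ η) (Pos-½ pη)))
        where
        at : Ev (λ n → (exp b n + η ≤ exp a n) × (exp a n ≤ exp b n + ½ η)) → ⊥
        at (M , f) = proj₂ (Pos-½ pη) (antisym (0≤-⇒≤ (subst (0# ≤_)
          (trans (cong (λ t → exp b M + ½ η - (exp b M + t)) (sym (½+½ η))) (solve 2 (λ e h → e :+ h :- (e :+ (h :+ h)) := con (pos 0) :- h) refl (exp b M) (½ η)))
          (≤⇒0≤- (≤-trans (proj₁ (f M ℕ.≤-refl)) (proj₂ (f M ℕ.≤-refl)))))) (proj₁ (Pos-½ pη)))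
      go : Ev (λ n → a n ≤ b n + ε) ⊎ (∃ λ δ → Pos δ × Ev (λ n → b n + δ ≤ a n)) → Ev (λ n → a n ≤ b n + ε)
      go (inj₁ l) = l
      go (inj₂ (δ , pδ , gap)) = ⊥-elim (clash (exp-strict cb ca pδ gap))

    -- At each index either a ≤ b, and the product rule applies with a factor of at least 1, or a
    -- exceeds b by less than δ, and the Lipschitz bound applies.
    exp-mono : ∀ {a b} → Cauchy a → Cauchy b → a ⊑ b → exp a ⊑ exp b
    exp-mono {a} {b} ca cb h ε p = outer (bounded ca) (bounded cb)
     where
     go : ∀ c d → Ev (λ n → a n ≈[ ι c ] 0#) → Ev (λ n → b n ≈[ ι d ] 0#) → (∃ λ B → ∀ n → Sx (ι (c ℕ.+ d)) n ≤ ι B) →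
       (∃ λ κ → Pos κ × Ev (λ n → κ ≤ exp a n)) → Ev (λ n → exp a n ≤ exp b n + ε)
     outer : (∃ λ c → Ev (λ n → a n ≈[ ι c ] 0#)) → (∃ λ d → Ev (λ n → b n ≈[ ι d ] 0#)) → Ev (λ n → exp a n ≤ exp b n + ε)
     outer (c , ha) (d , hb) = go c d ha hb (Sx-bound (c ℕ.+ d)) (exp-positive {c = c} ha)
     go c d ha hb (B , hB) (κ , pκ , hκ) = Ev-map (λ n (((((u , v) , l) , k) , pr) , 2≤n) → main n u v l k pr 2≤n)
            (Ev-× (Ev-× (Ev-× (Ev-× (Ev-× ha hb) (h δ pδ)) hκ) (exp-product {c = c} {d ℕ.+ c} ha (diff-bounded {c = c} {d} ha hb) p)) (Ev-≥ 2))
      where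
      δ = ρ (suc B) * ε
      pδ = Pos-* (Pos-ρ (suc B) 1≤s) p
      δB : δ * ι (suc B) ≡ ε
      δB = trans (solve 3 (λ r e b → r :* e :* b := b :* r :* e) refl (ρ (suc B)) ε (ι (suc B))) (trans (cong (_* ε) (ρ-inverse {suc B} 1≤s)) (*-identityˡ ε))
      main : ∀ n → a n ≈[ ι c ] 0# → b n ≈[ ι d ] 0# → a n ≤ b n + δ → κ ≤ exp a n → exp a n * Sx (b n - a n) n ≈[ ε ] Sx (a n + (b n - a n)) n → 2 ℕ.≤ n → exp a n ≤ exp b n + ε
      main n u v l k pr 2≤n with total (a n) (b n)
      ... | inj₁ a≤b = ≤-trans (≤-trans (≤-reflexive (sym (*-identityʳ _))) (*-monoˡ (≤-trans (proj₁ pκ) k) (1≤Sx (≤⇒0≤- a≤b) (ℕ.<⇒≤ 2≤n)))) (≤-trans (proj₁ pr) (≤-reflexive (cong (λ z → Sx z n + ε) (difference (a n) (b n)))))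
      ... | inj₂ b≤a = ≤-trans (proj₁ (Sx-lipschitz n (proj₁ pδ) (≈-weaken (ι-mono (ℕ.m≤m+n c d)) u) (≈-weaken (ι-mono (ℕ.m≤n+m d c)) v) (l , ≤-trans b≤a (x≤x+y (proj₁ pδ))) (0≤ι (c ℕ.+ d))))
        (+-monoʳ-≤ _ (≤-trans (*-monoˡ (proj₁ pδ) (≤-trans (hB n) (ι-mono (ℕ.n≤1+n B)))) (≤-reflexive δB)))

    infix 4 _⋍_
    _⋍_ : Seq → Seq → Set
    a ⋍ b = a ⊑ b × b ⊑ a

    exp-multiple : ∀ {u Y} → Cauchy u → exp u ⋍ const (ι Y) → ∀ k → ∀ ε → Pos ε → Ev (λ n → Sx (ι k * u n) n ≈[ ε ] ι (Y ℕ.^ k))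
    exp-multiple {u} cu h zero ε p = 1 , λ n l → ≈-subst (sym (trans (cong (λ z → Sx z n) (zeroˡ (u n))) (Sx-0 n l))) refl (≈-weaken (proj₁ p) ≈-refl)
    exp-multiple {u} {Y} cu h (suc k) ε p = go (bounded cu) (exp-multiple cu h k)
     where
     go : (∃ λ c → Ev (λ n → u n ≈[ ι c ] 0#)) → (∀ ε → Pos ε → Ev (λ n → Sx (ι k * u n) n ≈[ ε ] ι (Y ℕ.^ k))) → Ev (λ n → Sx (ι (suc k) * u n) n ≈[ ε ] ι (Y ℕ.^ suc k))
     go (c , hc) rec = Ev-map main (Ev-× (Ev-× (proj₁ h δ pδ) (proj₂ h δ pδ)) (Ev-× (rec δ pδ) (exp-product {u} {λ n → ι k * u n} {c} {k ℕ.* c} hc (Ev-map scaled hc) (Pos-½ p))))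
      where
      Z = Y ℕ.^ k
      -- δ ≤ 1 and δ (Y + 1 + Z) ≤ ε/2
      B = suc (Y ℕ.+ Z)
      sm = small (Pos-* (Pos-ρ B 1≤s) (Pos-½ p))
      δ = ρ (suc (proj₁ sm))
      pδ : Pos δ
      pδ = Pos-ρ (suc (proj₁ sm)) 1≤s
      δ≤1 : δ ≤ 1#
      δ≤1 = subst (δ ≤_) ρ1 (ρ-antitone {1} {suc (proj₁ sm)} ℕ.≤-refl 1≤s)
      scaled : ∀ n → u n ≈[ ι c ] 0# → ι k * u n ≈[ ι (k ℕ.* c) ] 0#
      scaled n a = ≈-weaken (≤-reflexive (sym (ι-* k c))) (≈0-* (≈0-nonNeg (0≤ι k)) a)
      main : ∀ n → ((exp u n ≤ ι Y + δ) × (ι Y ≤ exp u n + δ)) × (Sx (ι k * u n) n ≈[ δ ] ι Z × exp u n * Sx (ι k * u n) n ≈[ ½ ε ] Sx (u n + ι k * u n) n) → Sx (ι (suc k) * u n) n ≈[ ε ] ι (Y ℕ.^ suc k)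
      main n ((a , b) , c′ , pr) = ≈-subst (cong (λ z → Sx z n) (trans (solve 2 (λ k u → u :+ k :* u := (:1 :+ k) :* u) refl (ι k) (u n)) (cong (_* u n) (sym (ι-suc k))))) (sym (ι-* Y Z))
        (≈-weaken (≤-reflexive (½+½ ε)) (≈-trans (≈-sym pr) (≈0⇐ (≈-weaken bound (≈-subst (solve 4 (λ x y X Z → x :* (y :- Z) :+ (x :- X) :* Z := x :* y :- X :* Z) refl x y (ι Y) (ι Z)) (+-identityʳ 0#)
          (≈-+ (≈0-* x-abs (≈0⇒ c′)) (≈0-* (≈0⇒ (a , b)) (≈0-nonNeg (0≤ι Z)))))))))
        where
        x = exp u n
        y = Sx (ι k * u n) n
        x-abs : x ≈[ ι (suc Y) ] 0#
        x-abs = ≤-trans a (≤-trans (+-monoʳ-≤ (ι Y) δ≤1) (≤-reflexive (trans (trans (+-comm (ι Y) 1#) (sym (ι-suc Y))) (sym (+-identityˡ _))))) ,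
          ≤-trans (≤-trans (0≤ι Y) b) (+-monoʳ-≤ x (≤-trans δ≤1 (1≤ι {suc Y} 1≤s)))
        bound : ι (suc Y) * δ + δ * ι Z ≤ ½ ε
        bound = ≤-trans (≤-reflexive (trans (solve 3 (λ a d z → a :* d :+ d :* z := (a :+ z) :* d) refl (ι (suc Y)) δ (ι Z)) (cong (_* δ) (sym (ι-+ (suc Y) Z)))))
          (≤-trans (*-monoˡ (0≤ι B) (proj₂ sm)) (≤-reflexive (trans (sym (*-assoc _ _ _)) (trans (cong (_* ½ ε) (ρ-inverse {B} 1≤s)) (*-identityˡ _)))))

    -- y n is the largest multiple of 1/(n+1) whose exponential does not exceed x.
    module Approximation {x : Seq} (cx : Cauchy x) (y : Seq) (0≤y : ∀ n → 0# ≤ y n)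
        (below : ∀ n → Sx (y n) ⊑ x) (above : ∀ n → ¬ Sx (y n + ρ (suc n)) ⊑ x)
        (B : ℕ) (y≤B : ∀ n → y n ≤ ι B) (S : ℕ) (Sx≤S : ∀ n → Sx (ι (2 ℕ.+ B)) n ≤ ι S) where

      private
        δ : ℕ → Carrier
        δ n = ρ (suc n)
        C = 2 ℕ.+ B

        y≤ : ∀ m n → y m ≤ y n + δ n
        y≤ m n with total (y m) (y n + δ n)
        ... | inj₁ l = l
        ... | inj₂ l = contradiction (λ ε pε → Ev-map (λ k → ≤-trans (Sx-mono k (0≤+ (0≤y n) (0≤ρ (suc n))) l)) (below m ε pε)) (above n)

        δ≤1 : ∀ n → δ n ≤ 1#
        δ≤1 n = subst (δ n ≤_) ρ1 (ρ-antitone {1} {suc n} ℕ.≤-refl 1≤s)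

      cauchy : Cauchy y
      cauchy ε p = let M , h = small p in M , λ m n a b →
        ≤-trans (y≤ m n) (+-monoʳ-≤ (y n) (≤-trans (ρ-antitone {suc M} {suc n} 1≤s (ℕ.s≤s b)) h)) , ≤-trans (y≤ n m) (+-monoʳ-≤ (y m) (≤-trans (ρ-antitone {suc M} {suc m} 1≤s (ℕ.s≤s a)) h))

      private
        y+≤C : ∀ n {d} → 0# ≤ d → d ≤ ι 2 → y n + d ≈[ ι C ] 0#
        y+≤C n {d} 0≤d d≤2 = ≤-trans (+-mono-≤ (y≤B n) d≤2) (≤-reflexive (trans (trans (+-comm (ι B) (ι 2)) (sym (ι-+ 2 B))) (sym (+-identityˡ (ι C))))) , 0≤+ (0≤+ (0≤y n) 0≤d) (0≤ι C)

        y≈C : ∀ n → y n ≈[ ι C ] 0#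
        y≈C n = ≈-subst (+-identityʳ (y n)) refl (y+≤C n ≤-refl (0≤ι 2))

        module At {ε : Carrier} (p : Pos ε) (N₀ : ℕ) (sm : ρ (suc N₀) ≤ ρ (2 ℕ.* suc S) * ½ ε) where
          d = δ N₀
          0≤d : 0# ≤ d
          0≤d = 0≤ρ (suc N₀)
          2dS : (d + d) * ι S ≤ ½ ε
          2dS = ≤-trans (≤-trans (*-monoˡ (0≤+ 0≤d 0≤d) (ι-mono (ℕ.n≤1+n S))) (≤-reflexive (trans (solve 2 (λ d b → (d :+ d) :* b := con (pos 2) :* b :* d) refl d (ι (suc S))) (cong (_* d) (sym (ι-* 2 (suc S)))))))
            (≤-trans (*-monoˡ (0≤ι (2 ℕ.* suc S)) sm) (≤-reflexive (trans (sym (*-assoc _ _ _)) (trans (cong (_* ½ ε) (ρ-inverse {2 ℕ.* suc S} 1≤s)) (*-identityˡ _)))))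
          w = y N₀ + d
          w≈C : w ≈[ ι C ] 0#
          w≈C = y+≤C N₀ 0≤d (≤-trans (δ≤1 N₀) (ι-mono {1} {2} 1≤s))

          upper : ∀ n → Sx (y N₀) n ≤ x n + ½ ε → exp y n ≤ x n + ε
          upper n h = begin
            Sx (y n) n ≤⟨ Sx-mono n (0≤y n) (y≤ n N₀) ⟩
            Sx w n ≤⟨ proj₁ (Sx-lipschitz n 0≤d w≈C (y≈C N₀) (≤-refl , ≤-trans (x≤x+y 0≤d) (x≤x+y 0≤d)) (0≤ι C)) ⟩
            Sx (y N₀) n + d * Sx (ι C) n ≤⟨ +-mono-≤ h (≤-trans (*-monoˡ 0≤d (Sx≤S n)) (≤-trans (*-monoʳ (0≤ι S) (x≤x+y 0≤d)) 2dS)) ⟩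
            x n + ½ ε + ½ ε ≡⟨ trans (+-assoc (x n) (½ ε) (½ ε)) (cong (x n +_) (½+½ ε)) ⟩
            x n + ε ∎
            where open ≤-Reasoning

          lower : ∀ n → N₀ ℕ.≤ n → x n ≤ Sx w n + ½ ε → x n ≤ exp y n + ε
          lower n l h = begin
            x n ≤⟨ h ⟩
            Sx w n + ½ ε ≤⟨ +-monoˡ-≤ (½ ε) (≤-trans (proj₂ lip) (+-monoʳ-≤ (exp y n) (≤-trans (*-monoˡ (0≤+ 0≤d 0≤d) (Sx≤S n)) 2dS))) ⟩
            exp y n + ½ ε + ½ ε ≡⟨ trans (+-assoc (exp y n) (½ ε) (½ ε)) (cong (exp y n +_) (½+½ ε)) ⟩
            exp y n + ε ∎
            where
            open ≤-Reasoning
            lip : Sx (y n) n ≈[ (d + d) * Sx (ι C) n ] Sx w n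
            lip = Sx-lipschitz n (0≤+ 0≤d 0≤d) (y≈C n) w≈C
              (≤-trans (y≤ n N₀) (x≤x+y (0≤+ 0≤d 0≤d)) ,
               ≤-trans (+-monoˡ-≤ d (≤-trans (y≤ N₀ n) (+-monoʳ-≤ (y n) (ρ-antitone {suc N₀} {suc n} 1≤s (ℕ.s≤s l))))) (≤-reflexive (+-assoc (y n) d d))) (0≤ι C)

        fine : ∀ {ε} → Pos ε → ∃ λ N₀ → ρ (suc N₀) ≤ ρ (2 ℕ.* suc S) * ½ ε
        fine p = small (Pos-* (Pos-ρ (2 ℕ.* suc S) 1≤s) (Pos-½ p))

      exp-≤ : exp y ⊑ x
      exp-≤ ε p = let N₀ , sm = fine p in Ev-map (At.upper p N₀ sm) (below N₀ (½ ε) (Pos-½ p))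

      exp-≥ : x ⊑ exp y
      exp-≥ ε p = go (fine p)
        where
        go : (∃ λ N₀ → ρ (suc N₀) ≤ ρ (2 ℕ.* suc S) * ½ ε) → Ev (λ n → x n ≤ exp y n + ε)
        go (N₀ , sm) = Ev-map (λ n (h , l) → At.lower p N₀ sm n l h) (Ev-× (reversed (dichotomy cx (Sx-cauchy w) (½ ε) (Pos-½ p))) (Ev-≥ N₀))
          where
          w = y N₀ + δ N₀
          reversed : Ev (λ n → x n ≤ Sx w n + ½ ε) ⊎ (∃ λ δ → Pos δ × Ev (λ n → Sx w n + δ ≤ x n)) → Ev (λ n → x n ≤ Sx w n + ½ ε)
          reversed (inj₁ l) = l
          reversed (inj₂ (δ , pδ , gap)) = contradiction (⊑-pointwise (Ev-map (λ n → ≤-trans (x≤x+y (proj₁ pδ))) gap)) (above N₀)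

    -- Excluded middle decides whether exp q ≤ x for a rational q. Searching along the multiples of
    -- 1/(n + 1) gives approximations from below; the search is finite because exp q ≥ 1 + q
    -- outgrows any bound for x.
    logarithm : (∀ (P : Set) → Dec P) → ∀ {x} → Cauchy x → const 1# ⊑ x → ∃ λ y → Cauchy y × exp y ⋍ x
    logarithm lem {x} cx 1⊑x = outer (bounded cx)
      where
      P : Carrier → Set
      P q = Sx q ⊑ x

      P0 : P 0#
      P0 ε p = Ev-map (λ n (h , l) → ≤-trans (≤-reflexive (Sx-0 n l)) h) (Ev-× (1⊑x ε p) (Ev-≥ 1))

      search : ∀ r K → ¬ P (ι K * r) → ∃ λ k → P (ι k * r) × ¬ P (ι (suc k) * r)
      search r zero np = contradiction (subst P (sym (zeroˡ r)) P0) np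
      search r (suc K) np with lem (P (ι K * r))
      ... | yes p = K , p , np
      ... | no np′ = search r K np′

      outer : (∃ λ b → Ev (λ n → x n ≈[ ι b ] 0#)) → ∃ λ y → Cauchy y × exp y ⋍ x
      outer (b , hb) = build (λ n → search (ρ (suc n)) (suc B ℕ.* suc n) (¬P (≤-reflexive (sym (trans (cong (_* ρ (suc n)) (ι-* (suc B) (suc n)))
          (trans (*-assoc _ _ _) (trans (cong (ι (suc B) *_) (ρ-inverse {suc n} 1≤s)) (*-identityʳ _)))))))) (Sx-bound (3 ℕ.+ B))
        where
        B = suc b

        ¬P : ∀ {q} → ι (suc B) ≤ q → ¬ P q
        ¬P {q} l p = at (Ev-× (Ev-× (p 1# (0≤1 , 1≢0)) hb) (Ev-≥ 2))
          where
          at : Ev (λ n → ((Sx q n ≤ x n + 1#) × x n ≈[ ι b ] 0#) × 2 ℕ.≤ n) → ⊥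
          at (M , f) = 1≢0 (antisym (0≤-⇒≤ (begin
            0# ≤⟨ 0≤+ (≤⇒0≤- (≤-trans (1+z≤Sx (≤-trans (0≤ι (suc B)) l) (proj₂ fM)) (proj₁ (proj₁ fM)))) (0≤+ (≤⇒0≤- l) (≤⇒0≤- (proj₁ (proj₂ (proj₁ fM))))) ⟩
            (x M + 1# - (1# + q)) + ((q - ι (suc B)) + (0# + ι b - x M))
              ≡⟨ cong (λ t → (x M + 1# - (1# + q)) + ((q - t) + (0# + ι b - x M))) (cong (1# +_) (ι-suc b)) ⟩
            (x M + 1# - (1# + q)) + ((q - (1# + (1# + ι b))) + (0# + ι b - x M))
              ≡⟨ solve 3 (λ x q b → (x :+ :1 :- (:1 :+ q)) :+ ((q :- (:1 :+ (:1 :+ b))) :+ (con (pos 0) :+ b :- x)) := con (pos 0) :- :1 :- :1) refl (x M) q (ι b) ⟩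
            0# - 1# - 1# ≤⟨ +-monoˡ-≤ _ (0≤-⇒≤ (subst (0# ≤_) (solve 0 (:1 := con (pos 0) :- (con (pos 0) :- :1)) refl) 0≤1)) ⟩
            0# - 1# ∎)) 0≤1)
            where
            open ≤-Reasoning
            fM = f M ℕ.≤-refl

        build : (∀ n → ∃ λ k → P (ι k * ρ (suc n)) × ¬ P (ι (suc k) * ρ (suc n))) → (∃ λ S → ∀ n → Sx (ι (3 ℕ.+ B)) n ≤ ι S) → ∃ λ y → Cauchy y × exp y ⋍ x
        build found (S , hS) = y , cauchy , exp-≤ , exp-≥
          where
          y : Seq
          y n = ι (proj₁ (found n)) * ρ (suc n)
          advance : ∀ n → ι (suc (proj₁ (found n))) * ρ (suc n) ≡ y n + ρ (suc n)
          advance n = trans (cong (_* ρ (suc n)) (ι-suc (proj₁ (found n)))) (solve 2 (λ k d → (:1 :+ k) :* d := k :* d :+ d) refl (ι (proj₁ (found n))) (ρ (suc n)))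
          y≤B : ∀ n → y n ≤ ι (suc B)
          y≤B n with total (y n) (ι (suc B))
          ... | inj₁ l = l
          ... | inj₂ l = contradiction (proj₁ (proj₂ (found n))) (¬P l)
          open Approximation cx y (λ n → *-nonNeg (0≤ι (proj₁ (found n))) (0≤ρ (suc n))) (λ n → proj₁ (proj₂ (found n)))
            (λ n p → proj₂ (proj₂ (found n)) (subst P (sym (advance n)) p)) (suc B) y≤B S hS

    log-upper : ∀ {y} n → Cauchy y → exp y ⊑ const (ι (suc n)) → y ⊑ const (ℋ n)
    log-upper {y} n cy h = exp-reflects cy (const-cauchy (ℋ n)) (⊑-trans {b = const (ι (suc n))} h (⊑-pointwise (suc n , λ m l → suc≤Sx-ℋ n m l)))

    log-lower : ∀ {y g N} → Cauchy y → 4 ℕ.^ g ℕ.≤ N → const (ι N) ⊑ exp y → const (ι g) ⊑ y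
    log-lower {y} {g} {N} cy l h = exp-reflects (const-cauchy (ι g)) cy (⊑-trans {b = const (ι N)} (⊑-pointwise (0 , λ m _ → ≤-trans (Sx-ι≤4^ g m) (ι-mono l))) h)

    module _ (lem : ∀ (P : Set) → Dec P) where

      private
        log-of : ∀ {g} → 1 ℕ.≤ g → ∃ λ u → Cauchy u × exp u ⋍ const (ι g)
        log-of {g} 1≤g = logarithm lem (const-cauchy (ι g)) (⊑-pointwise (0 , λ _ _ → 1≤ι 1≤g))

        ⊑-scale : ∀ {a b} c → 1 ℕ.≤ c → a ⊑ b → (λ n → ι c * a n) ⊑ (λ n → ι c * b n)
        ⊑-scale {a} {b} c 1≤c h ε p = Ev-map (λ n l → ≤-trans (*-monoˡ (0≤ι c) l) (≤-reflexive (trans (distribˡ (ι c) (b n) _) (cong (ι c * b n +_) (trans (sym (*-assoc _ _ ε)) (trans (cong (_* ε) (ρ-inverse 1≤c)) (*-identityˡ ε)))))))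
          (h (ρ c * ε) (Pos-* (Pos-ρ c 1≤c) p))

        multiple-⊑ : ∀ {u Y} → Cauchy u → exp u ⋍ const (ι Y) → ∀ k → const (ι (Y ℕ.^ k)) ⊑ (λ n → Sx (ι k * u n) n)
        multiple-⊑ cu h k ε p = Ev-map (λ n → proj₂) (exp-multiple cu h k ε p)

        multiple-⊒ : ∀ {u Y} → Cauchy u → exp u ⋍ const (ι Y) → ∀ k → (λ n → Sx (ι k * u n) n) ⊑ const (ι (Y ℕ.^ k))
        multiple-⊒ cu h k ε p = Ev-map (λ n → proj₁) (exp-multiple cu h k ε p)

      power-lower : ∀ {w g} A → 1 ℕ.≤ A → 1 ℕ.≤ g → Cauchy w → const (ι g) ⊑ exp w → const (ι (g ℕ.^ A)) ⊑ (λ n → Sx (ι A * w n) n)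
      power-lower {w} {g} A 1≤A 1≤g cw h = go (log-of 1≤g)
        where
        go : (∃ λ u → Cauchy u × exp u ⋍ const (ι g)) → const (ι (g ℕ.^ A)) ⊑ (λ n → Sx (ι A * w n) n)
        go (u , cu , eu) = ⊑-trans {b = λ n → Sx (ι A * u n) n} (multiple-⊑ cu eu A)
          (exp-mono (scale-cauchy (ι A) (0≤ι A) cu arch) (scale-cauchy (ι A) (0≤ι A) cw arch) (⊑-scale A 1≤A (exp-reflects cu cw (⊑-trans {b = const (ι g)} (proj₁ eu) h))))

      -- From Y^b ≤ N follows b log Y ≤ log N, hence Y^a ≤ exp ((a/b) log N). No b-th root of N is
      -- formed.
      root-lower : ∀ {y N Y} a b → 1 ℕ.≤ a → 1 ℕ.≤ b → 1 ℕ.≤ Y → Y ℕ.^ b ℕ.≤ N → Cauchy y → const (ι N) ⊑ exp y →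
        const (ι (Y ℕ.^ a)) ⊑ (λ n → Sx (ι a * (ρ b * y n)) n)
      root-lower {y} {N} {Y} a b 1≤a 1≤b 1≤Y l cy h = go (log-of 1≤Y)
        where
        go : (∃ λ u → Cauchy u × exp u ⋍ const (ι Y)) → const (ι (Y ℕ.^ a)) ⊑ (λ n → Sx (ι a * (ρ b * y n)) n)
        go (u , cu , eu) = ⊑-trans {b = λ n → Sx (ι a * u n) n} (multiple-⊑ cu eu a) (exp-mono (scale-cauchy (ι a) (0≤ι a) cu arch) (scale-cauchy (ι a) (0≤ι a) cz arch) (⊑-scale a 1≤a u⊑z))
          where
          z : Seq
          z n = ρ b * y n
          cz : Cauchy z
          cz = scale-cauchy (ρ b) (0≤ρ b) cy arch
          bu⊑y : (λ n → ι b * u n) ⊑ y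
          bu⊑y = exp-reflects (scale-cauchy (ι b) (0≤ι b) cu arch) cy (⊑-trans {b = const (ι (Y ℕ.^ b))} (multiple-⊒ cu eu b) (⊑-trans {b = const (ι N)} (⊑-pointwise (0 , λ _ _ → ι-mono l)) h))
          u⊑z : u ⊑ z
          u⊑z ε p = Ev-map (λ n k → ≤-trans (≤-reflexive (sym (cancel (u n)))) (≤-trans (*-monoˡ (0≤ρ b) k) (≤-reflexive (trans (distribˡ (ρ b) (y n) _) (cong (ρ b * y n +_) (cancel ε))))))
            (bu⊑y (ι b * ε) (Pos-* (Pos-ι b 1≤b) p))
            where
            cancel : ∀ t → ρ b * (ι b * t) ≡ t
            cancel t = trans (sym (*-assoc _ _ t)) (trans (cong (_* t) (trans (*-comm _ _) (ρ-inverse 1≤b))) (*-identityˡ t))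

    -- Eventually x ≥ G - 1/2 ≥ G/2 and x I ≤ 3/2, so I ≤ 3/G; nonnegativity follows since x I is at
    -- least 1/2.
    inverse-bound : ∀ {x I : Seq} G → 1 ℕ.≤ G → const (ι G) ⊑ x → (λ n → x n * I n) ⋍ const 1# → Ev (λ n → (0# ≤ I n) × (I n ≤ ι 3 * ρ G))
    inverse-bound {x} {I} G 1≤G hx (h₁ , h₂) = Ev-map (λ n ((a , b) , c) → main n a b c) (Ev-× (Ev-× (hx (ρ 2) pos½) (h₁ (ρ 2) pos½)) (h₂ (ρ 2) pos½))
      where
      pos½ = Pos-ρ 2 1≤s
      main : ∀ n → ι G ≤ x n + ρ 2 → x n * I n ≤ 1# + ρ 2 → 1# ≤ x n * I n + ρ 2 → (0# ≤ I n) × (I n ≤ ι 3 * ρ G)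
      main n a b c = 0≤I (total 0# (I n)) , bound (total 0# (I n))
        where
        half : ρ 2 + ρ 2 ≡ 1#
        half = trans (solve 1 (λ r → r :+ r := con (pos 2) :* r) refl (ρ 2)) (ρ-inverse {2} 1≤s)
        -- G/2 ≤ x
        G≤2x : ι G ≤ ι 2 * x n
        G≤2x = 0≤-⇒≤ (begin
          0# ≤⟨ 0≤+ (≤⇒0≤- a) (0≤+ (≤⇒0≤- a) (≤⇒0≤- (1≤ι 1≤G))) ⟩
          (x n + ρ 2 - ι G) + ((x n + ρ 2 - ι G) + (ι G - 1#)) ≡⟨ cong (λ t → (x n + ρ 2 - ι G) + ((x n + ρ 2 - ι G) + (ι G - t))) (sym half) ⟩
          (x n + ρ 2 - ι G) + ((x n + ρ 2 - ι G) + (ι G - (ρ 2 + ρ 2))) ≡⟨ solve 3 (λ x r g → (x :+ r :- g) :+ ((x :+ r :- g) :+ (g :- (r :+ r))) := con (pos 2) :* x :- g) refl (x n) (ρ 2) (ι G) ⟩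
          ι 2 * x n - ι G ∎)
          where open ≤-Reasoning
        0≤x : 0# ≤ x n
        0≤x = *-cancelˡ-≤ {ι 2} (0≤ι 2) (ι≢0 {2} 1≤s) (≤-trans (≤-reflexive (zeroʳ (ι 2))) (≤-trans (0≤ι G) G≤2x))
        r≤xI : ρ 2 ≤ x n * I n
        r≤xI = 0≤-⇒≤ (subst (0# ≤_) (trans (cong (λ t → x n * I n + ρ 2 - t) (sym half)) (solve 2 (λ u r → u :+ r :- (r :+ r) := u :- r) refl (x n * I n) (ρ 2))) (≤⇒0≤- c))
        0≤I : 0# ≤ I n ⊎ I n ≤ 0# → 0# ≤ I n
        0≤I (inj₁ p) = p
        0≤I (inj₂ p) = contradiction (antisym (≤-trans r≤xI (≤-trans (*-monoˡ 0≤x p) (≤-reflexive (zeroʳ (x n))))) (0≤ρ 2)) (proj₂ (Pos-ρ 2 1≤s))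
        bound : 0# ≤ I n ⊎ I n ≤ 0# → I n ≤ ι 3 * ρ G
        bound (inj₂ p) = ≤-trans p (*-nonNeg (0≤ι 3) (0≤ρ G))
        bound (inj₁ p) = *-cancelˡ-≤ {ι G} (0≤ι G) (ι≢0 1≤G) (begin
          ι G * I n ≤⟨ *-monoʳ p G≤2x ⟩
          ι 2 * x n * I n ≡⟨ *-assoc _ _ _ ⟩
          ι 2 * (x n * I n) ≤⟨ *-monoˡ (0≤ι 2) b ⟩
          ι 2 * (1# + ρ 2) ≡⟨ trans (solve 1 (λ r → con (pos 2) :* (:1 :+ r) := con (pos 2) :+ con (pos 2) :* r) refl (ρ 2)) (trans (cong (ι 2 +_) (ρ-inverse {2} 1≤s)) (solve 0 (con (pos 2) :+ :1 := con (pos 3)) refl)) ⟩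
          ι 3 ≡⟨ sym (trans (solve 3 (λ g a r → g :* (a :* r) := a :* (g :* r)) refl (ι G) (ι 3) (ρ G)) (trans (cong (ι 3 *_) (ρ-inverse 1≤G)) (*-identityʳ (ι 3)))) ⟩
          ι G * (ι 3 * ρ G) ∎)
          where open ≤-Reasoning

    inverse-approx : ∀ {I : Seq} c → 1 ℕ.≤ c → (λ n → ι c * I n) ⋍ const 1# → ∀ ε → Pos ε → Ev (λ n → I n ≈[ ε ] ρ c)
    inverse-approx {I} c 1≤c (h₁ , h₂) ε p = Ev-map (λ n (a , b) → cancel a , cancel′ b) (Ev-× (h₁ ε p) (h₂ ε p))
      where
      ε≤cε : ε ≤ ι c * ε
      ε≤cε = ≤-trans (≤-reflexive (sym (*-identityˡ ε))) (*-monoʳ (proj₁ p) (1≤ι 1≤c))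
      cancel : ∀ {i} → ι c * i ≤ 1# + ε → i ≤ ρ c + ε
      cancel {i} a = *-cancelˡ-≤ {ι c} (0≤ι c) (ι≢0 1≤c) (≤-trans a (≤-trans (+-mono-≤ (≤-reflexive (sym (ρ-inverse 1≤c))) ε≤cε) (≤-reflexive (sym (distribˡ (ι c) (ρ c) ε)))))
      cancel′ : ∀ {i} → 1# ≤ ι c * i + ε → ρ c ≤ i + ε
      cancel′ {i} b = *-cancelˡ-≤ {ι c} (0≤ι c) (ι≢0 1≤c) (≤-trans (≤-reflexive (ρ-inverse 1≤c)) (≤-trans b (≤-trans (+-monoʳ-≤ (ι c * i) ε≤cε) (≤-reflexive (sym (distribˡ (ι c) i ε))))))

  -- Translation of list sums, residues and error totals.

  ∑-[1⋯] : ∀ N (f : ℕ → Carrier) → ∑[ [1⋯ N ] ] f ≡ ∑ N f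
  ∑-[1⋯] zero f = refl
  ∑-[1⋯] (suc N) f = trans (cong (λ xs → ∑[ xs ] f) (sym (List.applyUpTo-∷ʳ suc N))) (trans (∑[]-++ [1⋯ N ] _ f) (cong₂ _+_ (∑-[1⋯] N f) (+-identityʳ _)))

  ι-sum : ∀ {A : Set} (f : A → ℕ) xs → ι (ℕ-sum (List.map f xs)) ≡ ∑[ xs ] (λ x → ι (f x))
  ι-sum f [] = refl
  ι-sum f (x ∷ xs) = trans (ι-+ (f x) _) (cong (ι (f x) +_) (ι-sum f xs))

  ⟦⟧-sum : ∀ {A : Set} (f : A → ℤ) xs → ⟦ List.foldr ℤ._+_ (pos 0) (List.map f xs) ⟧ℤ ≡ ∑[ xs ] (λ x → ⟦ f x ⟧ℤ)
  ⟦⟧-sum f [] = refl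
  ⟦⟧-sum f (x ∷ xs) = trans (+-homo (f x) _) (cong (⟦ f x ⟧ℤ +_) (⟦⟧-sum f xs))

  ⟦⟧-abs : ∀ i → ⟦ i ⟧ℤ ≈[ ι ℤ.∣ i ∣ ] 0#
  ⟦⟧-abs (pos n) = ≤⇒≈0 ≤-refl (≤-trans (0≤-⇒≤ (subst (0# ≤_) (solve 1 (λ x → x := con (pos 0) :- :- x) refl (ι n)) (0≤ι n))) (0≤ι n))
  ⟦⟧-abs -[1+ n ] = ≤⇒≈0 (≤-trans (0≤-⇒≤ (subst (0# ≤_) (solve 1 (λ x → x := con (pos 0) :- :- x) refl (ι (suc n))) (0≤ι (suc n)))) (0≤ι (suc n))) (≤-reflexive (solve 1 (λ x → :- :- x := x) refl (ι (suc n))))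

  module _ (q a : ℕ) (1≤q : 1 ℕ.≤ q) where

    private
      instance
        nonZero : ℕ.NonZero q
        nonZero = ℕ.>-nonZero 1≤q

    -- The conditions take their maxima over residues from 1 to q, while the sieve produces
    -- arbitrary ones. Adding q - 1 before the division yields a remainder that starts at 1.
    representative : ∃ λ a′ → 1 ℕ.≤ a′ × a′ ℕ.≤ q × Cong q a′ a × Cong q a a′
    representative = suc r , ℕ.s≤s ℕ.z≤n , m%n<n (a ℕ.+ ℕ.pred q) q , (t , 1 , eq) , (1 , t , sym eq)
      where
      r = (a ℕ.+ ℕ.pred q) % q
      t = (a ℕ.+ ℕ.pred q) / q
      eq : suc r ℕ.+ t ℕ.* q ≡ a ℕ.+ 1 ℕ.* q
      eq = trans (cong suc (sym (m≡m%n+[m/n]*n (a ℕ.+ ℕ.pred q) q))) (trans (sym (ℕ.+-suc a (ℕ.pred q))) (cong (a ℕ.+_) (trans (ℕ.suc-pred q) (sym (ℕ.*-identityˡ q)))))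

  Cong-coprime : ∀ {q a b} → Cong q a b → Coprime a q → Coprime b q
  Cong-coprime {q} {a} {b} c cop {d} (d∣b , d∣q) = cop (subst (d ∣_) (ℕ.+-identityʳ a) (Cong-divisor {d} {a} {b} {0} (Cong-weaken {q} {d} {a} {b} d∣q c) (subst (d ∣_) (sym (ℕ.+-identityʳ b)) d∣b)) , d∣q)

  class-cong : ∀ {q a b} n → Cong q a b → Cong q b a → 𝟙 (q ∣? ℕ.∣ n - a ∣) ≡ 𝟙 (q ∣? ℕ.∣ n - b ∣)
  class-cong {q} {a} {b} n c c′ = 𝟙-cong (q ∣? ℕ.∣ n - a ∣) (q ∣? ℕ.∣ n - b ∣) (λ d → Cong⇒∣ n b (Cong-trans {q} {n} {a} {b} (∣⇒Cong n a d) c)) (λ d → Cong⇒∣ n a (Cong-trans {q} {n} {b} {a} (∣⇒Cong n b d) c′))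

  Ev-all : ∀ Q {P : ℕ → ℕ → Set} → (∀ q → 1 ℕ.≤ q → Ev (P q)) → Ev (λ n → ∀ q → 1 ℕ.≤ q → q ℕ.≤ Q → P q n)
  Ev-all zero h = 0 , λ n _ q 1≤q q≤0 → contradiction (ℕ.≤-trans 1≤q q≤0) λ ()
  Ev-all (suc Q) {P} h = Ev-map (λ n (a , b) q 1≤q q≤ → at n a b q 1≤q (ℕ.m≤n⇒m<n∨m≡n q≤)) (Ev-× (Ev-all Q h) (h (suc Q) 1≤s))
    where
    at : ∀ n → (∀ q → 1 ℕ.≤ q → q ℕ.≤ Q → P q n) → P (suc Q) n → ∀ q → 1 ℕ.≤ q → q ℕ.< suc Q ⊎ q ≡ suc Q → P q n
    at n a b q 1≤q (inj₁ (ℕ.s≤s l)) = a q 1≤q l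
    at n a b q 1≤q (inj₂ refl) = b

  sum-error : ∀ {A g b Q Q′} (P : ℕ → Carrier) → NonNeg P → 1 ℕ.≤ g → Q′ ℕ.≤ Q → ι (g ℕ.^ suc A) * ∑ Q P ≤ ι b → ι (g ℕ.^ A) * ∑ Q′ P ≤ ι b
  sum-error {A} {g} {b} {Q} {Q′} P 0≤P 1≤g Q′≤Q h = ≤-trans (*-monoˡ (0≤ι (g ℕ.^ A)) (∑-extend Q′≤Q 0≤P))
    (≤-trans (*-monoʳ (∑-nonNeg Q 0≤P) (ι-mono (ℕ.^-monoʳ-≤ g ⦃ ℕ.>-nonZero 1≤g ⦄ (ℕ.n≤1+n A)))) h)

  -- The additional N/(Q′ g^A) is the tolerance for replacing the approximate value of 1/φ(q) at a
  -- finite index by the exact one. Over all q it adds up to N/g^A, so the constant grows by 1.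
  total-error : ∀ {A B g N Q Q′} (P : ℕ → Carrier) → NonNeg P → 1 ℕ.≤ g → 1 ℕ.≤ Q′ → Q′ ℕ.≤ Q → ι (g ℕ.^ suc A) * ∑ Q P ≤ ι (B ℕ.* N) →
    ι (g ℕ.^ A) * ∑ Q′ (λ q → P q + ι N * ρ (Q′ ℕ.* g ℕ.^ A)) ≤ ι (suc B ℕ.* N)
  total-error {A} {B} {g} {N} {Q} {Q′} P 0≤P 1≤g 1≤Q′ Q′≤Q h = begin
    ι G * ∑ Q′ (λ q → P q + ι N * ρ (Q′ ℕ.* G)) ≡⟨ cong (ι G *_) (trans (∑-+ Q′ P (λ _ → ι N * ρ (Q′ ℕ.* G))) (cong (∑ Q′ P +_) (∑-const Q′ (ι N * ρ (Q′ ℕ.* G))))) ⟩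
    ι G * (∑ Q′ P + ι Q′ * (ι N * ρ (Q′ ℕ.* G))) ≡⟨ solve 5 (λ g s q n r → g :* (s :+ q :* (n :* r)) := g :* s :+ (q :* g) :* r :* n) refl (ι G) (∑ Q′ P) (ι Q′) (ι N) (ρ (Q′ ℕ.* G)) ⟩
    ι G * ∑ Q′ P + (ι Q′ * ι G) * ρ (Q′ ℕ.* G) * ι N ≡⟨ cong (λ t → ι G * ∑ Q′ P + t) (trans (cong (_* ι N) (trans (cong (_* ρ (Q′ ℕ.* G)) (sym (ι-* Q′ G))) (ρ-inverse (ℕ.*-mono-≤ 1≤Q′ 1≤G)))) (*-identityˡ (ι N))) ⟩
    ι G * ∑ Q′ P + ι N ≤⟨ +-monoˡ-≤ (ι N) (sum-error {A} {b = B ℕ.* N} P 0≤P 1≤g Q′≤Q h) ⟩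
    ι (B ℕ.* N) + ι N ≡⟨ trans (+-comm (ι (B ℕ.* N)) (ι N)) (sym (ι-+ N (B ℕ.* N))) ⟩
    ι (suc B ℕ.* N) ∎
    where
    open ≤-Reasoning
    G = g ℕ.^ A
    1≤G : 1 ℕ.≤ G
    1≤G = ℕ.m^n>0 g ⦃ ℕ.>-nonZero 1≤g ⦄ A

-- The rationals as an ordered field.

module Rationals where
  open import Data.Integer as ℤ using (ℤ; +_; -[1+_])
  import Data.Integer.Properties as ℤ
  open import Data.Nat as ℕ using (ℕ; zero; suc)
  import Data.Nat.Properties as ℕ
  open import Data.Product using (∃; _,_)
  open import Data.Rational as ℚ using (ℚ; 0ℚ; 1ℚ; _/_; mkℚ)
  import Data.Rational.Properties as ℚ
  import Data.Rational.Unnormalised as ℚᵘ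
  import Data.Rational.Unnormalised.Properties as ℚᵘ
  open import Relation.Binary.PropositionalEquality using (_≡_; _≢_; refl; sym; trans; cong; cong₂; subst; subst₂)
  open import Relation.Nullary using (yes; no; contradiction)
  open import Defs using (fromℕ)

  inverse : ℚ → ℚ
  inverse q with q ℚ.≟ 0ℚ
  ... | yes _ = 0ℚ
  ... | no ne = (ℚ.1/ q) ⦃ ℚ.≢-nonZero ne ⦄

  inverse-spec : ∀ {q} → q ≢ 0ℚ → q ℚ.* inverse q ≡ 1ℚ
  inverse-spec {q} h with q ℚ.≟ 0ℚ
  ... | yes e = contradiction e h
  ... | no ne = ℚ.*-inverseʳ q ⦃ ℚ.≢-nonZero ne ⦄

  ℚ-field : OrderedField
  ℚ-field = record
    { Carrier = ℚ ; _+_ = ℚ._+_ ; _*_ = ℚ._*_ ; -_ = ℚ.-_ ; _⁻¹ = inverse ; 0# = 0ℚ ; 1# = 1ℚ ; _≤_ = ℚ._≤_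
    ; isCommutativeRing = ℚ.+-*-isCommutativeRing ; isTotalOrder = ℚ.≤-isTotalOrder
    ; +-monoʳ-≤ = λ z → ℚ.+-monoʳ-≤ z
    ; *-nonNeg = λ {p} {q} hp hq → ℚ.nonNegative⁻¹ (p ℚ.* q) ⦃ ℚ.nonNeg*nonNeg⇒nonNeg p ⦃ ℚ.nonNegative hp ⦄ q ⦃ ℚ.nonNegative hq ⦄ ⦄
    ; ⁻¹-inverseʳ = inverse-spec ; 1≢0 = λ () }

  module ℚF = OverField ℚ-field
  open ℚF using (ι; ι-suc; ρ; ρ-unique)

  private
    toℚᵘ-/ : ∀ i n .⦃ _ : ℕ.NonZero n ⦄ → ℚ.toℚᵘ (i / n) ℚᵘ.≃ (i ℚᵘ./ n)
    toℚᵘ-/ i (suc n) = ℚ.toℚᵘ-fromℚᵘ (ℚᵘ.mkℚᵘ i n)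

  fromℕ≡ι : ∀ n → fromℕ n ≡ ι n
  fromℕ≡ι zero = refl
  fromℕ≡ι (suc n) = trans step (trans (cong (1ℚ ℚ.+_) (fromℕ≡ι n)) (sym (ι-suc n)))
    where
    step : fromℕ (suc n) ≡ 1ℚ ℚ.+ fromℕ n
    step = ℚ.toℚᵘ-injective (ℚᵘ.≃-trans (toℚᵘ-/ (+ suc n) 1) (ℚᵘ.≃-trans (ℚᵘ.*≡* (cong (ℤ._* + 1) (cong (ℤ._+_ (+ 1)) (sym (ℤ.*-identityʳ (+ n))))))
      (ℚᵘ.≃-trans (ℚᵘ.+-congʳ (ℚ.toℚᵘ 1ℚ) (ℚᵘ.≃-sym (toℚᵘ-/ (+ n) 1))) (ℚᵘ.≃-sym (ℚ.toℚᵘ-homo-+ 1ℚ (fromℕ n))))))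

  /≡ι*ρ : ∀ m n → + m / suc n ≡ ι m ℚ.* ρ (suc n)
  /≡ι*ρ m n = trans product (cong₂ ℚ._*_ (fromℕ≡ι m) unit)
    where
    product : + m / suc n ≡ fromℕ m ℚ.* (+ 1 / suc n)
    product = ℚ.toℚᵘ-injective (ℚᵘ.≃-trans (toℚᵘ-/ (+ m) (suc n)) (ℚᵘ.≃-trans (ℚᵘ.*≡* (cong₂ ℤ._*_ (sym (ℤ.*-identityʳ (+ m))) (cong +_ (ℕ.*-identityˡ (suc n)))))
      (ℚᵘ.≃-trans (ℚᵘ.*-cong (ℚᵘ.≃-sym (toℚᵘ-/ (+ m) 1)) (ℚᵘ.≃-sym (toℚᵘ-/ (+ 1) (suc n)))) (ℚᵘ.≃-sym (ℚ.toℚᵘ-homo-* (fromℕ m) (+ 1 / suc n))))))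
    reciprocal : fromℕ (suc n) ℚ.* (+ 1 / suc n) ≡ 1ℚ
    reciprocal = ℚ.toℚᵘ-injective (ℚᵘ.≃-trans (ℚ.toℚᵘ-homo-* (fromℕ (suc n)) (+ 1 / suc n)) (ℚᵘ.≃-trans (ℚᵘ.*-cong (toℚᵘ-/ (+ suc n) 1) (toℚᵘ-/ (+ 1) (suc n)))
      (ℚᵘ.*≡* (trans (ℤ.*-identityʳ (+ suc n ℤ.* + 1)) (trans (ℤ.*-identityʳ (+ suc n)) (sym (trans (ℤ.*-identityˡ _) (cong +_ (ℕ.*-identityˡ (suc n))))))))))
    unit : + 1 / suc n ≡ ρ (suc n)
    unit = ρ-unique {suc n} (ℕ.s≤s ℕ.z≤n) (trans (cong (ℚ._* (+ 1 / suc n)) (sym (fromℕ≡ι (suc n)))) reciprocal)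

  archimedean : ∀ q → ∃ λ n → q ℚ.≤ ι n
  archimedean q@(mkℚ i d _) = ℤ.∣ i ∣ , subst (q ℚ.≤_) (fromℕ≡ι ℤ.∣ i ∣) (ℚ.toℚᵘ-cancel-≤
    (ℚᵘ.≤-trans (ℚᵘ.*≤* (bound i)) (ℚᵘ.≤-reflexive (ℚᵘ.≃-sym (toℚᵘ-/ (+ ℤ.∣ i ∣) 1)))))
    where
    bound : ∀ i → i ℤ.* + 1 ℤ.≤ + ℤ.∣ i ∣ ℤ.* + suc d
    bound (+ n) = subst₂ ℤ._≤_ (ℤ.pos-* n 1) (ℤ.pos-* n (suc d)) (ℤ.+≤+ (ℕ.*-monoʳ-≤ n (ℕ.s≤s ℕ.z≤n)))
    bound -[1+ n ] = ℤ.-≤+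

-- Cauchy reals read as sequences over that field.

module Reals where
  open Rationals
  open ℚF
  open import Data.Empty using (⊥-elim)
  open import Data.Nat as ℕ using (ℕ; zero; suc)
  import Data.Nat.Properties as ℕ
  open import Data.Product using (∃; _×_; _,_)
  open import Data.Rational as ℚ using (ℚ; 0ℚ)
  import Data.Rational.Properties as ℚ
  open import Data.Sum using (_⊎_; inj₁; inj₂)
  open import Level using (0ℓ)
  open import Relation.Binary.PropositionalEquality using (_≡_; _≢_; refl; sym; trans; cong; cong₂; subst; subst₂)
  open import Relation.Nullary using (¬_; Dec; yes; no; contradiction)
  open import Defs using (fromℕ; expTerm; expSum; ℝ; mkℝ; fromℚᴿ; fromℕᴿ; _≤ᴿ_; _<ᴿ_; _≈ᴿ_; _*ᴿ_; 0ᴿ; 1ᴿ; log; ⌊_⌋; _⁻¹ᴿ) renaming (exp to expᴿ)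
  open ℝ

  <⇒Pos : ∀ {ε} → 0ℚ ℚ.< ε → Pos ε
  <⇒Pos h = ℚ.<⇒≤ h , λ e → ℚ.<-irrefl (sym e) h

  Pos⇒< : ∀ {ε} → Pos ε → 0ℚ ℚ.< ε
  Pos⇒< (p , ne) = ℚ.≰⇒> λ h → ne (antisym h p)

  x≤∣x∣ : ∀ x → x ≤ ℚ.∣ x ∣
  x≤∣x∣ x with total 0# x
  ... | inj₁ h = ≤-reflexive (sym (ℚ.0≤p⇒∣p∣≡p h))
  ... | inj₂ h = ≤-trans h (ℚ.0≤∣p∣ x)

  ∣-∣≤⇒≈ : ∀ {x y ε} → ℚ.∣ x - y ∣ ≤ ε → x ≈[ ε ] y
  ∣-∣≤⇒≈ {x} {y} {ε} h = ≈0⇐ (≤⇒≈0 (≤-trans (x≤∣x∣ (x - y)) h) (≤-trans (x≤∣x∣ (- (x - y))) (≤-trans (≤-reflexive (ℚ.∣-p∣≡∣p∣ (x - y))) h)))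

  ≈⇒∣-∣≤ : ∀ {x y ε} → x ≈[ ε ] y → ℚ.∣ x - y ∣ ≤ ε
  ≈⇒∣-∣≤ {x} {y} {ε} h = main (≈0⇒≤ (≈0⇒ h))
    where
    main : x - y ≤ ε × - (x - y) ≤ ε → ℚ.∣ x - y ∣ ≤ ε
    main (a , b) with ℚ.∣p∣≡p∨∣p∣≡-p (x - y)
    ... | inj₁ eq = ≤-trans (≤-reflexive eq) a
    ... | inj₂ eq = ≤-trans (≤-reflexive eq) b

  seq-cauchy : ∀ x → Cauchy (seq x)
  seq-cauchy x ε p = go (cauchy x ε (Pos⇒< p))
    where
    go : (∃ λ M → ∀ m n → M ℕ.≤ m → M ℕ.≤ n → ℚ.∣ seq x m - seq x n ∣ ≤ ε) → ∃ λ M → ∀ m n → M ℕ.≤ m → M ℕ.≤ n → seq x m ≈[ ε ] seq x n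
    go (M , f) = M , λ m n a b → ∣-∣≤⇒≈ (f m n a b)

  real : ∀ {s} → Cauchy s → ℝ
  real {s} c = mkℝ s λ ε p → let (M , f) = c ε (<⇒Pos p) in M , λ m n a b → ≈⇒∣-∣≤ (f m n a b)

  ≤ᴿ⇒⊑ : ∀ {x y} → x ≤ᴿ y → seq x ⊑ seq y
  ≤ᴿ⇒⊑ h ε p = h ε (Pos⇒< p)

  ⊑⇒≤ᴿ : ∀ {x y} → seq x ⊑ seq y → x ≤ᴿ y
  ⊑⇒≤ᴿ h ε p = h ε (<⇒Pos p)

  expTerm≡T : ∀ z k → expTerm z k ≡ T z k
  expTerm≡T z zero = refl
  expTerm≡T z (suc k) = cong₂ _*_ (expTerm≡T z k) (cong (z *_) (trans (/≡ι*ρ 1 k) (*-identityˡ (ρ (suc k)))))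

  expSum≡Sx : ∀ z n → expSum z n ≡ Sx z n
  expSum≡Sx z zero = refl
  expSum≡Sx z (suc n) = cong₂ _+_ (expSum≡Sx z n) (expTerm≡T z n)

  Sx-cauchy : ∀ c → Cauchy (Sx c)
  Sx-cauchy c ε p = go (seq-cauchy (expᴿ (fromℚᴿ c)) ε p)
    where
    go : (∃ λ M → ∀ m n → M ℕ.≤ m → M ℕ.≤ n → expSum c m ≈[ ε ] expSum c n) → ∃ λ M → ∀ m n → M ℕ.≤ m → M ℕ.≤ n → Sx c m ≈[ ε ] Sx c n
    go (M , f) = M , λ m n a b → ≈-subst (expSum≡Sx c m) (expSum≡Sx c n) (f m n a b)

  open Exponential archimedean Sx-cauchy public

  expᴿ≡ : ∀ x n → seq (expᴿ x) n ≡ exp (seq x) n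
  expᴿ≡ x n = expSum≡Sx (seq x n) n

  fromℕᴿ≡ : ∀ k n → seq (fromℕᴿ k) n ≡ ι k
  fromℕᴿ≡ k n = fromℕ≡ι k

  ⊑-≡ : ∀ {a a′ b b′ : Seq} → (∀ n → a n ≡ a′ n) → (∀ n → b n ≡ b′ n) → a ⊑ b → a′ ⊑ b′
  ⊑-≡ e f h ε p = Ev-map (λ n → subst₂ _≤_ (e n) (cong (_+ ε) (f n))) (h ε p)

  module _ (decide : ∀ (P : Set) → Dec P) where

    log-exists : ∀ x → (∃ λ y → expᴿ y ≈ᴿ x) → expᴿ (log (λ {P} → decide P) x) ≈ᴿ x
    log-exists x e with decide (∃ λ y → expᴿ y ≈ᴿ x)
    ... | yes (y , h) = h
    ... | no ¬e = contradiction e ¬e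

    log-spec : ∀ x → const 1# ⊑ seq x → exp (seq (log (λ {P} → decide P) x)) ⋍ seq x
    log-spec x h = convert (log-exists x (find (logarithm decide (seq-cauchy x) h)))
      where
      find : (∃ λ y → Cauchy y × exp y ⋍ seq x) → ∃ λ y → expᴿ y ≈ᴿ x
      find (y , cy , a , b) = real cy , ⊑⇒≤ᴿ {expᴿ (real cy)} {x} (⊑-≡ {b = seq x} (λ n → sym (expᴿ≡ (real cy) n)) (λ _ → refl) a) ,
        ⊑⇒≤ᴿ {x} {expᴿ (real cy)} (⊑-≡ {a = seq x} (λ _ → refl) (λ n → sym (expᴿ≡ (real cy) n)) b)
      y = log (λ {P} → decide P) x
      convert : expᴿ y ≈ᴿ x → exp (seq y) ⋍ seq x
      convert (a , b) = ⊑-≡ {b = seq x} (expᴿ≡ y) (λ _ → refl) (≤ᴿ⇒⊑ {expᴿ y} {x} a) , ⊑-≡ {a = seq x} (λ _ → refl) (expᴿ≡ y) (≤ᴿ⇒⊑ {x} {expᴿ y} b)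

    log-fromℕ : ∀ m → 1 ℕ.≤ m → exp (seq (log (λ {P} → decide P) (fromℕᴿ m))) ⋍ const (ι m)
    log-fromℕ m 1≤m = go (log-spec (fromℕᴿ m) (⊑-pointwise (0 , λ n _ → ≤-trans (1≤ι 1≤m) (≤-reflexive (sym (fromℕᴿ≡ m n))))))
      where
      go : exp (seq (log (λ {P} → decide P) (fromℕᴿ m))) ⋍ seq (fromℕᴿ m) → exp (seq (log (λ {P} → decide P) (fromℕᴿ m))) ⋍ const (ι m)
      go (a , b) = ⊑-≡ {exp (seq (log (λ {P} → decide P) (fromℕᴿ m)))} (λ _ → refl) (fromℕᴿ≡ m) a , ⊑-≡ {b = exp (seq (log (λ {P} → decide P) (fromℕᴿ m)))} (fromℕᴿ≡ m) (λ _ → refl) b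

    private
      below⇒<ᴿ : ∀ x k → ¬ const (ι k) ⊑ seq x → x <ᴿ fromℕᴿ k
      below⇒<ᴿ x k ¬h with decide (x <ᴿ fromℕᴿ k)
      ... | yes h = h
      ... | no ¬s = ⊥-elim (¬h λ ε p → go ε (dichotomy (const-cauchy (ι k)) (seq-cauchy x) ε p))
        where
        go : ∀ ε → Ev (λ n → ι k ≤ seq x n + ε) ⊎ (∃ λ δ → Pos δ × Ev (λ n → seq x n + δ ≤ ι k)) → Ev (λ n → ι k ≤ seq x n + ε)
        go ε (inj₁ h) = h
        go ε (inj₂ (δ , pδ , h)) = ⊥-elim (¬s (δ , Pos⇒< pδ , Ev-map (λ n l → ≤-trans l (≤-reflexive (sym (fromℕᴿ≡ k n)))) h))

      floor-exists : ∀ x m → const (ι m) ⊑ seq x → ∃ λ k → fromℕᴿ k ≤ᴿ x × x <ᴿ fromℕᴿ (suc k)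
      floor-exists x m h = outer (bounded (seq-cauchy x))
        where
        search : ∀ j k → const (ι k) ⊑ seq x → ¬ const (ι (j ℕ.+ suc k)) ⊑ seq x → ∃ λ k → fromℕᴿ k ≤ᴿ x × x <ᴿ fromℕᴿ (suc k)
        search j k hk ¬h with decide (const (ι (suc k)) ⊑ seq x)
        ... | no ¬s = k , ⊑⇒≤ᴿ {fromℕᴿ k} {x} (⊑-≡ {b = seq x} (λ n → sym (fromℕᴿ≡ k n)) (λ _ → refl) hk) , below⇒<ᴿ x (suc k) ¬s
        search zero k hk ¬h | yes s = ⊥-elim (¬h s)
        search (suc j) k hk ¬h | yes s = search j (suc k) s λ t → ¬h (subst (λ i → const (ι i) ⊑ seq x) (ℕ.+-suc j (suc k)) t)
        outer : (∃ λ c → Ev (λ n → seq x n ≈[ ι c ] 0#)) → ∃ λ k → fromℕᴿ k ≤ᴿ x × x <ᴿ fromℕᴿ (suc k)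
        outer (c , bd) = search (suc c) m h λ t → no-gap {seq x} {c} {suc c} ℕ.≤-refl
          (⊑-trans {b = const (ι (suc c ℕ.+ suc m))} {c = seq x} (⊑-pointwise (0 , λ _ _ → ι-mono (ℕ.m≤m+n (suc c) (suc m)))) t) (0≤1 , 1≢0)
          (Ev-map (λ n b → ≈0⇒+1≤ {c = c} b) bd)

    ≤⌊⌋-elim : ∀ x m → (∃ λ k → fromℕᴿ k ≤ᴿ x × x <ᴿ fromℕᴿ (suc k)) → (∀ k → x <ᴿ fromℕᴿ (suc k) → m ℕ.≤ k) → m ℕ.≤ ⌊_⌋ (λ {P} → decide P) x
    ≤⌊⌋-elim x m e f with decide (∃ λ k → fromℕᴿ k ≤ᴿ x × x <ᴿ fromℕᴿ (suc k))
    ... | yes (k , _ , h) = f k h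
    ... | no ¬e = contradiction e ¬e

    ≤⌊⌋ : ∀ x m → const (ι m) ⊑ seq x → m ℕ.≤ ⌊_⌋ (λ {P} → decide P) x
    ≤⌊⌋ x m h = ≤⌊⌋-elim x m (floor-exists x m h) below
      where
      below : ∀ k → x <ᴿ fromℕᴿ (suc k) → m ℕ.≤ k
      below k (δ , 0<δ , gap) = ℕ.≮⇒≥ λ k<m → no-gap {seq x} k<m h (<⇒Pos 0<δ) (Ev-map (λ n l → ≤-trans l (≤-reflexive (fromℕᴿ≡ (suc k) n))) gap)

    inverse-cases : ∀ x → x *ᴿ _⁻¹ᴿ (λ {P} → decide P) x ≈ᴿ 1ᴿ ⊎ (¬ (∃ λ y → x *ᴿ y ≈ᴿ 1ᴿ) × _⁻¹ᴿ (λ {P} → decide P) x ≡ 0ᴿ)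
    inverse-cases x with decide (∃ λ y → x *ᴿ y ≈ᴿ 1ᴿ)
    ... | yes (y , h) = inj₁ h
    ... | no ¬e = inj₂ (¬e , refl)

    inverse-fromℕ : ∀ c → 1 ℕ.≤ c → (λ n → ι c * seq (_⁻¹ᴿ (λ {P} → decide P) (fromℕᴿ c)) n) ⋍ const 1#
    inverse-fromℕ c 1≤c = go (inverse-cases (fromℕᴿ c))
      where
      y = _⁻¹ᴿ (λ {P} → decide P) (fromℕᴿ c)
      eq : fromℕ c * ρ c ≡ 1#
      eq = trans (cong (_* ρ c) (fromℕ≡ι c)) (ρ-inverse 1≤c)
      go : fromℕᴿ c *ᴿ y ≈ᴿ 1ᴿ ⊎ (¬ (∃ λ y → fromℕᴿ c *ᴿ y ≈ᴿ 1ᴿ) × y ≡ 0ᴿ) → (λ n → ι c * seq y n) ⋍ const 1#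
      go (inj₁ (a , b)) = ⊑-≡ {b = const 1#} (λ n → cong (_* seq y n) (fromℕᴿ≡ c n)) (λ _ → refl) (≤ᴿ⇒⊑ {fromℕᴿ c *ᴿ y} {1ᴿ} a) ,
        ⊑-≡ {a = const 1#} (λ _ → refl) (λ n → cong (_* seq y n) (fromℕᴿ≡ c n)) (≤ᴿ⇒⊑ {1ᴿ} {fromℕᴿ c *ᴿ y} b)
      go (inj₂ (¬e , _)) = ⊥-elim (¬e (fromℚᴿ (ρ c) , ⊑⇒≤ᴿ {fromℕᴿ c *ᴿ fromℚᴿ (ρ c)} {1ᴿ} (⊑-pointwise (0 , λ n _ → ≤-reflexive eq)) ,
        ⊑⇒≤ᴿ {1ᴿ} {fromℕᴿ c *ᴿ fromℚᴿ (ρ c)} (⊑-pointwise (0 , λ n _ → ≤-reflexive (sym eq)))))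

-- From a level of distribution to rational bounds.

module HasLevel where
  open Rationals
  open ℚF hiding (_^_)
  open Reals
  open import Data.Nat as ℕ using (ℕ; suc; _^_)
  import Data.Nat.Properties as ℕ
  open import Data.Product using (∃; _×_; _,_; proj₂)
  open import Data.Sum using (_⊎_; inj₁; inj₂)
  open import Level using (0ℓ)
  open import Relation.Binary.PropositionalEquality using (_≡_; _≢_; refl; sym; trans; cong)
  open import Relation.Nullary using (¬_; Dec)
  open import Defs using (fromℕ; expSum; ℝ; fromℚᴿ; fromℕᴿ; _≤ᴿ_; _<ᴿ_; _≈ᴿ_; _*ᴿ_; _-ᴿ_; 0ᴿ; 1ᴿ; log; ⌊_⌋; _⁻¹ᴿ; _^ᴿ_; _/ᴿ_; HasLevel)
  open ℝ

  module _ (decide : ∀ (P : Set) → Dec P) where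

    private

      infix 9 _⁻¹′
      _⁻¹′ : ℝ → ℝ
      x ⁻¹′ = _⁻¹ᴿ (λ {P} → decide P) x

    -- Should no inverse exist, the dummy value 0 satisfies the bound too, so invertibility of x
    -- need not be established first.
    inverse-small : ∀ x G → 1 ℕ.≤ G → const (ι G) ⊑ seq x → Ev (λ n → (0# ≤ seq (x ⁻¹′) n) × (seq (x ⁻¹′) n ≤ ι 3 * ρ G))
    inverse-small x G 1≤G h = go (inverse-cases decide x)
      where
      go : x *ᴿ x ⁻¹′ ≈ᴿ 1ᴿ ⊎ (¬ (∃ λ y → x *ᴿ y ≈ᴿ 1ᴿ) × x ⁻¹′ ≡ 0ᴿ) → Ev (λ n → (0# ≤ seq (x ⁻¹′) n) × (seq (x ⁻¹′) n ≤ ι 3 * ρ G))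
      go (inj₁ (a , b)) = inverse-bound {seq x} {seq (x ⁻¹′)} G 1≤G h (≤ᴿ⇒⊑ {x *ᴿ x ⁻¹′} {1ᴿ} a , ≤ᴿ⇒⊑ {1ᴿ} {x *ᴿ x ⁻¹′} b)
      go (inj₂ (_ , e)) = 0 , λ n _ → ≤-reflexive (cong (λ z → seq z n) (sym e)) , ≤-trans (≤-reflexive (cong (λ z → seq z n) e)) (*-nonNeg (0≤ι 3) (0≤ρ G))

    log-large : ∀ {N g} → 1 ℕ.≤ g → 4 ^ g ℕ.≤ N → const (ι g) ⊑ seq (log (λ {P} → decide P) (fromℕᴿ N))
    log-large {N} {g} 1≤g h = log-lower {seq (log (λ {P} → decide P) (fromℕᴿ N))} {g} {N} (seq-cauchy (log (λ {P} → decide P) (fromℕᴿ N))) h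
      (proj₂ (log-fromℕ decide N (ℕ.≤-trans (ℕ.m^n>0 4 g) h)))

    log-power-large : ∀ {N g} A → 1 ℕ.≤ A → 1 ℕ.≤ g → 4 ^ g ℕ.≤ N → const (ι (g ^ A)) ⊑ seq (_^ᴿ_ (λ {P} → decide P) (log (λ {P} → decide P) (fromℕᴿ N)) (fromℕᴿ A))
    log-power-large {N} {g} A 1≤A 1≤g h = ⊑-≡ {const (ι (g ^ A))} {const (ι (g ^ A))} {λ n → Sx (ι A * seq w n) n} {seq (_^ᴿ_ (λ {P} → decide P) x (fromℕᴿ A))} (λ _ → refl) convert
      (power-lower decide {seq w} {g} A 1≤A 1≤g (seq-cauchy w) (⊑-trans {const (ι g)} {seq x} {exp (seq w)} g⊑ (proj₂ (log-spec decide x 1⊑))))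
      where
      x = log (λ {P} → decide P) (fromℕᴿ N)
      w = log (λ {P} → decide P) x
      g⊑ : const (ι g) ⊑ seq x
      g⊑ = log-large {N} {g} 1≤g h
      1⊑ : const 1# ⊑ seq x
      1⊑ = ⊑-trans {const 1#} {const (ι g)} {seq x} (⊑-pointwise (0 , λ _ _ → 1≤ι {g} 1≤g)) g⊑
      convert : ∀ n → Sx (ι A * seq w n) n ≡ expSum (fromℕ A * seq w n) n
      convert n = sym (trans (expSum≡Sx (fromℕ A * seq w n) n) (cong (λ t → Sx (t * seq w n) n) (fromℕ≡ι A)))

    private
      root-exponent : ∀ {N Y} num D → 1 ℕ.≤ num → 1 ℕ.≤ D → 1 ℕ.≤ Y → Y ^ D ℕ.≤ N → const (ι (Y ^ num)) ⊑ (λ n → Sx (ι num * (ρ D * seq (log (λ {P} → decide P) (fromℕᴿ N)) n)) n)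
      root-exponent {N} {Y} num D 1≤num 1≤D 1≤Y h = root-lower decide {seq (log (λ {P} → decide P) (fromℕᴿ N))} {N} {Y} num D 1≤num 1≤D 1≤Y h (seq-cauchy (log (λ {P} → decide P) (fromℕᴿ N)))
        (proj₂ (log-fromℕ decide N (ℕ.≤-trans (ℕ.m^n>0 Y ⦃ ℕ.>-nonZero 1≤Y ⦄ D) h)))

      exponent≡ : ∀ s y num D → (∀ n → seq s n ≡ ι num * ρ D) → ∀ n → Sx (ι num * (ρ D * seq y n)) n ≡ expSum (seq s n * seq y n) n
      exponent≡ s y num D e n = sym (trans (expSum≡Sx (seq s n * seq y n) n) (cong (λ t → Sx t n) (trans (cong (_* seq y n) (e n)) (*-assoc (ι num) (ρ D) (seq y n)))))

      root-⊑ : ∀ {N Y} s num D → 1 ℕ.≤ num → 1 ℕ.≤ D → 1 ℕ.≤ Y → Y ^ D ℕ.≤ N → (∀ n → seq s n ≡ ι num * ρ D) → const (ι (Y ^ num)) ⊑ seq (_^ᴿ_ (λ {P} → decide P) (fromℕᴿ N) s)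
      root-⊑ {N} {Y} s num D 1≤num 1≤D 1≤Y h e =
        ⊑-≡ {const (ι (Y ^ num))} {const (ι (Y ^ num))} {λ n → Sx (ι num * (ρ D * seq (log (λ {P} → decide P) (fromℕᴿ N)) n)) n} {seq (_^ᴿ_ (λ {P} → decide P) (fromℕᴿ N) s)} (λ _ → refl) (exponent≡ s (log (λ {P} → decide P) (fromℕᴿ N)) num D e) (root-exponent {N} {Y} num D 1≤num 1≤D 1≤Y h)

    root-large : ∀ {N Y} s num D → 1 ℕ.≤ num → 1 ℕ.≤ D → 1 ℕ.≤ Y → Y ^ D ℕ.≤ N → (∀ n → seq s n ≡ ι num * ρ D) → Y ^ num ℕ.≤ ⌊_⌋ (λ {P} → decide P) (_^ᴿ_ (λ {P} → decide P) (fromℕᴿ N) s)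
    root-large {N} {Y} s num D 1≤num 1≤D 1≤Y h e = ≤⌊⌋ decide _ (Y ^ num) (root-⊑ {N} {Y} s num D 1≤num 1≤D 1≤Y h e)

    level-bound : ∀ (E : ℕ → ℕ → ℝ) ϑ ϑ₀ num D → 1 ℕ.≤ num → 1 ℕ.≤ D → ϑ₀ ≡ ι num * ρ D → fromℚᴿ ϑ₀ <ᴿ ϑ → HasLevel (λ {P} → decide P) E ϑ →
      ∀ A → 1 ℕ.≤ A → ∃ λ B → ∀ N Y g → 1 ℕ.≤ g → 4 ^ g ℕ.≤ N → Y ^ D ℕ.≤ N → 1 ℕ.≤ Y →
      ∃ λ Q → Y ^ num ℕ.≤ Q × Ev (λ n → ι (g ^ A) * seq (E N Q) n ≤ ι (B ℕ.* N))
    level-bound E ϑ ϑ₀ num D 1≤num 1≤D eq (δ , 0<δ , gap) hyp A 1≤A = outer (hyp ε (fromℕᴿ A) 0<ε 0<A)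
      where
      -- The whole strict gap is spent at once: ϑ - ε is then `ϑ₀` at every index, and the range of
      -- moduli is N^ϑ₀ exactly.
      ε = ϑ -ᴿ fromℚᴿ ϑ₀
      Q : ℕ → ℕ
      Q N = ⌊_⌋ (λ {P} → decide P) (_^ᴿ_ (λ {P} → decide P) (fromℕᴿ N) (ϑ -ᴿ ε))
      0<ε : 0ᴿ <ᴿ ε
      0<ε = δ , 0<δ , Ev-map (λ n l → gap-shift l) gap
      0<A : 0ᴿ <ᴿ fromℕᴿ A
      0<A = 1# , Pos⇒< (0≤1 , 1≢0) , 0 , λ n _ → ≤-trans (≤-reflexive (+-identityˡ 1#)) (≤-trans (1≤ι {A} 1≤A) (≤-reflexive (sym (fromℕᴿ≡ A n))))
      Bound : ℝ → Set
      Bound C = ∀ N → 2 ℕ.≤ N → E N (Q N) ≤ᴿ C *ᴿ (_/ᴿ_ (λ {P} → decide P) (fromℕᴿ N) (_^ᴿ_ (λ {P} → decide P) (log (λ {P} → decide P) (fromℕᴿ N)) (fromℕᴿ A)))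
      Result : Set
      Result = ∃ λ B → ∀ N Y g → 1 ℕ.≤ g → 4 ^ g ℕ.≤ N → Y ^ D ℕ.≤ N → 1 ℕ.≤ Y →
        ∃ λ Q → Y ^ num ℕ.≤ Q × Ev (λ n → ι (g ^ A) * seq (E N Q) n ≤ ι (B ℕ.* N))
      inner : ∀ C → Bound C → (∃ λ c → Ev (λ n → seq C n ≈[ ι c ] 0#)) → Result
      inner C bd (c , hc) = suc (c ℕ.* 3) , λ N Y g 1≤g 4^g≤N Y≤N 1≤Y → Q N ,
        root-large {N} {Y} (ϑ -ᴿ ε) num D 1≤num 1≤D 1≤Y Y≤N (λ n → trans (x-[x-a] (seq ϑ n) ϑ₀) eq) ,
        at N g 1≤g 4^g≤N
        where
        at : ∀ N g → 1 ℕ.≤ g → 4 ^ g ℕ.≤ N → Ev (λ n → ι (g ^ A) * seq (E N (Q N)) n ≤ ι (suc (c ℕ.* 3) ℕ.* N))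
        at N g 1≤g 4^g≤N = Ev-map (λ n ((u , w) , (v , v′)) → level-arithmetic {seq (E N (Q N)) n} {seq C n} {seq (P ⁻¹′) n} {c} {N} {G} 1≤G (ℕ.≤-trans (ℕ.s≤s ℕ.z≤n) 4≤N) (≤-trans u (≤-reflexive (cong (λ t → seq C n * (t * seq (P ⁻¹′) n) + ρ G) (fromℕ≡ι N)))) w v v′)
          (Ev-× (Ev-× (≤ᴿ⇒⊑ {E N (Q N)} {C *ᴿ (_/ᴿ_ (λ {P} → decide P) (fromℕᴿ N) P)} (bd N 2≤N) (ρ G) (Pos-ρ G 1≤G)) hc) (inverse-small P G 1≤G (log-power-large {N} {g} A 1≤A 1≤g 4^g≤N)))
          where
          P = _^ᴿ_ (λ {P} → decide P) (log (λ {P} → decide P) (fromℕᴿ N)) (fromℕᴿ A)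
          G = g ^ A
          1≤G : 1 ℕ.≤ G
          1≤G = ℕ.m^n>0 g ⦃ ℕ.>-nonZero 1≤g ⦄ A
          4≤N : 4 ℕ.≤ N
          4≤N = ℕ.≤-trans (ℕ.^-monoʳ-≤ 4 1≤g) 4^g≤N
          2≤N : 2 ℕ.≤ N
          2≤N = ℕ.≤-trans (ℕ.s≤s (ℕ.s≤s ℕ.z≤n)) 4≤N
      outer : (∃ λ C → Bound C) → Result
      outer (C , bd) = inner C bd (bounded (seq-cauchy C))

-- Conditions (A) and (B) in rational form.

module Levels where
  open Rationals
  open ℚF hiding (_^_)
  open Arith using (Cong)
  open Reals
  open HasLevel
  open import Data.Integer as ℤ using (ℤ) renaming (+_ to pos)
  open import Data.List using (List; []; _∷_; filter; foldr; map)
  open import Data.List.Extrema.Nat using (max; xs≤max)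
  open import Data.List.Membership.Propositional using (_∈_)
  open import Data.List.Membership.Propositional.Properties using (∈-map⁺; ∈-filter⁺; ∈-applyUpTo⁺)
  import Data.List.Relation.Unary.All as All
  open import Data.List.Relation.Unary.Any using (here; there)
  open import Data.Nat as ℕ using (ℕ; zero; suc; _^_)
  open import Data.Nat.Coprimality using (Coprime; coprime?)
  open import Data.Nat.Divisibility using (_∣_; _∣?_)
  open import Data.Nat.ListAction using (sum)
  open import Data.Nat.Primality using (Prime; prime?)
  import Data.Nat.Properties as ℕ
  open import Data.Product using (∃; _×_; _,_; proj₁; proj₂)
  open import Data.Rational as ℚ using (ℚ)
  import Data.Rational.Properties as ℚ
  open import Level using (0ℓ)
  open import Relation.Binary.PropositionalEquality using (_≡_; _≢_; refl; sym; trans; cong; subst)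
  open import Relation.Nullary using (Dec)
  open import Relation.Nullary.Decidable using (_×-dec_)
  open import Defs using (ℝ; fromℚᴿ; fromℕᴿ; _<ᴿ_; sumᴿ; maxᴿ; [1⋯_]; φ; liouville; liouvilleError; log; _⁻¹ᴿ; _/ᴿ_; primeError; ConditionA; ConditionB)
  open ℝ

  seq-sum : ∀ {A : Set} (f : A → ℝ) xs n → seq (sumᴿ (map f xs)) n ≡ ∑[ xs ] (λ x → seq (f x) n)
  seq-sum f [] n = refl
  seq-sum f (x ∷ xs) n = cong (seq (f x) n +_) (seq-sum f xs n)

  ≤-seq-max : ∀ {A : Set} (f : A → ℝ) {x xs} → x ∈ xs → ∀ n → seq (f x) n ≤ seq (maxᴿ (map f xs)) n
  ≤-seq-max f {x} {y ∷ ys} (here refl) n = ℚ.p≤p⊔q (seq (f x) n) (seq (maxᴿ (map f ys)) n)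
  ≤-seq-max f {x} {y ∷ ys} (there h) n = ≤-trans (≤-seq-max f h n) (ℚ.p≤q⊔p (seq (f y) n) (seq (maxᴿ (map f ys)) n))

  0≤seq-max : ∀ xs n → 0# ≤ seq (maxᴿ xs) n
  0≤seq-max [] n = ≤-refl
  0≤seq-max (x ∷ xs) n = ≤-trans (0≤seq-max xs n) (ℚ.p≤q⊔p (seq x n) (seq (maxᴿ xs) n))

  ≤-max-form : ∀ {A : Set} (f : A → ℝ) {p a xs v} → a ∈ xs → ∀ n → p ≡ maxᴿ (map f xs) → seq (f a) n ≡ v → v ≤ seq p n
  ≤-max-form f a∈ n refl refl = ≤-seq-max f a∈ n

  ⊔⇒≈ : ∀ {x y x′ y′ c} → x ≡ x′ → y ≡ y′ → (x - y) ℚ.⊔ (- (x - y)) ≤ c → x′ ≈[ c ] y′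
  ⊔⇒≈ {x} {y} refl refl h = ≈0⇐ {x} {y} (≤⇒≈0 (≤-trans (ℚ.p≤p⊔q (x - y) (- (x - y))) h) (≤-trans (ℚ.p≤q⊔p (x - y) (- (x - y))) h))

  ∈-[1⋯] : ∀ {a q} → 1 ℕ.≤ a → a ℕ.≤ q → a ∈ [1⋯ q ]
  ∈-[1⋯] {suc a} _ h = ∈-applyUpTo⁺ suc h

  module _ (decide : ∀ (P : Set) → Dec P) where

    private
      lp : ℕ → ℕ → ℚ
      lp n m = seq (log (λ {P} → decide P) (fromℕᴿ m)) n

      err : ℕ → ℕ → ℕ → ℚ
      err N n q = seq (primeError (λ {P} → decide P) N q) n

    log-bounds : ∀ m → 1 ℕ.≤ m → Ev (λ n → lp n m ≤ ℋ m + 1# × 0# ≤ lp n m + 1#)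
    log-bounds (suc m) 1≤m = Ev-map (λ n (a , b) → ≤-trans a (+-monoˡ-≤ 1# (ℋ-mono (ℕ.n≤1+n m))) , b)
      (Ev-× (log-upper m (seq-cauchy y) (proj₁ spec) 1# (0≤1 , 1≢0)) (log-lower {g = 0} {suc m} (seq-cauchy y) 1≤m (proj₂ spec) 1# (0≤1 , 1≢0)))
      where
      y = log (λ {P} → decide P) (fromℕᴿ (suc m))
      spec = log-fromℕ decide (suc m) 1≤m

    private
      P? : ∀ q a p → Dec (Prime p × q ∣ ℕ.∣ p - a ∣)
      P? q a p = prime? p ×-dec (q ∣? ℕ.∣ p - a ∣)

      θ : ℕ → ℕ → ℕ → ℕ → ℚ
      θ N q a n = seq (sumᴿ (map (λ p → log (λ {P} → decide P) (fromℕᴿ p)) (filter (P? q a) [1⋯ N ]))) n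

      expected : ℕ → ℕ → ℕ → ℚ
      expected N q n = seq (_/ᴿ_ (λ {P} → decide P) (fromℕᴿ N) (fromℕᴿ (φ q))) n

      units : ℕ → List ℕ
      units q = filter (λ a → coprime? a q) [1⋯ q ]

      -- Stated on the sequences: an equation of reals would also compare their Cauchy proofs.
      primeError-form : ∀ N q → ∃ λ (f : ℕ → ℝ) → primeError (λ {P} → decide P) N q ≡ maxᴿ (map f (units q)) ×
        (∀ a n → seq (f a) n ≡ (θ N q a n - expected N q n) ℚ.⊔ (- (θ N q a n - expected N q n)))
      primeError-form N q = _ , refl , λ a n → refl

    prime-class : ∀ N {q a} → 1 ℕ.≤ a → a ℕ.≤ q → Coprime a q → ∀ n →
      ∑ N (λ m → 𝟙 (q ∣? ℕ.∣ m - a ∣) * (𝟙 (prime? m) * lp n m)) ≈[ err N n q ] ι N * seq (_⁻¹ᴿ (λ {P} → decide P) (fromℕᴿ (φ q))) n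
    prime-class N {q} {a} 1≤a a≤q cop n = ⊔⇒≈ {θ N q a n} {expected N q n} {S} {ι N * I} {err N n q} sum≡ expected≡ bound
      where
      I = seq (_⁻¹ᴿ (λ {P} → decide P) (fromℕᴿ (φ q))) n
      S = ∑ N (λ m → 𝟙 (q ∣? ℕ.∣ m - a ∣) * (𝟙 (prime? m) * lp n m))
      sum≡ : θ N q a n ≡ S
      sum≡ = trans (trans (seq-sum (λ p → log (λ {P} → decide P) (fromℕᴿ p)) (filter (P? q a) [1⋯ N ]) n) (∑-filter (P? q a) N (lp n)))
        (∑-cong N λ m _ _ → trans (cong (_* lp n m) (sym (𝟙-× (q ∣? ℕ.∣ m - a ∣) (prime? m) (P? q a m) (λ d p → p , d) (λ (p , d) → d , p)))) (*-assoc (𝟙 (q ∣? ℕ.∣ m - a ∣)) (𝟙 (prime? m)) (lp n m)))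
      expected≡ : expected N q n ≡ ι N * I
      expected≡ = cong (_* I) (fromℕ≡ι N)
      a∈ : a ∈ units q
      a∈ = ∈-filter⁺ (λ a → coprime? a q) (∈-[1⋯] 1≤a a≤q) cop
      form = primeError-form N q
      bound : (θ N q a n - expected N q n) ℚ.⊔ (- (θ N q a n - expected N q n)) ≤ err N n q
      bound = ≤-max-form (proj₁ form) a∈ n (proj₁ (proj₂ form)) (proj₂ (proj₂ form) a n)

    private
      PrimeData : ℕ → ℕ → ℕ → ℕ → ℕ → Set
      PrimeData A B N Q′ g = ∃ λ (lp : ℕ → ℚ) → ∃ λ (e : ℕ → ℚ) → NonNeg e × (∀ m → 1 ℕ.≤ m → m ℕ.≤ N → lp m ≤ ℋ m + 1# × 0# ≤ lp m + 1#) ×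
        (∀ q a → 1 ℕ.≤ q → q ℕ.≤ Q′ → Coprime a q → ∑ N (λ m → 𝟙 (q ∣? ℕ.∣ m - a ∣) * (𝟙 (prime? m) * lp m)) ≈[ e q ] ι N * ρ (φ q)) ×
        ι (g ^ A) * ∑ Q′ e ≤ ι (B ℕ.* N)

    module _ (A B N Q′ g : ℕ) (1≤g : 1 ℕ.≤ g) (1≤Q′ : 1 ℕ.≤ Q′) {Q : ℕ} (Q′≤Q : Q′ ℕ.≤ Q) where

      private
        pδ : Pos (ρ (Q′ ℕ.* g ^ A))
        pδ = Pos-ρ (Q′ ℕ.* g ^ A) (ℕ.*-mono-≤ 1≤Q′ (ℕ.m^n>0 g ⦃ ℕ.>-nonZero 1≤g ⦄ A))
        inv : ℕ → ℕ → ℚ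
        inv q n = seq (_⁻¹ᴿ (λ {P} → decide P) (fromℕᴿ (φ q))) n
        approx : ∀ q → 1 ℕ.≤ q → Ev (λ n → inv q n ≈[ ρ (Q′ ℕ.* g ^ A) ] ρ (φ q))
        approx q 1≤q = inverse-approx {inv q} (φ q) (1≤φ q 1≤q) (inverse-fromℕ decide (φ q) (1≤φ q 1≤q)) (ρ (Q′ ℕ.* g ^ A)) pδ
        0≤err : ∀ n → NonNeg (err N n)
        0≤err n q = let (f , e , _) = primeError-form N q in subst (λ x → 0# ≤ seq x n) (sym e) (0≤seq-max (map f (units q)) n)

        class-estimate : ∀ n q a → 1 ℕ.≤ q → Coprime a q → inv q n ≈[ ρ (Q′ ℕ.* g ^ A) ] ρ (φ q) →
          ∑ N (λ m → 𝟙 (q ∣? ℕ.∣ m - a ∣) * (𝟙 (prime? m) * lp n m)) ≈[ err N n q + ι N * ρ (Q′ ℕ.* g ^ A) ] ι N * ρ (φ q)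
        class-estimate n q a 1≤q cop near = via (representative q a 1≤q)
          where
          S : ℕ → ℚ
          S a = ∑ N (λ m → 𝟙 (q ∣? ℕ.∣ m - a ∣) * (𝟙 (prime? m) * lp n m))
          via : (∃ λ a′ → 1 ℕ.≤ a′ × a′ ℕ.≤ q × Cong q a′ a × Cong q a a′) → S a ≈[ err N n q + ι N * ρ (Q′ ℕ.* g ^ A) ] ι N * ρ (φ q)
          via (a′ , 1≤a′ , a′≤q , c , c′) = ≈-subst {S a′} {S a} {ι N * ρ (φ q)} {ι N * ρ (φ q)} {err N n q + ι N * ρ (Q′ ℕ.* g ^ A)} (∑-cong N λ m _ _ → cong (_* (𝟙 (prime? m) * lp n m)) (class-cong m c c′)) refl
            (≈-trans {S a′} {ι N * inv q n} {ι N * ρ (φ q)} {err N n q} {ι N * ρ (Q′ ℕ.* g ^ A)} (prime-class N 1≤a′ a′≤q (λ {d} → Cong-coprime {q} {a} {a′} c′ cop {d}) n)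
              (≈-scale {ι N} {inv q n} {ρ (φ q)} {ρ (Q′ ℕ.* g ^ A)} (0≤ι N) near))

        Bound : ℕ → Set
        Bound n = ι (g ^ suc A) * seq (sumᴿ (map (primeError (λ {P} → decide P) N) [1⋯ Q ])) n ≤ ι (B ℕ.* N)

        total-bound : ∀ n → Bound n → ι (g ^ A) * ∑ Q′ (λ q → err N n q + ι N * ρ (Q′ ℕ.* g ^ A)) ≤ ι (suc B ℕ.* N)
        total-bound n h = total-error {A} {B} {g} {N} {Q} {Q′} (err N n) (0≤err n) 1≤g 1≤Q′ Q′≤Q
          (subst (λ t → ι (g ^ suc A) * t ≤ ι (B ℕ.* N)) (trans (seq-sum (primeError (λ {P} → decide P) N) [1⋯ Q ] n) (∑-[1⋯] Q (err N n))) h)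

      prime-data : Ev Bound → PrimeData A (suc B) N Q′ g
      prime-data bound = pick (Ev-× {Bound} bound (Ev-× (Ev-all N log-bounds) (Ev-all Q′ {λ q n → inv q n ≈[ ρ (Q′ ℕ.* g ^ A) ] ρ (φ q)} approx)))
        where
        pick : Ev (λ n → Bound n × (∀ m → 1 ℕ.≤ m → m ℕ.≤ N → lp n m ≤ ℋ m + 1# × 0# ≤ lp n m + 1#) × (∀ q → 1 ℕ.≤ q → q ℕ.≤ Q′ → inv q n ≈[ ρ (Q′ ℕ.* g ^ A) ] ρ (φ q))) → PrimeData A (suc B) N Q′ g
        pick (n , f) = at (f n ℕ.≤-refl)
          where
          at : Bound n × (∀ m → 1 ℕ.≤ m → m ℕ.≤ N → lp n m ≤ ℋ m + 1# × 0# ≤ lp n m + 1#) × (∀ q → 1 ℕ.≤ q → q ℕ.≤ Q′ → inv q n ≈[ ρ (Q′ ℕ.* g ^ A) ] ρ (φ q)) → PrimeData A (suc B) N Q′ g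
          at (h , logs , near) = lp n , (λ q → err N n q + ι N * ρ (Q′ ℕ.* g ^ A)) , (λ q → 0≤+ {err N n q} {ι N * ρ (Q′ ℕ.* g ^ A)} (0≤err n q) (*-nonNeg {ι N} {ρ (Q′ ℕ.* g ^ A)} (0≤ι N) (proj₁ pδ))) , logs ,
            (λ q a 1≤q q≤ cop → class-estimate n q a 1≤q cop (near q 1≤q q≤)) , total-bound n h

    prime-level : ∀ ϑ ϑ₀ num D → 1 ℕ.≤ num → 1 ℕ.≤ D → ϑ₀ ≡ ι num * ρ D → fromℚᴿ ϑ₀ <ᴿ ϑ → ConditionA (λ {P} → decide P) ϑ →
      ∀ A → ∃ λ B → ∀ N Y g → 1 ℕ.≤ g → 4 ^ g ℕ.≤ N → Y ^ D ℕ.≤ N → 1 ℕ.≤ Y → PrimeData A B N (Y ^ num) g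
    -- The conditions speak of positive exponents only, while `A` may be 0; therefore they are used
    -- with `suc A`.
    prime-level ϑ ϑ₀ num D 1≤num 1≤D eq gap hyp A = start (level-bound decide (λ N Q → sumᴿ (map (primeError (λ {P} → decide P) N) [1⋯ Q ])) ϑ ϑ₀ num D 1≤num 1≤D eq gap hyp (suc A) 1≤s)
      where
      start : (∃ λ B → ∀ N Y g → 1 ℕ.≤ g → 4 ^ g ℕ.≤ N → Y ^ D ℕ.≤ N → 1 ℕ.≤ Y →
          ∃ λ Q → Y ^ num ℕ.≤ Q × Ev (λ n → ι (g ^ suc A) * seq (sumᴿ (map (primeError (λ {P} → decide P) N) [1⋯ Q ])) n ≤ ι (B ℕ.* N))) →
        ∃ λ B → ∀ N Y g → 1 ℕ.≤ g → 4 ^ g ℕ.≤ N → Y ^ D ℕ.≤ N → 1 ℕ.≤ Y → PrimeData A B N (Y ^ num) g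
      start (B , h) = suc B , λ N Y g 1≤g 4^g≤N Y≤N 1≤Y → let (_ , Y≤Q , bound) = h N Y g 1≤g 4^g≤N Y≤N 1≤Y in prime-data A B N (Y ^ num) g 1≤g (ℕ.m^n>0 Y ⦃ ℕ.>-nonZero 1≤Y ⦄ num) Y≤Q bound

    private
      ∈⇒≤max : ∀ {v xs} → v ∈ xs → v ℕ.≤ max 0 xs
      ∈⇒≤max {xs = xs} = All.lookup (xs≤max 0 xs)

    sign-class : ∀ N {q a y} → 1 ℕ.≤ a → a ℕ.≤ q → y ℕ.≤ N → ∑ y (λ n → 𝟙 (q ∣? ℕ.∣ n - a ∣) * ⟦ liouville n ⟧ℤ) ≈[ ι (liouvilleError N q) ] 0#
    -- The maximum in the condition starts at y = 1, so the empty sum is treated apart.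
    sign-class N {q} {y = zero} _ _ _ = ≈-weaken (0≤ι (liouvilleError N q)) ≈-refl
    sign-class N {q} {a} {y@(suc _)} 1≤a a≤q y≤N = ≈-subst (trans (⟦⟧-sum liouville (filter (λ n → q ∣? ℕ.∣ n - a ∣) [1⋯ y ])) (∑-filter (λ n → q ∣? ℕ.∣ n - a ∣) y (λ n → ⟦ liouville n ⟧ℤ))) refl
      (≈-weaken (ι-mono (ℕ.≤-trans (∈⇒≤max (∈-map⁺ (λ a → ℤ.∣ S y a ∣) (∈-[1⋯] 1≤a a≤q))) (∈⇒≤max (∈-map⁺ (λ y → max 0 (map (λ a → ℤ.∣ S y a ∣) [1⋯ q ])) (∈-[1⋯] {y} {N} 1≤s y≤N))))) (⟦⟧-abs (S y a)))
      where
      S : ℕ → ℕ → ℤ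
      S y a = foldr ℤ._+_ (pos 0) (map liouville (filter (λ n → q ∣? ℕ.∣ n - a ∣) [1⋯ y ]))

    private
      SignData : ℕ → ℕ → ℕ → ℕ → ℕ → Set
      SignData A B N Q′ g = ∃ λ (e : ℕ → ℚ) → NonNeg e × (∀ q a y → 1 ℕ.≤ q → q ℕ.≤ Q′ → y ℕ.≤ N → ∑ y (λ n → 𝟙 (q ∣? ℕ.∣ n - a ∣) * ⟦ liouville n ⟧ℤ) ≈[ e q ] 0#) ×
        ι (g ^ A) * ∑ Q′ e ≤ ι (B ℕ.* N)

      sign-data : ∀ A B N Q′ g {Q} n → 1 ℕ.≤ g → Q′ ℕ.≤ Q → ι (g ^ suc A) * seq (fromℕᴿ (sum (map (liouvilleError N) [1⋯ Q ]))) n ≤ ι (B ℕ.* N) → SignData A B N Q′ g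
      sign-data A B N Q′ g {Q} n 1≤g Q′≤Q h = e , 0≤e , class , sum-error {A} {g} {B ℕ.* N} {Q} {Q′} e 0≤e 1≤g Q′≤Q (subst (λ t → ι (g ^ suc A) * t ≤ ι (B ℕ.* N)) sum≡ h)
        where
        e : ℕ → ℚ
        e q = ι (liouvilleError N q)
        0≤e : NonNeg e
        0≤e q = 0≤ι (liouvilleError N q)
        sum≡ : seq (fromℕᴿ (sum (map (liouvilleError N) [1⋯ Q ]))) n ≡ ∑ Q e
        sum≡ = trans (fromℕ≡ι (sum (map (liouvilleError N) [1⋯ Q ]))) (trans (ι-sum (liouvilleError N) [1⋯ Q ]) (∑-[1⋯] Q e))
        class : ∀ q a y → 1 ℕ.≤ q → q ℕ.≤ Q′ → y ℕ.≤ N → ∑ y (λ n → 𝟙 (q ∣? ℕ.∣ n - a ∣) * ⟦ liouville n ⟧ℤ) ≈[ e q ] 0#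
        class q a y 1≤q _ y≤N = via (representative q a 1≤q)
          where
          S : ℕ → ℚ
          S a = ∑ y (λ n → 𝟙 (q ∣? ℕ.∣ n - a ∣) * ⟦ liouville n ⟧ℤ)
          via : (∃ λ a′ → 1 ℕ.≤ a′ × a′ ℕ.≤ q × Cong q a′ a × Cong q a a′) → S a ≈[ e q ] 0#
          via (a′ , 1≤a′ , a′≤q , c , c′) = ≈-subst {S a′} {S a} {0#} {0#} {e q} (∑-cong y λ n _ _ → cong (_* ⟦ liouville n ⟧ℤ) (class-cong n c c′)) refl (sign-class N 1≤a′ a′≤q y≤N)

    sign-level : ∀ ϑ ϑ₀ num D → 1 ℕ.≤ num → 1 ℕ.≤ D → ϑ₀ ≡ ι num * ρ D → fromℚᴿ ϑ₀ <ᴿ ϑ → ConditionB (λ {P} → decide P) ϑ →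
      ∀ A → ∃ λ B → ∀ N Y g → 1 ℕ.≤ g → 4 ^ g ℕ.≤ N → Y ^ D ℕ.≤ N → 1 ℕ.≤ Y → SignData A B N (Y ^ num) g
    sign-level ϑ ϑ₀ num D 1≤num 1≤D eq gap hyp A = start (level-bound decide (λ N Q → fromℕᴿ (sum (map (liouvilleError N) [1⋯ Q ]))) ϑ ϑ₀ num D 1≤num 1≤D eq gap hyp (suc A) 1≤s)
      where
      start : (∃ λ B → ∀ N Y g → 1 ℕ.≤ g → 4 ^ g ℕ.≤ N → Y ^ D ℕ.≤ N → 1 ℕ.≤ Y →
          ∃ λ Q → Y ^ num ℕ.≤ Q × Ev (λ n → ι (g ^ suc A) * seq (fromℕᴿ (sum (map (liouvilleError N) [1⋯ Q ]))) n ≤ ι (B ℕ.* N))) →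
        ∃ λ B → ∀ N Y g → 1 ℕ.≤ g → 4 ^ g ℕ.≤ N → Y ^ D ℕ.≤ N → 1 ℕ.≤ Y → SignData A B N (Y ^ num) g
      start (B , h) = B , λ N Y g 1≤g 4^g≤N Y≤N 1≤Y → let (_ , Y≤Q , n , f) = h N Y g 1≤g 4^g≤N Y≤N 1≤Y in sign-data A B N (Y ^ num) g n 1≤g Y≤Q (f n ℕ.≤-refl)

-- Lower limits, prime gaps and the pointwise inequality.

module Final where
  open import Data.Empty using (⊥; ⊥-elim)
  open import Data.Integer as ℤ using (ℤ; +_; -1ℤ; 1ℤ)
  import Data.Integer.Properties as ℤ
  open import Data.List using ([]; _∷_)
  open import Data.List.Relation.Unary.All using (All; []; _∷_)
  import Data.List.Relation.Unary.All as All
  open import Data.List.Relation.Unary.AllPairs using (AllPairs; []; _∷_)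
  open import Data.Nat as ℕ using (ℕ; zero; suc; _≤_; _<_; _+_; _*_; _∸_)
  open import Data.Nat.Primality using (Prime; prime?)
  import Data.Nat.Properties as ℕ
  open import Data.Product using (∃; _×_; _,_; proj₁; proj₂)
  open import Data.Sum using (_⊎_; inj₁; inj₂)
  open import Relation.Binary.PropositionalEquality using (_≡_; _≢_; refl; sym; trans; cong; cong₂; subst)
  open import Relation.Binary.Definitions using (tri<; tri≈; tri>)
  open import Relation.Nullary using (¬_; Dec; yes; no; contradiction)
  open import Defs using (InfinitelyMany; Ω; liouville; nextPrime; nthPrime; primeGap; IsTailInf; IsLimInf)

  module _ (decide : ∀ (P : Set) → Dec P) where

    finitely-many : ∀ {P : ℕ → Set} → ¬ InfinitelyMany P → ∃ λ m → ∀ n → m < n → ¬ P n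
    finitely-many {P} h with decide (∃ λ m → ∀ n → m < n → ¬ P n)
    ... | yes e = e
    ... | no ¬e = ⊥-elim (h beyond)
      where
      beyond : InfinitelyMany P
      beyond m with decide (∃ λ n → m < n × P n)
      ... | yes e = e
      ... | no ¬f = ⊥-elim (¬e (m , λ n l p → ¬f (n , l , p)))

    module _ (g : ℕ → ℕ) where

      -- Descent through the finitely many bounds up to `D`. Minimality is stated for the
      -- predecessor of L, and is vacuous at L = 0.
      least-frequent : ∀ D → InfinitelyMany (λ n → g n ≤ D) → ∃ λ L → L ≤ D × InfinitelyMany (λ n → g n ≤ L) × (∀ L′ → L ≡ suc L′ → ¬ InfinitelyMany (λ n → g n ≤ L′))
      least-frequent zero h = 0 , ℕ.z≤n , h , λ _ ()
      least-frequent (suc D) h with decide (InfinitelyMany (λ n → g n ≤ D))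
      ... | yes h′ = let (L , l , rest) = least-frequent D h′ in L , ℕ.m≤n⇒m≤1+n l , rest
      ... | no ¬h = suc D , ℕ.≤-refl , h , λ { _ refl → ¬h }

      -- For values in the naturals the lower limit is the least L that bounds infinitely many of
      -- them: no tail infimum exceeds L, and beyond the last value below L the tail infimum equals
      -- L.
      limInf-exists : ∀ D → InfinitelyMany (λ n → g n ≤ D) → ∃ λ L → IsLimInf g L × L ≤ D
      limInf-exists D h = build (least-frequent D h)
        where
        build : (∃ λ L → L ≤ D × InfinitelyMany (λ n → g n ≤ L) × (∀ L′ → L ≡ suc L′ → ¬ InfinitelyMany (λ n → g n ≤ L′))) → ∃ λ L → IsLimInf g L × L ≤ D
        build (L , L≤D , often , least) = L , (upper , lower L often least) , L≤D
          where
          upper : ∀ n m → IsTailInf g n m → m ≤ L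
          upper n m (below , _) = let (k , n<k , gk≤L) = often n in ℕ.≤-trans (below k (ℕ.<⇒≤ n<k)) gk≤L
          lower : ∀ L → InfinitelyMany (λ n → g n ≤ L) → (∀ L′ → L ≡ suc L′ → ¬ InfinitelyMany (λ n → g n ≤ L′)) → ∀ U → (∀ n m → IsTailInf g n m → m ≤ U) → L ≤ U
          lower zero _ _ U _ = ℕ.z≤n
          lower (suc L′) often least U h with finitely-many (least L′ refl)
          ... | n₀ , rare = h (suc n₀) (suc L′) ((λ k l → ℕ.≰⇒> (rare k l)) , λ l below → let (k , n₀<k , gk≤L) = often n₀ in ℕ.≤-trans (below k n₀<k) gk≤L)

  nthPrime-hits : ∀ {p} → Prime p → ∀ i → nthPrime i < p → ∃ λ j → i < j × nthPrime j ≡ p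
  nthPrime-hits {p} pp i l = go (p ∸ nthPrime i) i l ℕ.≤-refl
    where
    go : ∀ fuel i → nthPrime i < p → p ∸ nthPrime i ≤ fuel → ∃ λ j → i < j × nthPrime j ≡ p
    go zero i l f = contradiction (ℕ.≤-trans (ℕ.m<n⇒0<n∸m l) f) λ ()
    go (suc fuel) i l f with nextPrime (nthPrime i) in eq
    ... | r , _ , i<r , least with ℕ.m≤n⇒m<n∨m≡n (least p pp l)
    ... | inj₂ r≡p = suc i , ℕ.≤-refl , trans (cong proj₁ eq) r≡p
    ... | inj₁ r<p = let (j , i<j , e) = go fuel (suc i) (subst (_< p) (sym (cong proj₁ eq)) r<p)
                              (ℕ.≤-pred (ℕ.≤-trans (subst (λ t → suc (p ∸ t) ≤ p ∸ nthPrime i) (sym (cong proj₁ eq)) (ℕ.∸-monoʳ-< i<r (ℕ.<⇒≤ r<p))) f))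
                       in j , ℕ.<⇒≤ i<j , e

  -- The prime following p is at most p′, so the gap after p would be one of the small gaps that no
  -- longer occur.
  primes-apart : ∀ {D m} → (∀ n → m < n → ¬ primeGap n ≤ D) → ∀ {p p′} → Prime p → Prime p′ → nthPrime m < p → p < p′ → ¬ p′ ∸ p ≤ D
  primes-apart {D} {m} rare {p} {p′} pp pp′ m<p p<p′ close = go (nthPrime-hits pp m m<p)
    where
    go : (∃ λ j → m < j × nthPrime j ≡ p) → ⊥
    go (j , m<j , refl) = rare j m<j (ℕ.≤-trans (ℕ.∸-monoˡ-≤ (nthPrime j) (proj₂ (proj₂ (proj₂ (nextPrime (nthPrime j)))) p′ pp′ p<p′)) close)

  liouville-sign : ∀ n → liouville n ≡ 1ℤ ⊎ liouville n ≡ -1ℤ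
  liouville-sign n = go (Ω n)
    where
    go : ∀ k → -1ℤ ℤ.^ k ≡ 1ℤ ⊎ -1ℤ ℤ.^ k ≡ -1ℤ
    go zero = inj₁ refl
    go (suc k) with go k
    ... | inj₁ e = inj₂ (cong (-1ℤ ℤ.*_) e)
    ... | inj₂ e = inj₁ (cong (-1ℤ ℤ.*_) e)

  module Pointwise (F : OrderedField) where
    open OverField F hiding (_≤_; _+_; _*_)
    private
      module 𝔽 = OrderedField F

    -- The shift that gives the prime is described by what it inherits: every property of all shifts
    -- holds for it.
    one-prime : ∀ n hs → AllPairs (λ h h′ → Prime (n + h) → ¬ Prime (n + h′)) hs →
      ∑[ hs ] (λ h → 𝟙 (prime? (n + h))) ≡ 0# ⊎ (∑[ hs ] (λ h → 𝟙 (prime? (n + h))) ≡ 1# × ∃ λ h → (∀ {P : ℕ → Set} → All P hs → P h) × Prime (n + h))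
    one-prime n [] [] = inj₁ refl
    one-prime n (h ∷ hs) (a ∷ as) with prime? (n + h)
    ... | yes p = inj₂ (trans (cong (1# 𝔽.+_) (none hs (All.map (λ f → f p) a))) (+-identityʳ 1#) , h , All.head , p)
      where
      none : ∀ hs → All (λ h → ¬ Prime (n + h)) hs → ∑[ hs ] (λ h → 𝟙 (prime? (n + h))) ≡ 0#
      none [] [] = refl
      none (h ∷ hs) (x ∷ xs) = trans (cong₂ 𝔽._+_ (𝟙-no (prime? (n + h)) x) (none hs xs)) (+-identityʳ 0#)
    ... | no _ with one-prime n hs as
    ... | inj₁ e = inj₁ (trans (+-identityˡ _) e)
    ... | inj₂ (e , h′ , get , p) = inj₂ (trans (+-identityˡ _) e , h′ , (λ al → get (All.tail al)) , p)

    lam≤1 : ∀ n → ⟦ liouville n ⟧ℤ ≈[ 1# ] 0#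
    lam≤1 n with liouville n | liouville-sign n
    ... | _ | inj₁ refl = ≤⇒≈0 ≤-refl (≤-trans (0≤-⇒≤ (subst (0# 𝔽.≤_) (solve 1 (λ x → x := con (+ 0) :- :- x) refl 1#) 0≤1)) 0≤1)
    ... | _ | inj₂ refl = ≤⇒≈0 (≤-trans (0≤-⇒≤ (subst (0# 𝔽.≤_) (solve 1 (λ x → x := con (+ 0) :- :- x) refl 1#) 0≤1)) 0≤1) (≤-reflexive (solve 1 (λ x → :- :- x := x) refl 1#))

    pointwise : ∀ n hs h₀ → AllPairs (λ h h′ → Prime (n + h) → ¬ Prime (n + h′)) hs → All (λ h → Prime (n + h) → liouville (n + h₀) ≡ 1ℤ) hs →
      ι 2 𝔽.* ∑[ hs ] (λ h → 𝟙 (prime? (n + h))) 𝔽.≤ 1# 𝔽.+ ⟦ liouville (n + h₀) ⟧ℤ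
    pointwise n hs h₀ apart positive with one-prime n hs apart
    ... | inj₁ e = ≤-trans (≤-reflexive (trans (cong (ι 2 𝔽.*_) e) (zeroʳ (ι 2)))) (≤-trans (proj₂ (lam≤1 (n + h₀))) (≤-reflexive (+-comm _ 1#)))
    ... | inj₂ (e , h , get , p) = ≤-reflexive (trans (cong (ι 2 𝔽.*_) e) (trans (*-identityʳ (ι 2)) (cong (1# 𝔽.+_) (sym (cong ⟦_⟧ℤ (get positive p))))))

  Candidates : ℕ → ℕ → Set
  Candidates D₄ D₃ = (∃ λ (d : ℤ) → 0 < ℤ.∣ d ∣ × ℤ.∣ d ∣ ≤ D₄ ×
      InfinitelyMany (λ p → Prime p × + 0 ℤ.< + p ℤ.+ d × liouville ℤ.∣ + p ℤ.+ d ∣ ≡ -1ℤ))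
    ⊎ (∃ λ (L : ℕ) → IsLimInf primeGap L × L ≤ D₃)

  module _ {m D : ℕ} (rare : ∀ n → m < n → ¬ primeGap n ≤ D) {n : ℕ} (large : nthPrime m < n) where

    private
      ordered : ∀ {h h′} → h′ ≤ D → h < h′ → Prime (n + h) → ¬ Prime (n + h′)
      ordered {h} {h′} h′≤ h<h′ p p′ = primes-apart rare p p′ (ℕ.<-≤-trans large (ℕ.m≤m+n n h)) (ℕ.+-monoʳ-< n h<h′)
        (ℕ.≤-trans (ℕ.≤-reflexive (ℕ.[m+n]∸[m+o]≡n∸o n h′ h)) (ℕ.≤-trans (ℕ.m∸n≤m h′ h) h′≤))

      pair : ∀ {h h′} → h ≤ D → h ≢ h′ → h′ ≤ D → Prime (n + h) → ¬ Prime (n + h′)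
      pair {h} {h′} h≤ ne h′≤ p p′ with ℕ.<-cmp h h′
      ... | tri< l _ _ = ordered h′≤ l p p′
      ... | tri≈ _ e _ = ne e
      ... | tri> _ _ l = ordered h≤ l p′ p

    shifts-apart : ∀ {hs} → AllPairs _≢_ hs → All (_≤ D) hs → AllPairs (λ h h′ → Prime (n + h) → ¬ Prime (n + h′)) hs
    shifts-apart [] [] = []
    shifts-apart (a ∷ as) (b ∷ bs) = All.zipWith (λ (ne , h′≤) → pair b ne h′≤) (a , bs) ∷ shifts-apart as bs

  module _ (decide : ∀ (P : Set) → Dec P) where

    -- A prime p = n + h satisfies p + (h₀ - h) = n + h₀. If none of the numbers d = h₀ - h gives
    -- infinitely many negative signs, the sign is eventually +1; if small gaps are finite in
    -- number, two shifts cannot both be prime, as their difference is at most `D₃`.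
    dichotomy-or-sieve : ∀ D₄ D₃ hs h₀ → AllPairs _≢_ hs → All (λ h → 0 < ℤ.∣ + h₀ ℤ.- + h ∣ × ℤ.∣ + h₀ ℤ.- + h ∣ ≤ D₄ × h ≤ D₃) hs →
      Candidates D₄ D₃ ⊎ (∃ λ n₀ → ∀ n → n₀ < n → AllPairs (λ h h′ → Prime (n + h) → ¬ Prime (n + h′)) hs × All (λ h → Prime (n + h) → liouville (n + h₀) ≡ 1ℤ) hs)
    dichotomy-or-sieve D₄ D₃ hs h₀ distinct near with decide (∃ λ (d : ℤ) → 0 < ℤ.∣ d ∣ × ℤ.∣ d ∣ ≤ D₄ × InfinitelyMany (λ p → Prime p × + 0 ℤ.< + p ℤ.+ d × liouville ℤ.∣ + p ℤ.+ d ∣ ≡ -1ℤ))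
    ... | yes i = inj₁ (inj₁ i)
    ... | no ¬i with decide (InfinitelyMany (λ n → primeGap n ≤ D₃))
    ... | yes often = inj₁ (inj₂ (limInf-exists decide primeGap D₃ often))
    ... | no ¬often = inj₂ (combine (finitely-many decide ¬often) (bounds hs near))
      where
      Good : ℕ → ℕ → Set
      Good n h = Prime (n + h) → liouville (n + h₀) ≡ 1ℤ
      bound : ∀ h → 0 < ℤ.∣ + h₀ ℤ.- + h ∣ × ℤ.∣ + h₀ ℤ.- + h ∣ ≤ D₄ × h ≤ D₃ → ∃ λ m → ∀ n → m < n → Good n h
      bound h (0<d , d≤ , _) = go (finitely-many decide λ inf → ¬i (+ h₀ ℤ.- + h , 0<d , d≤ , inf))
        where
        shift : ∀ n → + (n + h) ℤ.+ (+ h₀ ℤ.- + h) ≡ + (n + h₀)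
        shift n = trans (cong (ℤ._+ (+ h₀ ℤ.- + h)) (ℤ.pos-+ n h)) (trans (ring (+ n) (+ h) (+ h₀)) (sym (ℤ.pos-+ n h₀)))
          where
          ring : ∀ n h k → (n ℤ.+ h) ℤ.+ (k ℤ.- h) ≡ n ℤ.+ k
          ring n h k = trans (ℤ.+-assoc n h (k ℤ.- h)) (cong (ℤ._+_ n) (trans (cong (ℤ._+_ h) (ℤ.+-comm k (ℤ.- h))) (trans (sym (ℤ.+-assoc h (ℤ.- h) k)) (trans (cong (ℤ._+ k) (ℤ.+-inverseʳ h)) (ℤ.+-identityˡ k)))))
        go : (∃ λ m → ∀ p → m < p → ¬ (Prime p × + 0 ℤ.< + p ℤ.+ (+ h₀ ℤ.- + h) × liouville ℤ.∣ + p ℤ.+ (+ h₀ ℤ.- + h) ∣ ≡ -1ℤ)) → ∃ λ m → ∀ n → m < n → Good n h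
        go (m , none) = m , λ n m<n p → positive n m<n p (liouville-sign (n + h₀))
          where
          positive : ∀ n → m < n → Prime (n + h) → liouville (n + h₀) ≡ 1ℤ ⊎ liouville (n + h₀) ≡ -1ℤ → liouville (n + h₀) ≡ 1ℤ
          positive n m<n p (inj₁ e) = e
          positive n m<n p (inj₂ e) = ⊥-elim (none (n + h) (ℕ.<-≤-trans m<n (ℕ.m≤m+n n h))
            (p , subst (+ 0 ℤ.<_) (sym (shift n)) (ℤ.+<+ (ℕ.<-≤-trans (ℕ.≤-<-trans ℕ.z≤n m<n) (ℕ.m≤m+n n h₀))) , trans (cong (λ t → liouville ℤ.∣ t ∣) (shift n)) e))
      bounds : ∀ hs → All (λ h → 0 < ℤ.∣ + h₀ ℤ.- + h ∣ × ℤ.∣ + h₀ ℤ.- + h ∣ ≤ D₄ × h ≤ D₃) hs → ∃ λ m → ∀ n → m < n → All (Good n) hs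
      bounds [] [] = 0 , λ _ _ → []
      bounds (h ∷ hs) (x ∷ xs) = let (m , f) = bound h x ; (m′ , f′) = bounds hs xs in
        m ℕ.⊔ m′ , λ n l → f n (ℕ.≤-<-trans (ℕ.m≤m⊔n m m′) l) ∷ f′ n (ℕ.≤-<-trans (ℕ.m≤n⊔m m m′) l)
      combine : (∃ λ m → ∀ n → m < n → ¬ primeGap n ≤ D₃) → (∃ λ m → ∀ n → m < n → All (Good n) hs) →
        ∃ λ n₀ → ∀ n → n₀ < n → AllPairs (λ h h′ → Prime (n + h) → ¬ Prime (n + h′)) hs × All (Good n) hs
      combine (m , rare) (m′ , good) = nthPrime m ℕ.⊔ m′ , λ n l →
        shifts-apart rare (ℕ.≤-<-trans (ℕ.m≤m⊔n (nthPrime m) m′) l) distinct (All.map (λ (_ , _ , h≤) → h≤) near) , good n (ℕ.≤-<-trans (ℕ.m≤n⊔m (nthPrime m) m′) l)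

-- The four triples.

open Rationals
open Levels
open Final
open Numerics using (pre⁺; module Run)
open import Data.Bool using (true)
open import Data.Empty using (⊥-elim)
open import Data.Integer as ℤ using (ℤ; +_; -1ℤ)
open import Data.List using ([]; _∷_; length)
open import Data.List.Membership.Propositional using (_∈_)
open import Data.List.Relation.Unary.All using (All; []; _∷_)
open import Data.List.Relation.Unary.AllPairs using (AllPairs; []; _∷_)
open import Data.List.Relation.Unary.Any using (here; there)
open import Data.Nat as ℕ using (ℕ; zero; suc; _≤_; _<_)
open import Data.Nat.Divisibility using (_∣_; divides)
open import Data.Nat.Primality using (Prime)
import Data.Nat.Properties as ℕ
open import Data.Product using (∃; _×_; _,_; proj₁; proj₂)
open import Data.Rational as ℚ using (ℚ; _/_)
open import Data.Sum using (_⊎_; inj₁; inj₂)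
open import Data.Unit using (tt)
open import Axiom.ExcludedMiddle using (ExcludedMiddle)
open import Level using (0ℓ)
open import Relation.Binary.PropositionalEquality using (_≡_; refl)
open import Relation.Nullary using (¬_; Dec)
open import Defs

open ℚF using (ι; ρ; ⟦_⟧ℤ)

d₀≤pre⁺ : ∀ f i → f 0 ≤ pre⁺ f i
d₀≤pre⁺ f zero = ℕ.≤-refl
d₀≤pre⁺ f (suc i) = ℕ.≤-trans (d₀≤pre⁺ f i) (ℕ.m≤m+n (pre⁺ f i) (f (suc i)))

-- N is X^(1000 sc) and R is X^J. The level condition 2J + 1 ≤ sc · num says that R² times one
-- further X, which pays for W, stays below N^(num/1000). The tuple has k = l + 2 elements, and `c`,
-- `a`, `b` give the weight c + a i + b i (i + 1)/2 at X^(J - i).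
sieve : ∀ (decide : ∀ (P : Set) → Dec P) D₄ D₃ l hs h₀ num sc J M c a b →
  AllPairs _≢_ hs → All (λ h → 2 ∣ h × ℕ.∣ 4 - h ∣ ∣ 8 × h ≤ 12) hs → length hs ≡ suc (suc l) → h₀ ≤ 12 →
  All (λ h → 0 < ℤ.∣ + h₀ ℤ.- + h ∣ × ℤ.∣ + h₀ ℤ.- + h ∣ ≤ D₄ × h ≤ D₃) hs →
  1 ≤ num → num ≤ 1000 → 1 ≤ J → 1 ≤ M → 1 ≤ c → suc (J ℕ.+ J) ≤ sc ℕ.* num →
  Run.inequality c a b (suc l) (sc ℕ.* 1000) M (Run.results c a b (suc (suc l)) (suc l) J) ≡ true →
  (∃ λ (ϑ : ℝ) → fromℚᴿ (+ num / 1000) <ᴿ ϑ × ConditionA (λ {P} → decide P) ϑ × ConditionB (λ {P} → decide P) ϑ) → Candidates D₄ D₃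
sieve decide D₄ D₃ l hs h₀ num sc J M c a b distinct shape len h₀≤ near 1≤num num≤ 1≤J 1≤M 1≤c level check (ϑ , gap , condA , condB) =
  finish (dichotomy-or-sieve decide D₄ D₃ hs h₀ distinct near)
  where
  finish : Candidates D₄ D₃ ⊎ (∃ λ n₀ → ∀ n → n₀ < n → AllPairs (λ h h′ → Prime (n ℕ.+ h) → ¬ Prime (n ℕ.+ h′)) hs × All (λ h → Prime (n ℕ.+ h) → liouville (n ℕ.+ h₀) ≡ + 1) hs) → Candidates D₄ D₃
  finish (inj₁ done) = done
  finish (inj₂ (n₀ , rigid)) = ⊥-elim (ℚF.Theorem.contradictory (suc l) hs distinct shape len h₀ h₀≤ num sc J M num≤ 1≤J 1≤M level
    (Run.d c a b) (ℕ.≤-trans 1≤c (d₀≤pre⁺ (Run.d c a b) J)) (Run.verified c a b l J (sc ℕ.* 1000) M check)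
    (λ n → ⟦ liouville n ⟧ℤ) (Pointwise.lam≤1 ℚ-field)
    (prime-level decide ϑ (+ num / 1000) num 1000 1≤num (ℕ.s≤s ℕ.z≤n) (fraction num 1000) gap condA)
    (sign-level decide ϑ (+ num / 1000) num 1000 1≤num (ℕ.s≤s ℕ.z≤n) (fraction num 1000) gap condB)
    n₀ (λ n n₀<n → Pointwise.pointwise ℚ-field n hs h₀ (proj₁ (rigid n n₀<n)) (proj₂ (rigid n n₀<n))))
    where
    fraction : ∀ m n .⦃ _ : ℕ.NonZero n ⦄ → + m / n ≡ ι m ℚ.* ρ n
    fraction m (suc n) = /≡ι*ρ m n

private
  -- All shifts in use, 0, 2, 6, 8 and 12, are even and at a power of two from 4. Hence the one
  -- class -4 modulo every odd prime up to z makes each tuple admissible.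
  Shape : ℕ → Set
  Shape h = 2 ∣ h × ℕ.∣ 4 - h ∣ ∣ 8 × h ≤ 12

  shape₀ : Shape 0
  shape₀ = divides 0 refl , divides 2 refl , ℕ.z≤n
  shape₂ : Shape 2
  shape₂ = divides 1 refl , divides 4 refl , ℕ.≤ᵇ⇒≤ 2 12 tt
  shape₆ : Shape 6
  shape₆ = divides 3 refl , divides 4 refl , ℕ.≤ᵇ⇒≤ 6 12 tt
  shape₈ : Shape 8
  shape₈ = divides 4 refl , divides 2 refl , ℕ.≤ᵇ⇒≤ 8 12 tt
  shape₁₂ : Shape 12
  shape₁₂ = divides 6 refl , divides 1 refl , ℕ.≤ᵇ⇒≤ 12 12 tt

case-729 : (decide : ∀ (P : Set) → Dec P) → (∃ λ (ϑ : ℝ) → fromℚᴿ (+ 729 / 1000) <ᴿ ϑ × ConditionA (λ {P} → decide P) ϑ × ConditionB (λ {P} → decide P) ϑ) → Candidates 1 2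
-- The values of d are 1 and -1. The weight is linear, 911 + i for i up to 1093, and 2 · 1093 + 1
-- equals 3 · 729, so no part of the level is lost to rounding. The closing `refl` evaluates the
-- inequality.
case-729 decide = sieve decide 1 2 0 (0 ∷ 2 ∷ []) 1 729 3 1093 10000 911 1 0
  (((λ ()) ∷ []) ∷ [] ∷ []) (shape₀ ∷ shape₂ ∷ []) refl (ℕ.≤ᵇ⇒≤ 1 12 tt)
  ((ℕ.≤ᵇ⇒≤ 1 1 tt , ℕ.≤ᵇ⇒≤ 1 1 tt , ℕ.z≤n) ∷ (ℕ.≤ᵇ⇒≤ 1 1 tt , ℕ.≤ᵇ⇒≤ 1 1 tt , ℕ.≤ᵇ⇒≤ 2 2 tt) ∷ [])
  (ℕ.≤ᵇ⇒≤ 1 729 tt) (ℕ.≤ᵇ⇒≤ 729 1000 tt) (ℕ.≤ᵇ⇒≤ 1 1093 tt) (ℕ.≤ᵇ⇒≤ 1 10000 tt) (ℕ.≤ᵇ⇒≤ 1 911 tt) (ℕ.≤ᵇ⇒≤ 2187 2187 tt) refl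

case-616 : (decide : ∀ (P : Set) → Dec P) → (∃ λ (ϑ : ℝ) → fromℚᴿ (+ 616 / 1000) <ᴿ ϑ × ConditionA (λ {P} → decide P) ϑ × ConditionB (λ {P} → decide P) ϑ) → Candidates 3 6
-- The values of d are 3, 1 and -3. The weight is quadratic, 4740120 + 2463 i + i (i + 1), for i up
-- to 3079.
case-616 decide = sieve decide 3 6 1 (0 ∷ 2 ∷ 6 ∷ []) 3 616 10 3079 10000 4740120 2463 2
  (((λ ()) ∷ (λ ()) ∷ []) ∷ ((λ ()) ∷ []) ∷ [] ∷ []) (shape₀ ∷ shape₂ ∷ shape₆ ∷ []) refl (ℕ.≤ᵇ⇒≤ 3 12 tt)
  ((ℕ.≤ᵇ⇒≤ 1 3 tt , ℕ.≤ᵇ⇒≤ 3 3 tt , ℕ.z≤n) ∷ (ℕ.≤ᵇ⇒≤ 1 1 tt , ℕ.≤ᵇ⇒≤ 1 3 tt , ℕ.≤ᵇ⇒≤ 2 6 tt) ∷ (ℕ.≤ᵇ⇒≤ 1 3 tt , ℕ.≤ᵇ⇒≤ 3 3 tt , ℕ.≤ᵇ⇒≤ 6 6 tt) ∷ [])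
  (ℕ.≤ᵇ⇒≤ 1 616 tt) (ℕ.≤ᵇ⇒≤ 616 1000 tt) (ℕ.≤ᵇ⇒≤ 1 3079 tt) (ℕ.≤ᵇ⇒≤ 1 10000 tt) (ℕ.≤ᵇ⇒≤ 1 4740120 tt) (ℕ.≤ᵇ⇒≤ 6159 6160 tt) refl

case-554 : (decide : ∀ (P : Set) → Dec P) → (∃ λ (ϑ : ℝ) → fromℚᴿ (+ 554 / 1000) <ᴿ ϑ × ConditionA (λ {P} → decide P) ϑ × ConditionB (λ {P} → decide P) ϑ) → Candidates 4 8
-- The values of d are 4, 2, -2 and -4, symmetric because `h₀` is the centre of the tuple.
case-554 decide = sieve decide 4 8 2 (0 ∷ 2 ∷ 6 ∷ 8 ∷ []) 4 554 20 5539 10000 10226840 5539 2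
  (((λ ()) ∷ (λ ()) ∷ (λ ()) ∷ []) ∷ ((λ ()) ∷ (λ ()) ∷ []) ∷ ((λ ()) ∷ []) ∷ [] ∷ []) (shape₀ ∷ shape₂ ∷ shape₆ ∷ shape₈ ∷ []) refl (ℕ.≤ᵇ⇒≤ 4 12 tt)
  ((ℕ.≤ᵇ⇒≤ 1 4 tt , ℕ.≤ᵇ⇒≤ 4 4 tt , ℕ.z≤n) ∷ (ℕ.≤ᵇ⇒≤ 1 2 tt , ℕ.≤ᵇ⇒≤ 2 4 tt , ℕ.≤ᵇ⇒≤ 2 8 tt) ∷
   (ℕ.≤ᵇ⇒≤ 1 2 tt , ℕ.≤ᵇ⇒≤ 2 4 tt , ℕ.≤ᵇ⇒≤ 6 8 tt) ∷ (ℕ.≤ᵇ⇒≤ 1 4 tt , ℕ.≤ᵇ⇒≤ 4 4 tt , ℕ.≤ᵇ⇒≤ 8 8 tt) ∷ [])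
  (ℕ.≤ᵇ⇒≤ 1 554 tt) (ℕ.≤ᵇ⇒≤ 554 1000 tt) (ℕ.≤ᵇ⇒≤ 1 5539 tt) (ℕ.≤ᵇ⇒≤ 1 10000 tt) (ℕ.≤ᵇ⇒≤ 1 10226840 tt) (ℕ.≤ᵇ⇒≤ 11079 11080 tt) refl

case-515 : (decide : ∀ (P : Set) → Dec P) → (∃ λ (ϑ : ℝ) → fromℚᴿ (+ 515 / 1000) <ᴿ ϑ × ConditionA (λ {P} → decide P) ϑ × ConditionB (λ {P} → decide P) ϑ) → Candidates 7 12
-- The values of d are 5, 3, -1, -3 and -7; the last one forces the bound 7.
case-515 decide = sieve decide 7 12 3 (0 ∷ 2 ∷ 6 ∷ 8 ∷ 12 ∷ []) 5 515 20 5149 10000 3787457 2942 2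
  (((λ ()) ∷ (λ ()) ∷ (λ ()) ∷ (λ ()) ∷ []) ∷ ((λ ()) ∷ (λ ()) ∷ (λ ()) ∷ []) ∷ ((λ ()) ∷ (λ ()) ∷ []) ∷ ((λ ()) ∷ []) ∷ [] ∷ [])
  (shape₀ ∷ shape₂ ∷ shape₆ ∷ shape₈ ∷ shape₁₂ ∷ []) refl (ℕ.≤ᵇ⇒≤ 5 12 tt)
  ((ℕ.≤ᵇ⇒≤ 1 5 tt , ℕ.≤ᵇ⇒≤ 5 7 tt , ℕ.z≤n) ∷ (ℕ.≤ᵇ⇒≤ 1 3 tt , ℕ.≤ᵇ⇒≤ 3 7 tt , ℕ.≤ᵇ⇒≤ 2 12 tt) ∷ (ℕ.≤ᵇ⇒≤ 1 1 tt , ℕ.≤ᵇ⇒≤ 1 7 tt , ℕ.≤ᵇ⇒≤ 6 12 tt) ∷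
   (ℕ.≤ᵇ⇒≤ 1 3 tt , ℕ.≤ᵇ⇒≤ 3 7 tt , ℕ.≤ᵇ⇒≤ 8 12 tt) ∷ (ℕ.≤ᵇ⇒≤ 1 7 tt , ℕ.≤ᵇ⇒≤ 7 7 tt , ℕ.≤ᵇ⇒≤ 12 12 tt) ∷ [])
  (ℕ.≤ᵇ⇒≤ 1 515 tt) (ℕ.≤ᵇ⇒≤ 515 1000 tt) (ℕ.≤ᵇ⇒≤ 1 5149 tt) (ℕ.≤ᵇ⇒≤ 1 10000 tt) (ℕ.≤ᵇ⇒≤ 1 3787457 tt) (ℕ.≤ᵇ⇒≤ 10299 10300 tt) refl

by-triple : (decide : ∀ (P : Set) → Dec P) (ϑ₀ : ℚ) (D₄ D₃ : ℕ) → (ϑ₀ , D₄ , D₃) ∈ triples →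
  (∃ λ (ϑ : ℝ) → fromℚᴿ ϑ₀ <ᴿ ϑ × ConditionA (λ {P} → decide P) ϑ × ConditionB (λ {P} → decide P) ϑ) → Candidates D₄ D₃
by-triple decide _ _ _ (here refl) = case-729 decide
by-triple decide _ _ _ (there (here refl)) = case-616 decide
by-triple decide _ _ _ (there (there (here refl))) = case-554 decide
by-triple decide _ _ _ (there (there (there (here refl)))) = case-515 decide

-- The conditions are variables here, so that they stay folded when the two
-- forms of excluded middle are identified.
generalised : (CA CB : ExcludedMiddle 0ℓ → ℝ → Set) (X : ℚ → ℝ → Set) (R : ℚ → ℕ → ℕ → Set) (C : ℕ → ℕ → Set) →
  ((decide : ∀ (P : Set) → Dec P) (ϑ₀ : ℚ) (D₄ D₃ : ℕ) → R ϑ₀ D₄ D₃ → (∃ λ (ϑ : ℝ) → X ϑ₀ ϑ × CA (λ {P} → decide P) ϑ × CB (λ {P} → decide P) ϑ) → C D₄ D₃) →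
  (lem : ExcludedMiddle 0ℓ) (ϑ₀ : ℚ) (D₄ D₃ : ℕ) → R ϑ₀ D₄ D₃ → (∃ λ (ϑ : ℝ) → X ϑ₀ ϑ × CA lem ϑ × CB lem ϑ) → C D₄ D₃
generalised CA CB X R C k lem ϑ₀ D₄ D₃ m h = k (λ P → lem {P}) ϑ₀ D₄ D₃ m h

theorem7 : (lem : ExcludedMiddle 0ℓ) (ϑ₀ : ℚ) (D₄ D₃ : ℕ) → (ϑ₀ , D₄ , D₃) ∈ triples →
    (∃ λ (ϑ : ℝ) → fromℚᴿ ϑ₀ <ᴿ ϑ × ConditionA lem ϑ × ConditionB lem ϑ) →
    (∃ λ (d : ℤ) → 0 < ℤ.∣ d ∣ × ℤ.∣ d ∣ ≤ D₄ ×
    InfinitelyMany (λ p → Prime p × + 0 ℤ.< + p ℤ.+ d × liouville ℤ.∣ + p ℤ.+ d ∣ ≡ -1ℤ))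
    ⊎ (∃ λ (L : ℕ) → IsLimInf primeGap L × L ≤ D₃)
theorem7 = generalised ConditionA ConditionB (λ ϑ₀ ϑ → fromℚᴿ ϑ₀ <ᴿ ϑ) (λ ϑ₀ D₄ D₃ → (ϑ₀ , D₄ , D₃) ∈ triples) Candidates by-triple
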